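{- Let $d\ge 1$ be an integer and let $\Delta=\operatorname{conv}(v_1,\ldots,v_{2d})\subset\mathbb{R}^{2d-1}$ be a $(2d-1)$-dimensional lattice simplex (with respect to $\mathbb{Z}^{2d-1}$) all of whose codimension-$1$ facets are basic lattice simplices. Then the following statements are equivalent: (1) for all $k=1,\ldots,d-1$ there are no lattice points in the interior of $k\Delta$, i.e. $\mathrm{Int}(k\Delta)\cap\mathbb{Z}^{2d-1}=\emptyset$; (2) $\Delta\cong\Delta_1*\cdots*\Delta_d$ for some $1$-dimensional lattice simplices (lattice segments) $\Delta_1,\ldots,\Delta_d\subset\mathbb{R}^d$.
   Context: A $k$-dimensional lattice simplex $\operatorname{conv}(w_1,\ldots,w_{k+1})\subset\mathbb{R}^m$ (vertices in $\mathbb{Z}^m$, affinely independent) is called basic if $w_1-w_{k+1},\ldots,w_k-w_{k+1}$ is part of a lattice basis of $\mathbb{Z}^m$ (equivalently, it is mapped onto $\operatorname{conv}(0,e_1,\ldots,e_k)$ by an affine unimodular isomorphism of $\mathbb{R}^m$). Cayley polytope: for lattice polytopes $\Sigma_1,\ldots,\Sigma_r\subset\mathbb{R}^d$ ($r\le d$), $\Sigma_1*\cdots*\Sigma_r$ is the convex hull of $e_1\times\Sigma_1,\ldots,e_r\times\Sigma_r$ in $\mathbb{R}^{r+d}=\mathbb{R}^r\times\mathbb{R}^d$, where $e_i$ are the standard basis vectors of $\mathbb{R}^r$; it lies in the affine hyperplane $H=\{x\in\mathbb{R}^{r+d}:x_1+\cdots+x_r=1\}$, which carries the affine lattice $H\cap\mathbb{Z}^{r+d}$.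 Here $\Delta\cong P$ for $P\subset H$ (with $r=d$, so $H$ has dimension $2d-1$) means there is an affine isomorphism $\varphi:\mathbb{R}^{2d-1}\to H$ with $\varphi(\mathbb{Z}^{2d-1})=H\cap\mathbb{Z}^{2d}$ and $\varphi(\Delta)=P$. -}

module Defs where

open import Data.Nat using (ℕ; zero; suc; _+_)
open import Data.Fin using (Fin; zero; suc; inject₁; fromℕ; punchIn; _↑ˡ_)
open import Data.Fin.Properties using () renaming (_≟_ to _≟ᶠ_)
open import Data.Integer using (ℤ; +_) renaming (_+_ to _+ℤ_; _*_ to _*ℤ_; _-_ to _-ℤ_)
open import Data.Rational using (ℚ; 0ℚ; 1ℚ; _/_; _≤_; _<_) renaming (_+_ to _+ℚ_; _*_ to _*ℚ_)
open import Data.Vec.Functional using (_++_)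
open import Data.Product using (Σ; _×_; ∃)
open import Data.Bool using (if_then_else_)
open import Relation.Nullary using (¬_; does)
open import Relation.Binary.PropositionalEquality using (_≡_)
open import Function.Definitions using (Injective)

Pt : ℕ → Set
Pt m = Fin m → ℤ

QPt : ℕ → Set
QPt m = Fin m → ℚ

ℤ→ℚ : ℤ → ℚ
ℤ→ℚ z = z / 1

ℕ→ℚ : ℕ → ℚ
ℕ→ℚ k = (+ k) / 1

toQ : ∀ {m} → Pt m → QPt m
toQ x t = ℤ→ℚ (x t)

_≋ℤ_ : ∀ {m} → Pt m → Pt m → Set
x ≋ℤ y = ∀ t → x t ≡ y t

_≋ℚ_ : ∀ {m} → QPt m → QPt m → Set
x ≋ℚ y = ∀ t → x t ≡ y t

sumℤ : ∀ {n} → (Fin n → ℤ) → ℤ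
sumℤ {zero} f = + 0
sumℤ {suc n} f = f zero +ℤ sumℤ (λ i → f (suc i))

sumℚ : ∀ {n} → (Fin n → ℚ) → ℚ
sumℚ {zero} f = 0ℚ
sumℚ {suc n} f = f zero +ℚ sumℚ (λ i → f (suc i))

combℤ : ∀ {n m} → (Fin n → ℤ) → (Fin n → Pt m) → Pt m
combℤ a p t = sumℤ (λ i → a i *ℤ p i t)

combℚ : ∀ {n m} → (Fin n → ℚ) → (Fin n → QPt m) → QPt m
combℚ a p t = sumℚ (λ i → a i *ℚ p i t)

AffIndep : ∀ {n m} → (Fin n → Pt m) → Set
AffIndep {n} {m} p =
  (λs : Fin n → ℚ) → sumℚ λs ≡ 0ℚ → combℚ λs (λ i → toQ (p i)) ≋ℚ (λ _ → 0ℚ) →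
  ∀ i → λs i ≡ 0ℚ

IsLatticeBasis : ∀ {m} → (Fin m → Pt m) → Set
IsLatticeBasis {m} b =
  ((z : Pt m) → ∃ λ (a : Fin m → ℤ) → combℤ a b ≋ℤ z) ×
  ((a : Fin m → ℤ) → combℤ a b ≋ℤ (λ _ → + 0) → ∀ i → a i ≡ + 0)

PartOfLatticeBasis : ∀ {k m} → (Fin k → Pt m) → Set
PartOfLatticeBasis {k} {m} u =
  Σ (Fin m → Pt m) λ b → Σ (Fin k → Fin m) λ ι →
    Injective _≡_ _≡_ ι × IsLatticeBasis b × (∀ i → b (ι i) ≡ u i)

IsBasic : ∀ {k m} → (Fin (suc k) → Pt m) → Set
IsBasic {k} {m} w =
  AffIndep w ×
  PartOfLatticeBasis (λ (i : Fin k) → λ t → w (inject₁ i) t -ℤ w (fromℕ k) t)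

InConv : ∀ {N m} → (Fin N → QPt m) → QPt m → Set
InConv {N} {m} p x =
  Σ (Fin N → ℚ) λ λs → (∀ i → 0ℚ ≤ λs i) × sumℚ λs ≡ 1ℚ × combℚ λs p ≋ℚ x

-- x ∈ Int(k Δ) for the full-dimensional simplex Δ = conv(v_1,…,v_{m+1}) ⊂ ℝ^m:
-- x = k·y with y in the interior of Δ, i.e. with all barycentric coordinates > 0.
InIntMultiple : ∀ {m} → ℕ → (Fin (suc m) → Pt m) → Pt m → Set
InIntMultiple {m} k v x =
  Σ (Fin (suc m) → ℚ) λ λs → (∀ i → 0ℚ < λs i) × sumℚ λs ≡ 1ℚ ×
    ((λ t → ℕ→ℚ k *ℚ combℚ λs (λ i → toQ (v i)) t) ≋ℚ toQ x)

-- Affine maps ℝ^m → ℝ^M, x ↦ c + A x, with integral c and A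
-- (any affine map sending ℤ^m into ℤ^M has this form).
record AffMap (m M : ℕ) : Set where
  field
    c : Pt M
    A : Fin M → Fin m → ℤ

applyℤ : ∀ {m M} → AffMap m M → Pt m → Pt M
applyℤ φ x t = AffMap.c φ t +ℤ sumℤ (λ j → AffMap.A φ t j *ℤ x j)

applyℚ : ∀ {m M} → AffMap m M → QPt m → QPt M
applyℚ φ x t = ℤ→ℚ (AffMap.c φ t) +ℚ sumℚ (λ j → ℤ→ℚ (AffMap.A φ t j) *ℚ x j)

InH : ∀ r {d} → QPt (r + d) → Set
InH r {d} y = sumℚ (λ (i : Fin r) → y (i ↑ˡ d)) ≡ 1ℚ

IsLatticeIsoOntoH : ∀ m r d → AffMap m (r + d) → Set
IsLatticeIsoOntoH m r d φ =
  -- φ maps ℝ^m into H (checked on ℚ^m; affine, so equivalent)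
  ((x : QPt m) → InH r (applyℚ φ x)) ×
  -- φ is injective (hence, dim H = m being assumed, a bijection ℝ^m → H)
  ((x y : QPt m) → applyℚ φ x ≋ℚ applyℚ φ y → x ≋ℚ y) ×
  ((y : Pt (r + d)) → InH r (toQ y) → ∃ λ (x : Pt m) → applyℤ φ x ≋ℤ y)

unitVec : ∀ {r} → Fin r → Pt r
unitVec i t = if does (i ≟ᶠ t) then + 1 else + 0

-- vertex family of the Cayley polytope Δ_1 * ⋯ * Δ_r of segments
-- Δ_i = conv(a_i, b_i) ⊂ ℝ^d : points e_i × a_i and e_i × b_i in ℝ^{r+d}
cayleyVerts : ∀ {r d} → (Fin r → Pt d) → (Fin r → Pt d) → Fin (r + r) → Pt (r + d)
cayleyVerts a b = (λ i → unitVec i ++ a i) ++ (λ i → unitVec i ++ b i)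

seg : ∀ {d} → Pt d → Pt d → Fin 2 → Pt d
seg p q zero = p
seg p q (suc _) = q

MapsOnto : ∀ {m M N K} → AffMap m M → (Fin N → Pt m) → (Fin K → Pt M) → Set
MapsOnto {m} {M} φ v w =
  (y : QPt M) →
    (InConv (λ j → toQ (w j)) y → ∃ λ (x : QPt m) → InConv (λ i → toQ (v i)) x × applyℚ φ x ≋ℚ y) ×
    ((x : QPt m) → InConv (λ i → toQ (v i)) x → applyℚ φ x ≋ℚ y → InConv (λ j → toQ (w j)) y)

-- Statement (1): no lattice points in Int(kΔ) for k = 1, …, d-1  (here d = suc e)
NoInteriorPoints : ∀ e {m} → (Fin (suc m) → Pt m) → Set
NoInteriorPoints e {m} v =
  (k : ℕ) → 1 Data.Nat.≤ k → k Data.Nat.≤ e → (x : Pt m) → ¬ InIntMultiple k v x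

IsCayleyOfSegments : ∀ d {m} → (Fin (suc m) → Pt m) → Set
IsCayleyOfSegments d {m} v =
  Σ (Fin d → Pt d) λ a → Σ (Fin d → Pt d) λ b →
    (∀ i → AffIndep (seg (a i) (b i))) ×
    Σ (AffMap m (d + d)) λ φ →
      IsLatticeIsoOntoH m d d φ × MapsOnto φ v (cayleyVerts a b)

{-# OPTIONS --safe #-}
-- Since the facets are basic, ℤ^(2d-1) modulo the lattice of the vertices v₀, …, v₂ₑ₊₁ (e = d - 1) is cyclic of some
-- order n, generated by a vector Γ with nΓ = Σ aᵢ vᵢ, Σ aᵢ = 0 and all aᵢ units mod n.  For r ≢ 0 the numbers r aᵢ mod n
-- are the barycentric coordinates, scaled by n, of a lattice point in Int(kΔ), where kn is their sum; so (1), for r and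
-- for -r, says that Σ (r aᵢ mod n) = dn for every r ≢ 0.
--
-- The arithmetic heart is that such aᵢ fall into d pairs with aᵢ + aⱼ ≡ 0 (mod n); given the pairs, the sums of the
-- barycentric coordinates over the pairs are the first d coordinates of the isomorphism in (2).  For the pairing one
-- must show that the odd function h(m) = #{i : aᵢ m ≡ 1} - #{i : aᵢ m ≡ -1} vanishes; this is equivalent to L(1, χ) ≠ 0
-- for all odd characters χ.  The sums being constant, the finite Fourier transform (sawtooth to cotangent) gives
-- Σ_{m ≤ x} h(km)/m = O(1/x) for every k, i.e. the series Σ h(km)/m vanish.  Let χ₀ be the indicator of the units mod n
-- and E(N) = Σ h(km) h(km′) χ₀(a) χ₀(b), over all k mod n and all mam′b = N.  By Ingham's identity E(N) is a sum of
-- squares of divisor sums when N is prime to n, and E(D²) ≥ Σ h(k)²; hence the average of E grows unless h = 0, whereas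
-- the bounds above keep it small.
--
-- All analysis is done over ℚ: cos and sin are replaced by the real and imaginary parts P, Q of (1 + √-y)ᵐ, and the
-- value y = tan²(π/M) with Q = 0 by a sequence of rational approximations.
--
-- For (2) ⇒ (1), the first d coordinates of the isomorphism are integral and positive on Int(kΔ) and add up to k.
module Submission where

open import Data.Nat.Base as ℕ using (ℕ; zero; suc; s≤s; z≤n; NonZero; _%_; _∸_)
import Data.Nat.Properties as ℕ
import Data.Nat.Tactic.RingSolver as ℕR

module Sums where

  open import Algebra.Bundles using (CommutativeMonoid; Semiring)
  open import Data.Fin.Base as Fin using (Fin; toℕ; fromℕ<)
  import Data.Fin.Properties as Fin
  open import Data.Fin.Permutation using (Permutation; permutation)
  open import Function.Base using (_∘_)
  open import Level using (0ℓ)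
  open import Relation.Binary.PropositionalEquality as ≡ using (_≡_; _≢_)

  module RangeSum (R : Semiring 0ℓ 0ℓ) where
    open Semiring R hiding (zero)
    open import Algebra.Properties.CommutativeMonoid.Sum +-commutativeMonoid using (sum; sum-permute; sum-cong-≋)
    open import Algebra.Properties.CommutativeSemigroup
      (CommutativeMonoid.commutativeSemigroup +-commutativeMonoid) using (interchange)
    open import Algebra.Properties.Semiring.Mult R using (_×_)
    open import Relation.Binary.Reasoning.Setoid setoid

    ∑ : ℕ → (ℕ → Carrier) → Carrier
    ∑ zero    f = 0#
    ∑ (suc N) f = f zero + ∑ N (λ i → f (suc i))

    private
      ∑≡sum : ∀ N f → ∑ N f ≡ sum {N} (λ i → f (toℕ i))
      ∑≡sum zero    f = ≡.refl
      ∑≡sum (suc N) f = ≡.cong (f zero +_) (∑≡sum N (λ i → f (suc i)))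

    ∑-cong : ∀ N {f g} → (∀ i → i ℕ.< N → f i ≈ g i) → ∑ N f ≈ ∑ N g
    ∑-cong zero    eq = refl
    ∑-cong (suc N) eq = +-cong (eq zero (s≤s z≤n)) (∑-cong N (λ i i<N → eq (suc i) (s≤s i<N)))

    ∑-cong′ : ∀ N {f g} → (∀ i → f i ≈ g i) → ∑ N f ≈ ∑ N g
    ∑-cong′ N eq = ∑-cong N (λ i _ → eq i)

    ∑-zero : ∀ N {f} → (∀ i → i ℕ.< N → f i ≈ 0#) → ∑ N f ≈ 0#
    ∑-zero zero    eq = refl
    ∑-zero (suc N) eq = trans (+-cong (eq zero (s≤s z≤n)) (∑-zero N (λ i i<N → eq (suc i) (s≤s i<N))))
      (+-identityˡ 0#)

    ∑-replicate : ∀ N x → ∑ N (λ _ → x) ≈ N × x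
    ∑-replicate zero    x = refl
    ∑-replicate (suc N) x = +-congˡ (∑-replicate N x)

    ∑-distrib-+ : ∀ N f g → ∑ N (λ i → f i + g i) ≈ ∑ N f + ∑ N g
    ∑-distrib-+ zero    f g = sym (+-identityˡ 0#)
    ∑-distrib-+ (suc N) f g = trans (+-congˡ (∑-distrib-+ N _ _)) (interchange _ _ _ _)

    ∑-comm : ∀ M N (f : ℕ → ℕ → Carrier) →
             ∑ M (λ i → ∑ N (f i)) ≈ ∑ N (λ j → ∑ M (λ i → f i j))
    ∑-comm zero    N f = sym (∑-zero N λ _ _ → refl)
    ∑-comm (suc M) N f = trans (+-congˡ (∑-comm M N (λ i → f (suc i)))) (sym (∑-distrib-+ N _ _))

    *-distribˡ-∑ : ∀ N x f → x * ∑ N f ≈ ∑ N (λ i → x * f i)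
    *-distribˡ-∑ zero    x f = zeroʳ x
    *-distribˡ-∑ (suc N) x f = trans (distribˡ x _ _) (+-congˡ (*-distribˡ-∑ N x _))

    *-distribʳ-∑ : ∀ N x f → ∑ N f * x ≈ ∑ N (λ i → f i * x)
    *-distribʳ-∑ zero    x f = zeroˡ x
    *-distribʳ-∑ (suc N) x f = trans (distribʳ x _ _) (+-congˡ (*-distribʳ-∑ N x _))

    ∑-split : ∀ M N f → ∑ (M ℕ.+ N) f ≈ ∑ M f + ∑ N (λ i → f (M ℕ.+ i))
    ∑-split zero    N f = sym (+-identityˡ _)
    ∑-split (suc M) N f = trans (+-congˡ (∑-split M N (f ∘ suc))) (sym (+-assoc _ _ _))

    ∑-last : ∀ N f → ∑ (suc N) f ≈ ∑ N f + f N
    ∑-last zero    f = trans (+-identityʳ _) (sym (+-identityˡ _))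
    ∑-last (suc N) f = trans (+-congˡ (∑-last N (f ∘ suc))) (sym (+-assoc _ _ _))

    ∑-blocks : ∀ L n f → ∑ (L ℕ.* n) f ≈ ∑ L (λ l → ∑ n (λ r → f (l ℕ.* n ℕ.+ r)))
    ∑-blocks zero    n f = refl
    ∑-blocks (suc L) n f = begin
      ∑ (n ℕ.+ L ℕ.* n) f                                         ≈⟨ ∑-split n (L ℕ.* n) f ⟩
      ∑ n f + ∑ (L ℕ.* n) (λ i → f (n ℕ.+ i))                     ≈⟨ +-congˡ (∑-blocks L n _) ⟩
      ∑ n f + ∑ L (λ l → ∑ n (λ r → f (n ℕ.+ (l ℕ.* n ℕ.+ r))))   ≈⟨ +-congˡ (∑-cong′ L λ l → ∑-cong′ n (reindex l)) ⟩
      ∑ n f + ∑ L (λ l → ∑ n (λ r → f (suc l ℕ.* n ℕ.+ r))) ∎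
      where
      reindex : ∀ l r → f (n ℕ.+ (l ℕ.* n ℕ.+ r)) ≈ f (suc l ℕ.* n ℕ.+ r)
      reindex l r = reflexive (≡.cong f (≡.sym (ℕ.+-assoc n (l ℕ.* n) r)))

    progressionSum : ℕ → ℕ → (ℕ → Carrier) → ℕ → Carrier
    progressionSum n L f α = ∑ L (λ l → f (l ℕ.* n ℕ.+ α))

    ∑-single : ∀ N {f} i₀ → i₀ ℕ.< N → (∀ i → i ℕ.< N → i ≢ i₀ → f i ≈ 0#) → ∑ N f ≈ f i₀
    ∑-single (suc N) zero _ off =
      trans (+-congˡ (∑-zero N λ i i<N → off (suc i) (s≤s i<N) λ ())) (+-identityʳ _)
    ∑-single (suc N) (suc i₀) (s≤s i₀<N) off =
      trans (+-cong (off zero (s≤s z≤n) λ ())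
                    (∑-single N i₀ i₀<N λ i i<N i≢ → off (suc i) (s≤s i<N) (i≢ ∘ ℕ.suc-injective)))
            (+-identityˡ _)

    ∑-extend : ∀ {M N} f → M ℕ.≤ N → (∀ i → M ℕ.≤ i → f i ≈ 0#) → ∑ N f ≈ ∑ M f
    ∑-extend {M} {N} f M≤N off = begin
      ∑ N f                 ≡⟨ ≡.cong (λ k → ∑ k f) (≡.sym (ℕ.m+[n∸m]≡n M≤N)) ⟩
      ∑ (M ℕ.+ (N ∸ M)) f   ≈⟨ ∑-split M (N ∸ M) f ⟩
      ∑ M f + ∑ (N ∸ M) (λ i → f (M ℕ.+ i))
        ≈⟨ +-congˡ (∑-zero (N ∸ M) λ i _ → off _ (ℕ.m≤m+n M i)) ⟩
      ∑ M f + 0#            ≈⟨ +-identityʳ _ ⟩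
      ∑ M f ∎

    ∑-permute : ∀ N f (π π⁻¹ : ℕ → ℕ) →
                (∀ i → i ℕ.< N → π i ℕ.< N) → (∀ i → i ℕ.< N → π⁻¹ i ℕ.< N) →
                (∀ i → i ℕ.< N → π (π⁻¹ i) ≡ i) → (∀ i → i ℕ.< N → π⁻¹ (π i) ≡ i) →
                ∑ N f ≈ ∑ N (f ∘ π)
    ∑-permute N f π π⁻¹ π< π⁻¹< ππ⁻¹ π⁻¹π = begin
      ∑ N f                           ≡⟨ ∑≡sum N f ⟩
      sum {N} (λ i → f (toℕ i))       ≈⟨ sum-permute (λ i → f (toℕ i)) perm ⟩
      sum {N} (λ i → f (toℕ (restrict π π< i)))
        ≈⟨ sum-cong-≋ {N} (λ i → reflexive (≡.cong f (toℕ-restrict π π< i))) ⟩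
      sum {N} (λ i → f (π (toℕ i)))   ≡⟨ ≡.sym (∑≡sum N (f ∘ π)) ⟩
      ∑ N (f ∘ π) ∎
      where
      restrict : (ρ : ℕ → ℕ) → (∀ i → i ℕ.< N → ρ i ℕ.< N) → Fin N → Fin N
      restrict ρ ρ< i = fromℕ< (ρ< (toℕ i) (Fin.toℕ<n i))
      toℕ-restrict : ∀ ρ ρ< i → toℕ (restrict ρ ρ< i) ≡ ρ (toℕ i)
      toℕ-restrict ρ ρ< i = Fin.toℕ-fromℕ< _
      restrict-inverse : ∀ ρ ρ< τ τ< → (∀ i → i ℕ.< N → ρ (τ i) ≡ i) → ∀ i → restrict ρ ρ< (restrict τ τ< i) ≡ i
      restrict-inverse ρ ρ< τ τ< ρτ i = Fin.toℕ-injective (≡.trans (toℕ-restrict ρ ρ< _)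
        (≡.trans (≡.cong ρ (toℕ-restrict τ τ< i)) (ρτ _ (Fin.toℕ<n i))))
      perm : Permutation N N
      perm = permutation (restrict π π<) (restrict π⁻¹ π⁻¹<)
        (restrict-inverse π π< π⁻¹ π⁻¹< ππ⁻¹) (restrict-inverse π⁻¹ π⁻¹< π π< π⁻¹π)

    ∑-reverse : ∀ N f → ∑ N f ≈ ∑ N (λ i → f (N ∸ suc i))
    ∑-reverse N f = ∑-permute N f (λ i → N ∸ suc i) (λ i → N ∸ suc i) reverse< reverse< involutive involutive
      where
      reverse< : ∀ i → i ℕ.< N → N ∸ suc i ℕ.< N
      reverse< i i<N = ℕ.∸-monoʳ-< (s≤s z≤n) i<N
      involutive : ∀ i → i ℕ.< N → N ∸ suc (N ∸ suc i) ≡ i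
      involutive i i<N = ≡.trans (≡.cong (N ∸_) (≡.sym (ℕ.+-∸-assoc 1 i<N))) (ℕ.m∸[m∸n]≡n (ℕ.<⇒≤ i<N))

  open RangeSum ℕ.+-*-semiring public using () renaming (∑ to ℕ∑; ∑-cong′ to ℕ∑-cong)

module Rationals where

  open import Algebra.Bundles using (CommutativeMonoid; CommutativeRing)
  open import Data.Empty public using (⊥-elim)
  open import Data.Integer.Base as ℤ using (ℤ; +_; -[1+_])
  import Data.Integer.Properties as ℤ
  open import Data.Maybe.Base using (Maybe; just; nothing)
  open import Data.Product public using (∃; _×_; _,_; proj₁; proj₂)
  open import Data.Rational.Base using (_/_; positive; ≢-nonZero)
  open import Data.Rational.Base public hiding (NonZero; _/_; positive; ≢-nonZero; >-nonZero;
    +-rawMonoid; *-rawMonoid)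
  open import Data.Rational.Properties public
  open import Data.Rational.Unnormalised.Base as ℚᵘ using (mkℚᵘ; *≡*; *≤*)
  import Data.Rational.Unnormalised.Properties as ℚᵘ
  open import Data.Sum public using (inj₁; inj₂)
  open import Level using (0ℓ)
  open import Relation.Binary.PropositionalEquality public using (_≡_; _≢_; refl; sym; trans; cong; cong₂; subst;
    subst₂; module ≡-Reasoning)
  open import Relation.Nullary public using (Dec; yes; no; ¬_)
  open import Tactic.RingSolver public using (solve-∀)
  import Tactic.RingSolver.Core.AlmostCommutativeRing as ACR
  open Sums

  private
    0≟ : (x : ℚ) → Maybe (0ℚ ≡ x)
    0≟ x with 0ℚ ≟ x
    ... | yes p = just p
    ... | no _  = nothing

  ringℚ : ACR.AlmostCommutativeRing 0ℓ 0ℓ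
  ringℚ = ACR.fromCommutativeRing +-*-commutativeRing 0≟

  open import Algebra.Properties.CommutativeSemigroup
    (CommutativeMonoid.commutativeSemigroup *-1-commutativeMonoid) public
    using (x∙yz≈y∙xz; xy∙z≈y∙xz; xy∙z≈xz∙y; interchange)

  open import Algebra.Properties.AbelianGroup +-0-abelianGroup public using (xyx⁻¹≈y; ⁻¹-anti-homo‿-)

  private
    toℚᵘ-/1 : ∀ i → toℚᵘ (i / 1) ℚᵘ.≃ mkℚᵘ i 0
    toℚᵘ-/1 i = toℚᵘ-fromℚᵘ (mkℚᵘ i 0)

  -- Sealed: otherwise unification tries to invert the normalisation of fractions.
  abstract
    fromℤ : ℤ → ℚ
    fromℤ i = i / 1

    fromℤ≡/1 : ∀ i → fromℤ i ≡ i / 1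
    fromℤ≡/1 i = refl

    fromℤ-0 : fromℤ (+ 0) ≡ 0ℚ
    fromℤ-0 = refl

    fromℤ-1 : fromℤ (+ 1) ≡ 1ℚ
    fromℤ-1 = refl

    fromℤ-+ : ∀ i j → fromℤ (i ℤ.+ j) ≡ fromℤ i + fromℤ j
    fromℤ-+ i j = toℚᵘ-injective (ℚᵘ.≃-trans (toℚᵘ-/1 (i ℤ.+ j)) (ℚᵘ.≃-sym
      (ℚᵘ.≃-trans (toℚᵘ-homo-+ (i / 1) (j / 1))
        (ℚᵘ.≃-trans (ℚᵘ.+-cong (toℚᵘ-/1 i) (toℚᵘ-/1 j))
          (*≡* (cong (ℤ._* + 1) (cong₂ ℤ._+_ (ℤ.*-identityʳ i) (ℤ.*-identityʳ j))))))))

    fromℤ-* : ∀ i j → fromℤ (i ℤ.* j) ≡ fromℤ i * fromℤ j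
    fromℤ-* i j = toℚᵘ-injective (ℚᵘ.≃-trans (toℚᵘ-/1 (i ℤ.* j)) (ℚᵘ.≃-sym
      (ℚᵘ.≃-trans (toℚᵘ-homo-* (i / 1) (j / 1)) (ℚᵘ.*-cong (toℚᵘ-/1 i) (toℚᵘ-/1 j)))))

    fromℤ-mono : ∀ {i j} → i ℤ.≤ j → fromℤ i ≤ fromℤ j
    fromℤ-mono {i} {j} i≤j = toℚᵘ-cancel-≤ (ℚᵘ.≤-respˡ-≃ (ℚᵘ.≃-sym (toℚᵘ-/1 i))
      (ℚᵘ.≤-respʳ-≃ (ℚᵘ.≃-sym (toℚᵘ-/1 j))
        (*≤* (subst₂ ℤ._≤_ (sym (ℤ.*-identityʳ i)) (sym (ℤ.*-identityʳ j)) i≤j))))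

    fromℤ-injective : ∀ {i j} → fromℤ i ≡ fromℤ j → i ≡ j
    fromℤ-injective {i} {j} eq
      with ℚᵘ.≃-trans (ℚᵘ.≃-sym (toℚᵘ-/1 i)) (ℚᵘ.≃-trans (toℚᵘ-cong eq) (toℚᵘ-/1 j))
    ... | *≡* e = trans (sym (ℤ.*-identityʳ i)) (trans e (ℤ.*-identityʳ j))

  ι : ℕ → ℚ
  ι n = fromℤ (+ n)

  2ℚ 4ℚ : ℚ
  2ℚ = 1ℚ + 1ℚ
  4ℚ = 2ℚ + 2ℚ

  ι-+ : ∀ m n → ι (m ℕ.+ n) ≡ ι m + ι n
  ι-+ m n = fromℤ-+ (+ m) (+ n)

  ι-* : ∀ m n → ι (m ℕ.* n) ≡ ι m * ι n
  ι-* m n = trans (cong fromℤ (ℤ.pos-* m n)) (fromℤ-* (+ m) (+ n))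

  ι-suc : ∀ n → ι (suc n) ≡ 1ℚ + ι n
  ι-suc n = trans (ι-+ 1 n) (cong (_+ ι n) fromℤ-1)

  ι-2 : ι 2 ≡ 2ℚ
  ι-2 = trans (ι-+ 1 1) (cong₂ _+_ fromℤ-1 fromℤ-1)

  ι-4 : ι 4 ≡ 4ℚ
  ι-4 = trans (ι-+ 2 2) (cong₂ _+_ ι-2 ι-2)

  ι-0* : ∀ x → ι 0 * x ≡ 0ℚ
  ι-0* x = trans (cong (_* x) fromℤ-0) (*-zeroˡ x)

  ι-suc* : ∀ n x → ι (suc n) * x ≡ ι n * x + x
  ι-suc* n x = trans (cong (_* x) (ι-suc n)) (distribute (ι n) x)
    where
    distribute : ∀ i x → (1ℚ + i) * x ≡ i * x + x
    distribute = solve-∀ ringℚ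

  ι-mono : ∀ {m n} → m ℕ.≤ n → ι m ≤ ι n
  ι-mono m≤n = fromℤ-mono (ℤ.+≤+ m≤n)

  ι≥0 : ∀ n → 0ℚ ≤ ι n
  ι≥0 n = subst (_≤ ι n) fromℤ-0 (ι-mono z≤n)

  ι≥1 : ∀ n → 1ℚ ≤ ι (suc n)
  ι≥1 n = subst (_≤ ι (suc n)) fromℤ-1 (ι-mono (s≤s z≤n))

  0<1 : 0ℚ < 1ℚ
  0<1 = positive⁻¹ 1ℚ

  0≤1 : 0ℚ ≤ 1ℚ
  0≤1 = <⇒≤ 0<1

  0<2 : 0ℚ < 2ℚ
  0<2 = positive⁻¹ 2ℚ

  0≤2 : 0ℚ ≤ 2ℚ
  0≤2 = <⇒≤ 0<2

  0<½ : 0ℚ < ½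
  0<½ = positive⁻¹ ½

  0≤½ : 0ℚ ≤ ½
  0≤½ = <⇒≤ 0<½

  ι>0 : ∀ n → 0ℚ < ι (suc n)
  ι>0 n = <-≤-trans 0<1 (ι≥1 n)

  fromℤ≥1 : ∀ {i} → 0ℚ < fromℤ i → + 1 ℤ.≤ i
  fromℤ≥1 {+ zero}    lt = ⊥-elim (<-irrefl (sym fromℤ-0) lt)
  fromℤ≥1 {+ suc i}   lt = ℤ.+≤+ (s≤s z≤n)
  fromℤ≥1 { -[1+ i ]} lt = ⊥-elim (<-irrefl (sym fromℤ-0) (<-≤-trans lt (fromℤ-mono { -[1+ i ]} {+ 0} ℤ.-≤+)))

  p≤q⇒0≤q-p : ∀ {x y} → x ≤ y → 0ℚ ≤ y - x
  p≤q⇒0≤q-p {x} {y} x≤y = subst (_≤ y - x) (+-inverseʳ x) (+-monoˡ-≤ (- x) x≤y)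

  0≤q-p⇒p≤q : ∀ {x y} → 0ℚ ≤ y - x → x ≤ y
  0≤q-p⇒p≤q {x} {y} 0≤y-x = subst₂ _≤_ (+-identityʳ x) (trans (sym (+-assoc x y (- x))) (xyx⁻¹≈y x y))
    (+-monoʳ-≤ x 0≤y-x)

  ≤-by : ∀ {x y} e → 0ℚ ≤ e → x + e ≡ y → x ≤ y
  ≤-by {x} e 0≤e refl = subst (_≤ x + e) (+-identityʳ x) (+-monoʳ-≤ x 0≤e)

  <-by : ∀ {x y} e → 0ℚ < e → x + e ≡ y → x < y
  <-by {x} e 0<e refl = subst (_< x + e) (+-identityʳ x) (+-monoʳ-< x 0<e)

  x≡0⇒x*y≡0 : ∀ {x} y → x ≡ 0ℚ → x * y ≡ 0ℚ
  x≡0⇒x*y≡0 y refl = *-zeroˡ y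

  y≡0⇒x*y≡0 : ∀ x {y} → y ≡ 0ℚ → x * y ≡ 0ℚ
  y≡0⇒x*y≡0 x refl = *-zeroʳ x

  +≥0 : ∀ {x y} → 0ℚ ≤ x → 0ℚ ≤ y → 0ℚ ≤ x + y
  +≥0 = +-mono-≤

  *≥0 : ∀ {x y} → 0ℚ ≤ x → 0ℚ ≤ y → 0ℚ ≤ x * y
  *≥0 {x} {y} 0≤x 0≤y = nonNegative⁻¹ _ {{nonNeg*nonNeg⇒nonNeg x {{nonNegative 0≤x}} y {{nonNegative 0≤y}}}}

  *>0 : ∀ {x y} → 0ℚ < x → 0ℚ < y → 0ℚ < x * y
  *>0 {x} {y} 0<x 0<y = positive⁻¹ _ {{pos*pos⇒pos x {{positive 0<x}} y {{positive 0<y}}}}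

  *-monoˡ : ∀ {z x y} → 0ℚ ≤ z → x ≤ y → z * x ≤ z * y
  *-monoˡ {z} 0≤z = *-monoˡ-≤-nonNeg z {{nonNegative 0≤z}}

  *-monoʳ : ∀ {z x y} → 0ℚ ≤ z → x ≤ y → x * z ≤ y * z
  *-monoʳ {z} 0≤z = *-monoʳ-≤-nonNeg z {{nonNegative 0≤z}}

  *-mono : ∀ {x y x′ y′} → 0ℚ ≤ x → x ≤ x′ → 0ℚ ≤ y → y ≤ y′ → x * y ≤ x′ * y′
  *-mono 0≤x x≤x′ 0≤y y≤y′ = ≤-trans (*-monoʳ 0≤y x≤x′) (*-monoˡ (≤-trans 0≤x x≤x′) y≤y′)

  *-cancelˡ-≤ : ∀ {z x y} → 0ℚ < z → z * x ≤ z * y → x ≤ y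
  *-cancelˡ-≤ {z} 0<z = *-cancelˡ-≤-pos z {{positive 0<z}}

  *-cancelˡ-≡ : ∀ {z x y} → 0ℚ < z → z * x ≡ z * y → x ≡ y
  *-cancelˡ-≡ 0<z eq = ≤-antisym (*-cancelˡ-≤ 0<z (≤-reflexive eq)) (*-cancelˡ-≤ 0<z (≤-reflexive (sym eq)))

  sq≥0 : ∀ x → 0ℚ ≤ x * x
  sq≥0 x with ≤-total 0ℚ x
  ... | inj₁ 0≤x = *≥0 0≤x 0≤x
  ... | inj₂ x≤0 = subst (0ℚ ≤_) (neg-sq x) (*≥0 (neg-antimono-≤ x≤0) (neg-antimono-≤ x≤0))
    where
    neg-sq : ∀ x → (- x) * (- x) ≡ x * x
    neg-sq = solve-∀ ringℚ

  <⇒≱ : ∀ {x y} → x < y → ¬ y ≤ x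
  <⇒≱ x<y y≤x = <-irrefl refl (<-≤-trans x<y y≤x)

  -- Total, with the junk value inv 0 = 0.
  abstract
    inv : ℚ → ℚ
    inv x with x ≟ 0ℚ
    ... | yes _  = 0ℚ
    ... | no x≢0 = (1/ x) {{≢-nonZero x≢0}}

    *-inv : ∀ {x} → x ≢ 0ℚ → x * inv x ≡ 1ℚ
    *-inv {x} x≢0 with x ≟ 0ℚ
    ... | yes x≡0 = ⊥-elim (x≢0 x≡0)
    ... | no x≢0  = *-inverseʳ x {{≢-nonZero x≢0}}

  x*x≡0⇒x≡0 : ∀ {x} → x * x ≡ 0ℚ → x ≡ 0ℚ
  x*x≡0⇒x≡0 {x} eq with x ≟ 0ℚ
  ... | yes x≡0 = x≡0
  ... | no x≢0  = trans (sym (*-identityʳ x)) (trans (cong (x *_) (sym (*-inv x≢0)))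
                    (trans (sym (*-assoc x x (inv x))) (x≡0⇒x*y≡0 (inv x) eq)))

  0<⇒≢0 : ∀ {x} → 0ℚ < x → x ≢ 0ℚ
  0<⇒≢0 0<x refl = <-irrefl refl 0<x

  *-inv⁺ : ∀ {x} → 0ℚ < x → x * inv x ≡ 1ℚ
  *-inv⁺ 0<x = *-inv (0<⇒≢0 0<x)

  inv>0 : ∀ {x} → 0ℚ < x → 0ℚ < inv x
  inv>0 {x} 0<x with 0ℚ <? inv x
  ... | yes p = p
  ... | no ¬p = ⊥-elim (<⇒≱ 0<1 (subst (_≤ 0ℚ) (*-inv⁺ 0<x)
                  (subst (x * inv x ≤_) (*-zeroʳ x) (*-monoˡ (<⇒≤ 0<x) (≮⇒≥ ¬p)))))

  inv≥0 : ∀ {x} → 0ℚ < x → 0ℚ ≤ inv x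
  inv≥0 0<x = <⇒≤ (inv>0 0<x)

  inv-unique : ∀ {x y} → 0ℚ < x → x * y ≡ 1ℚ → y ≡ inv x
  inv-unique 0<x eq = *-cancelˡ-≡ 0<x (trans eq (sym (*-inv⁺ 0<x)))

  inv-anti : ∀ {x y} → 0ℚ < x → x ≤ y → inv y ≤ inv x
  inv-anti {x} {y} 0<x x≤y = *-cancelˡ-≤ (*>0 0<x 0<y) (begin
    x * y * inv y     ≡⟨ *-assoc x y (inv y) ⟩
    x * (y * inv y)   ≡⟨ cong (x *_) (*-inv⁺ 0<y) ⟩
    x * 1ℚ            ≡⟨ *-identityʳ x ⟩
    x                 ≤⟨ x≤y ⟩
    y                 ≡⟨ *-identityˡ y ⟨
    1ℚ * y            ≡⟨ cong (_* y) (sym (*-inv⁺ 0<x)) ⟩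
    x * inv x * y     ≡⟨ xy∙z≈xz∙y x (inv x) y ⟩
    x * y * inv x ∎)
    where
    open ≤-Reasoning
    0<y : 0ℚ < y
    0<y = <-≤-trans 0<x x≤y

  inv-1 : inv 1ℚ ≡ 1ℚ
  inv-1 = sym (inv-unique {1ℚ} {1ℚ} 0<1 refl)

  inv≤1 : ∀ {x} → 1ℚ ≤ x → inv x ≤ 1ℚ
  inv≤1 1≤x = ≤-trans (inv-anti 0<1 1≤x) (≤-reflexive inv-1)

  ≤-inv : ∀ {x y z} → 0ℚ < z → z * x ≤ y → x ≤ y * inv z
  ≤-inv {x} {y} {z} 0<z le = *-cancelˡ-≤ 0<z (≤-trans le (≤-reflexive (sym
    (trans (x∙yz≈y∙xz z y (inv z)) (trans (cong (y *_) (*-inv⁺ 0<z)) (*-identityʳ y))))))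

  x≤∣x∣ : ∀ x → x ≤ ∣ x ∣
  x≤∣x∣ x with ≤-total 0ℚ x
  ... | inj₁ 0≤x = ≤-reflexive (sym (0≤p⇒∣p∣≡p 0≤x))
  ... | inj₂ x≤0 = ≤-trans x≤0 (0≤∣p∣ x)

  -x≤∣x∣ : ∀ x → - x ≤ ∣ x ∣
  -x≤∣x∣ x = subst (- x ≤_) (∣-p∣≡∣p∣ x) (x≤∣x∣ (- x))

  ∣∣≤ : ∀ {x b} → x ≤ b → - x ≤ b → ∣ x ∣ ≤ b
  ∣∣≤ {x} x≤b -x≤b with ∣p∣≡p∨∣p∣≡-p x
  ... | inj₁ eq = subst (_≤ _) (sym eq) x≤b
  ... | inj₂ eq = subst (_≤ _) (sym eq) -x≤b

  ∣∣-+ : ∀ {x y a b} → ∣ x ∣ ≤ a → ∣ y ∣ ≤ b → ∣ x + y ∣ ≤ a + b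
  ∣∣-+ {x} {y} p q = ≤-trans (∣p+q∣≤∣p∣+∣q∣ x y) (+-mono-≤ p q)

  ∣∣-- : ∀ {x y a b} → ∣ x ∣ ≤ a → ∣ y ∣ ≤ b → ∣ x - y ∣ ≤ a + b
  ∣∣-- {x} {y} p q = ≤-trans (∣p-q∣≤∣p∣+∣q∣ x y) (+-mono-≤ p q)

  ∣∣-* : ∀ {x y a b} → ∣ x ∣ ≤ a → ∣ y ∣ ≤ b → ∣ x * y ∣ ≤ a * b
  ∣∣-* {x} {y} p q = subst (_≤ _) (sym (∣p*q∣≡∣p∣*∣q∣ x y)) (*-mono (0≤∣p∣ x) p (0≤∣p∣ y) q)

  ∣x-y∣≡∣y-x∣ : ∀ x y → ∣ x - y ∣ ≡ ∣ y - x ∣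
  ∣x-y∣≡∣y-x∣ x y = trans (sym (∣-p∣≡∣p∣ (x - y))) (cong ∣_∣ (⁻¹-anti-homo‿- x y))

  ∣x∣≤∣2x∣ : ∀ x → ∣ x ∣ ≤ ∣ 2ℚ * x ∣
  ∣x∣≤∣2x∣ x = begin
    ∣ x ∣            ≡⟨ *-identityˡ ∣ x ∣ ⟨
    1ℚ * ∣ x ∣       ≤⟨ *-monoʳ {∣ x ∣} {1ℚ} {2ℚ} (0≤∣p∣ x) (≤-by 1ℚ 0≤1 refl) ⟩
    ∣ 2ℚ ∣ * ∣ x ∣   ≡⟨ ∣p*q∣≡∣p∣*∣q∣ 2ℚ x ⟨
    ∣ 2ℚ * x ∣ ∎
    where open ≤-Reasoning

  ∣∣-nonNeg : ∀ {x y} → 0ℚ ≤ x → x ≤ y → ∣ x ∣ ≤ y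
  ∣∣-nonNeg 0≤x x≤y = subst (_≤ _) (sym (0≤p⇒∣p∣≡p 0≤x)) x≤y

  archimedean : ∀ x → ∃ λ N → x ≤ ι N
  archimedean x = ℤ.∣ ↥ x ∣ , toℚᵘ-cancel-≤
    (ℚᵘ.≤-respʳ-≃ (ℚᵘ.≃-sym (ℚᵘ.≃-trans (toℚᵘ-cong (fromℤ≡/1 _)) (toℚᵘ-/1 (+ ℤ.∣ ↥ x ∣)))) (x≤∣↥x∣ x))
    where
    i≤∣i∣ : ∀ i → i ℤ.≤ + ℤ.∣ i ∣
    i≤∣i∣ (+ n)    = ℤ.≤-refl
    i≤∣i∣ -[1+ n ] = ℤ.-≤+
    x≤∣↥x∣ : ∀ x → toℚᵘ x ℚᵘ.≤ mkℚᵘ (+ ℤ.∣ ↥ x ∣) 0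
    x≤∣↥x∣ (mkℚ i d _) = *≤* (subst (ℤ._≤ + ℤ.∣ i ∣ ℤ.* + suc d) (sym (ℤ.*-identityʳ i))
      (ℤ.≤-trans (i≤∣i∣ i) (subst (+ ℤ.∣ i ∣ ℤ.≤_) (ℤ.pos-* ℤ.∣ i ∣ (suc d))
        (ℤ.+≤+ (ℕ.m≤m*n ℤ.∣ i ∣ (suc d))))))

  ≤0-by-archimedean : ∀ {x} C → (∀ N → ι N * x ≤ C) → x ≤ 0ℚ
  ≤0-by-archimedean {x} C bound with x ≤? 0ℚ
  ... | yes p = p
  ... | no ¬p with archimedean (C * inv x)
  ...   | N , le = ⊥-elim (<⇒≱ (<-by x 0<x refl) (≤-trans contra (bound (suc N))))
    where
    0<x : 0ℚ < x
    0<x = ≰⇒> ¬p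
    contra : C + x ≤ ι (suc N) * x
    contra = begin
      C + x                 ≡⟨ cong (_+ x) (sym (*-identityʳ C)) ⟩
      C * 1ℚ + x            ≡⟨ cong (λ o → C * o + x) (sym (*-inv⁺ 0<x)) ⟩
      C * (x * inv x) + x   ≡⟨ cong (_+ x) (trans (sym (*-assoc C x (inv x))) (xy∙z≈xz∙y C x (inv x))) ⟩
      C * inv x * x + x     ≤⟨ +-monoˡ-≤ x (*-monoʳ (<⇒≤ 0<x) le) ⟩
      ι N * x + x           ≡⟨ ι-suc* N x ⟨
      ι (suc N) * x ∎
      where open ≤-Reasoning

  open RangeSum (CommutativeRing.semiring +-*-commutativeRing) public

  ∑-mono : ∀ N {f g} → (∀ i → i ℕ.< N → f i ≤ g i) → ∑ N f ≤ ∑ N g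
  ∑-mono zero    le = ≤-refl
  ∑-mono (suc N) le = +-mono-≤ (le zero (s≤s z≤n)) (∑-mono N λ i i<N → le (suc i) (s≤s i<N))

  ∑-nonNeg : ∀ N {f} → (∀ i → i ℕ.< N → 0ℚ ≤ f i) → 0ℚ ≤ ∑ N f
  ∑-nonNeg zero    le = ≤-refl
  ∑-nonNeg (suc N) le = +≥0 (le zero (s≤s z≤n)) (∑-nonNeg N λ i i<N → le (suc i) (s≤s i<N))

  term≤∑ : ∀ N {f} i₀ → i₀ ℕ.< N → (∀ i → i ℕ.< N → 0ℚ ≤ f i) → f i₀ ≤ ∑ N f
  term≤∑ (suc N) {f} zero     _          le =
    ≤-by _ (∑-nonNeg N λ i i<N → le (suc i) (s≤s i<N)) refl
  term≤∑ (suc N) {f} (suc i₀) (s≤s i₀<N) le = ≤-trans (term≤∑ N i₀ i₀<N λ i i<N → le (suc i) (s≤s i<N))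
    (≤-by (f zero) (le zero (s≤s z≤n)) (+-comm _ (f zero)))

  ∑-abs : ∀ N {f g} → (∀ i → i ℕ.< N → ∣ f i ∣ ≤ g i) → ∣ ∑ N f ∣ ≤ ∑ N g
  ∑-abs zero    le = ≤-refl
  ∑-abs (suc N) le = ∣∣-+ (le zero (s≤s z≤n)) (∑-abs N λ i i<N → le (suc i) (s≤s i<N))

  ∑-const : ∀ N x → ∑ N (λ _ → x) ≡ ι N * x
  ∑-const zero    x = sym (ι-0* x)
  ∑-const (suc N) x = trans (cong (λ z → x + z) (∑-const N x)) (trans (+-comm x _) (sym (ι-suc* N x)))

  ∑-neg : ∀ N f → ∑ N (λ i → - f i) ≡ - ∑ N f
  ∑-neg zero    f = refl
  ∑-neg (suc N) f = trans (cong (λ z → - f zero + z) (∑-neg N _)) (sym (neg-distrib-+ (f zero) _))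

  ∑-- : ∀ N f g → ∑ N (λ i → f i - g i) ≡ ∑ N f - ∑ N g
  ∑-- N f g = trans (∑-distrib-+ N f (λ i → - g i)) (cong (λ z → ∑ N f + z) (∑-neg N g))

  ∑-telescope : ∀ N (g : ℕ → ℚ) → ∑ N (λ i → g i - g (suc i)) ≡ g 0 - g N
  ∑-telescope zero    g = sym (+-inverseʳ (g 0))
  ∑-telescope (suc N) g = trans (cong (λ z → g 0 - g 1 + z) (∑-telescope N (λ i → g (suc i))))
    (cancel (g 0) (g 1) (g (suc N)))
    where
    cancel : ∀ a b c → a - b + (b - c) ≡ a - c
    cancel = solve-∀ ringℚ

  ⟦_⟧ : ∀ {P : Set} → Dec P → ℚ
  ⟦ yes _ ⟧ = 1ℚ
  ⟦ no _  ⟧ = 0ℚ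

  ⟦⟧-yes : ∀ {P : Set} (d : Dec P) → P → ⟦ d ⟧ ≡ 1ℚ
  ⟦⟧-yes (yes _) p = refl
  ⟦⟧-yes (no ¬p) p = ⊥-elim (¬p p)

  ⟦⟧-no : ∀ {P : Set} (d : Dec P) → ¬ P → ⟦ d ⟧ ≡ 0ℚ
  ⟦⟧-no (yes p) ¬p = ⊥-elim (¬p p)
  ⟦⟧-no (no _)  ¬p = refl

  ∑-select : ∀ N (f : ℕ → ℚ) k → (N ℕ.≤ k → f k ≡ 0ℚ) → ∑ N (λ i → ⟦ i ℕ.≟ k ⟧ * f i) ≡ f k
  ∑-select N f k outside with k ℕ.<? N
  ... | yes k<N = trans (∑-single N k k<N λ i _ i≢k → x≡0⇒x*y≡0 (f i) (⟦⟧-no (i ℕ.≟ k) i≢k))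
                    (trans (cong (_* f k) (⟦⟧-yes (k ℕ.≟ k) refl)) (*-identityˡ (f k)))
  ... | no k≮N  = trans (∑-zero N λ i i<N → x≡0⇒x*y≡0 (f i) (⟦⟧-no (i ℕ.≟ k) λ i≡k → k≮N (subst (ℕ._< N) i≡k i<N)))
                    (sym (outside (ℕ.≮⇒≥ k≮N)))

  ⟦⟧-cong : ∀ {P Q : Set} (d : Dec P) (e : Dec Q) → (P → Q) → (Q → P) → ⟦ d ⟧ ≡ ⟦ e ⟧
  ⟦⟧-cong (yes p) e f g = sym (⟦⟧-yes e (f p))
  ⟦⟧-cong (no ¬p) e f g = sym (⟦⟧-no e (λ q → ¬p (g q)))

  ⟦⟧-× : ∀ {P Q S : Set} (d : Dec P) (e : Dec Q) (f : Dec S) → (P → Q × S) → (Q → S → P) → ⟦ d ⟧ ≡ ⟦ e ⟧ * ⟦ f ⟧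
  ⟦⟧-× d (yes q) (yes s) split merge = ⟦⟧-yes d (merge q s)
  ⟦⟧-× d (yes q) (no ¬s) split merge = ⟦⟧-no d λ p → ¬s (proj₂ (split p))
  ⟦⟧-× d (no ¬q) f       split merge = trans (⟦⟧-no d λ p → ¬q (proj₁ (split p))) (sym (*-zeroˡ ⟦ f ⟧))

  ⟦⟧≥0 : ∀ {P : Set} (d : Dec P) → 0ℚ ≤ ⟦ d ⟧
  ⟦⟧≥0 (yes _) = 0≤1
  ⟦⟧≥0 (no _)  = ≤-refl

  ⟦⟧≤1 : ∀ {P : Set} (d : Dec P) → ⟦ d ⟧ ≤ 1ℚ
  ⟦⟧≤1 (yes _) = ≤-refl
  ⟦⟧≤1 (no _)  = 0≤1

  summation-by-parts : ∀ N (f g : ℕ → ℚ) → ∑ (suc N) (λ i → f i * g i)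
       ≡ ∑ (suc N) f * g N + ∑ N (λ i → ∑ (suc i) f * (g i - g (suc i)))
  summation-by-parts zero    f g = cong (λ x → x * g 0 + 0ℚ) (sym (+-identityʳ (f 0)))
  summation-by-parts (suc N) f g = begin-equality
    ∑ (suc (suc N)) (λ i → f i * g i)
      ≡⟨ ∑-last (suc N) (λ i → f i * g i) ⟩
    ∑ (suc N) (λ i → f i * g i) + f (suc N) * g (suc N)
      ≡⟨ cong (_+ f (suc N) * g (suc N)) (summation-by-parts N f g) ⟩
    F * g N + S + f (suc N) * g (suc N)
      ≡⟨ regroup F (g N) S (f (suc N)) (g (suc N)) ⟩
    (F + f (suc N)) * g (suc N) + (S + F * (g N - g (suc N)))
      ≡⟨ cong₂ (λ u v → u * g (suc N) + v) (sym (∑-last (suc N) f))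
           (sym (∑-last N (λ i → ∑ (suc i) f * (g i - g (suc i))))) ⟩
    ∑ (suc (suc N)) f * g (suc N) + ∑ (suc N) (λ i → ∑ (suc i) f * (g i - g (suc i)))
      ∎
    where
    open ≤-Reasoning
    F S : ℚ
    F = ∑ (suc N) f
    S = ∑ N (λ i → ∑ (suc i) f * (g i - g (suc i)))
    regroup : ∀ F g S f g′ → F * g + S + f * g′ ≡ (F + f) * g′ + (S + F * (g - g′))
    regroup = solve-∀ ringℚ

  summation-by-parts-bound : ∀ N (f g v : ℕ → ℚ) C → 0ℚ ≤ C → (∀ i → ∣ ∑ i f ∣ ≤ C) →
               (∀ i → i ℕ.< N → ∣ g i - g (suc i) ∣ ≤ v i) →
               ∣ ∑ (suc N) (λ i → f i * g i) ∣ ≤ C * (∣ g N ∣ + ∑ N v)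
  summation-by-parts-bound N f g v C 0≤C partial var = begin
    ∣ ∑ (suc N) (λ i → f i * g i) ∣     ≡⟨ cong ∣_∣ (summation-by-parts N f g) ⟩
    _                                    ≤⟨ ∣∣-+ (∣∣-* (partial (suc N)) ≤-refl)
                                              (∑-abs N λ i i<N → ∣∣-* (partial (suc i)) (var i i<N)) ⟩
    C * ∣ g N ∣ + ∑ N (λ i → C * v i)   ≡⟨ cong (λ z → C * ∣ g N ∣ + z) (sym (*-distribˡ-∑ N C v)) ⟩
    C * ∣ g N ∣ + C * ∑ N v             ≡⟨ *-distribˡ-+ C _ _ ⟨
    C * (∣ g N ∣ + ∑ N v) ∎
    where open ≤-Reasoning

module Congruence where

  open import Data.Empty using (⊥-elim)
  open import Data.Nat.Base using (_+_; _*_; _≤_; _<_; >-nonZero⁻¹)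
  open import Data.Nat.Coprimality as Coprimality using (Coprime; coprime-Bézout; coprime-divisor)
  open import Data.Nat.Divisibility
  open import Data.Nat.DivMod hiding (_mod_)
  open import Data.Nat.GCD using (module Bézout)
  open import Data.Nat.Properties
  open import Data.Nat.Tactic.RingSolver using (solve-∀)
  open import Data.Product using (∃; _,_)
  open Sums using (ℕ∑)
  open import Relation.Binary.PropositionalEquality using (_≡_; refl; sym; trans; cong; cong₂; subst;
    module ≡-Reasoning)

  coprime-∣ : ∀ {d m n} → d ∣ m → Coprime m n → Coprime d n
  coprime-∣ d∣m m⊥n (e∣d , e∣n) = m⊥n (∣-trans e∣d d∣m , e∣n)

  coprime-* : ∀ {a b n} → Coprime a n → Coprime b n → Coprime (a * b) n
  coprime-* {a} {b} a⊥n b⊥n {d} (d∣ab , d∣n) = b⊥n (coprime-divisor {d} {a} {b} d⊥a d∣ab , d∣n)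
    where
    d⊥a : Coprime d a
    d⊥a = coprime-∣ d∣n (Coprimality.sym a⊥n)

  infix 4 _≡_mod_

  _≡_mod_ : ℕ → ℕ → (n : ℕ) .{{_ : NonZero n}} → Set
  a ≡ b mod n = a % n ≡ b % n

  module _ (n : ℕ) .{{_ : NonZero n}} where

    %-mod : ∀ a → a % n ≡ a mod n
    %-mod a = m%n%n≡m%n a n

    +-mod : ∀ {a b c d} → a ≡ b mod n → c ≡ d mod n → a + c ≡ b + d mod n
    +-mod {a} {b} {c} {d} p q = trans (%-distribˡ-+ a c n)
      (trans (cong₂ (λ x y → (x + y) % n) p q) (sym (%-distribˡ-+ b d n)))

    *-mod : ∀ {a b c d} → a ≡ b mod n → c ≡ d mod n → a * c ≡ b * d mod n
    *-mod {a} {b} {c} {d} p q = trans (%-distribˡ-* a c n)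
      (trans (cong₂ (λ x y → (x * y) % n) p q) (sym (%-distribˡ-* b d n)))

    coprime⇒invertible : ∀ {g} → Coprime g n → ∃ λ g′ → g * g′ ≡ 1 mod n
    coprime⇒invertible {g} cop with coprime-Bézout cop
    ... | Bézout.+- x y eq = x , trans (cong (_% n) (trans (*-comm g x) (sym eq))) ([m+kn]%n≡m%n 1 y n)
    ... | Bézout.-+ x y eq = (n ∸ 1) * x , (begin
        (g * ((n ∸ 1) * x)) % n                 ≡⟨ [m+kn]%n≡m%n _ y n ⟨
        (g * ((n ∸ 1) * x) + y * n) % n         ≡⟨ cong (λ z → (g * ((n ∸ 1) * x) + z) % n) (sym eq) ⟩
        (g * ((n ∸ 1) * x) + (1 + x * g)) % n   ≡⟨ cong (_% n) (expand g (n ∸ 1) x) ⟩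
        (1 + x * g * suc (n ∸ 1)) % n           ≡⟨ cong (λ z → (1 + x * g * z) % n) (m+[n∸m]≡n (>-nonZero⁻¹ n)) ⟩
        (1 + x * g * n) % n                     ≡⟨ [m+kn]%n≡m%n 1 (x * g) n ⟩
        1 % n ∎)
      where
      open ≡-Reasoning
      expand : ∀ g p x → g * (p * x) + (1 + x * g) ≡ 1 + x * g * (1 + p)
      expand = solve-∀

    invertible⇒coprime : ∀ {g g′} → g * g′ ≡ 1 mod n → Coprime g n
    invertible⇒coprime {g} {g′} eq {d} (d∣g , d∣n) =
      ∣1⇒≡1 (∣n∣m%n⇒∣m d∣n
        (subst (d ∣_) eq (%-presˡ-∣ (∣m⇒∣m*n g′ d∣g) d∣n)))

    scale-inverse : ∀ {g g′} → g * g′ ≡ 1 mod n → ∀ k → k < n → ((k * g % n) * g′) % n ≡ k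
    scale-inverse {g} {g′} inv k k<n = begin
      ((k * g % n) * g′) % n   ≡⟨ *-mod {c = g′} (%-mod (k * g)) refl ⟩
      (k * g * g′) % n         ≡⟨ cong (_% n) (*-assoc k g g′) ⟩
      (k * (g * g′)) % n       ≡⟨ *-mod {k} refl inv ⟩
      (k * 1) % n              ≡⟨ cong (_% n) (*-identityʳ k) ⟩
      k % n                    ≡⟨ m<n⇒m%n≡m k<n ⟩
      k ∎
      where open ≡-Reasoning

    0-mod : ∀ {z} → z % n ≡ 0 → z ≡ 0 mod n
    0-mod z≡0 = trans z≡0 (sym (m<n⇒m%n≡m (>-nonZero⁻¹ n)))

    mod-0 : ∀ {z} → z ≡ 0 mod n → z % n ≡ 0
    mod-0 z≡0 = trans z≡0 (m<n⇒m%n≡m (>-nonZero⁻¹ n))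

    *-mod-0 : ∀ c {z} → z % n ≡ 0 → (c * z) % n ≡ 0
    *-mod-0 c {z} z≡0 = mod-0 (trans (*-mod {c} {c} {z} {0} refl (0-mod z≡0)) (cong (_% n) (*-zeroʳ c)))

    inverse-cancel : ∀ {k k′} m → k * k′ ≡ 1 mod n → k * (k′ * m) ≡ m mod n
    inverse-cancel {k} {k′} m kk′≡1 = trans (cong (_% n) (sym (*-assoc k k′ m)))
      (trans (*-mod {c = m} kk′≡1 refl) (cong (_% n) (*-identityˡ m)))

    opposite⇒complement : ∀ m {α} → 0 < α → α < n → (m + α) % n ≡ 0 → m % n ≡ n ∸ α
    opposite⇒complement m {α} 0<α α<n m+α≡0 = only-one-n (m%n≡0⇒n∣m (m % n + α) n
      (trans (+-mod {c = α} (%-mod m) refl) m+α≡0))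
      where
      only-one-n : n ∣ m % n + α → m % n ≡ n ∸ α
      only-one-n (divides zero eq) = ⊥-elim (<-irrefl (sym (m+n≡0⇒n≡0 (m % n) eq)) 0<α)
      only-one-n (divides 1 eq)    = trans (sym (m+n∸n≡m (m % n) α)) (cong (_∸ α) (trans eq (*-identityˡ n)))
      only-one-n (divides (suc (suc k)) eq) =
        ⊥-elim (<-irrefl eq (<-≤-trans (+-mono-< (m%n<n m n) α<n) (+-monoʳ-≤ n (m≤m+n n (k * n)))))

    complement⇒opposite : ∀ m {α} → α < n → m % n ≡ n ∸ α → (m + α) % n ≡ 0
    complement⇒opposite m {α} α<n m≡n∸α = begin
      (m + α) % n       ≡⟨ +-mod {c = α} (%-mod m) refl ⟨
      (m % n + α) % n   ≡⟨ cong (λ z → (z + α) % n) m≡n∸α ⟩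
      (n ∸ α + α) % n   ≡⟨ cong (_% n) (m∸n+n≡m (<⇒≤ α<n)) ⟩
      n % n             ≡⟨ n%n≡0 n ⟩
      0 ∎
      where open ≡-Reasoning

    -- n - 1 plays the role of -1.
    negated-inverse : ∀ a {α} → α ≤ n → a * α ≡ 1 mod n → (n ∸ 1) * a * (n ∸ α) ≡ 1 mod n
    negated-inverse a {α} α≤n aα≡1 = begin
      x % n                   ≡⟨ [m+kn]%n≡m%n x y n ⟨
      (x + y * n) % n         ≡⟨ cong (λ k → (x + y * k) % n) (sym 1+n-1≡n) ⟩
      (x + y * suc n-1) % n   ≡⟨ cong (_% n) (trans (cong (x +_) (*-suc y n-1)) (sym (+-assoc x y (y * n-1)))) ⟩
      (x + y + y * n-1) % n   ≡⟨ +-mod {c = y * n-1} (trans x+y≡0 (sym aα+y≡0)) refl ⟩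
      (a * α + y + y * n-1) % n
        ≡⟨ cong (_% n) (trans (+-assoc (a * α) y (y * n-1))
           (cong (a * α +_) (trans (sym (*-suc y n-1)) (cong (y *_) 1+n-1≡n)))) ⟩
      (a * α + y * n) % n     ≡⟨ [m+kn]%n≡m%n (a * α) y n ⟩
      (a * α) % n             ≡⟨ aα≡1 ⟩
      1 % n ∎
      where
      open ≡-Reasoning
      n-1 x y : ℕ
      n-1 = n ∸ 1
      x   = n-1 * a * (n ∸ α)
      y   = n-1 * a * α
      1+n-1≡n : suc n-1 ≡ n
      1+n-1≡n = m+[n∸m]≡n (>-nonZero⁻¹ n)
      x+y≡0 : (x + y) % n ≡ 0
      x+y≡0 = trans (cong (_% n) (trans (sym (*-distribˡ-+ (n-1 * a) (n ∸ α) α)) (cong (n-1 * a *_) (m∸n+n≡m α≤n))))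
        (m*n%n≡0 (n-1 * a) n)
      aα+y≡0 : (a * α + y) % n ≡ 0
      aα+y≡0 = trans (cong (_% n) (trans (collect a α n-1) (cong (a * α *_) 1+n-1≡n))) (m*n%n≡0 (a * α) n)
        where
        collect : ∀ a α k → a * α + k * a * α ≡ a * α * (1 + k)
        collect = solve-∀

    record IsInverse (a α : ℕ) : Set where
      field
        positive : 0 < α
        reduced  : α < n
        inverse  : a * α ≡ 1 mod n

      %-reduced : α % n ≡ α
      %-reduced = m<n⇒m%n≡m reduced

      ≡⇒inverse : ∀ {m} → m % n ≡ α → a * m ≡ 1 mod n
      ≡⇒inverse {m} m≡α = trans (*-mod {a} {a} {m} {α} refl (trans m≡α (sym %-reduced))) inverse

    open IsInverse

    IsInverse-neg : ∀ {a α} → IsInverse a α → IsInverse ((n ∸ 1) * a) (n ∸ α)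
    IsInverse-neg {a} i = record
      { positive = m<n⇒0<n∸m (reduced i)
      ; reduced  = ∸-monoʳ-< (positive i) (<⇒≤ (reduced i))
      ; inverse  = negated-inverse a (<⇒≤ (reduced i)) (inverse i)
      }

    *-inverse-cancel : ∀ {k k′} → k * k′ ≡ 1 mod n → ∀ α → k * (k′ * α % n) ≡ α mod n
    *-inverse-cancel {k} {k′} kk′≡1 α = trans (*-mod {k} refl (%-mod (k′ * α))) (inverse-cancel {k} {k′} α kk′≡1)

    IsInverse-* : ∀ {k k′ a α} → k * k′ ≡ 1 mod n → IsInverse a α → IsInverse (k * a) (k′ * α % n)
    IsInverse-* {k} {k′} {a} {α} kk′≡1 i = record
      { positive = n≢0⇒n>0 λ α′≡0 → <-irrefl (sym (α≡0 α′≡0)) (positive i)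
      ; reduced  = m%n<n (k′ * α) n
      ; inverse  = begin
          (k * a * (k′ * α % n)) % n     ≡⟨ cong (_% n) (reorder k a (k′ * α % n)) ⟩
          (a * (k * (k′ * α % n))) % n   ≡⟨ *-mod {a} refl (*-inverse-cancel {k} {k′} kk′≡1 α) ⟩
          (a * α) % n                    ≡⟨ inverse i ⟩
          1 % n ∎
      }
      where
      open ≡-Reasoning
      reorder : ∀ k a b → k * a * b ≡ a * (k * b)
      reorder = solve-∀
      α≡0 : k′ * α % n ≡ 0 → α ≡ 0
      α≡0 α′≡0 = begin
        α                        ≡⟨ %-reduced i ⟨
        α % n                    ≡⟨ *-inverse-cancel {k} {k′} kk′≡1 α ⟨
        (k * (k′ * α % n)) % n   ≡⟨ cong (λ z → (k * z) % n) α′≡0 ⟩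
        (k * 0) % n              ≡⟨ mod-0 (cong (_% n) (*-zeroʳ k)) ⟩
        0 ∎

    residueSum : ℕ → (ℕ → ℕ) → ℕ → ℕ
    residueSum N a r = ℕ∑ N (λ i → r * a i % n)

    Balanced : ℕ → (ℕ → ℕ) → Set
    Balanced N a = ∀ r → residueSum N a r ≡ residueSum N (λ i → (n ∸ 1) * a i) r

    progression-index< : ∀ {l L α} → l < L → α < n → l * n + α < n * L
    progression-index< {l} {L} {α} l<L α<n = begin-strict
      l * n + α   <⟨ +-monoʳ-< (l * n) α<n ⟩
      l * n + n   ≡⟨ +-comm (l * n) n ⟩
      suc l * n   ≤⟨ *-monoˡ-≤ n l<L ⟩
      L * n       ≡⟨ *-comm L n ⟩
      n * L ∎
      where open ≤-Reasoning

module GcdSums where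

  open import Data.Nat.Coprimality as Cop using (Coprime; coprime?; coprime⇒gcd≡1; gcd≡1⇒coprime; coprime-divisor)
  open import Data.Nat.Divisibility
  open import Data.Nat.GCD
  open Rationals

  ∑∑-cong : ∀ M N {f g : ℕ → ℕ → ℚ} → (∀ i → i ℕ.< M → ∀ j → j ℕ.< N → f i j ≡ g i j) →
            ∑ M (λ i → ∑ N (f i)) ≡ ∑ M (λ i → ∑ N (g i))
  ∑∑-cong M N eq = ∑-cong M λ i i<M → ∑-cong N λ j j<N → eq i i<M j j<N

  coprime-products : ∀ {k u v N} → k ℕ.* u ∣ N → k ℕ.* v ∣ N → Coprime u v → .{{_ : NonZero N}} → k ℕ.* u ℕ.* v ∣ N
  coprime-products {zero}  0∣N _ _ {{N≢0}} = 0∣N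
  coprime-products {suc k} {u} {v} {N} (divides q eq) kv∣N cop with coprime-divisor (Cop.sym cop)
    (*-cancelˡ-∣ (suc k) (subst (suc k ℕ.* v ∣_) N≡ kv∣N))
    where
    N≡ : N ≡ suc k ℕ.* (u ℕ.* q)
    N≡ = trans eq (trans (ℕ.*-comm q (suc k ℕ.* u)) (ℕ.*-assoc (suc k) u q))
  ... | v∣q = subst (suc k ℕ.* u ℕ.* v ∣_) (sym (trans eq (ℕ.*-comm q _))) (*-monoʳ-∣ (suc k ℕ.* u) v∣q)

  module _ (Z : ℕ) where

    private
      gcd-factor : ∀ {m m′ g u v} → Coprime u v → m ≡ g ℕ.* u → m′ ≡ g ℕ.* v → g ≡ gcd m m′
      gcd-factor {g = g} {u} {v} cop refl refl = sym (trans (sym (c*gcd[m,n]≡gcd[cm,cn] g u v))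
        (trans (cong (g ℕ.*_) (coprime⇒gcd≡1 cop)) (ℕ.*-identityʳ g)))

      χ : ℕ → ℕ → ℕ → ℕ → ℕ → ℚ
      χ m m′ g u v = ⟦ coprime? u v ⟧ * (⟦ m ℕ.≟ g ℕ.* u ⟧ * ⟦ m′ ℕ.≟ g ℕ.* v ⟧)

      χ-off : ∀ m m′ g u v → ¬ (Coprime u v × m ≡ g ℕ.* u × m′ ≡ g ℕ.* v) → χ m m′ g u v ≡ 0ℚ
      χ-off m m′ g u v ¬split with coprime? u v | m ℕ.≟ g ℕ.* u | m′ ℕ.≟ g ℕ.* v
      ... | yes u⊥v | yes m≡gu | yes m′≡gv = ⊥-elim (¬split (u⊥v , m≡gu , m′≡gv))
      ... | yes _   | yes _    | no _      = refl
      ... | yes _   | no _     | m′≟gv     = trans (*-identityˡ _) (*-zeroˡ ⟦ m′≟gv ⟧)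
      ... | no _    | m≟gu     | m′≟gv     = *-zeroˡ (⟦ m≟gu ⟧ * ⟦ m′≟gv ⟧)

      χ-count : ∀ m m′ → 0 ℕ.< m → m ℕ.< Z → 0 ℕ.< m′ → m′ ℕ.< Z →
                ∑ Z (λ g → ∑ Z (λ u → ∑ Z (λ v → χ m m′ g u v))) ≡ 1ℚ
      χ-count m m′ 0<m m<Z 0<m′ m′<Z = begin
        ∑ Z (λ g → ∑ Z (λ u → ∑ Z (λ v → χ m m′ g u v)))
          ≡⟨ ∑-single Z G (ℕ.≤-<-trans (∣⇒≤ {{ℕ.>-nonZero 0<m}} (gcd[m,n]∣m m m′)) m<Z)
               (λ g _ g≢G → ∑-zero Z λ u _ → ∑-zero Z λ v _ → χ-off m m′ g u v λ (c , p , q) →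
                 g≢G (gcd-factor {m} {m′} {g} {u} {v} c p q)) ⟩
        ∑ Z (λ u → ∑ Z (λ v → χ m m′ G u v))
          ≡⟨ ∑-single Z U (ℕ.≤-<-trans (∣⇒≤ {{ℕ.>-nonZero 0<m}} (divides G m≡GU)) m<Z)
               (λ u _ u≢U → ∑-zero Z λ v _ → χ-off m m′ G u v λ (_ , p , _) →
                 u≢U (ℕ.*-cancelˡ-≡ u U G (trans (sym p) m≡GU))) ⟩
        ∑ Z (λ v → χ m m′ G U v)
          ≡⟨ ∑-single Z V (ℕ.≤-<-trans (∣⇒≤ {{ℕ.>-nonZero 0<m′}} (divides G m′≡GV)) m′<Z)
               (λ v _ v≢V → χ-off m m′ G U v λ (_ , _ , p) → v≢V (ℕ.*-cancelˡ-≡ v V G (trans (sym p) m′≡GV))) ⟩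
        χ m m′ G U V
          ≡⟨ cong₂ _*_ (⟦⟧-yes (coprime? U V) cop) (cong₂ _*_ (⟦⟧-yes (m ℕ.≟ G ℕ.* U) m≡GU)
             (⟦⟧-yes (m′ ℕ.≟ G ℕ.* V) m′≡GV)) ⟩
        1ℚ ∎
        where
        open ≡-Reasoning
        G : ℕ
        G = gcd m m′
        instance
          G≢0 : NonZero G
          G≢0 = ℕ.≢-nonZero (gcd[m,n]≢0 m m′ (inj₁ λ m≡0 → ℕ.<-irrefl (sym m≡0) 0<m))
        U V : ℕ
        U = quotient (gcd[m,n]∣m m m′)
        V = quotient (gcd[m,n]∣n m m′)
        m≡GU : m ≡ G ℕ.* U
        m≡GU = m∣n⇒n≡m*quotient (gcd[m,n]∣m m m′)
        m′≡GV : m′ ≡ G ℕ.* V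
        m′≡GV = m∣n⇒n≡m*quotient (gcd[m,n]∣n m m′)
        cop : Coprime U V
        cop = gcd≡1⇒coprime (ℕ.*-cancelˡ-≡ (gcd U V) 1 G (begin
          G ℕ.* gcd U V             ≡⟨ c*gcd[m,n]≡gcd[cm,cn] G U V ⟩
          gcd (G ℕ.* U) (G ℕ.* V)   ≡⟨ cong₂ gcd (sym m≡GU) (sym m′≡GV) ⟩
          G                         ≡⟨ ℕ.*-identityʳ G ⟨
          G ℕ.* 1 ∎))

    module _ (Φ : ℕ → ℕ → ℚ) (Φ0≡0 : ∀ m → Φ 0 m ≡ 0ℚ) (Φm0≡0 : ∀ m → Φ m 0 ≡ 0ℚ)
      (outsideˡ : ∀ m m′ → Z ℕ.≤ m → Φ m m′ ≡ 0ℚ) (outsideʳ : ∀ m m′ → Z ℕ.≤ m′ → Φ m m′ ≡ 0ℚ) where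

      private
        weigh : ∀ m → m ℕ.< Z → ∀ m′ → m′ ℕ.< Z →
                Φ m m′ ≡ ∑ Z (λ g → ∑ Z (λ u → ∑ Z (λ v → χ m m′ g u v * Φ m m′)))
        weigh m m<Z m′ m′<Z = trans (count m m<Z m′ m′<Z)
          (trans (*-distribʳ-∑ Z (Φ m m′) _) (∑-cong′ Z λ g → trans (*-distribʳ-∑ Z (Φ m m′) _)
            (∑-cong′ Z λ u → *-distribʳ-∑ Z (Φ m m′) _)))
          where
          vanishing : ∀ x {φ} → φ ≡ 0ℚ → φ ≡ x * φ
          vanishing x φ≡0 = trans φ≡0 (sym (y≡0⇒x*y≡0 x φ≡0))
          count : ∀ m → m ℕ.< Z → ∀ m′ → m′ ℕ.< Z → Φ m m′ ≡ ∑ Z (λ g → ∑ Z (λ u → ∑ Z (λ v → χ m m′ g u v))) * Φ m m′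
          count zero _ m′ _ = vanishing (∑ Z (λ g → ∑ Z (λ u → ∑ Z (λ v → χ 0 m′ g u v)))) (Φ0≡0 m′)
          count (suc m) _ zero _ = vanishing (∑ Z (λ g → ∑ Z (λ u → ∑ Z (λ v → χ (suc m) 0 g u v)))) (Φm0≡0 (suc m))
          count m@(suc _) m<Z m′@(suc _) m′<Z =
            sym (trans (cong (_* Φ m m′) (χ-count m m′ (s≤s z≤n) m<Z (s≤s z≤n) m′<Z)) (*-identityˡ (Φ m m′)))

        evaluate : ∀ g u v →
                   ∑ Z (λ m → ∑ Z (λ m′ → χ m m′ g u v * Φ m m′)) ≡ ⟦ coprime? u v ⟧ * Φ (g ℕ.* u) (g ℕ.* v)
        evaluate g u v = begin
          ∑ Z (λ m → ∑ Z (λ m′ → χ m m′ g u v * Φ m m′))                       ≡⟨ ∑-cong′ Z row ⟩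
          ∑ Z (λ m → ⟦ coprime? u v ⟧ * (⟦ m ℕ.≟ g ℕ.* u ⟧ * Φ m (g ℕ.* v)))   ≡⟨ *-distribˡ-∑ Z ⟦ coprime? u v ⟧ _ ⟨
          ⟦ coprime? u v ⟧ * ∑ Z (λ m → ⟦ m ℕ.≟ g ℕ.* u ⟧ * Φ m (g ℕ.* v))
            ≡⟨ cong (⟦ coprime? u v ⟧ *_) (∑-select Z (λ m → Φ m (g ℕ.* v)) (g ℕ.* u)
               (outsideˡ (g ℕ.* u) (g ℕ.* v))) ⟩
          ⟦ coprime? u v ⟧ * Φ (g ℕ.* u) (g ℕ.* v) ∎
          where
          open ≡-Reasoning
          regroup : ∀ c p q φ → c * (p * q) * φ ≡ c * p * (q * φ)
          regroup = solve-∀ ringℚ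
          row : ∀ m → ∑ Z (λ m′ → χ m m′ g u v * Φ m m′) ≡ ⟦ coprime? u v ⟧ * (⟦ m ℕ.≟ g ℕ.* u ⟧ * Φ m (g ℕ.* v))
          row m = begin
            ∑ Z (λ m′ → χ m m′ g u v * Φ m m′)
              ≡⟨ ∑-cong′ Z (λ m′ → regroup ⟦ coprime? u v ⟧ ⟦ m ℕ.≟ g ℕ.* u ⟧ ⟦ m′ ℕ.≟ g ℕ.* v ⟧ (Φ m m′)) ⟩
            ∑ Z (λ m′ → ⟦ coprime? u v ⟧ * ⟦ m ℕ.≟ g ℕ.* u ⟧ * (⟦ m′ ℕ.≟ g ℕ.* v ⟧ * Φ m m′))
              ≡⟨ *-distribˡ-∑ Z (⟦ coprime? u v ⟧ * ⟦ m ℕ.≟ g ℕ.* u ⟧) _ ⟨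
            ⟦ coprime? u v ⟧ * ⟦ m ℕ.≟ g ℕ.* u ⟧ * ∑ Z (λ m′ → ⟦ m′ ℕ.≟ g ℕ.* v ⟧ * Φ m m′)
              ≡⟨ cong (⟦ coprime? u v ⟧ * ⟦ m ℕ.≟ g ℕ.* u ⟧ *_) (∑-select Z (Φ m) (g ℕ.* v) (outsideʳ m (g ℕ.* v))) ⟩
            ⟦ coprime? u v ⟧ * ⟦ m ℕ.≟ g ℕ.* u ⟧ * Φ m (g ℕ.* v)
              ≡⟨ *-assoc ⟦ coprime? u v ⟧ ⟦ m ℕ.≟ g ℕ.* u ⟧ (Φ m (g ℕ.* v)) ⟩
            ⟦ coprime? u v ⟧ * (⟦ m ℕ.≟ g ℕ.* u ⟧ * Φ m (g ℕ.* v)) ∎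

      ∑-by-gcd : ∑ Z (λ m → ∑ Z (λ m′ → Φ m m′)) ≡
                 ∑ Z (λ g → ∑ Z (λ u → ∑ Z (λ v → ⟦ coprime? u v ⟧ * Φ (g ℕ.* u) (g ℕ.* v))))
      ∑-by-gcd = begin
        ∑ Z (λ m → ∑ Z (λ m′ → Φ m m′))
          ≡⟨ ∑∑-cong Z Z weigh ⟩
        ∑ Z (λ m → ∑ Z (λ m′ → ∑ Z (λ g → ∑ Z (λ u → ∑ Z (λ v → χ m m′ g u v * Φ m m′)))))
          ≡⟨ ∑-cong′ Z (λ m → inward) ⟩
        ∑ Z (λ m → ∑ Z (λ g → ∑ Z (λ u → ∑ Z (λ v → ∑ Z (λ m′ → χ m m′ g u v * Φ m m′)))))
          ≡⟨ inward ⟩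
        ∑ Z (λ g → ∑ Z (λ u → ∑ Z (λ v → ∑ Z (λ m → ∑ Z (λ m′ → χ m m′ g u v * Φ m m′)))))
          ≡⟨ ∑-cong′ Z (λ g → ∑∑-cong Z Z λ u _ v _ → evaluate g u v) ⟩
        ∑ Z (λ g → ∑ Z (λ u → ∑ Z (λ v → ⟦ coprime? u v ⟧ * Φ (g ℕ.* u) (g ℕ.* v)))) ∎
        where
        open ≡-Reasoning
        inward : ∀ {F : ℕ → ℕ → ℕ → ℕ → ℚ} → ∑ Z (λ m → ∑ Z (λ g → ∑ Z (λ u → ∑ Z (λ v → F m g u v))))
                                            ≡ ∑ Z (λ g → ∑ Z (λ u → ∑ Z (λ v → ∑ Z (λ m → F m g u v))))
        inward = trans (∑-comm Z Z _) (∑-cong′ Z λ g → trans (∑-comm Z Z _) (∑-cong′ Z λ u → ∑-comm Z Z _))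

module InghamIdentity where

  open import Data.Nat.Coprimality as Cop using (Coprime; coprime?; 0-coprimeTo-m⇒m≡1)
  open import Data.Nat.Divisibility
  open import Data.Nat.DivMod using (m%n<n)
  open Rationals hiding (∣_∣)
  open Congruence
  open GcdSums

  ∑-rescale : ∀ n {{_ : NonZero n}} {g} → Coprime g n → (f : ℕ → ℚ) → (∀ a b → a ≡ b mod n → f a ≡ f b) →
              ∑ n (λ k → f (k ℕ.* g)) ≡ ∑ n f
  ∑-rescale n {g} cop f f-mod with coprime⇒invertible n cop
  ... | g′ , gg′≡1 = begin
    ∑ n (λ k → f (k ℕ.* g))   ≡⟨ ∑-cong′ n (λ k → f-mod _ _ (sym (%-mod n (k ℕ.* g)))) ⟩
    ∑ n (λ k → f (k ℕ.* g % n))    ≡⟨ ∑-permute n f (λ k → k ℕ.* g % n) (λ k → k ℕ.* g′ % n)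
                                        (λ k _ → m%n<n (k ℕ.* g) n) (λ k _ → m%n<n (k ℕ.* g′) n)
                                        (scale-inverse n (trans (cong (_% n) (ℕ.*-comm g′ g)) gg′≡1))
                                        (scale-inverse n gg′≡1) ⟨
    ∑ n f ∎
    where open ≡-Reasoning

  record UnitFunction (n : ℕ) {{_ : NonZero n}} (h : ℕ → ℚ) : Set where
    field
      periodic : ∀ m → h (m % n) ≡ h m
      support  : ∀ m → ¬ Coprime m n → h m ≡ 0ℚ

  module GramMatrix (n : ℕ) {{_ : NonZero n}} (1<n : 1 ℕ.< n) (h : ℕ → ℚ) (unitFunction : UnitFunction n h) where

    open UnitFunction unitFunction

    R : ℕ → ℕ → ℚ
    R m m′ = ∑ n (λ k → h (k ℕ.* m) * h (k ℕ.* m′))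

    h-mod : ∀ {a b} → a ≡ b mod n → h a ≡ h b
    h-mod {a} {b} eq = trans (sym (periodic a)) (trans (cong h eq) (periodic b))

    h-0 : h 0 ≡ 0ℚ
    h-0 = support 0 λ cop → ℕ.<-irrefl (sym (0-coprimeTo-m⇒m≡1 cop)) 1<n

    R-0ˡ : ∀ m → R 0 m ≡ 0ℚ
    R-0ˡ m = ∑-zero n λ k _ → x≡0⇒x*y≡0 (h (k ℕ.* m)) (trans (cong h (ℕ.*-zeroʳ k)) h-0)

    R-0ʳ : ∀ m → R m 0 ≡ 0ℚ
    R-0ʳ m = ∑-zero n λ k _ → y≡0⇒x*y≡0 (h (k ℕ.* m)) (trans (cong h (ℕ.*-zeroʳ k)) h-0)

    R-scale : ∀ {g} → Coprime g n → ∀ u v → R (g ℕ.* u) (g ℕ.* v) ≡ R u v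
    R-scale {g} cop u v = trans
      (∑-cong′ n λ k → cong₂ (λ a b → h a * h b) (sym (ℕ.*-assoc k g u)) (sym (ℕ.*-assoc k g v)))
      (∑-rescale n cop (λ k → h (k ℕ.* u) * h (k ℕ.* v))
        (λ a b eq → cong₂ _*_ (h-mod (*-mod n {c = u} eq refl)) (h-mod (*-mod n {c = v} eq refl))))

    squares : ∀ Z (α : ℕ → ℚ) →
              ∑ Z (λ x → ∑ Z (λ y → α x * α y * R x y)) ≡
              ∑ n (λ k → ∑ Z (λ x → α x * h (k ℕ.* x)) * ∑ Z (λ x → α x * h (k ℕ.* x)))
    squares Z α = begin
      ∑ Z (λ x → ∑ Z (λ y → α x * α y * R x y))
        ≡⟨ ∑∑-cong Z Z (λ x _ y _ → *-distribˡ-∑ n (α x * α y) _) ⟩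
      ∑ Z (λ x → ∑ Z (λ y → ∑ n (λ k → α x * α y * (h (k ℕ.* x) * h (k ℕ.* y)))))
        ≡⟨ trans (∑-cong′ Z (λ x → ∑-comm Z n _)) (∑-comm Z n _) ⟩
      ∑ n (λ k → ∑ Z (λ x → ∑ Z (λ y → α x * α y * (h (k ℕ.* x) * h (k ℕ.* y)))))
        ≡⟨ ∑-cong′ n (λ k → ∑∑-cong Z Z λ x _ y _ → interchange (α x) (α y) (h (k ℕ.* x)) (h (k ℕ.* y))) ⟩
      ∑ n (λ k → ∑ Z (λ x → ∑ Z (λ y → α x * h (k ℕ.* x) * (α y * h (k ℕ.* y)))))
        ≡⟨ ∑-cong′ n (λ k → trans (∑-cong′ Z λ x → sym (*-distribˡ-∑ Z (α x * h (k ℕ.* x)) _))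
                                   (sym (*-distribʳ-∑ Z (∑ Z (λ y → α y * h (k ℕ.* y))) _))) ⟩
      ∑ n (λ k → ∑ Z (λ x → α x * h (k ℕ.* x)) * ∑ Z (λ x → α x * h (k ℕ.* x))) ∎
      where open ≡-Reasoning

    module _ (Z N : ℕ) {{_ : NonZero N}} (N<Z : N ℕ.< Z) (N⊥n : Coprime N n) where

      inghamSum : ℚ
      inghamSum = ∑ Z (λ m → ∑ Z (λ m′ → ∑ Z (λ a → ⟦ m ℕ.* m′ ℕ.* a ∣? N ⟧) * R m m′))

      Squares : ℕ → ℚ
      Squares d = ∑ Z (λ x → ∑ Z (λ y → ⟦ d ℕ.* d ℕ.* x ∣? N ⟧ * ⟦ d ℕ.* d ℕ.* y ∣? N ⟧ * R x y))

      private
        ∣⇒<Z : ∀ {m} → m ∣ N → ¬ Z ℕ.≤ m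
        ∣⇒<Z m∣N Z≤m = ℕ.<-irrefl refl (ℕ.<-≤-trans N<Z (ℕ.≤-trans Z≤m (∣⇒≤ m∣N)))

        split-divisor : ∀ g u v a → (g ℕ.* u) ℕ.* (g ℕ.* v) ℕ.* a ∣ N →
          (g ℕ.* g ℕ.* (a ℕ.* u) ∣ N) × (g ℕ.* g ℕ.* (a ℕ.* v) ∣ N)
        split-divisor g u v a d = m*n∣⇒m∣ (g ℕ.* g ℕ.* (a ℕ.* u)) v (subst (_∣ N) (isolate-v g u v a) d) ,
                                  m*n∣⇒m∣ (g ℕ.* g ℕ.* (a ℕ.* v)) u (subst (_∣ N) (isolate-u g u v a) d)
          where
          isolate-v : ∀ g u v a → (g ℕ.* u) ℕ.* (g ℕ.* v) ℕ.* a ≡ g ℕ.* g ℕ.* (a ℕ.* u) ℕ.* v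
          isolate-v = ℕR.solve-∀
          isolate-u : ∀ g u v a → (g ℕ.* u) ℕ.* (g ℕ.* v) ℕ.* a ≡ g ℕ.* g ℕ.* (a ℕ.* v) ℕ.* u
          isolate-u = ℕR.solve-∀

        merge-divisors : ∀ g u v a → Coprime u v →
                         g ℕ.* g ℕ.* (a ℕ.* u) ∣ N → g ℕ.* g ℕ.* (a ℕ.* v) ∣ N → (g ℕ.* u) ℕ.* (g ℕ.* v) ℕ.* a ∣ N
        merge-divisors g u v a u⊥v p q = subst (_∣ N) (regroup g u v a)
          (coprime-products {g ℕ.* g ℕ.* a} {u} {v} (subst (_∣ N) (sym (ℕ.*-assoc (g ℕ.* g) a u)) p)
            (subst (_∣ N) (sym (ℕ.*-assoc (g ℕ.* g) a v)) q) u⊥v)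
          where
          regroup : ∀ g u v a → g ℕ.* g ℕ.* a ℕ.* u ℕ.* v ≡ (g ℕ.* u) ℕ.* (g ℕ.* v) ℕ.* a
          regroup = ℕR.solve-∀

        termwise : ∀ g u v a →
          ⟦ coprime? u v ⟧ * (⟦ (g ℕ.* u) ℕ.* (g ℕ.* v) ℕ.* a ∣? N ⟧ * R (g ℕ.* u) (g ℕ.* v)) ≡
          ⟦ coprime? u v ⟧ * (⟦ g ℕ.* g ℕ.* (a ℕ.* u) ∣? N ⟧ * ⟦ g ℕ.* g ℕ.* (a ℕ.* v) ∣? N ⟧ * R (a ℕ.* u) (a ℕ.* v))
        termwise g u v a with coprime? u v
        ... | no _    = trans (*-zeroˡ (⟦ (g ℕ.* u) ℕ.* (g ℕ.* v) ℕ.* a ∣? N ⟧ * R (g ℕ.* u) (g ℕ.* v))) (sym (*-zeroˡ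
          (⟦ g ℕ.* g ℕ.* (a ℕ.* u) ∣? N ⟧ * ⟦ g ℕ.* g ℕ.* (a ℕ.* v) ∣? N ⟧ * R (a ℕ.* u) (a ℕ.* v))))
        ... | yes u⊥v = cong (1ℚ *_) (trans (rescale ((g ℕ.* u) ℕ.* (g ℕ.* v) ℕ.* a ∣? N))
          (cong (_* R (a ℕ.* u) (a ℕ.* v))
            (⟦⟧-× (_ ∣? N) (g ℕ.* g ℕ.* (a ℕ.* u) ∣? N) (g ℕ.* g ℕ.* (a ℕ.* v) ∣? N)
              (split-divisor g u v a) (merge-divisors g u v a u⊥v))))
          where
          g∣ : (g ℕ.* u) ℕ.* (g ℕ.* v) ℕ.* a ∣ N → g ∣ N
          g∣ d = m*n∣⇒m∣ g u (m*n∣⇒m∣ (g ℕ.* u) (g ℕ.* v) (m*n∣⇒m∣ (g ℕ.* u ℕ.* (g ℕ.* v)) a d))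
          rescale : (d : Dec ((g ℕ.* u) ℕ.* (g ℕ.* v) ℕ.* a ∣ N)) →
                    ⟦ d ⟧ * R (g ℕ.* u) (g ℕ.* v) ≡ ⟦ d ⟧ * R (a ℕ.* u) (a ℕ.* v)
          rescale (yes d) = cong (1ℚ *_) (trans (R-scale (coprime-∣ (g∣ d) N⊥n) u v)
            (sym (R-scale (coprime-∣ (m*n∣⇒n∣ (g ℕ.* u ℕ.* (g ℕ.* v)) a d) N⊥n) u v)))
          rescale (no _)  = trans (*-zeroˡ (R (g ℕ.* u) (g ℕ.* v))) (sym (*-zeroˡ (R (a ℕ.* u) (a ℕ.* v))))

      -- Ingham's identity: both sides sum R u v over coprime u, v and all g, a with g²auv ∣ N,
      -- once after writing (m, m′) = (gu, gv) and once after writing (x, y) = (au, av), d = g.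
      inghamSum≡∑Squares : inghamSum ≡ ∑ Z Squares
      inghamSum≡∑Squares = begin
        inghamSum
          ≡⟨ ∑-by-gcd Z (λ m m′ → ∑ Z (λ a → ⟦ m ℕ.* m′ ℕ.* a ∣? N ⟧) * R m m′)
               (λ m → y≡0⇒x*y≡0 (∑ Z (λ a → ⟦ 0 ℕ.* m ℕ.* a ∣? N ⟧)) (R-0ˡ m))
               (λ m → y≡0⇒x*y≡0 (∑ Z (λ a → ⟦ m ℕ.* 0 ℕ.* a ∣? N ⟧)) (R-0ʳ m))
               (λ m m′ Z≤m → x≡0⇒x*y≡0 (R m m′) (∑-zero Z λ a _ → ⟦⟧-no (m ℕ.* m′ ℕ.* a ∣? N) λ d →
                 ∣⇒<Z (m*n∣⇒m∣ m m′ (m*n∣⇒m∣ (m ℕ.* m′) a d)) Z≤m))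
               (λ m m′ Z≤m′ → x≡0⇒x*y≡0 (R m m′) (∑-zero Z λ a _ → ⟦⟧-no (m ℕ.* m′ ℕ.* a ∣? N) λ d →
                 ∣⇒<Z (m*n∣⇒n∣ m m′ (m*n∣⇒m∣ (m ℕ.* m′) a d)) Z≤m′)) ⟩
        ∑ Z (λ g → ∑ Z (λ u → ∑ Z (λ v → ⟦ coprime? u v ⟧ * (∑ Z (λ a → ⟦ (g ℕ.* u) ℕ.* (g ℕ.* v) ℕ.* a ∣? N ⟧) * R
          (g ℕ.* u) (g ℕ.* v)))))
          ≡⟨ ∑-cong′ Z (λ g → ∑∑-cong Z Z λ u _ v _ →
               trans (cong (⟦ coprime? u v ⟧ *_) (*-distribʳ-∑ Z (R (g ℕ.* u) (g ℕ.* v)) _))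
                 (trans (*-distribˡ-∑ Z ⟦ coprime? u v ⟧ _)
                     (∑-cong′ Z (termwise g u v)))) ⟩
        ∑ Z (λ g → ∑ Z (λ u → ∑ Z (λ v → ∑ Z (λ a → ψ g a u v))))
          ≡⟨ ∑-cong′ Z (λ g → trans (∑-cong′ Z λ u → ∑-comm Z Z _) (∑-comm Z Z _)) ⟩
        ∑ Z (λ g → ∑ Z (λ a → ∑ Z (λ u → ∑ Z (λ v → ψ g a u v))))
          ≡⟨ ∑-cong′ Z (λ d → sym (∑-by-gcd Z (λ x y → ⟦ d ℕ.* d ℕ.* x ∣? N ⟧ * ⟦ d ℕ.* d ℕ.* y ∣? N ⟧ * R x y)
               (λ m → y≡0⇒x*y≡0 (⟦ d ℕ.* d ℕ.* 0 ∣? N ⟧ * ⟦ d ℕ.* d ℕ.* m ∣? N ⟧) (R-0ˡ m))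
               (λ m → y≡0⇒x*y≡0 (⟦ d ℕ.* d ℕ.* m ∣? N ⟧ * ⟦ d ℕ.* d ℕ.* 0 ∣? N ⟧) (R-0ʳ m))
               (λ m m′ Z≤m → x≡0⇒x*y≡0 (R m m′) (x≡0⇒x*y≡0 ⟦ d ℕ.* d ℕ.* m′ ∣? N ⟧ (⟦⟧-no (d ℕ.* d ℕ.* m ∣? N) λ p →
                 ∣⇒<Z (m*n∣⇒n∣ (d ℕ.* d) m p) Z≤m)))
               (λ m m′ Z≤m′ → x≡0⇒x*y≡0 (R m m′) (y≡0⇒x*y≡0 ⟦ d ℕ.* d ℕ.* m ∣? N ⟧ (⟦⟧-no (d ℕ.* d ℕ.* m′ ∣? N) λ p →
                 ∣⇒<Z (m*n∣⇒n∣ (d ℕ.* d) m′ p) Z≤m′))))) ⟩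
        ∑ Z Squares ∎
        where
        open ≡-Reasoning
        ψ : ℕ → ℕ → ℕ → ℕ → ℚ
        ψ g a u v = ⟦ coprime? u v ⟧ * (⟦ g ℕ.* g ℕ.* (a ℕ.* u) ∣? N ⟧ * ⟦ g ℕ.* g ℕ.* (a ℕ.* v) ∣? N ⟧ * R
          (a ℕ.* u) (a ℕ.* v))

      Squares≥0 : ∀ d → 0ℚ ≤ Squares d
      Squares≥0 d = subst (0ℚ ≤_) (sym (squares Z (λ x → ⟦ d ℕ.* d ℕ.* x ∣? N ⟧)))
        (∑-nonNeg n λ k _ → sq≥0 (∑ Z (λ x → ⟦ d ℕ.* d ℕ.* x ∣? N ⟧ * h (k ℕ.* x))))

      inghamSum≥0 : 0ℚ ≤ inghamSum
      inghamSum≥0 = subst (0ℚ ≤_) (sym inghamSum≡∑Squares) (∑-nonNeg Z λ d _ → Squares≥0 d)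

      R11≤inghamSum : ∀ D → D ℕ.* D ≡ N → R 1 1 ≤ inghamSum
      R11≤inghamSum D D²≡N = begin
        R 1 1         ≡⟨ Squares-D ⟨
        Squares D     ≤⟨ term≤∑ Z D (ℕ.≰⇒> (∣⇒<Z (divides D (sym D²≡N)))) (λ d _ → Squares≥0 d) ⟩
        ∑ Z Squares   ≡⟨ inghamSum≡∑Squares ⟨
        inghamSum ∎
        where
        open ≤-Reasoning
        D²x∣N⇒x≡1 : ∀ {x} → D ℕ.* D ℕ.* x ∣ N → x ≡ 1
        D²x∣N⇒x≡1 {x} d = ∣1⇒≡1 (*-cancelˡ-∣ N (subst₂ _∣_ (cong (ℕ._* x) D²≡N) (sym (ℕ.*-identityʳ N)) d))
        only-one : ∀ k → ∑ Z (λ x → ⟦ D ℕ.* D ℕ.* x ∣? N ⟧ * h (k ℕ.* x)) ≡ h (k ℕ.* 1)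
        only-one k = trans
          (∑-single Z 1 (ℕ.≤-trans (s≤s (ℕ.>-nonZero⁻¹ N)) N<Z) λ x _ x≢1 →
            x≡0⇒x*y≡0 (h (k ℕ.* x)) (⟦⟧-no (D ℕ.* D ℕ.* x ∣? N) λ d → x≢1 (D²x∣N⇒x≡1 d)))
          (trans (cong (_* h (k ℕ.* 1)) (⟦⟧-yes (D ℕ.* D ℕ.* 1 ∣? N) (∣-reflexive (trans (ℕ.*-identityʳ _) D²≡N))))
                 (*-identityˡ (h (k ℕ.* 1))))
        Squares-D : Squares D ≡ R 1 1
        Squares-D = trans (squares Z (λ x → ⟦ D ℕ.* D ℕ.* x ∣? N ⟧))
          (∑-cong′ n λ k → cong₂ _*_ (only-one k) (only-one k))

module Sawtooth where

  open import Relation.Binary.Definitions using (Tri; tri<; tri≈; tri>)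
  open Rationals

  infix 8 _⁺

  _⁺ : ℚ → ℚ
  x ⁺ = 0ℚ ⊔ x

  ⁺-pos : ∀ {x} → 0ℚ ≤ x → x ⁺ ≡ x
  ⁺-pos = p≤q⇒p⊔q≡q

  ⁺-neg : ∀ {x} → x ≤ 0ℚ → x ⁺ ≡ 0ℚ
  ⁺-neg = p≥q⇒p⊔q≡p

  ⁺≥0 : ∀ x → 0ℚ ≤ x ⁺
  ⁺≥0 x = p≤p⊔q 0ℚ x

  ⁺-scale : ∀ {c} → 0ℚ ≤ c → ∀ x → c * x ⁺ ≡ (c * x) ⁺
  ⁺-scale {c} 0≤c x = trans (*-distribˡ-⊔-nonNeg c {{nonNegative 0≤c}} 0ℚ x) (cong (_⊔ (c * x)) (*-zeroʳ c))

  floor-ℕ : ∀ Y → 0ℚ ≤ Y → ∃ λ J → ι J ≤ Y × Y < ι (suc J)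
  floor-ℕ Y 0≤Y = search (proj₁ upper-bound) (<-≤-trans (<-by 1ℚ 0<1 refl) (proj₂ upper-bound))
    where
    upper-bound : ∃ λ N → Y + 1ℚ ≤ ι N
    upper-bound = archimedean (Y + 1ℚ)
    search : ∀ N → Y < ι N → ∃ λ J → ι J ≤ Y × Y < ι (suc J)
    search zero    lt = ⊥-elim (<⇒≱ lt (subst (_≤ Y) (sym fromℤ-0) 0≤Y))
    search (suc N) lt with ι N ≤? Y
    ... | yes le = N , le , lt
    ... | no ¬le = search N (≰⇒> ¬le)

  -- sawtooth Z Y is θ(1 − θ) with θ the fractional part of Y, provided Y ≤ Z.
  sawtooth : ℕ → ℚ → ℚ
  sawtooth Z Y = 2ℚ * ∑ Z (λ a → (Y - ι (suc a)) ⁺) - Y * Y + Y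

  private
    arithmetic-series : ∀ Y J → 2ℚ * ∑ J (λ a → Y - ι (suc a)) ≡ ι J * (Y + Y - ι J - 1ℚ)
    arithmetic-series Y zero    = sym (ι-0* (Y + Y - ι 0 - 1ℚ))
    arithmetic-series Y (suc J) = begin-equality
      2ℚ * ∑ (suc J) f        ≡⟨ cong (2ℚ *_) (∑-last J f) ⟩
      2ℚ * (∑ J f + f J)      ≡⟨ *-distribˡ-+ 2ℚ (∑ J f) (f J) ⟩
      2ℚ * ∑ J f + 2ℚ * f J   ≡⟨ cong₂ _+_ (arithmetic-series Y J) (cong (λ z → 2ℚ * (Y - z)) (ι-suc J)) ⟩
      ι J * (Y + Y - ι J - 1ℚ) + 2ℚ * (Y - (1ℚ + ι J))
        ≡⟨ extend (ι J) Y ⟩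
      (1ℚ + ι J) * (Y + Y - (1ℚ + ι J) - 1ℚ)
        ≡⟨ cong (λ z → z * (Y + Y - z - 1ℚ)) (sym (ι-suc J)) ⟩
      ι (suc J) * (Y + Y - ι (suc J) - 1ℚ) ∎
      where
      open ≤-Reasoning
      f : ℕ → ℚ
      f a = Y - ι (suc a)
      extend : ∀ j y → j * (y + y - j - 1ℚ) + (1ℚ + 1ℚ) * (y - (1ℚ + j)) ≡ (1ℚ + j) * (y + y - (1ℚ + j) - 1ℚ)
      extend = solve-∀ ringℚ

  sawtooth-floor : ∀ Z Y J → J ℕ.≤ Z → ι J ≤ Y → Y < ι (suc J) → sawtooth Z Y ≡ (Y - ι J) * (1ℚ - (Y - ι J))
  sawtooth-floor Z Y J J≤Z J≤Y Y<J+1 = begin-equality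
    2ℚ * ∑ Z f - Y * Y + Y                       ≡⟨ cong (λ s → 2ℚ * s - Y * Y + Y) (∑-extend f J≤Z outside) ⟩
    2ℚ * ∑ J f - Y * Y + Y                       ≡⟨ cong (λ s → 2ℚ * s - Y * Y + Y) (∑-cong J inside) ⟩
    2ℚ * ∑ J (λ a → Y - ι (suc a)) - Y * Y + Y   ≡⟨ cong (λ s → s - Y * Y + Y) (arithmetic-series Y J) ⟩
    ι J * (Y + Y - ι J - 1ℚ) - Y * Y + Y         ≡⟨ complete (ι J) Y ⟩
    (Y - ι J) * (1ℚ - (Y - ι J)) ∎
    where
    open ≤-Reasoning
    f : ℕ → ℚ
    f a = (Y - ι (suc a)) ⁺
    complete : ∀ j y → j * (y + y - j - 1ℚ) - y * y + y ≡ (y - j) * (1ℚ - (y - j))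
    complete = solve-∀ ringℚ
    inside : ∀ a → a ℕ.< J → f a ≡ Y - ι (suc a)
    inside a a<J = ⁺-pos (p≤q⇒0≤q-p (≤-trans (ι-mono a<J) J≤Y))
    outside : ∀ a → J ℕ.≤ a → f a ≡ 0ℚ
    outside a J≤a = ⁺-neg {Y - ι (suc a)} (≤-by (ι (suc a) - Y) (p≤q⇒0≤q-p (≤-trans (<⇒≤ Y<J+1) (ι-mono (s≤s J≤a))))
      (cancel Y (ι (suc a))))
      where
      cancel : ∀ y a → (y - a) + (a - y) ≡ 0ℚ
      cancel = solve-∀ ringℚ

  private
    ∣θ[1-θ]-θ′[1-θ′]∣≤θ-θ′ : ∀ θ θ′ → θ′ ≤ θ → 0ℚ ≤ θ′ → θ ≤ 1ℚ → ∣ θ * (1ℚ - θ) - θ′ * (1ℚ - θ′) ∣ ≤ θ - θ′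
    ∣θ[1-θ]-θ′[1-θ′]∣≤θ-θ′ θ θ′ θ′≤θ 0≤θ′ θ≤1 = ∣∣≤
      (≤-by ((θ - θ′) * (θ + θ′)) (*≥0 (p≤q⇒0≤q-p θ′≤θ) (+≥0 (≤-trans 0≤θ′ θ′≤θ) 0≤θ′)) (upper θ θ′))
      (≤-by ((θ - θ′) * ((1ℚ - θ) + (1ℚ - θ′)))
        (*≥0 (p≤q⇒0≤q-p θ′≤θ) (+≥0 (p≤q⇒0≤q-p θ≤1) (p≤q⇒0≤q-p (≤-trans θ′≤θ θ≤1)))) (lower θ θ′))
      where
      upper : ∀ s t → s * (1ℚ - s) - t * (1ℚ - t) + (s - t) * (s + t) ≡ s - t
      upper = solve-∀ ringℚ
      lower : ∀ s t → - (s * (1ℚ - s) - t * (1ℚ - t)) + (s - t) * ((1ℚ - s) + (1ℚ - t)) ≡ s - t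
      lower = solve-∀ ringℚ

    ∣θ[1-θ]-θ′[1-θ′]∣≤g+1+θ-θ′ : ∀ θ θ′ g → 0ℚ ≤ g → 0ℚ ≤ θ → θ ≤ 1ℚ → 0ℚ ≤ θ′ → θ′ ≤ 1ℚ →
                                 ∣ θ * (1ℚ - θ) - θ′ * (1ℚ - θ′) ∣ ≤ g + 1ℚ + θ - θ′
    ∣θ[1-θ]-θ′[1-θ′]∣≤g+1+θ-θ′ θ θ′ g 0≤g 0≤θ θ≤1 0≤θ′ θ′≤1 = ∣∣≤
      (≤-by (g + θ * θ + (1ℚ - θ′) + θ′ * (1ℚ - θ′))
        (+≥0 (+≥0 (+≥0 0≤g (*≥0 0≤θ 0≤θ)) 0≤1-θ′) (*≥0 0≤θ′ 0≤1-θ′)) (upper θ θ′ g))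
      (≤-by (g + θ + (1ℚ - θ′) * (1ℚ - θ′) + θ * (1ℚ - θ))
        (+≥0 (+≥0 (+≥0 0≤g 0≤θ) (*≥0 0≤1-θ′ 0≤1-θ′)) (*≥0 0≤θ (p≤q⇒0≤q-p θ≤1))) (lower θ θ′ g))
      where
      0≤1-θ′ : 0ℚ ≤ 1ℚ - θ′
      0≤1-θ′ = p≤q⇒0≤q-p θ′≤1
      upper : ∀ s t g → s * (1ℚ - s) - t * (1ℚ - t) + (g + s * s + (1ℚ - t) + t * (1ℚ - t)) ≡ g + 1ℚ + s - t
      upper = solve-∀ ringℚ
      lower : ∀ s t g →
        - (s * (1ℚ - s) - t * (1ℚ - t)) + (g + s + (1ℚ - t) * (1ℚ - t) + s * (1ℚ - s)) ≡ g + 1ℚ + s - t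
      lower = solve-∀ ringℚ

  module _ (Z : ℕ) where

    private
      record IntegerPart (Y : ℚ) : Set where
        field
          J       : ℕ
          J≤Y     : ι J ≤ Y
          Y<1+J   : Y < ι (suc J)
          formula : sawtooth Z Y ≡ (Y - ι J) * (1ℚ - (Y - ι J))

        0≤θ : 0ℚ ≤ Y - ι J
        0≤θ = p≤q⇒0≤q-p J≤Y

        θ≤1 : Y - ι J ≤ 1ℚ
        θ≤1 = ≤-by (ι (suc J) - Y) (p≤q⇒0≤q-p (<⇒≤ Y<1+J)) (trans (cong (λ z → Y - ι J + (z - Y)) (ι-suc J))
          (cancel Y (ι J)))
          where
          cancel : ∀ y j → y - j + (1ℚ + j - y) ≡ 1ℚ
          cancel = solve-∀ ringℚ

      integerPart : ∀ Y → 0ℚ ≤ Y → Y ≤ ι Z → IntegerPart Y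
      integerPart Y 0≤Y Y≤Z = record
        { J = J ; J≤Y = J≤Y ; Y<1+J = Y<1+J
        ; formula = sawtooth-floor Z Y J (ℕ.≮⇒≥ λ Z<J → <⇒≱ (<-≤-trans ιZ<ι[1+Z] (ι-mono Z<J)) (≤-trans J≤Y Y≤Z)) J≤Y
          Y<1+J
        }
        where
        J : ℕ
        J = proj₁ (floor-ℕ Y 0≤Y)
        J≤Y : ι J ≤ Y
        J≤Y = proj₁ (proj₂ (floor-ℕ Y 0≤Y))
        Y<1+J : Y < ι (suc J)
        Y<1+J = proj₂ (proj₂ (floor-ℕ Y 0≤Y))
        ιZ<ι[1+Z] : ι Z < ι (suc Z)
        ιZ<ι[1+Z] = <-by 1ℚ 0<1 (trans (+-comm (ι Z) 1ℚ) (sym (ι-suc Z)))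

    sawtooth≥0 : ∀ Y → 0ℚ ≤ Y → Y ≤ ι Z → 0ℚ ≤ sawtooth Z Y
    sawtooth≥0 Y 0≤Y Y≤Z = subst (0ℚ ≤_) (sym formula) (*≥0 0≤θ (p≤q⇒0≤q-p θ≤1))
      where open IntegerPart (integerPart Y 0≤Y Y≤Z)

    sawtooth≤ : ∀ Y → 0ℚ ≤ Y → Y ≤ ι Z → sawtooth Z Y ≤ Y
    sawtooth≤ Y 0≤Y Y≤Z = subst (_≤ Y) (sym formula)
      (≤-by ((Y - ι J) * (Y - ι J) + ι J) (+≥0 (*≥0 0≤θ 0≤θ) (ι≥0 J)) (restore (ι J) Y))
      where
      open IntegerPart (integerPart Y 0≤Y Y≤Z)
      restore : ∀ j y → (y - j) * (1ℚ - (y - j)) + ((y - j) * (y - j) + j) ≡ y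
      restore = solve-∀ ringℚ

    sawtooth-Lipschitz : ∀ Y Y′ → 0ℚ ≤ Y′ → Y′ ≤ Y → Y ≤ ι Z → ∣ sawtooth Z Y - sawtooth Z Y′ ∣ ≤ Y - Y′
    sawtooth-Lipschitz Y Y′ 0≤Y′ Y′≤Y Y≤Z = compare
      (integerPart Y (≤-trans 0≤Y′ Y′≤Y) Y≤Z) (integerPart Y′ 0≤Y′ (≤-trans Y′≤Y Y≤Z))
      where
      same-floor : ∀ y y′ j → (y - j) - (y′ - j) ≡ y - y′
      same-floor = solve-∀ ringℚ
      larger-floor : ∀ y y′ j j′ → j - (1ℚ + j′) + 1ℚ + (y - j) - (y′ - j′) ≡ y - y′
      larger-floor = solve-∀ ringℚ
      compare : IntegerPart Y → IntegerPart Y′ → ∣ sawtooth Z Y - sawtooth Z Y′ ∣ ≤ Y - Y′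
      compare s s′ = subst₂ (λ a b → ∣ a - b ∣ ≤ Y - Y′) (sym S.formula) (sym S′.formula)
        (by-floors (ℕ.<-cmp S′.J S.J))
        where
        module S = IntegerPart s
        module S′ = IntegerPart s′
        θ θ′ : ℚ
        θ = Y - ι S.J
        θ′ = Y′ - ι S′.J
        by-floors : Tri (S′.J ℕ.< S.J) (S′.J ≡ S.J) (S.J ℕ.< S′.J) → ∣ θ * (1ℚ - θ) - θ′ * (1ℚ - θ′) ∣ ≤ Y - Y′
        by-floors (tri> _ _ J<J′) = ⊥-elim (<⇒≱ S.Y<1+J (≤-trans (ι-mono J<J′) (≤-trans S′.J≤Y Y′≤Y)))
        by-floors (tri≈ _ J′≡J _) = ≤-trans
          (∣θ[1-θ]-θ′[1-θ′]∣≤θ-θ′ θ θ′ (0≤q-p⇒p≤q (subst (0ℚ ≤_) (sym θ-θ′≡Y-Y′) (p≤q⇒0≤q-p Y′≤Y))) S′.0≤θ S.θ≤1)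
          (≤-reflexive θ-θ′≡Y-Y′)
          where
          θ-θ′≡Y-Y′ : θ - θ′ ≡ Y - Y′
          θ-θ′≡Y-Y′ = trans (cong (λ J → θ - (Y′ - ι J)) J′≡J) (same-floor Y Y′ (ι S.J))
        by-floors (tri< J′<J _ _) = ≤-trans
          (∣θ[1-θ]-θ′[1-θ′]∣≤g+1+θ-θ′ θ θ′ (ι S.J - (1ℚ + ι S′.J))
            (p≤q⇒0≤q-p (subst (_≤ ι S.J) (ι-suc S′.J) (ι-mono J′<J))) S.0≤θ S.θ≤1 S′.0≤θ S′.θ≤1)
          (≤-reflexive (larger-floor Y Y′ (ι S.J) (ι S′.J)))

module Weight where

  open Rationals
  open Sawtooth

  w : ℚ → ℚ
  w s = (1ℚ - s) ⁺

  w≥0 : ∀ s → 0ℚ ≤ w s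
  w≥0 s = ⁺≥0 (1ℚ - s)

  w≤1 : ∀ {s} → 0ℚ ≤ s → w s ≤ 1ℚ
  w≤1 {s} 0≤s = subst (w s ≤_) (⁺-pos 0≤1) (⊔-monoʳ-≤ 0ℚ {1ℚ} {1ℚ - s} (≤-by s 0≤s (restore s)))
    where
    restore : ∀ s → 1ℚ - s + s ≡ 1ℚ
    restore = solve-∀ ringℚ

  w-zero : ∀ {s} → 1ℚ ≤ s → w s ≡ 0ℚ
  w-zero {s} 1≤s = ⁺-neg {1ℚ - s} (≤-by (s - 1ℚ) (p≤q⇒0≤q-p 1≤s) (cancel s))
    where
    cancel : ∀ s → 1ℚ - s + (s - 1ℚ) ≡ 0ℚ
    cancel = solve-∀ ringℚ

  ½≤w : ∀ {s} → s ≤ ½ → ½ ≤ w s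
  ½≤w {s} s≤½ = ≤-trans (≤-by (½ - s) (p≤q⇒0≤q-p s≤½) (double-half s)) (p≤q⊔p 0ℚ (1ℚ - s))
    where
    double-half : ∀ s → ½ + (½ - s) ≡ 1ℚ - s
    double-half = solve-∀ ringℚ

  w-antitone : ∀ {x y} → x ≤ y → w y ≤ w x
  w-antitone {x} {y} x≤y = ⊔-monoʳ-≤ 0ℚ (+-monoʳ-≤ 1ℚ (neg-antimono-≤ x≤y))

  w-dilate : ∀ {ρ η x} → 1ℚ ≤ ρ → ρ - 1ℚ ≤ η → 0ℚ ≤ x → ∣ w (ρ * x) - w x ∣ ≤ η
  w-dilate {ρ} {η} {x} 1≤ρ ρ-1≤η 0≤x with ≤-total 1ℚ x
  ... | inj₁ 1≤x = subst (λ d → ∣ d ∣ ≤ η) (sym (cong₂ _-_ (w-zero (≤-trans 1≤x x≤ρx)) (w-zero 1≤x)))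
                     (≤-trans (p≤q⇒0≤q-p 1≤ρ) ρ-1≤η)
    where
    x≤ρx : x ≤ ρ * x
    x≤ρx = subst (_≤ ρ * x) (*-identityˡ x) (*-monoʳ 0≤x 1≤ρ)
  ... | inj₂ x≤1 = ∣∣≤ (≤-by (η + (w x - w (ρ * x))) (+≥0 0≤η (p≤q⇒0≤q-p (w-antitone x≤ρx)))
    (cancel (w (ρ * x)) (w x) η))
                       (≤-trans drop≤ρ-1 ρ-1≤η)
    where
    0≤η : 0ℚ ≤ η
    0≤η = ≤-trans (p≤q⇒0≤q-p 1≤ρ) ρ-1≤η
    x≤ρx : x ≤ ρ * x
    x≤ρx = subst (_≤ ρ * x) (*-identityˡ x) (*-monoʳ 0≤x 1≤ρ)
    cancel : ∀ a b e → a - b + (e + (b - a)) ≡ e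
    cancel = solve-∀ ringℚ
    drop≤ρ-1 : - (w (ρ * x) - w x) ≤ ρ - 1ℚ
    drop≤ρ-1 = ≤-by ((w (ρ * x) - (1ℚ - ρ * x)) + (ρ - 1ℚ) * (1ℚ - x))
      (+≥0 (p≤q⇒0≤q-p (p≤q⊔p 0ℚ (1ℚ - ρ * x))) (*≥0 (p≤q⇒0≤q-p 1≤ρ) (p≤q⇒0≤q-p x≤1)))
      (trans (cong (λ v → - (w (ρ * x) - v) + ((w (ρ * x) - (1ℚ - ρ * x)) + (ρ - 1ℚ) * (1ℚ - x)))
        (⁺-pos (p≤q⇒0≤q-p x≤1)))
             (balance (w (ρ * x)) ρ x))
      where
      balance : ∀ v r x → - (v - (1ℚ - x)) + ((v - (1ℚ - r * x)) + (r - 1ℚ) * (1ℚ - x)) ≡ r - 1ℚ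
      balance = solve-∀ ringℚ

module Möbius where

  open import Data.Nat.Coprimality using (coprime?; coprime⇒gcd≡1; gcd≡1⇒coprime)
  open import Data.Nat.Divisibility
  open import Data.Nat.GCD
  open Rationals

  möbius : ∀ G → ∃ λ (μ : ℕ → ℚ) → ∀ g → 0 ℕ.< g → g ℕ.≤ G → ∑ (suc G) (λ δ → ⟦ δ ∣? g ⟧ * μ δ) ≡ ⟦ g ℕ.≟ 1 ⟧
  möbius zero = (λ _ → 0ℚ) , λ { g 0<g g≤0 → ⊥-elim (ℕ.<-irrefl refl (ℕ.<-≤-trans 0<g g≤0)) }
  möbius (suc G) with möbius G
  ... | μ , inverse = μ′ , inverse′
    where
    value : ℚ
    value = ⟦ suc G ℕ.≟ 1 ⟧ - ∑ (suc G) (λ δ → ⟦ δ ∣? suc G ⟧ * μ δ)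
    μ′ : ℕ → ℚ
    μ′ δ with δ ℕ.≟ suc G
    ... | yes _ = value
    ... | no _  = μ δ
    μ′-old : ∀ δ → δ ℕ.< suc G → μ′ δ ≡ μ δ
    μ′-old δ δ<1+G with δ ℕ.≟ suc G
    ... | yes refl = ⊥-elim (ℕ.<-irrefl refl δ<1+G)
    ... | no _     = refl
    μ′-new : μ′ (suc G) ≡ value
    μ′-new with suc G ℕ.≟ suc G
    ... | yes _ = refl
    ... | no ¬p = ⊥-elim (¬p refl)
    divisor-sum : ∀ g →
      ∑ (suc (suc G)) (λ δ → ⟦ δ ∣? g ⟧ * μ′ δ) ≡ ∑ (suc G) (λ δ → ⟦ δ ∣? g ⟧ * μ δ) + ⟦ suc G ∣? g ⟧ * value
    divisor-sum g = trans (∑-last (suc G) (λ δ → ⟦ δ ∣? g ⟧ * μ′ δ))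
      (cong₂ _+_ (∑-cong (suc G) λ δ δ<1+G → cong (⟦ δ ∣? g ⟧ *_) (μ′-old δ δ<1+G)) (cong (⟦ suc G ∣? g ⟧ *_) μ′-new))
    inverse′ : ∀ g → 0 ℕ.< g → g ℕ.≤ suc G → ∑ (suc (suc G)) (λ δ → ⟦ δ ∣? g ⟧ * μ′ δ) ≡ ⟦ g ℕ.≟ 1 ⟧
    inverse′ g 0<g g≤1+G with ℕ.m≤n⇒m<n∨m≡n g≤1+G
    ... | inj₁ (s≤s g≤G) = trans (divisor-sum g) (trans (cong₂ _+_ (inverse g 0<g g≤G)
            (x≡0⇒x*y≡0 value (⟦⟧-no (suc G ∣? g) λ 1+G∣g → ℕ.<-irrefl refl
              (ℕ.<-≤-trans (s≤s g≤G) (∣⇒≤ {{ℕ.>-nonZero 0<g}} 1+G∣g)))))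
            (+-identityʳ ⟦ g ℕ.≟ 1 ⟧))
    ... | inj₂ refl = trans (divisor-sum (suc G)) (trans (cong (λ o → X + o * value) (⟦⟧-yes (suc G ∣? suc G) ∣-refl))
      (restore X ⟦ suc G ℕ.≟ 1 ⟧))
      where
      X : ℚ
      X = ∑ (suc G) (λ δ → ⟦ δ ∣? suc G ⟧ * μ δ)
      restore : ∀ x o → x + 1ℚ * (o - x) ≡ o
      restore = solve-∀ ringℚ

  ∑-multiples : ∀ Z δ (φ : ℕ → ℚ) → 0 ℕ.< δ → (∀ j → Z ℕ.< j → φ j ≡ 0ℚ) →
                ∑ Z (λ a → ⟦ δ ∣? suc a ⟧ * φ (suc a)) ≡ ∑ Z (λ b → φ (δ ℕ.* suc b))
  ∑-multiples Z δ@(suc δ′) φ 0<δ out = begin-equality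
    ∑ Z (λ a → ⟦ δ ∣? suc a ⟧ * φ (suc a))
      ≡⟨ ∑-cong Z (λ a a<Z → cong (_* φ (suc a)) (sym (count a a<Z))) ⟩
    ∑ Z (λ a → ∑ Z (λ b → ⟦ suc a ℕ.≟ δ ℕ.* suc b ⟧) * φ (suc a))
      ≡⟨ ∑-cong′ Z (λ a → *-distribʳ-∑ Z (φ (suc a)) (λ b → ⟦ suc a ℕ.≟ δ ℕ.* suc b ⟧)) ⟩
    ∑ Z (λ a → ∑ Z (λ b → ⟦ suc a ℕ.≟ δ ℕ.* suc b ⟧ * φ (suc a)))
      ≡⟨ ∑-comm Z Z _ ⟩
    ∑ Z (λ b → ∑ Z (λ a → ⟦ suc a ℕ.≟ δ ℕ.* suc b ⟧ * φ (suc a)))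
      ≡⟨ ∑-cong′ Z pick ⟩
    ∑ Z (λ b → φ (δ ℕ.* suc b)) ∎
    where
    open ≤-Reasoning
    count : ∀ a → a ℕ.< Z → ∑ Z (λ b → ⟦ suc a ℕ.≟ δ ℕ.* suc b ⟧) ≡ ⟦ δ ∣? suc a ⟧
    count a a<Z with δ ∣? suc a
    ... | no ¬d = ∑-zero Z λ b _ → ⟦⟧-no (suc a ℕ.≟ δ ℕ.* suc b) λ eq →
      ¬d (divides (suc b) (trans eq (ℕ.*-comm δ (suc b))))
    ... | yes (divides zero ())
    ... | yes (divides (suc b₀) eq) = trans
      (∑-single Z b₀ (ℕ.≤-trans (ℕ.≤-trans (ℕ.m≤m*n (suc b₀) δ) (ℕ.≤-reflexive (sym eq))) a<Z)
        (λ b _ b≢ → ⟦⟧-no (suc a ℕ.≟ δ ℕ.* suc b) λ eq′ → b≢ (ℕ.suc-injective (ℕ.*-cancelˡ-≡ (suc b) (suc b₀) δ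
          (trans (sym eq′) (trans eq (ℕ.*-comm (suc b₀) δ)))))))
      (⟦⟧-yes (suc a ℕ.≟ δ ℕ.* suc b₀) (trans eq (ℕ.*-comm (suc b₀) δ)))
    pick : ∀ b → ∑ Z (λ a → ⟦ suc a ℕ.≟ δ ℕ.* suc b ⟧ * φ (suc a)) ≡ φ (δ ℕ.* suc b)
    pick b with δ ℕ.* suc b ℕ.≤? Z
    ... | yes le = trans (∑-single Z (ℕ.pred (δ ℕ.* suc b)) le λ a _ a≢ → x≡0⇒x*y≡0 (φ (suc a))
      (⟦⟧-no (suc a ℕ.≟ δ ℕ.* suc b) λ eq → a≢ (cong ℕ.pred eq)))
                         (trans (cong (_* φ (δ ℕ.* suc b)) (⟦⟧-yes (δ ℕ.* suc b ℕ.≟ δ ℕ.* suc b) refl))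
                           (*-identityˡ (φ (δ ℕ.* suc b))))
    ... | no ¬le = trans (∑-zero Z λ a a<Z → x≡0⇒x*y≡0 (φ (suc a)) (⟦⟧-no (suc a ℕ.≟ δ ℕ.* suc b) λ eq →
      ¬le (subst (ℕ._≤ Z) eq a<Z)))
                         (sym (out _ (ℕ.≰⇒> ¬le)))

  module MöbiusFunction (n : ℕ) {{_ : NonZero n}} where

    μ : ℕ → ℚ
    μ = proj₁ (möbius n)

    ∥μ∥ : ℚ
    ∥μ∥ = ∑ (suc n) (λ δ → ∣ μ δ ∣)

    coprime-möbius : ∀ a → ⟦ coprime? a n ⟧ ≡ ∑ (suc n) (λ δ → ⟦ δ ∣? a ⟧ * (⟦ δ ∣? n ⟧ * μ δ))
    coprime-möbius a = begin-equality
      ⟦ coprime? a n ⟧   ≡⟨ ⟦⟧-cong (coprime? a n) (gcd a n ℕ.≟ 1) coprime⇒gcd≡1 gcd≡1⇒coprime ⟩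
      ⟦ gcd a n ℕ.≟ 1 ⟧                                    ≡⟨ proj₂ (möbius n) (gcd a n)
                                                                 (ℕ.n≢0⇒n>0 (gcd[m,n]≢0 a n (inj₂ (ℕ.≢-nonZero⁻¹ n))))
                                                                   (gcd[m,n]≤n a n) ⟨
      ∑ (suc n) (λ δ → ⟦ δ ∣? gcd a n ⟧ * μ δ)
        ≡⟨ ∑-cong′ (suc n) (λ δ → trans (cong (_* μ δ) (both δ)) (*-assoc ⟦ δ ∣? a ⟧ ⟦ δ ∣? n ⟧ (μ δ))) ⟩
      ∑ (suc n) (λ δ → ⟦ δ ∣? a ⟧ * (⟦ δ ∣? n ⟧ * μ δ)) ∎
      where
      open ≤-Reasoning
      both : ∀ δ → ⟦ δ ∣? gcd a n ⟧ ≡ ⟦ δ ∣? a ⟧ * ⟦ δ ∣? n ⟧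
      both δ = ⟦⟧-× (δ ∣? gcd a n) (δ ∣? a) (δ ∣? n)
        (λ δ∣gcd → ∣-trans δ∣gcd (gcd[m,n]∣m a n) , ∣-trans δ∣gcd (gcd[m,n]∣n a n)) gcd-greatest

module SmoothedSums where

  open import Data.Nat.Coprimality using (coprime?)
  open import Data.Nat.Divisibility using (_∣?_; 0∣⇒≡0)
  open Rationals
  open Sawtooth
  open Weight
  open Möbius

  harmonic : ℕ → ℚ
  harmonic N = ∑ N (λ i → inv (ι (suc i)))

  harmonic≥0 : ∀ N → 0ℚ ≤ harmonic N
  harmonic≥0 N = ∑-nonNeg N λ i _ → inv≥0 (ι>0 i)

  record SmallSums (Z : ℕ) (f : ℕ → ℚ) (C : ℚ) : Set where
    field
      C≥0     : 0ℚ ≤ C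
      partial : ∀ i → ∣ ∑ i f ∣ ≤ C
      mean    : ι Z * ∣ ∑ Z (λ m → f m * inv (ι (suc m))) ∣ ≤ C

  smoothedBound : ℕ → ℚ → ℚ
  smoothedBound Z C = C * (4ℚ + 2ℚ * harmonic (suc Z))

  smoothedBound≥0 : ∀ Z {C} → 0ℚ ≤ C → 0ℚ ≤ smoothedBound Z C
  smoothedBound≥0 Z C≥0 = *≥0 C≥0 (+≥0 (+≥0 0≤2 0≤2) (*≥0 0≤2 (harmonic≥0 (suc Z))))

  module Smoothing (Z : ℕ) (z : ℚ) (0<z : 0ℚ < z) (1≤Zz : 1ℚ ≤ ι Z * z) where

    smoothed : ℕ → ℚ
    smoothed m = ∑ Z (λ a → w (ι (suc m) * ι (suc a) * z))

    private
      u Y ρ : ℕ → ℚ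
      u m = ι (suc m) * z
      Y m = inv (u m)
      ρ m = u m * sawtooth Z (Y m)

      0<u : ∀ m → 0ℚ < u m
      0<u m = *>0 (ι>0 m) 0<z

      0≤Y : ∀ m → 0ℚ ≤ Y m
      0≤Y m = inv≥0 (0<u m)

      uY≡1 : ∀ m → u m * Y m ≡ 1ℚ
      uY≡1 m = *-inv⁺ (0<u m)

      Y≤Z : ∀ m → Y m ≤ ι Z
      Y≤Z m = *-cancelˡ-≤ (0<u m) (begin
        u m * Y m        ≡⟨ uY≡1 m ⟩
        1ℚ               ≤⟨ 1≤Zz ⟩
        ι Z * z          ≡⟨ cong (ι Z *_) (sym (*-identityˡ z)) ⟩
        ι Z * (1ℚ * z)   ≤⟨ *-monoˡ (ι≥0 Z) (*-monoʳ (<⇒≤ 0<z) (ι≥1 m)) ⟩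
        ι Z * u m        ≡⟨ *-comm (ι Z) (u m) ⟩
        u m * ι Z ∎)
        where open ≤-Reasoning

      smoothed-formula : ∀ m → 2ℚ * smoothed m ≡ Y m - 1ℚ + ρ m
      smoothed-formula m = begin-equality
        2ℚ * smoothed m       ≡⟨ cong (2ℚ *_) (∑-cong′ Z λ a → sym (term a)) ⟩
        2ℚ * ∑ Z (λ a → u m * (Y m - ι (suc a)) ⁺)
          ≡⟨ cong (2ℚ *_) (sym (*-distribˡ-∑ Z (u m) _)) ⟩
        2ℚ * (u m * S)        ≡⟨ complete (u m) (Y m) S ⟩
        Y m * (u m * Y m) - u m * Y m + u m * sawtooth Z (Y m)
          ≡⟨ cong (λ o → Y m * o - o + ρ m) (uY≡1 m) ⟩
        Y m * 1ℚ - 1ℚ + ρ m   ≡⟨ cong (λ y → y - 1ℚ + ρ m) (*-identityʳ (Y m)) ⟩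
        Y m - 1ℚ + ρ m ∎
        where
        open ≤-Reasoning
        S : ℚ
        S = ∑ Z (λ a → (Y m - ι (suc a)) ⁺)
        complete : ∀ u y s → (1ℚ + 1ℚ) * (u * s) ≡ y * (u * y) - u * y + u * ((1ℚ + 1ℚ) * s - y * y + y)
        complete = solve-∀ ringℚ
        distribute : ∀ i z y a → i * z * (y - a) ≡ i * z * y - i * a * z
        distribute = solve-∀ ringℚ
        term : ∀ a → u m * (Y m - ι (suc a)) ⁺ ≡ w (ι (suc m) * ι (suc a) * z)
        term a = trans (⁺-scale (<⇒≤ (0<u m)) (Y m - ι (suc a)))
          (cong _⁺ (trans (distribute (ι (suc m)) z (Y m) (ι (suc a)))
            (cong (_- ι (suc m) * ι (suc a) * z) (uY≡1 m))))

      ρ≥0 : ∀ m → 0ℚ ≤ ρ m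
      ρ≥0 m = *≥0 (<⇒≤ (0<u m)) (sawtooth≥0 Z (Y m) (0≤Y m) (Y≤Z m))

      ρ≤1 : ∀ m → ρ m ≤ 1ℚ
      ρ≤1 m = subst (ρ m ≤_) (uY≡1 m) (*-monoˡ (<⇒≤ (0<u m)) (sawtooth≤ Z (Y m) (0≤Y m) (Y≤Z m)))

      u-suc : ∀ m → u (suc m) ≡ u m + z
      u-suc m = ι-suc* (suc m) z

      zY : ∀ m → z * Y m ≡ inv (ι (suc m))
      zY m = inv-unique (ι>0 m) (trans (sym (*-assoc (ι (suc m)) z (Y m))) (uY≡1 m))

      Y-suc≤Y : ∀ m → Y (suc m) ≤ Y m
      Y-suc≤Y m = inv-anti (0<u m) (≤-by z (<⇒≤ 0<z) (sym (u-suc m)))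

      u[Y-Y-suc] : ∀ m → u m * (Y m - Y (suc m)) ≡ inv (ι (suc (suc m)))
      u[Y-Y-suc] m = begin
        u m * (Y m - Y (suc m))   ≡⟨ distribute (u m) z (Y m) (Y (suc m)) ⟩
        u m * Y m - (u m + z) * Y (suc m) + z * Y (suc m)
          ≡⟨ cong (λ v → u m * Y m - v * Y (suc m) + z * Y (suc m)) (sym (u-suc m)) ⟩
        u m * Y m - u (suc m) * Y (suc m) + z * Y (suc m)
          ≡⟨ cong₂ (λ o o′ → o - o′ + z * Y (suc m)) (uY≡1 m) (uY≡1 (suc m)) ⟩
        0ℚ + z * Y (suc m)        ≡⟨ trans (+-identityˡ (z * Y (suc m))) (zY (suc m)) ⟩
        inv (ι (suc (suc m))) ∎
        where
        open ≡-Reasoning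
        distribute : ∀ u z a b → u * (a - b) ≡ u * a - (u + z) * b + z * b
        distribute = solve-∀ ringℚ

      ρ-variation : ∀ m → ∣ ρ m - ρ (suc m) ∣ ≤ 2ℚ * inv (ι (suc (suc m)))
      ρ-variation m = begin
        ∣ u m * T - u (suc m) * T′ ∣
          ≡⟨ cong ∣_∣ (trans (cong (λ v → u m * T - v * T′) (u-suc m)) (regroup (u m) z T T′)) ⟩
        ∣ u m * (T - T′) - z * T′ ∣
          ≤⟨ ∣∣-- (∣∣-* (∣∣-nonNeg (<⇒≤ (0<u m)) ≤-refl) (sawtooth-Lipschitz Z (Y m) (Y (suc m)) (0≤Y (suc m))
             (Y-suc≤Y m) (Y≤Z m)))
               (∣∣-nonNeg (*≥0 (<⇒≤ 0<z) (sawtooth≥0 Z (Y (suc m)) (0≤Y (suc m)) (Y≤Z (suc m))))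
                 (*-monoˡ (<⇒≤ 0<z) (sawtooth≤ Z (Y (suc m)) (0≤Y (suc m)) (Y≤Z (suc m))))) ⟩
        u m * (Y m - Y (suc m)) + z * Y (suc m)
          ≡⟨ cong₂ _+_ (u[Y-Y-suc] m) (zY (suc m)) ⟩
        inv (ι (suc (suc m))) + inv (ι (suc (suc m)))
          ≡⟨ double (inv (ι (suc (suc m)))) ⟩
        2ℚ * inv (ι (suc (suc m))) ∎
        where
        open ≤-Reasoning
        T T′ : ℚ
        T = sawtooth Z (Y m)
        T′ = sawtooth Z (Y (suc m))
        regroup : ∀ u z s t → u * s - (u + z) * t ≡ u * (s - t) - z * t
        regroup = solve-∀ ringℚ
        double : ∀ x → x + x ≡ (1ℚ + 1ℚ) * x
        double = solve-∀ ringℚ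

    module _ {f : ℕ → ℚ} {C : ℚ} (small : SmallSums Z f C) where

      open SmallSums small

      private
        main-term : ∣ ∑ Z (λ m → f m * Y m) ∣ ≤ C
        main-term = begin
          ∣ ∑ Z (λ m → f m * Y m) ∣   ≡⟨ cong ∣_∣ (trans (∑-cong′ Z separate) (sym (*-distribˡ-∑ Z (inv z) _))) ⟩
          ∣ inv z * M ∣               ≡⟨ ∣p*q∣≡∣p∣*∣q∣ (inv z) M ⟩
          ∣ inv z ∣ * ∣ M ∣           ≤⟨ *-monoʳ (0≤∣p∣ M) (∣∣-nonNeg (inv≥0 0<z) inv≤Z) ⟩
          ι Z * ∣ M ∣                 ≤⟨ mean ⟩
          C ∎
          where
          open ≤-Reasoning
          M : ℚ
          M = ∑ Z (λ m → f m * inv (ι (suc m)))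
          inv≤Z : inv z ≤ ι Z
          inv≤Z = *-cancelˡ-≤ 0<z (subst₂ _≤_ (sym (*-inv⁺ 0<z)) (*-comm (ι Z) z) 1≤Zz)
          Y≡ : ∀ m → Y m ≡ inv z * inv (ι (suc m))
          Y≡ m = sym (inv-unique (0<u m) (trans (regroup (ι (suc m)) z (inv z) (inv (ι (suc m))))
            (cong₂ _*_ (*-inv⁺ (ι>0 m)) (*-inv⁺ 0<z))))
            where
            regroup : ∀ a b c d → a * b * (c * d) ≡ (a * d) * (b * c)
            regroup = solve-∀ ringℚ
          separate : ∀ m → f m * Y m ≡ inv z * (f m * inv (ι (suc m)))
          separate m = trans (cong (f m *_) (Y≡ m)) (x∙yz≈y∙xz (f m) (inv z) (inv (ι (suc m))))

        remainder : ∣ ∑ Z (λ m → f m * ρ m) ∣ ≤ C * (1ℚ + 2ℚ * harmonic (suc Z))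
        remainder = up-to Z refl
          where
          reciprocal : ℕ → ℚ
          reciprocal i = inv (ι (suc i))
          tail≤harmonic : ∀ N → ∑ N (λ i → reciprocal (suc i)) ≤ harmonic (suc (suc N))
          tail≤harmonic N = ≤-trans
            (≤-by (reciprocal 0) (inv≥0 (ι>0 0)) (+-comm (∑ N (λ i → reciprocal (suc i))) (reciprocal 0)))
            (≤-by (reciprocal (suc N)) (inv≥0 (ι>0 (suc N))) (sym (∑-last (suc N) reciprocal)))
          up-to : ∀ N → N ≡ Z → ∣ ∑ N (λ m → f m * ρ m) ∣ ≤ C * (1ℚ + 2ℚ * harmonic (suc Z))
          up-to zero    refl = *≥0 C≥0 (+≥0 0≤1 (*≥0 0≤2 (harmonic≥0 (suc Z))))
          up-to (suc N) refl = ≤-trans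
            (summation-by-parts-bound N f ρ (λ i → 2ℚ * reciprocal (suc i)) C C≥0 partial (λ i _ → ρ-variation i))
            (*-monoˡ C≥0 (+-mono-≤ (∣∣-nonNeg (ρ≥0 N) (ρ≤1 N))
              (subst (_≤ 2ℚ * harmonic (suc Z)) (*-distribˡ-∑ N 2ℚ (λ i → reciprocal (suc i)))
                (*-monoˡ 0≤2 (tail≤harmonic N)))))

        doubled : 2ℚ * ∑ Z (λ m → f m * smoothed m) ≡ ∑ Z (λ m → f m * Y m) - ∑ Z f + ∑ Z (λ m → f m * ρ m)
        doubled = begin
          2ℚ * ∑ Z (λ m → f m * smoothed m)         ≡⟨ *-distribˡ-∑ Z 2ℚ _ ⟩
          ∑ Z (λ m → 2ℚ * (f m * smoothed m))       ≡⟨ ∑-cong′ Z expand ⟩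
          ∑ Z (λ m → f m * Y m - f m + f m * ρ m)   ≡⟨ ∑-distrib-+ Z (λ m → f m * Y m - f m) (λ m → f m * ρ m) ⟩
          ∑ Z (λ m → f m * Y m - f m) + ∑ Z (λ m → f m * ρ m)
            ≡⟨ cong (_+ ∑ Z (λ m → f m * ρ m)) (∑-- Z (λ m → f m * Y m) f) ⟩
          ∑ Z (λ m → f m * Y m) - ∑ Z f + ∑ Z (λ m → f m * ρ m) ∎
          where
          open ≡-Reasoning
          distribute : ∀ f y r → f * (y - 1ℚ + r) ≡ f * y - f + f * r
          distribute = solve-∀ ringℚ
          expand : ∀ m → 2ℚ * (f m * smoothed m) ≡ f m * Y m - f m + f m * ρ m
          expand m = trans (x∙yz≈y∙xz 2ℚ (f m) (smoothed m))
            (trans (cong (f m *_) (smoothed-formula m)) (distribute (f m) (Y m) (ρ m)))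

      -- The main term Σ f(m)/(mz) is small by the hypothesis on Σ f(m)/m; the remainder ρ has bounded variation.
      smoothed-bound : ∣ ∑ Z (λ m → f m * smoothed m) ∣ ≤ smoothedBound Z C
      smoothed-bound = begin
        ∣ S ∣        ≤⟨ ∣x∣≤∣2x∣ S ⟩
        ∣ 2ℚ * S ∣   ≡⟨ cong ∣_∣ doubled ⟩
        ∣ ∑ Z (λ m → f m * Y m) - ∑ Z f + ∑ Z (λ m → f m * ρ m) ∣
          ≤⟨ ∣∣-+ {∑ Z (λ m → f m * Y m) - ∑ Z f} (∣∣-- main-term (partial Z)) remainder ⟩
        C + C + C * (1ℚ + 2ℚ * harmonic (suc Z))
          ≤⟨ ≤-by C C≥0 (collect C (2ℚ * harmonic (suc Z))) ⟩
        smoothedBound Z C ∎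
        where
        open ≤-Reasoning
        S : ℚ
        S = ∑ Z (λ m → f m * smoothed m)
        collect : ∀ c x → c + c + c * (1ℚ + x) + c ≡ c * ((1ℚ + 1ℚ) + (1ℚ + 1ℚ) + x)
        collect = solve-∀ ringℚ

  module CoprimeSmoothing (n : ℕ) {{_ : NonZero n}} where

    open MöbiusFunction n

    module _ {Z : ℕ} {z : ℚ} (0<z : 0ℚ < z) (1≤Zz : 1ℚ ≤ ι Z * z) {f : ℕ → ℚ} {C : ℚ} (small : SmallSums Z f C) where

      private
        κ : ℕ → ℚ
        κ δ = ⟦ δ ∣? n ⟧ * μ δ

        V : ℕ → ℕ → ℚ
        V δ m = ∑ Z (λ a → ⟦ δ ∣? suc a ⟧ * w (ι (suc m) * ι (suc a) * z))

        sieve : ∀ m →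
          ∑ Z (λ a → ⟦ coprime? (suc a) n ⟧ * w (ι (suc m) * ι (suc a) * z)) ≡ ∑ (suc n) (λ δ → κ δ * V δ m)
        sieve m = begin
          ∑ Z (λ a → ⟦ coprime? (suc a) n ⟧ * W a)
            ≡⟨ ∑-cong′ Z (λ a → trans (cong (_* W a) (coprime-möbius (suc a)))
               (*-distribʳ-∑ (suc n) (W a) (λ δ → ⟦ δ ∣? suc a ⟧ * κ δ))) ⟩
          ∑ Z (λ a → ∑ (suc n) (λ δ → ⟦ δ ∣? suc a ⟧ * κ δ * W a))
            ≡⟨ ∑-comm Z (suc n) (λ a δ → ⟦ δ ∣? suc a ⟧ * κ δ * W a) ⟩
          ∑ (suc n) (λ δ → ∑ Z (λ a → ⟦ δ ∣? suc a ⟧ * κ δ * W a))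
            ≡⟨ ∑-cong′ (suc n) (λ δ → trans (∑-cong′ Z λ a → xy∙z≈y∙xz ⟦ δ ∣? suc a ⟧ (κ δ) (W a))
               (sym (*-distribˡ-∑ Z (κ δ) _))) ⟩
          ∑ (suc n) (λ δ → κ δ * V δ m) ∎
          where
          open ≡-Reasoning
          W : ℕ → ℚ
          W a = w (ι (suc m) * ι (suc a) * z)

        V-multiples : ∀ δ′ m → let δ = suc δ′ in V δ m ≡ ∑ Z (λ b → w (ι (suc m) * ι (suc b) * (ι δ * z)))
        V-multiples δ′ m = trans (∑-multiples Z δ (λ j → w (ι (suc m) * ι j * z)) (s≤s z≤n) outside)
          (∑-cong′ Z λ b → cong w (trans (cong (λ x → ι (suc m) * x * z) (ι-* δ (suc b)))
            (regroup (ι (suc m)) (ι δ) (ι (suc b)) z)))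
          where
          δ : ℕ
          δ = suc δ′
          regroup : ∀ m d b z → m * (d * b) * z ≡ m * b * (d * z)
          regroup = solve-∀ ringℚ
          outside : ∀ j → Z ℕ.< j → w (ι (suc m) * ι j * z) ≡ 0ℚ
          outside j Z<j = w-zero (≤-trans 1≤Zz (*-monoʳ (<⇒≤ 0<z) (≤-trans (ι-mono (ℕ.<⇒≤ Z<j))
            (subst (_≤ ι (suc m) * ι j) (*-identityˡ (ι j)) (*-monoʳ (ι≥0 j) (ι≥1 m))))))

        V-bound : ∀ δ → 0 ℕ.< δ → ∣ ∑ Z (λ m → f m * V δ m) ∣ ≤ smoothedBound Z C
        V-bound δ@(suc δ′) _ = subst (λ S → ∣ S ∣ ≤ smoothedBound Z C) (∑-cong′ Z λ m → cong (f m *_)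
          (sym (V-multiples δ′ m)))
          (Smoothing.smoothed-bound Z (ι δ * z) (*>0 (ι>0 δ′) 0<z) 1≤Zδz small)
          where
          1≤Zδz : 1ℚ ≤ ι Z * (ι δ * z)
          1≤Zδz = ≤-trans 1≤Zz (*-monoˡ (ι≥0 Z) (subst (_≤ ι δ * z) (*-identityˡ z) (*-monoʳ (<⇒≤ 0<z) (ι≥1 δ′))))

        κ-bound : ∀ δ → ∣ κ δ ∣ ≤ ∣ μ δ ∣
        κ-bound δ = subst (_≤ ∣ μ δ ∣) (sym (∣p*q∣≡∣p∣*∣q∣ ⟦ δ ∣? n ⟧ (μ δ)))
          (≤-trans (*-monoʳ (0≤∣p∣ (μ δ)) (∣∣-nonNeg (⟦⟧≥0 (δ ∣? n)) (⟦⟧≤1 (δ ∣? n))))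
            (≤-reflexive (*-identityˡ ∣ μ δ ∣)))

        κ-0 : κ 0 ≡ 0ℚ
        κ-0 = x≡0⇒x*y≡0 (μ 0) (⟦⟧-no (0 ∣? n) λ 0∣n → ℕ.≢-nonZero⁻¹ n (0∣⇒≡0 0∣n))

        divisor-term : ∀ δ → ∣ κ δ * ∑ Z (λ m → f m * V δ m) ∣ ≤ ∣ μ δ ∣ * smoothedBound Z C
        divisor-term zero = subst (_≤ ∣ μ 0 ∣ * smoothedBound Z C)
          (sym (cong ∣_∣ (x≡0⇒x*y≡0 (∑ Z (λ m → f m * V 0 m)) κ-0)))
          (*≥0 (0≤∣p∣ (μ 0)) (smoothedBound≥0 Z (SmallSums.C≥0 small)))
        divisor-term δ@(suc _) = ∣∣-* (κ-bound δ) (V-bound δ (s≤s z≤n))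

      coprime-smoothed-bound :
        ∣ ∑ Z (λ m → f m * ∑ Z (λ a → ⟦ coprime? (suc a) n ⟧ * w (ι (suc m) * ι (suc a) * z))) ∣ ≤
          ∥μ∥ * smoothedBound Z C
      coprime-smoothed-bound = begin
        ∣ ∑ Z (λ m → f m * ∑ Z (λ a → ⟦ coprime? (suc a) n ⟧ * w (ι (suc m) * ι (suc a) * z))) ∣
          ≡⟨ cong ∣_∣ (∑-cong′ Z λ m → trans (cong (f m *_) (sieve m))
             (*-distribˡ-∑ (suc n) (f m) (λ δ → κ δ * V δ m))) ⟩
        ∣ ∑ Z (λ m → ∑ (suc n) (λ δ → f m * (κ δ * V δ m))) ∣
          ≡⟨ cong ∣_∣ (trans (∑-comm Z (suc n) (λ m δ → f m * (κ δ * V δ m))) (∑-cong′ (suc n) pull)) ⟩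
        ∣ ∑ (suc n) (λ δ → κ δ * ∑ Z (λ m → f m * V δ m)) ∣
          ≤⟨ ∑-abs (suc n) (λ δ _ → divisor-term δ) ⟩
        ∑ (suc n) (λ δ → ∣ μ δ ∣ * smoothedBound Z C)
          ≡⟨ *-distribʳ-∑ (suc n) (smoothedBound Z C) (λ δ → ∣ μ δ ∣) ⟨
        ∥μ∥ * smoothedBound Z C ∎
        where
        open ≤-Reasoning
        pull : ∀ δ → ∑ Z (λ m → f m * (κ δ * V δ m)) ≡ κ δ * ∑ Z (λ m → f m * V δ m)
        pull δ = trans (∑-cong′ Z λ m → x∙yz≈y∙xz (f m) (κ δ) (V δ m)) (sym (*-distribˡ-∑ Z (κ δ) _))

module Powers where

  open import Algebra.Bundles using (CommutativeRing)
  open Rationals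
  open import Algebra.Properties.CommutativeSemiring.Exp
    (CommutativeRing.commutativeSemiring +-*-commutativeRing) public
    using (_^_; ^-homo-*; ^-assocʳ; ^-distrib-*)

  ^-assocˡ : ∀ x m n → (x ^ n) ^ m ≡ x ^ (m ℕ.* n)
  ^-assocˡ x m n = trans (^-assocʳ x n m) (cong (x ^_) (ℕ.*-comm n m))

  1^ : ∀ i → 1ℚ ^ i ≡ 1ℚ
  1^ zero    = refl
  1^ (suc i) = trans (*-identityˡ (1ℚ ^ i)) (1^ i)

  ι-^ : ∀ n i → ι (n ℕ.^ i) ≡ ι n ^ i
  ι-^ n zero    = fromℤ-1
  ι-^ n (suc i) = trans (ι-* n (n ℕ.^ i)) (cong (ι n *_) (ι-^ n i))

  ^>0 : ∀ {x} → 0ℚ < x → ∀ i → 0ℚ < x ^ i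
  ^>0 0<x zero    = 0<1
  ^>0 0<x (suc i) = *>0 0<x (^>0 0<x i)

  ^≤1 : ∀ {x} → 0ℚ < x → x ≤ 1ℚ → ∀ i → x ^ i ≤ 1ℚ
  ^≤1 0<x x≤1 zero    = ≤-refl
  ^≤1 0<x x≤1 (suc i) = *-mono (<⇒≤ 0<x) x≤1 (<⇒≤ (^>0 0<x i)) (^≤1 0<x x≤1 i)

  1≤^ : ∀ {x} → 1ℚ ≤ x → ∀ i → 1ℚ ≤ x ^ i
  1≤^ 1≤x zero    = ≤-refl
  1≤^ {x} 1≤x (suc i) = ≤-trans (1≤^ 1≤x i)
    (subst (_≤ x * x ^ i) (*-identityˡ (x ^ i)) (*-monoʳ (≤-trans 0≤1 (1≤^ 1≤x i)) 1≤x))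

  ^-anti : ∀ {x} → 0ℚ < x → x ≤ 1ℚ → ∀ {i j} → i ℕ.≤ j → x ^ j ≤ x ^ i
  ^-anti {x} 0<x x≤1 {i} {j} i≤j = subst₂ _≤_
    (trans (sym (^-homo-* x i (j ∸ i))) (cong (x ^_) (ℕ.m+[n∸m]≡n i≤j))) (*-identityʳ (x ^ i))
    (*-monoˡ (<⇒≤ (^>0 0<x i)) (^≤1 0<x x≤1 (j ∸ i)))

  ^-mono : ∀ {x} → 1ℚ ≤ x → ∀ {i j} → i ℕ.≤ j → x ^ i ≤ x ^ j
  ^-mono {x} 1≤x {i} {j} i≤j = subst₂ _≤_ (*-identityʳ (x ^ i))
    (trans (sym (^-homo-* x i (j ∸ i))) (cong (x ^_) (ℕ.m+[n∸m]≡n i≤j)))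
    (*-monoˡ (≤-trans 0≤1 (1≤^ 1≤x i)) (1≤^ 1≤x (j ∸ i)))

  bernoulli : ∀ η → 0ℚ ≤ η → ∀ i → 1ℚ + ι i * η ≤ (1ℚ + η) ^ i
  bernoulli η 0≤η zero    = ≤-reflexive (trans (cong (λ z → 1ℚ + z) (ι-0* η)) (+-identityʳ 1ℚ))
  bernoulli η 0≤η (suc i) = ≤-trans
    (≤-by (ι i * (η * η)) (*≥0 (ι≥0 i) (*≥0 0≤η 0≤η))
      (trans (cong (λ z → 1ℚ + z * η + ι i * (η * η)) (ι-suc i)) (factor (ι i) η)))
    (*-monoˡ (+≥0 0≤1 0≤η) (bernoulli η 0≤η i))
    where
    factor : ∀ i e → 1ℚ + (1ℚ + i) * e + i * (e * e) ≡ (1ℚ + e) * (1ℚ + i * e)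
    factor = solve-∀ ringℚ

module LogScale where

  open import Data.Product using (∃₂)
  open Rationals
  open Weight
  open Powers

  -- The logarithmic scale pⁱ, where 1/p = 1 + η is close to 1.
  record Mesh : Set where
    field
      p η      : ℚ
      0<p      : 0ℚ < p
      0≤η      : 0ℚ ≤ η
      p[1+η]≡1 : p * (1ℚ + η) ≡ 1ℚ

    p≤1 : p ≤ 1ℚ
    p≤1 = subst₂ _≤_ (*-identityʳ p) p[1+η]≡1 (*-monoˡ (<⇒≤ 0<p) (≤-by η 0≤η refl))

    p^>0 : ∀ i → 0ℚ < p ^ i
    p^>0 = ^>0 0<p

    p^≥0 : ∀ i → 0ℚ ≤ p ^ i
    p^≥0 i = <⇒≤ (p^>0 i)

    p^-anti : ∀ {i j} → i ℕ.≤ j → p ^ j ≤ p ^ i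
    p^-anti = ^-anti 0<p p≤1

  module Scales (mesh : Mesh) where

    open Mesh mesh

    t : ℕ → ℕ → ℚ
    t i M = w (ι M * p ^ i)

    t≥0 : ∀ i M → 0ℚ ≤ t i M
    t≥0 i M = w≥0 (ι M * p ^ i)

    ∣t∣≤1 : ∀ i M → ∣ t i M ∣ ≤ 1ℚ
    ∣t∣≤1 i M = ∣∣-nonNeg (t≥0 i M) (w≤1 (*≥0 (ι≥0 M) (p^≥0 i)))

    t-zero : ∀ i M → 1ℚ ≤ ι M * p ^ i → t i M ≡ 0ℚ
    t-zero i M = w-zero

    ω : ℕ → ℕ → ℕ → ℚ
    ω I M M′ = ∑ (suc I) (λ i → t i M * t (I ∸ i) M′)

    Ω : ℕ → ℕ → ℚ
    Ω I = ω I 1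

    Ω≥0 : ∀ I N → 0ℚ ≤ Ω I N
    Ω≥0 I N = ∑-nonNeg (suc I) λ i _ → *≥0 (t≥0 i 1) (t≥0 (I ∸ i) N)

    Ω-zero : ∀ I N → 1ℚ ≤ ι N * p ^ I → Ω I N ≡ 0ℚ
    Ω-zero I N 1≤Np^I = ∑-zero (suc I) λ i _ → y≡0⇒x*y≡0 (t i 1) (t-zero (I ∸ i) N
      (≤-trans 1≤Np^I (*-monoˡ (ι≥0 N) (p^-anti (ℕ.m∸n≤m I i)))))

    private
      crossing : ∀ M I → 1ℚ ≤ ι M → ι M * p ^ I < 1ℚ →
                 ∃₂ λ s L → s ℕ.+ L ≡ I × 1ℚ ≤ ι M * p ^ s × ι M * p ^ suc s < 1ℚ
      crossing M zero    1≤M Mp^I<1 = ⊥-elim (<⇒≱ Mp^I<1 (subst (1ℚ ≤_) (sym (*-identityʳ (ι M))) 1≤M))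
      crossing M (suc I) 1≤M Mp^I<1 with 1ℚ ≤? ι M * p ^ I
      ... | yes 1≤Mp^I = I , 1 , ℕ.+-comm I 1 , 1≤Mp^I , Mp^I<1
      ... | no 1≰Mp^I with crossing M I 1≤M (≰⇒> 1≰Mp^I)
      ...   | s , L , s+L≡I , above , below = s , suc L , trans (ℕ.+-suc s L) (cong suc s+L≡I) , above , below

      product-diff : ∀ {a b c d e} → ∣ a - b ∣ ≤ e → ∣ c - d ∣ ≤ e → ∣ a ∣ ≤ 1ℚ → ∣ d ∣ ≤ 1ℚ →
        ∣ a * c - b * d ∣ ≤ e + e
      product-diff {a} {b} {c} {d} {e} a≈b c≈d a≤1 d≤1 =
        subst₂ (λ x y → ∣ x ∣ ≤ y) (sym (telescope a b c d)) (cong₂ _+_ (*-identityˡ e) (*-identityʳ e))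
          (∣∣-+ (∣∣-* a≤1 c≈d) (∣∣-* a≈b d≤1))
        where
        telescope : ∀ a b c d → a * c - b * d ≡ a * (c - d) + (a - b) * d
        telescope = solve-∀ ringℚ

      -- The first s terms of ω and the last s terms of Ω vanish; the others match up to a dilation by ρ ≈ 1.
      module Crossing (s L M M′-1 : ℕ) (above : 1ℚ ≤ ι M * p ^ s) (below : ι M * p ^ suc s < 1ℚ) where

        M′ : ℕ
        M′ = suc M′-1

        ρ : ℚ
        ρ = ι M * p ^ s

        ρ-1≤η : ρ - 1ℚ ≤ η
        ρ-1≤η = ≤-by ((1ℚ - ι M * p ^ suc s) * (1ℚ + η)) (*≥0 (p≤q⇒0≤q-p (<⇒≤ below)) (+≥0 0≤1 0≤η))
          (trans (expand (ι M) (p ^ s) p η) (trans (cong (λ o → ρ - 1ℚ + (1ℚ + η - ρ * o)) p[1+η]≡1) (cancel ρ η)))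
          where
          expand : ∀ m x p e →
            m * x - 1ℚ + (1ℚ - m * (p * x)) * (1ℚ + e) ≡ m * x - 1ℚ + (1ℚ + e - m * x * (p * (1ℚ + e)))
          expand = solve-∀ ringℚ
          cancel : ∀ r e → r - 1ℚ + (1ℚ + e - r * 1ℚ) ≡ e
          cancel = solve-∀ ringℚ

        F G : ℕ → ℚ
        F j = t (s ℕ.+ j) M * t (L ∸ j) M′
        G j = t j 1 * t (s ℕ.+ (L ∸ j)) (M ℕ.* M′)

        ω-tail : ω (s ℕ.+ L) M M′ ≡ ∑ (suc L) F
        ω-tail = begin-equality
          ∑ (suc (s ℕ.+ L)) f                     ≡⟨ cong (λ N → ∑ N f) (sym (ℕ.+-suc s L)) ⟩
          ∑ (s ℕ.+ suc L) f                       ≡⟨ ∑-split s (suc L) f ⟩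
          ∑ s f + ∑ (suc L) (λ j → f (s ℕ.+ j))   ≡⟨ cong₂ _+_ (∑-zero s vanish) (∑-cong′ (suc L) reindex) ⟩
          0ℚ + ∑ (suc L) F                        ≡⟨ +-identityˡ (∑ (suc L) F) ⟩
          ∑ (suc L) F ∎
          where
          open ≤-Reasoning
          f : ℕ → ℚ
          f i = t i M * t (s ℕ.+ L ∸ i) M′
          vanish : ∀ i → i ℕ.< s → f i ≡ 0ℚ
          vanish i i<s = x≡0⇒x*y≡0 (t (s ℕ.+ L ∸ i) M′)
            (t-zero i M (≤-trans above (*-monoˡ (ι≥0 M) (p^-anti (ℕ.<⇒≤ i<s)))))
          reindex : ∀ j → f (s ℕ.+ j) ≡ F j
          reindex j = cong (λ k → t (s ℕ.+ j) M * t k M′) (ℕ.[m+n]∸[m+o]≡n∸o s L j)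

        Ω-head : Ω (s ℕ.+ L) (M ℕ.* M′) ≡ ∑ (suc L) G
        Ω-head = begin-equality
          ∑ (suc (s ℕ.+ L)) f   ≡⟨ cong (λ N → ∑ N f) (cong suc (ℕ.+-comm s L)) ⟩
          ∑ (suc L ℕ.+ s) f     ≡⟨ ∑-split (suc L) s f ⟩
          ∑ (suc L) f + ∑ s (λ j → f (suc L ℕ.+ j))
            ≡⟨ cong₂ _+_ (∑-cong (suc L) reindex) (∑-zero s vanish) ⟩
          ∑ (suc L) G + 0ℚ      ≡⟨ +-identityʳ (∑ (suc L) G) ⟩
          ∑ (suc L) G ∎
          where
          open ≤-Reasoning
          f : ℕ → ℚ
          f j = t j 1 * t (s ℕ.+ L ∸ j) (M ℕ.* M′)
          reindex : ∀ j → j ℕ.< suc L → f j ≡ G j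
          reindex j (s≤s j≤L) = cong (λ k → t j 1 * t k (M ℕ.* M′)) (ℕ.+-∸-assoc s j≤L)
          index≤s : ∀ j → s ℕ.+ L ∸ (suc L ℕ.+ j) ℕ.≤ s
          index≤s j = ℕ.≤-trans (ℕ.∸-monoʳ-≤ (s ℕ.+ L) (ℕ.≤-trans (ℕ.n≤1+n L) (ℕ.m≤m+n (suc L) j)))
            (ℕ.≤-reflexive (ℕ.m+n∸n≡m s L))
          vanish : ∀ j → j ℕ.< s → f (suc L ℕ.+ j) ≡ 0ℚ
          vanish j j<s = y≡0⇒x*y≡0 (t (suc L ℕ.+ j) 1) (t-zero (s ℕ.+ L ∸ (suc L ℕ.+ j)) (M ℕ.* M′)
            (≤-trans above (*-mono (ι≥0 M) (ι-mono (ℕ.m≤m*n M M′)) (p^≥0 s) (p^-anti (index≤s j)))))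

        F≈G : ∀ j → ∣ F j - G j ∣ ≤ η + η
        F≈G j = product-diff first second (∣t∣≤1 (s ℕ.+ j) M) (∣t∣≤1 (s ℕ.+ (L ∸ j)) (M ℕ.* M′))
          where
          first : ∣ t (s ℕ.+ j) M - t j 1 ∣ ≤ η
          first = subst₂ (λ x y → ∣ w x - w y ∣ ≤ η)
            (trans (*-assoc (ι M) (p ^ s) (p ^ j)) (cong (ι M *_) (sym (^-homo-* p s j))))
            (trans (sym (*-identityˡ (p ^ j))) (cong (_* p ^ j) (sym fromℤ-1)))
            (w-dilate above ρ-1≤η (p^≥0 j))
          dilated : ρ * (ι M′ * p ^ (L ∸ j)) ≡ ι (M ℕ.* M′) * p ^ (s ℕ.+ (L ∸ j))
          dilated = trans (interchange (ι M) (p ^ s) (ι M′) (p ^ (L ∸ j)))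
            (cong₂ _*_ (sym (ι-* M M′)) (sym (^-homo-* p s (L ∸ j))))
          second : ∣ t (L ∸ j) M′ - t (s ℕ.+ (L ∸ j)) (M ℕ.* M′) ∣ ≤ η
          second = subst (_≤ η)
            (trans (∣x-y∣≡∣y-x∣ (w (ρ * (ι M′ * p ^ (L ∸ j)))) (t (L ∸ j) M′))
              (cong (λ x → ∣ t (L ∸ j) M′ - w x ∣) dilated))
            (w-dilate above ρ-1≤η (*≥0 (ι≥0 M′) (p^≥0 (L ∸ j))))

        ω≈Ω-crossing : ∣ ω (s ℕ.+ L) M M′ - Ω (s ℕ.+ L) (M ℕ.* M′) ∣ ≤ ι (suc (s ℕ.+ L)) * (η + η)
        ω≈Ω-crossing = begin
          ∣ ω (s ℕ.+ L) M M′ - Ω (s ℕ.+ L) (M ℕ.* M′) ∣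
            ≡⟨ cong ∣_∣ (cong₂ _-_ ω-tail Ω-head) ⟩
          ∣ ∑ (suc L) F - ∑ (suc L) G ∣     ≡⟨ cong ∣_∣ (sym (∑-- (suc L) F G)) ⟩
          ∣ ∑ (suc L) (λ j → F j - G j) ∣   ≤⟨ ∑-abs (suc L) (λ j _ → F≈G j) ⟩
          ∑ (suc L) (λ _ → η + η)           ≡⟨ ∑-const (suc L) (η + η) ⟩
          ι (suc L) * (η + η)               ≤⟨ *-monoʳ (+≥0 0≤η 0≤η) (ι-mono (s≤s (ℕ.m≤n+m L s))) ⟩
          ι (suc (s ℕ.+ L)) * (η + η) ∎
          where open ≤-Reasoning

    ω≈Ω : ∀ I M M′ → 0 ℕ.< M → 0 ℕ.< M′ → ∣ ω I M M′ - Ω I (M ℕ.* M′) ∣ ≤ ι (suc I) * (η + η)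
    ω≈Ω I M@(suc M-1) M′@(suc M′-1) _ _ with 1ℚ ≤? ι M * p ^ I
    ... | no 1≰Mp^I with crossing M I (ι≥1 M-1) (≰⇒> 1≰Mp^I)
    ...   | s , L , refl , above , below = Crossing.ω≈Ω-crossing s L M M′-1 above below
    ω≈Ω I M@(suc M-1) M′@(suc M′-1) _ _ | yes 1≤Mp^I =
      subst (λ x → ∣ x ∣ ≤ ι (suc I) * (η + η)) (sym (cong₂ _-_ ω≡0 (Ω-zero I (M ℕ.* M′) 1≤MM′p^I)))
        (*≥0 (ι≥0 (suc I)) (+≥0 0≤η 0≤η))
      where
      ω≡0 : ω I M M′ ≡ 0ℚ
      ω≡0 = ∑-zero (suc I) λ { i (s≤s i≤I) →
        x≡0⇒x*y≡0 (t (I ∸ i) M′) (t-zero i M (≤-trans 1≤Mp^I (*-monoˡ (ι≥0 M) (p^-anti i≤I)))) }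
      1≤MM′p^I : 1ℚ ≤ ι (M ℕ.* M′) * p ^ I
      1≤MM′p^I = ≤-trans 1≤Mp^I (*-monoʳ (p^≥0 I) (ι-mono (ℕ.m≤m*n M M′)))

module Ingham where

  open import Data.Nat.Coprimality using (Coprime; coprime?; 0-coprimeTo-m⇒m≡1)
  open import Data.Nat.Divisibility
  open Rationals
  open Congruence
  open InghamIdentity
  open Weight
  open Möbius
  open SmoothedSums
  open Powers
  open LogScale

  module QuadrupleSum (Z : ℕ) where

    ∑⁴ : (ℕ → ℕ → ℕ → ℕ → ℚ) → ℚ
    ∑⁴ f = ∑ Z λ m → ∑ Z λ a → ∑ Z λ m′ → ∑ Z λ b → f m a m′ b

    ∑⁴-cong : ∀ {f g} → (∀ m a m′ b → f m a m′ b ≡ g m a m′ b) → ∑⁴ f ≡ ∑⁴ g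
    ∑⁴-cong eq = ∑-cong′ Z λ m → ∑-cong′ Z λ a → ∑-cong′ Z λ m′ → ∑-cong′ Z λ b → eq m a m′ b

    ∑⁴-zero : ∀ {f} → (∀ m a m′ b → f m a m′ b ≡ 0ℚ) → ∑⁴ f ≡ 0ℚ
    ∑⁴-zero eq = ∑-zero Z λ m _ → ∑-zero Z λ a _ → ∑-zero Z λ m′ _ → ∑-zero Z λ b _ → eq m a m′ b

    ∑-∑⁴-comm : ∀ N (f : ℕ → ℕ → ℕ → ℕ → ℕ → ℚ) →
                ∑ N (λ k → ∑⁴ (f k)) ≡ ∑⁴ (λ m a m′ b → ∑ N (λ k → f k m a m′ b))
    ∑-∑⁴-comm N f = trans (∑-comm N Z _) (∑-cong′ Z λ m → trans (∑-comm N Z _) (∑-cong′ Z λ a →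
      trans (∑-comm N Z _) (∑-cong′ Z λ m′ → ∑-comm N Z _)))

    *-distribˡ-∑⁴ : ∀ x f → x * ∑⁴ f ≡ ∑⁴ (λ m a m′ b → x * f m a m′ b)
    *-distribˡ-∑⁴ x f = trans (*-distribˡ-∑ Z x _) (∑-cong′ Z λ m → trans (*-distribˡ-∑ Z x _) (∑-cong′ Z λ a →
      trans (*-distribˡ-∑ Z x _) (∑-cong′ Z λ m′ → *-distribˡ-∑ Z x _)))

    ∑⁴-abs : ∀ f c → (∀ m a m′ b → ∣ f m a m′ b ∣ ≤ c) → ∣ ∑⁴ f ∣ ≤ ι Z * (ι Z * (ι Z * (ι Z * c)))
    ∑⁴-abs f c bound = ≤-trans (∑-abs Z λ m _ → ∑-abs Z λ a _ → ∑-abs Z λ m′ _ → ∑-abs Z λ b _ → bound m a m′ b)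
      (≤-reflexive (trans (∑-cong′ Z λ m → trans (∑-cong′ Z λ a → trans (∑-cong′ Z λ m′ → ∑-const Z c)
        (∑-const Z (ι Z * c)))
        (∑-const Z (ι Z * (ι Z * c)))) (∑-const Z (ι Z * (ι Z * (ι Z * c))))))

    ∑⁴-- : ∀ f g → ∑⁴ f - ∑⁴ g ≡ ∑⁴ (λ m a m′ b → f m a m′ b - g m a m′ b)
    ∑⁴-- f g = sym (trans (∑-cong′ Z λ m → trans (∑-cong′ Z λ a → trans (∑-cong′ Z λ m′ → ∑-- Z _ _) (∑-- Z _ _))
      (∑-- Z _ _)) (∑-- Z _ _))

    ∑⁴-product : ∀ (F G : ℕ → ℕ → ℚ) →
                 (∑ Z λ m → ∑ Z λ a → F m a) * (∑ Z λ m → ∑ Z λ a → G m a) ≡ ∑⁴ (λ m a m′ b → F m a * G m′ b)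
    ∑⁴-product F G = trans (*-distribʳ-∑ Z ∑G _) (∑-cong′ Z λ m → trans (*-distribʳ-∑ Z ∑G _) (∑-cong′ Z λ a →
      trans (*-distribˡ-∑ Z (F m a) _) (∑-cong′ Z λ m′ → *-distribˡ-∑ Z (F m a) _)))
      where
      ∑G : ℚ
      ∑G = ∑ Z λ m → ∑ Z λ a → G m a

  increasing≤∑ : ∀ Z (F : ℕ → ℚ) (N : ℕ → ℕ) W → (∀ i → i ℕ.< Z → 0ℚ ≤ F i) →
                 (∀ {i j} → i ℕ.< j → N i ℕ.< N j) → (∀ j → j ℕ.< W → N j ℕ.< Z) →
                 ∑ W (λ j → F (N j)) ≤ ∑ Z F
  increasing≤∑ Z F N W F≥0 increasing N<Z = begin
    ∑ W (λ j → F (N j))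
      ≡⟨ ∑-cong W (λ j j<W → sym (∑-select Z F (N j) (λ Z≤N → ⊥-elim (ℕ.<⇒≱ (N<Z j j<W) Z≤N)))) ⟩
    ∑ W (λ j → ∑ Z (λ i → ⟦ i ℕ.≟ N j ⟧ * F i))   ≡⟨ ∑-comm W Z _ ⟩
    ∑ Z (λ i → ∑ W (λ j → ⟦ i ℕ.≟ N j ⟧ * F i))   ≡⟨ ∑-cong′ Z (λ i → sym (*-distribʳ-∑ W (F i) _)) ⟩
    ∑ Z (λ i → ∑ W (λ j → ⟦ i ℕ.≟ N j ⟧) * F i)
      ≤⟨ ∑-mono Z (λ i i<Z → subst (∑ W (λ j → ⟦ i ℕ.≟ N j ⟧) * F i ≤_) (*-identityˡ (F i))
         (*-monoʳ (F≥0 i i<Z) (multiplicity≤1 W i))) ⟩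
    ∑ Z F ∎
    where
    open ≤-Reasoning
    multiplicity≤1 : ∀ W i → ∑ W (λ j → ⟦ i ℕ.≟ N j ⟧) ≤ 1ℚ
    multiplicity≤1 zero    i = 0≤1
    multiplicity≤1 (suc W) i with i ℕ.≟ N W
    ... | yes refl = ≤-reflexive (trans (∑-single (suc W) {λ j → ⟦ N W ℕ.≟ N j ⟧} W ℕ.≤-refl earlier)
      (⟦⟧-yes (N W ℕ.≟ N W) refl))
      where
      earlier : ∀ j → j ℕ.< suc W → j ≢ W → ⟦ N W ℕ.≟ N j ⟧ ≡ 0ℚ
      earlier j (s≤s j≤W) j≢W = ⟦⟧-no (N W ℕ.≟ N j) λ NW≡Nj → ℕ.<-irrefl (sym NW≡Nj) (increasing (ℕ.≤∧≢⇒< j≤W j≢W))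
    ... | no i≢NW = subst (_≤ 1ℚ) (sym (begin-equality
      ∑ (suc W) (λ j → ⟦ i ℕ.≟ N j ⟧)   ≡⟨ ∑-last W (λ j → ⟦ i ℕ.≟ N j ⟧) ⟩
      ∑ W (λ j → ⟦ i ℕ.≟ N j ⟧) + ⟦ i ℕ.≟ N W ⟧
        ≡⟨ cong (λ z → ∑ W (λ j → ⟦ i ℕ.≟ N j ⟧) + z) (⟦⟧-no (i ℕ.≟ N W) i≢NW) ⟩
      ∑ W (λ j → ⟦ i ℕ.≟ N j ⟧) + 0ℚ    ≡⟨ +-identityʳ (∑ W (λ j → ⟦ i ℕ.≟ N j ⟧)) ⟩
      ∑ W (λ j → ⟦ i ℕ.≟ N j ⟧) ∎)) (multiplicity≤1 W i)

  record SmallMeans (n : ℕ) {{_ : NonZero n}} (h : ℕ → ℚ) (C : ℚ) : Set where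
    field
      unitFunction : UnitFunction n h
      C≥0          : 0ℚ ≤ C
      partial      : ∀ k i → ∣ ∑ i (λ m → h (k ℕ.* m)) ∣ ≤ C
      mean         : ∀ k x → ι x * ∣ ∑ x (λ m → h (k ℕ.* suc m) * inv (ι (suc m))) ∣ ≤ C

  module Bounds (n : ℕ) {{_ : NonZero n}} (1<n : 1 ℕ.< n) {h : ℕ → ℚ} {C : ℚ} (smallMeans : SmallMeans n h C) where

    open SmallMeans smallMeans public
    open UnitFunction unitFunction
    open GramMatrix n 1<n h unitFunction public using (R; h-0; inghamSum; inghamSum≥0; R11≤inghamSum)
    open MöbiusFunction n public using (∥μ∥)

    χ : ℕ → ℚ
    χ a = ⟦ coprime? a n ⟧

    0⊥̸n : ¬ Coprime 0 n
    0⊥̸n 0⊥n = ℕ.<-irrefl (sym (0-coprimeTo-m⇒m≡1 0⊥n)) 1<n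

    χ-0 : χ 0 ≡ 0ℚ
    χ-0 = ⟦⟧-no (coprime? 0 n) 0⊥̸n

    Rmax : ℚ
    Rmax = ι n * ((C + C) * (C + C))

    Rmax≥0 : 0ℚ ≤ Rmax
    Rmax≥0 = *≥0 (ι≥0 n) (*≥0 (+≥0 C≥0 C≥0) (+≥0 C≥0 C≥0))

    h≤ : ∀ k m → ∣ h (k ℕ.* m) ∣ ≤ C + C
    h≤ k m = subst (λ x → ∣ x ∣ ≤ C + C) (trans (cong (_- ∑ m f) (∑-last m f)) (xyx⁻¹≈y (∑ m f) (f m)))
      (∣∣-- (partial k (suc m)) (partial k m))
      where
      f : ℕ → ℚ
      f m = h (k ℕ.* m)

    R≤ : ∀ m m′ → ∣ R m m′ ∣ ≤ Rmax
    R≤ m m′ = ≤-trans (∑-abs n λ k _ → ∣∣-* (h≤ k m) (h≤ k m′)) (≤-reflexive (∑-const n ((C + C) * (C + C))))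

    h-support : ∀ k {m} → ¬ Coprime m n → h (k ℕ.* m) ≡ 0ℚ
    h-support k {m} ¬m⊥n = support (k ℕ.* m) λ km⊥n → ¬m⊥n (coprime-∣ (n∣m*n k) km⊥n)

    weight : ℕ → ℕ → ℕ → ℕ → ℚ
    weight m a m′ b = R m m′ * (χ a * χ b)

    weight≤ : ∀ m a m′ b → ∣ weight m a m′ b ∣ ≤ Rmax
    weight≤ m a m′ b = subst (∣ weight m a m′ b ∣ ≤_) (*-identityʳ Rmax)
      (∣∣-* (R≤ m m′) (∣∣-nonNeg (*≥0 (⟦⟧≥0 (coprime? a n)) (⟦⟧≥0 (coprime? b n)))
        (*-mono (⟦⟧≥0 (coprime? a n)) (⟦⟧≤1 (coprime? a n)) (⟦⟧≥0 (coprime? b n)) (⟦⟧≤1 (coprime? b n)))))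

    weight-support : ∀ m a m′ b → ¬ Coprime (m ℕ.* a ℕ.* (m′ ℕ.* b)) n → weight m a m′ b ≡ 0ℚ
    weight-support m a m′ b ¬⊥ with coprime? a n | coprime? b n | coprime? m n | coprime? m′ n
    ... | no _    | b⊥?n    | _       | _        = y≡0⇒x*y≡0 (R m m′) (*-zeroˡ ⟦ b⊥?n ⟧)
    ... | yes _   | no _    | _       | _        = y≡0⇒x*y≡0 (R m m′) refl
    ... | yes _   | yes _   | no ¬m⊥n | _        = x≡0⇒x*y≡0 (1ℚ * 1ℚ) (∑-zero n λ k _ → x≡0⇒x*y≡0 (h (k ℕ.* m′))
      (h-support k ¬m⊥n))
    ... | yes _   | yes _   | yes _   | no ¬m′⊥n = x≡0⇒x*y≡0 (1ℚ * 1ℚ) (∑-zero n λ k _ → y≡0⇒x*y≡0 (h (k ℕ.* m))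
      (h-support k ¬m′⊥n))
    ... | yes a⊥n | yes b⊥n | yes m⊥n | yes m′⊥n =
      ⊥-elim (¬⊥ (coprime-* {m ℕ.* a} {m′ ℕ.* b} (coprime-* {m} {a} m⊥n a⊥n) (coprime-* {m′} {b} m′⊥n b⊥n)))

    module Average (mesh : Mesh) (Z Z′ I : ℕ) (Z≡1+Z′ : Z ≡ suc Z′) (large : 1ℚ ≤ ι Z′ * Mesh.p mesh ^ I) where

      open Mesh mesh
      open Scales mesh
      open QuadrupleSum Z

      smoothSum : ℕ → ℕ → ℚ
      smoothSum k i = ∑ Z λ m → ∑ Z λ a → h (k ℕ.* m) * (χ a * t i (m ℕ.* a))

      smoothSumMax : ℚ
      smoothSumMax = ∥μ∥ * smoothedBound Z′ C

      smoothSum≤ : ∀ k i → i ℕ.≤ I → ∣ smoothSum k i ∣ ≤ smoothSumMax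
      smoothSum≤ k i i≤I = subst (λ x → ∣ x ∣ ≤ smoothSumMax) (sym from-1)
        (CoprimeSmoothing.coprime-smoothed-bound n (p^>0 i) (≤-trans large (*-monoˡ (ι≥0 Z′) (p^-anti i≤I))) record
          { C≥0 = C≥0
          ; partial = λ j → subst (λ x → ∣ x ∣ ≤ C) (trans (cong (_+ ∑ j f) hk0≡0) (+-identityˡ (∑ j f)))
            (partial k (suc j))
          ; mean = mean k Z′
          })
        where
        open ≤-Reasoning
        f : ℕ → ℚ
        f m = h (k ℕ.* suc m)
        hk0≡0 : h (k ℕ.* 0) ≡ 0ℚ
        hk0≡0 = trans (cong h (ℕ.*-zeroʳ k)) h-0
        smoothed : ℕ → ℚ
        smoothed m = ∑ Z′ (λ a → χ (suc a) * w (ι (suc m) * ι (suc a) * p ^ i))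
        inner : ∀ m → ∑ (suc Z′) (λ a → χ a * t i (suc m ℕ.* a)) ≡ smoothed m
        inner m = trans (cong (_+ ∑ Z′ (λ a → χ (suc a) * t i (suc m ℕ.* suc a))) (x≡0⇒x*y≡0 (t i (suc m ℕ.* 0)) χ-0))
          (trans (+-identityˡ (∑ Z′ (λ a → χ (suc a) * t i (suc m ℕ.* suc a))))
            (∑-cong′ Z′ λ a → cong (λ x → χ (suc a) * w (x * p ^ i)) (ι-* (suc m) (suc a))))
        from-1 : smoothSum k i ≡ ∑ Z′ (λ m → f m * smoothed m)
        from-1 = begin-equality
          smoothSum k i
            ≡⟨ cong (λ Z → ∑ Z λ m → ∑ Z λ a → h (k ℕ.* m) * (χ a * t i (m ℕ.* a))) Z≡1+Z′ ⟩
          ∑ (suc Z′) (λ m → ∑ (suc Z′) λ a → h (k ℕ.* m) * (χ a * t i (m ℕ.* a)))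
            ≡⟨ cong₂ _+_ (∑-zero (suc Z′) λ a _ → x≡0⇒x*y≡0 (χ a * t i 0) hk0≡0)
                 (∑-cong′ Z′ λ m → trans (sym (*-distribˡ-∑ (suc Z′) (f m) (λ a → χ a * t i (suc m ℕ.* a))))
                   (cong (f m *_) (inner m))) ⟩
          0ℚ + ∑ Z′ (λ m → f m * smoothed m)
            ≡⟨ +-identityˡ (∑ Z′ (λ m → f m * smoothed m)) ⟩
          ∑ Z′ (λ m → f m * smoothed m) ∎

      -- The factorised form of the average below, up to the mesh error ω ≈ Ω.
      factorisedAverage : ℚ
      factorisedAverage = ∑ n (λ k → ∑ (suc I) (λ i → smoothSum k i * smoothSum k (I ∸ i)))

      factorisedAverage≤ : ∣ factorisedAverage ∣ ≤ ι n * (ι (suc I) * (smoothSumMax * smoothSumMax))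
      factorisedAverage≤ = ≤-trans
        (∑-abs n λ k _ → ∑-abs (suc I) {g = λ _ → smoothSumMax * smoothSumMax} λ { i (s≤s i≤I) →
          ∣∣-* (smoothSum≤ k i i≤I) (smoothSum≤ k (I ∸ i) (ℕ.m∸n≤m I i)) })
        (≤-reflexive (trans (∑-cong′ n λ _ → ∑-const (suc I) (smoothSumMax * smoothSumMax))
          (∑-const n (ι (suc I) * (smoothSumMax * smoothSumMax)))))

      factorisedAverage≡ : factorisedAverage ≡ ∑⁴ (λ m a m′ b → weight m a m′ b * ω I (m ℕ.* a) (m′ ℕ.* b))
      factorisedAverage≡ = begin-equality
        factorisedAverage
          ≡⟨ ∑-cong′ n (λ k → ∑-cong′ (suc I) λ i → ∑⁴-product (λ m a → h (k ℕ.* m) * (χ a * t i (m ℕ.* a)))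
             (λ m a → h (k ℕ.* m) * (χ a * t (I ∸ i) (m ℕ.* a)))) ⟩
        ∑ n (λ k → ∑ (suc I) (λ i → ∑⁴ (λ m a m′ b → term k i m a m′ b)))
          ≡⟨ ∑-cong′ n (λ k → ∑-∑⁴-comm (suc I) (λ i m a m′ b → term k i m a m′ b)) ⟩
        ∑ n (λ k → ∑⁴ (λ m a m′ b → ∑ (suc I) (λ i → term k i m a m′ b)))
          ≡⟨ ∑-∑⁴-comm n _ ⟩
        ∑⁴ (λ m a m′ b → ∑ n (λ k → ∑ (suc I) (λ i → term k i m a m′ b)))
          ≡⟨ ∑⁴-cong collect ⟩
        ∑⁴ (λ m a m′ b → weight m a m′ b * ω I (m ℕ.* a) (m′ ℕ.* b)) ∎
        where
        open ≤-Reasoning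
        term : ℕ → ℕ → ℕ → ℕ → ℕ → ℕ → ℚ
        term k i m a m′ b = h (k ℕ.* m) * (χ a * t i (m ℕ.* a)) * (h (k ℕ.* m′) * (χ b * t (I ∸ i) (m′ ℕ.* b)))
        regroup : ∀ x c u y d v → x * (c * u) * (y * (d * v)) ≡ x * y * (c * d) * (u * v)
        regroup = solve-∀ ringℚ
        collect : ∀ m a m′ b →
          ∑ n (λ k → ∑ (suc I) (λ i → term k i m a m′ b)) ≡ weight m a m′ b * ω I (m ℕ.* a) (m′ ℕ.* b)
        collect m a m′ b = begin-equality
          ∑ n (λ k → ∑ (suc I) (λ i → term k i m a m′ b))
            ≡⟨ ∑-cong′ n (λ k → trans
                 (∑-cong′ (suc I) λ i → regroup (h (k ℕ.* m)) (χ a) (t i (m ℕ.* a)) (h (k ℕ.* m′)) (χ b)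
                   (t (I ∸ i) (m′ ℕ.* b)))
                 (sym (*-distribˡ-∑ (suc I) (h (k ℕ.* m) * h (k ℕ.* m′) * (χ a * χ b))
                   (λ i → t i (m ℕ.* a) * t (I ∸ i) (m′ ℕ.* b))))) ⟩
          ∑ n (λ k → h (k ℕ.* m) * h (k ℕ.* m′) * (χ a * χ b) * ω I (m ℕ.* a) (m′ ℕ.* b))
            ≡⟨ *-distribʳ-∑ n (ω I (m ℕ.* a) (m′ ℕ.* b)) (λ k → h (k ℕ.* m) * h (k ℕ.* m′) * (χ a * χ b)) ⟨
          ∑ n (λ k → h (k ℕ.* m) * h (k ℕ.* m′) * (χ a * χ b)) * ω I (m ℕ.* a) (m′ ℕ.* b)
            ≡⟨ cong (_* ω I (m ℕ.* a) (m′ ℕ.* b))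
               (sym (*-distribʳ-∑ n (χ a * χ b) (λ k → h (k ℕ.* m) * h (k ℕ.* m′)))) ⟩
          weight m a m′ b * ω I (m ℕ.* a) (m′ ℕ.* b) ∎

      average : ℚ
      average = ∑⁴ (λ m a m′ b → weight m a m′ b * Ω I (m ℕ.* a ℕ.* (m′ ℕ.* b)))

      factorisedAverage≈average : ∣ factorisedAverage - average ∣ ≤
        ι Z * (ι Z * (ι Z * (ι Z * (Rmax * (ι (suc I) * (η + η))))))
      factorisedAverage≈average = subst (λ x → ∣ x ∣ ≤ ι Z * (ι Z * (ι Z * (ι Z * (Rmax * ε)))))
        (sym (trans (cong (_- average) factorisedAverage≡) (∑⁴-- _ _))) (∑⁴-abs _ (Rmax * ε) close)
        where
        ε : ℚ
        ε = ι (suc I) * (η + η)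
        ε≥0 : 0ℚ ≤ ε
        ε≥0 = *≥0 (ι≥0 (suc I)) (+≥0 0≤η 0≤η)
        factor : ∀ x u v → x * u - x * v ≡ x * (u - v)
        factor = solve-∀ ringℚ
        close : ∀ m a m′ b →
          ∣ weight m a m′ b * ω I (m ℕ.* a) (m′ ℕ.* b) - weight m a m′ b * Ω I (m ℕ.* a ℕ.* (m′ ℕ.* b)) ∣ ≤ Rmax * ε
        close m a m′ b = subst (λ x → ∣ x ∣ ≤ Rmax * ε) (sym (factor (weight m a m′ b) (ω I (m ℕ.* a) (m′ ℕ.* b))
          (Ω I (m ℕ.* a ℕ.* (m′ ℕ.* b)))))
          (by-product (m ℕ.* a ℕ.* (m′ ℕ.* b) ℕ.≟ 0))
          where
          Δ : ℚ
          Δ = ω I (m ℕ.* a) (m′ ℕ.* b) - Ω I (m ℕ.* a ℕ.* (m′ ℕ.* b))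
          by-product : Dec (m ℕ.* a ℕ.* (m′ ℕ.* b) ≡ 0) → ∣ weight m a m′ b * Δ ∣ ≤ Rmax * ε
          by-product (yes N≡0) = subst (λ x → ∣ x ∣ ≤ Rmax * ε)
            (sym (x≡0⇒x*y≡0 Δ (weight-support m a m′ b λ N⊥n → 0⊥̸n (subst (λ N → Coprime N n) N≡0 N⊥n))))
              (*≥0 Rmax≥0 ε≥0)
          by-product (no N≢0) = ∣∣-* (weight≤ m a m′ b)
            (ω≈Ω I (m ℕ.* a) (m′ ℕ.* b) (ℕ.n≢0⇒n>0 λ ma≡0 → N≢0 (cong (ℕ._* (m′ ℕ.* b)) ma≡0))
              (ℕ.n≢0⇒n>0 λ m′b≡0 → N≢0 (trans (cong (m ℕ.* a ℕ.*_) m′b≡0) (ℕ.*-zeroʳ (m ℕ.* a)))))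

      E : ℕ → ℚ
      E N = ∑⁴ (λ m a m′ b → ⟦ m ℕ.* a ℕ.* (m′ ℕ.* b) ℕ.≟ N ⟧ * weight m a m′ b)

      average≡ : average ≡ ∑ Z (λ N → Ω I N * E N)
      average≡ = sym (begin-equality
        ∑ Z (λ N → Ω I N * E N)
          ≡⟨ ∑-cong′ Z (λ N → *-distribˡ-∑⁴ (Ω I N) _) ⟩
        ∑ Z (λ N → ∑⁴ (λ m a m′ b → Ω I N * (⟦ m ℕ.* a ℕ.* (m′ ℕ.* b) ℕ.≟ N ⟧ * weight m a m′ b)))
          ≡⟨ ∑-∑⁴-comm Z _ ⟩
        ∑⁴ (λ m a m′ b → ∑ Z (λ N → Ω I N * (⟦ m ℕ.* a ℕ.* (m′ ℕ.* b) ℕ.≟ N ⟧ * weight m a m′ b)))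
          ≡⟨ ∑⁴-cong (λ m a m′ b → select (m ℕ.* a ℕ.* (m′ ℕ.* b)) (weight m a m′ b)) ⟩
        average ∎)
        where
        open ≤-Reasoning
        Ω-outside : ∀ N → Z ℕ.≤ N → Ω I N ≡ 0ℚ
        Ω-outside N Z≤N = Ω-zero I N
          (≤-trans large (*-monoʳ (p^≥0 I) (ι-mono (ℕ.≤-trans (ℕ.n≤1+n Z′) (subst (ℕ._≤ N) Z≡1+Z′ Z≤N)))))
        reorder : ∀ o d r → o * (d * r) ≡ r * (d * o)
        reorder = solve-∀ ringℚ
        select : ∀ P r → ∑ Z (λ N → Ω I N * (⟦ P ℕ.≟ N ⟧ * r)) ≡ r * Ω I P
        select P r = begin-equality
          ∑ Z (λ N → Ω I N * (⟦ P ℕ.≟ N ⟧ * r))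
            ≡⟨ ∑-cong′ Z (λ N → trans (reorder (Ω I N) ⟦ P ℕ.≟ N ⟧ r) (cong (λ d → r * (d * Ω I N))
               (⟦⟧-cong (P ℕ.≟ N) (N ℕ.≟ P) sym sym))) ⟩
          ∑ Z (λ N → r * (⟦ N ℕ.≟ P ⟧ * Ω I N))
            ≡⟨ *-distribˡ-∑ Z r (λ N → ⟦ N ℕ.≟ P ⟧ * Ω I N) ⟨
          r * ∑ Z (λ N → ⟦ N ℕ.≟ P ⟧ * Ω I N)
            ≡⟨ cong (r *_) (∑-select Z (Ω I) P (Ω-outside P)) ⟩
          r * Ω I P ∎

      E≡inghamSum : ∀ N {{_ : NonZero N}} (N<Z : N ℕ.< Z) (N⊥n : Coprime N n) → E N ≡ inghamSum Z N N<Z N⊥n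
      E≡inghamSum N N<Z N⊥n = ∑-cong′ Z λ m → trans (∑-comm Z Z _) (∑-cong′ Z λ m′ → begin-equality
        ∑ Z (λ a → ∑ Z (λ b → ⟦ m ℕ.* a ℕ.* (m′ ℕ.* b) ℕ.≟ N ⟧ * weight m a m′ b))
          ≡⟨ ∑-cong′ Z (λ a → ∑-cong′ Z λ b → regroup ⟦ m ℕ.* a ℕ.* (m′ ℕ.* b) ℕ.≟ N ⟧ (R m m′) (χ a * χ b)) ⟩
        ∑ Z (λ a → ∑ Z (λ b → ⟦ m ℕ.* a ℕ.* (m′ ℕ.* b) ℕ.≟ N ⟧ * (χ a * χ b) * R m m′))
          ≡⟨ ∑-cong′ Z (λ a → trans (sym (*-distribʳ-∑ Z (R m m′)
             (λ b → ⟦ m ℕ.* a ℕ.* (m′ ℕ.* b) ℕ.≟ N ⟧ * (χ a * χ b)))) (cong (_* R m m′) (cofactor m m′ a))) ⟩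
        ∑ Z (λ a → ⟦ m ℕ.* m′ ℕ.* a ∣? N ⟧ * R m m′)
          ≡⟨ *-distribʳ-∑ Z (R m m′) _ ⟨
        ∑ Z (λ a → ⟦ m ℕ.* m′ ℕ.* a ∣? N ⟧) * R m m′ ∎)
        where
        open ≤-Reasoning
        regroup : ∀ d r c → d * (r * c) ≡ d * c * r
        regroup = solve-∀ ringℚ
        reorder : ∀ m a m′ b → m ℕ.* a ℕ.* (m′ ℕ.* b) ≡ b ℕ.* (m ℕ.* m′ ℕ.* a)
        reorder = ℕR.solve-∀
        cofactor : ∀ m m′ a → ∑ Z (λ b → ⟦ m ℕ.* a ℕ.* (m′ ℕ.* b) ℕ.≟ N ⟧ * (χ a * χ b)) ≡ ⟦ m ℕ.* m′ ℕ.* a ∣? N ⟧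
        cofactor m m′ a with m ℕ.* m′ ℕ.* a ∣? N
        ... | no ∤N = ∑-zero Z λ b _ → x≡0⇒x*y≡0 (χ a * χ b)
          (⟦⟧-no (m ℕ.* a ℕ.* (m′ ℕ.* b) ℕ.≟ N) λ eq → ∤N (divides b (trans (sym eq) (reorder m a m′ b))))
        ... | yes mm′a∣N@(divides b₀ N≡b₀mm′a) = trans
          (∑-single Z b₀ (ℕ.≤-<-trans (∣⇒≤ b₀∣N) N<Z) λ b _ b≢b₀ → x≡0⇒x*y≡0 (χ a * χ b)
            (⟦⟧-no (m ℕ.* a ℕ.* (m′ ℕ.* b) ℕ.≟ N) λ eq →
              b≢b₀ (ℕ.*-cancelʳ-≡ b b₀ (m ℕ.* m′ ℕ.* a) {{mm′a≢0}} (trans (sym (reorder m a m′ b))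
                (trans eq N≡b₀mm′a)))))
          (cong₂ _*_ (⟦⟧-yes (m ℕ.* a ℕ.* (m′ ℕ.* b₀) ℕ.≟ N) (trans (reorder m a m′ b₀) (sym N≡b₀mm′a)))
            (cong₂ _*_ (⟦⟧-yes (coprime? a n) (coprime-∣ (m*n∣⇒n∣ (m ℕ.* m′) a mm′a∣N) N⊥n))
              (⟦⟧-yes (coprime? b₀ n) (coprime-∣ b₀∣N N⊥n))))
          where
          b₀∣N : b₀ ∣ N
          b₀∣N = divides (m ℕ.* m′ ℕ.* a) (trans N≡b₀mm′a (ℕ.*-comm b₀ (m ℕ.* m′ ℕ.* a)))
          mm′a≢0 : NonZero (m ℕ.* m′ ℕ.* a)
          mm′a≢0 = ℕ.≢-nonZero λ mm′a≡0 → ℕ.≢-nonZero⁻¹ N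
            (trans N≡b₀mm′a (trans (cong (b₀ ℕ.*_) mm′a≡0) (ℕ.*-zeroʳ b₀)))

      E≥0 : ∀ N → N ℕ.< Z → 0ℚ ≤ E N
      E≥0 N N<Z with coprime? N n
      ... | yes N⊥n = subst (0ℚ ≤_) (sym (E≡inghamSum N N<Z N⊥n)) (inghamSum≥0 Z N N<Z N⊥n)
        where
        instance
          N≢0 : NonZero N
          N≢0 = ℕ.≢-nonZero λ N≡0 → 0⊥̸n (subst (λ N → Coprime N n) N≡0 N⊥n)
      ... | no ¬N⊥n = ≤-reflexive (sym (∑⁴-zero λ m a m′ b → off m a m′ b (m ℕ.* a ℕ.* (m′ ℕ.* b) ℕ.≟ N)))
        where
        off : ∀ m a m′ b (d : Dec (m ℕ.* a ℕ.* (m′ ℕ.* b) ≡ N)) → ⟦ d ⟧ * weight m a m′ b ≡ 0ℚ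
        off m a m′ b (yes eq) = y≡0⇒x*y≡0 1ℚ (weight-support m a m′ b λ ⊥n → ¬N⊥n (subst (λ N → Coprime N n) eq ⊥n))
        off m a m′ b (no _)   = *-zeroˡ (weight m a m′ b)

      unitSquare : ℕ → ℕ
      unitSquare j = (1 ℕ.+ n ℕ.* j) ℕ.* (1 ℕ.+ n ℕ.* j)

      -- The squares of D = 1 + nj are coprime to n, and E is at least R 1 1 there.
      average-lower : ∀ W c → 0ℚ ≤ c → (∀ j → j ℕ.< W → unitSquare j ℕ.< Z) →
        (∀ j → j ℕ.< W → c ≤ Ω I (unitSquare j)) → 0ℚ ≤ R 1 1 → ι W * (c * R 1 1) ≤ average
      average-lower W c 0≤c D²<Z c≤Ω R≥0 = begin
        ι W * (c * R 1 1)         ≡⟨ ∑-const W (c * R 1 1) ⟨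
        ∑ W (λ _ → c * R 1 1)     ≤⟨ ∑-mono W (λ j j<W → *-mono 0≤c (c≤Ω j j<W) R≥0 (R≤E j j<W)) ⟩
        ∑ W (λ j → Ω I (unitSquare j) * E (unitSquare j))
          ≤⟨ increasing≤∑ Z (λ N → Ω I N * E N) unitSquare W (λ N N<Z → *≥0 (Ω≥0 I N) (E≥0 N N<Z))
             (λ i<j → ℕ.*-mono-< (D-mono i<j) (D-mono i<j)) D²<Z ⟩
        ∑ Z (λ N → Ω I N * E N)   ≡⟨ average≡ ⟨
        average ∎
        where
        open ≤-Reasoning
        D : ℕ → ℕ
        D j = 1 ℕ.+ n ℕ.* j
        D-mono : ∀ {i j} → i ℕ.< j → D i ℕ.< D j
        D-mono i<j = s≤s (ℕ.*-monoʳ-< n i<j)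
        D⊥n : ∀ j → Coprime (D j) n
        D⊥n j {d} (d∣D , d∣n) = ∣1⇒≡1 (∣m+n∣m⇒∣n (subst (d ∣_) (ℕ.+-comm 1 (n ℕ.* j)) d∣D) (∣m⇒∣m*n j d∣n))
        R≤E : ∀ j → j ℕ.< W → R 1 1 ≤ E (unitSquare j)
        R≤E j j<W = subst (R 1 1 ≤_) (sym (E≡inghamSum (unitSquare j) (D²<Z j j<W) D²⊥n))
          (R11≤inghamSum Z (unitSquare j) (D²<Z j j<W) D²⊥n (D j) refl)
          where
          D²⊥n : Coprime (unitSquare j) n
          D²⊥n = coprime-* {D j} {D j} (D⊥n j) (D⊥n j)

module NonVanishing where

  open import Data.Nat.DivMod using (m%n<n)
  open Rationals
  open InghamIdentity
  open Weight
  open Möbius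
  open SmoothedSums
  open Powers
  open LogScale
  open Ingham

  harmonic-+ : ∀ N M → harmonic (N ℕ.+ M) ≤ harmonic N + ι M * inv (ι (suc N))
  harmonic-+ N M = begin
    harmonic (N ℕ.+ M)                         ≡⟨ ∑-split N M _ ⟩
    harmonic N + ∑ M (λ i → inv (ι (suc (N ℕ.+ i))))
      ≤⟨ +-monoʳ-≤ (harmonic N) (∑-mono M λ i _ → inv-anti (ι>0 N) (ι-mono (s≤s (ℕ.m≤m+n N i)))) ⟩
    harmonic N + ∑ M (λ i → inv (ι (suc N)))   ≡⟨ cong (λ z → harmonic N + z) (∑-const M (inv (ι (suc N)))) ⟩
    harmonic N + ι M * inv (ι (suc N)) ∎
    where open ≤-Reasoning

  harmonic-^ : ∀ B k → harmonic (suc B ℕ.^ k) ≤ 1ℚ + ι k * ι B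
  harmonic-^ B zero    = ≤-reflexive (trans (+-identityʳ (inv (ι 1))) (trans (trans (cong inv fromℤ-1) inv-1)
    (sym (trans (cong (λ z → 1ℚ + z) (ι-0* (ι B))) (+-identityʳ 1ℚ)))))
  harmonic-^ B (suc k) = begin
    harmonic (N ℕ.+ B ℕ.* N)   ≤⟨ harmonic-+ N (B ℕ.* N) ⟩
    harmonic N + ι (B ℕ.* N) * inv (ι (suc N))
      ≤⟨ +-mono-≤ (harmonic-^ B k) block ⟩
    1ℚ + ι k * ι B + ι B       ≡⟨ +-assoc 1ℚ (ι k * ι B) (ι B) ⟩
    1ℚ + (ι k * ι B + ι B)     ≡⟨ cong (λ z → 1ℚ + z) (sym (ι-suc* k (ι B))) ⟩
    1ℚ + ι (suc k) * ι B ∎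
    where
    open ≤-Reasoning
    N : ℕ
    N = suc B ℕ.^ k
    block : ι (B ℕ.* N) * inv (ι (suc N)) ≤ ι B
    block = begin
      ι (B ℕ.* N) * inv (ι (suc N))         ≤⟨ *-monoʳ (inv≥0 (ι>0 N)) (ι-mono (ℕ.*-monoʳ-≤ B (ℕ.n≤1+n N))) ⟩
      ι (B ℕ.* suc N) * inv (ι (suc N))
        ≡⟨ trans (cong (_* inv (ι (suc N))) (ι-* B (suc N))) (*-assoc (ι B) (ι (suc N)) (inv (ι (suc N)))) ⟩
      ι B * (ι (suc N) * inv (ι (suc N)))   ≡⟨ trans (cong (ι B *_) (*-inv⁺ (ι>0 N))) (*-identityʳ (ι B)) ⟩
      ι B ∎

  first-power : ∀ q X → 1ℚ < X → ∀ i → X ≤ q ^ i → ∃ λ J → X ≤ q ^ suc J × q ^ J < X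
  first-power q X 1<X zero    X≤1 = ⊥-elim (<⇒≱ 1<X X≤1)
  first-power q X 1<X (suc i) X≤q^1+i with X ≤? q ^ i
  ... | yes X≤q^i = first-power q X 1<X i X≤q^i
  ... | no X≰q^i  = i , X≤q^1+i , ≰⇒> X≰q^i

  module _ (n : ℕ) {{_ : NonZero n}} (1<n : 1 ℕ.< n) {h : ℕ → ℚ} {C : ℚ} (smallMeans : SmallMeans n h C) where

    open Bounds n 1<n smallMeans
    open UnitFunction unitFunction using (periodic)

    private
      R≥0 : 0ℚ ≤ R 1 1
      R≥0 = ∑-nonNeg n λ k _ → sq≥0 (h (k ℕ.* 1))

      ∥μ∥≥0 : 0ℚ ≤ ∥μ∥
      ∥μ∥≥0 = ∑-nonNeg (suc n) λ δ _ → 0≤∣p∣ (MöbiusFunction.μ n δ)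

      κ R11Max : ℚ
      κ = ∥μ∥ * (C * (4ℚ + 2ℚ * (2ℚ + ι 8 * (ι 4 * ι n))))
      R11Max = ι 9 * 4ℚ * (ι n * (κ * κ) + 2ℚ * Rmax)

      κ≥0 : 0ℚ ≤ κ
      κ≥0 = *≥0 ∥μ∥≥0 (*≥0 C≥0 (+≥0 (+≥0 0≤2 0≤2) (*≥0 0≤2 (+≥0 0≤2 (*≥0 (ι≥0 8) (*≥0 (ι≥0 4) (ι≥0 n)))))))

      R11Max≥0 : 0ℚ ≤ R11Max
      R11Max≥0 = *≥0 (*≥0 (ι≥0 9) (+≥0 0≤2 0≤2)) (+≥0 (*≥0 (ι≥0 n) (*≥0 κ≥0 κ≥0)) (*≥0 0≤2 Rmax≥0))

      -- X⁶ exceeds twice the squares of 1 + nj for j < V³, while the logarithm of X⁸, hence the average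
      -- of E up to X⁸, grows more slowly than V³; η = Z⁻⁴ makes the mesh error negligible.
      module Parameters (V-1 : ℕ) where
        V X B Z′ Z W : ℕ
        V  = suc V-1
        X  = 2 ℕ.* (n ℕ.* V)
        B  = 2 ℕ.* X
        Z′ = B ℕ.^ 8
        Z  = suc Z′
        W  = V ℕ.* V ℕ.* V

        instance
          X≢0 : NonZero X
          X≢0 = ℕ.m*n≢0 2 (n ℕ.* V) {{_}} {{ℕ.m*n≢0 n V}}
          B≢0 : NonZero B
          B≢0 = ℕ.m*n≢0 2 X

        2≤X : 2 ℕ.≤ X
        2≤X = ℕ.m≤m*n 2 (n ℕ.* V) {{ℕ.m*n≢0 n V}}

        1<ιX : 1ℚ < ι X
        1<ιX = <-≤-trans (<-by 1ℚ 0<1 (sym ι-2)) (ι-mono 2≤X)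

        Z⁴ η q : ℚ
        Z⁴ = ι Z * (ι Z * (ι Z * ι Z))
        η = inv Z⁴
        q = 1ℚ + η

        Z⁴>0 : 0ℚ < Z⁴
        Z⁴>0 = *>0 (ι>0 Z′) (*>0 (ι>0 Z′) (*>0 (ι>0 Z′) (ι>0 Z′)))

        η≥0 : 0ℚ ≤ η
        η≥0 = inv≥0 Z⁴>0

        0<q : 0ℚ < q
        0<q = <-≤-trans 0<1 (≤-by η η≥0 refl)

        mesh : Mesh
        mesh = record
          { p = inv q ; η = η ; 0<p = inv>0 0<q ; 0≤η = η≥0
          ; p[1+η]≡1 = trans (*-comm (inv q) q) (*-inv⁺ 0<q)
          }

        open Mesh mesh hiding (η)

        q≤2 : q ≤ 2ℚ
        q≤2 = +-monoʳ-≤ 1ℚ {η} {1ℚ}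
          (inv≤1 (*-mono 0≤1 (ι≥1 Z′) 0≤1 (*-mono 0≤1 (ι≥1 Z′) 0≤1 (*-mono 0≤1 (ι≥1 Z′) 0≤1 (ι≥1 Z′)))))

        power : ∃ λ J → ι X ≤ q ^ suc J × q ^ J < ι X
        power = first-power q (ι X) 1<ιX X*Z⁴ (begin
          ι X               ≡⟨ *-identityʳ (ι X) ⟨
          ι X * 1ℚ          ≡⟨ cong (ι X *_) (sym (*-inv⁺ Z⁴>0)) ⟩
          ι X * (Z⁴ * η)    ≡⟨ trans (sym (*-assoc (ι X) Z⁴ η)) (cong (_* η) (sym ι-X*Z⁴)) ⟩
          ι X*Z⁴ * η        ≤⟨ ≤-by 1ℚ 0≤1 (+-comm (ι X*Z⁴ * η) 1ℚ) ⟩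
          1ℚ + ι X*Z⁴ * η   ≤⟨ bernoulli η η≥0 X*Z⁴ ⟩
          q ^ X*Z⁴ ∎)
          where
          open ≤-Reasoning
          X*Z⁴ : ℕ
          X*Z⁴ = X ℕ.* (Z ℕ.* (Z ℕ.* (Z ℕ.* Z)))
          ι-X*Z⁴ : ι X*Z⁴ ≡ ι X * Z⁴
          ι-X*Z⁴ = trans (ι-* X (Z ℕ.* (Z ℕ.* (Z ℕ.* Z)))) (cong (ι X *_) (trans (ι-* Z (Z ℕ.* (Z ℕ.* Z)))
            (cong (ι Z *_) (trans (ι-* Z (Z ℕ.* Z)) (cong (ι Z *_) (ι-* Z Z))))))

        J-1 J I : ℕ
        J-1 = proj₁ power
        J = suc J-1
        I = 8 ℕ.* J

        u : ℚ
        u = p ^ J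

        0<u : 0ℚ < u
        0<u = p^>0 J

        uq^J≡1 : u * q ^ J ≡ 1ℚ
        uq^J≡1 = trans (sym (^-distrib-* p q J)) (trans (cong (_^ J) p[1+η]≡1) (1^ J))

        Xu≤1 : ι X * u ≤ 1ℚ
        Xu≤1 = begin
          ι X * u     ≡⟨ *-comm (ι X) u ⟩
          u * ι X     ≤⟨ *-monoˡ (<⇒≤ 0<u) (proj₁ (proj₂ power)) ⟩
          u * q ^ J   ≡⟨ uq^J≡1 ⟩
          1ℚ ∎
          where open ≤-Reasoning

        1≤Bu : 1ℚ ≤ ι B * u
        1≤Bu = begin
          1ℚ             ≡⟨ trans (*-comm (q ^ J) u) uq^J≡1 ⟨
          q ^ J * u      ≤⟨ *-monoʳ (<⇒≤ 0<u) (*-mono (<⇒≤ 0<q) q≤2 (<⇒≤ (^>0 0<q J-1)) (<⇒≤ (proj₂ (proj₂ power)))) ⟩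
          2ℚ * ι X * u   ≡⟨ cong (_* u) (sym (trans (ι-* 2 X) (cong (_* ι X) ι-2))) ⟩
          ι B * u ∎
          where open ≤-Reasoning

        large : 1ℚ ≤ ι Z′ * p ^ I
        large = subst (1ℚ ≤_) (trans (^-distrib-* (ι B) u 8) (cong₂ _*_ (sym (ι-^ B 8)) (^-assocˡ p 8 J)))
          (1≤^ 1≤Bu 8)

        open Average mesh Z Z′ I refl large
        open Scales mesh using (t; t≥0; Ω)

        u≤½ : u ≤ ½
        u≤½ = *-cancelˡ-≤ (<-trans 0<1 1<ιX) (begin
          ι X * u   ≤⟨ Xu≤1 ⟩
          1ℚ        ≡⟨ cong (_* ½) (sym ι-2) ⟩
          ι 2 * ½   ≤⟨ *-monoʳ 0≤½ (ι-mono 2≤X) ⟩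
          ι X * ½ ∎)
          where open ≤-Reasoning

        -- For J ≤ i < 2J both weights in the i-th term of Ω are at least ½.
        Ω-lower : ∀ N → ι N * u ^ 6 ≤ ½ → ι J * (½ * ½) ≤ Ω I N
        Ω-lower N Nu⁶≤½ = begin
          ι J * (½ * ½)                       ≡⟨ ∑-const J (½ * ½) ⟨
          ∑ J (λ _ → ½ * ½)
            ≤⟨ ∑-mono J {λ _ → ½ * ½} {λ j → f (J ℕ.+ j)} (λ j j<J → *-mono 0≤½ (½≤w (first j)) 0≤½
               (½≤w (second j j<J))) ⟩
          ∑ J (λ j → f (J ℕ.+ j))
            ≤⟨ ≤-by (∑ J f + rest) (+≥0 (∑-nonNeg J {f} λ j _ → f≥0 j) (∑-nonNeg (suc (6 ℕ.* J)) λ j _ →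
               f≥0 (J ℕ.+ (J ℕ.+ j))))
                 (reorder (∑ J (λ j → f (J ℕ.+ j))) (∑ J f) rest) ⟩
          ∑ J f + (∑ J (λ j → f (J ℕ.+ j)) + rest)
            ≡⟨ trans (∑-split J (J ℕ.+ suc (6 ℕ.* J)) f)
               (cong (λ z → ∑ J f + z) (∑-split J (suc (6 ℕ.* J)) (λ j → f (J ℕ.+ j)))) ⟨
          ∑ (J ℕ.+ (J ℕ.+ suc (6 ℕ.* J))) f   ≡⟨ cong (λ N → ∑ N f) (blocks J) ⟩
          Ω I N ∎
          where
          open ≤-Reasoning
          f : ℕ → ℚ
          f i = t i 1 * t (I ∸ i) N
          rest : ℚ
          rest = ∑ (suc (6 ℕ.* J)) (λ j → f (J ℕ.+ (J ℕ.+ j)))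
          f≥0 : ∀ i → 0ℚ ≤ f i
          f≥0 i = *≥0 (t≥0 i 1) (t≥0 (I ∸ i) N)
          blocks : ∀ J → J ℕ.+ (J ℕ.+ suc (6 ℕ.* J)) ≡ suc (8 ℕ.* J)
          blocks = ℕR.solve-∀
          reorder : ∀ a b c → a + (b + c) ≡ b + (a + c)
          reorder = solve-∀ ringℚ
          first : ∀ j → ι 1 * p ^ (J ℕ.+ j) ≤ ½
          first j = subst (_≤ ½) (sym (trans (cong (_* p ^ (J ℕ.+ j)) fromℤ-1) (*-identityˡ (p ^ (J ℕ.+ j)))))
            (≤-trans (p^-anti (ℕ.m≤m+n J j)) u≤½)
          second : ∀ j → j ℕ.< J → ι N * p ^ (I ∸ (J ℕ.+ j)) ≤ ½
          second j j<J = ≤-trans (*-monoˡ (ι≥0 N) (≤-trans (p^-anti 6J≤) (≤-reflexive (sym (^-assocˡ p 6 J))))) Nu⁶≤½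
            where
            six+two : ∀ J → 8 ℕ.* J ≡ 6 ℕ.* J ℕ.+ (J ℕ.+ J)
            six+two = ℕR.solve-∀
            6J≤ : 6 ℕ.* J ℕ.≤ I ∸ (J ℕ.+ j)
            6J≤ = subst (ℕ._≤ I ∸ (J ℕ.+ j)) (trans (cong (_∸ (J ℕ.+ J)) (six+two J)) (ℕ.m+n∸n≡m (6 ℕ.* J) (J ℕ.+ J)))
              (ℕ.∸-monoʳ-≤ I (ℕ.+-monoʳ-≤ J (ℕ.<⇒≤ j<J)))

        2D²≤X⁶ : ∀ j → j ℕ.< W → 2 ℕ.* unitSquare j ℕ.≤ X ℕ.^ 6
        2D²≤X⁶ j j<W = ℕ.≤-trans (ℕ.*-monoʳ-≤ 2 (ℕ.*-mono-≤ D≤nW D≤nW))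
          (ℕ.≤-trans (ℕ.m≤m*n (2 ℕ.* ((n ℕ.* W) ℕ.* (n ℕ.* W))) (32 ℕ.* (n ℕ.^ 4))
            {{ℕ.m*n≢0 32 (n ℕ.^ 4) {{_}} {{ℕ.m^n≢0 n 4}}}})
            (ℕ.≤-reflexive (sixth-power n V)))
          where
          D≤nW : 1 ℕ.+ n ℕ.* j ℕ.≤ n ℕ.* W
          D≤nW = ℕ.≤-trans (ℕ.+-monoˡ-≤ (n ℕ.* j) (ℕ.>-nonZero⁻¹ n)) (ℕ.≤-trans (ℕ.≤-reflexive (sym (ℕ.*-suc n j)))
            (ℕ.*-monoʳ-≤ n j<W))
          sixth-power : ∀ n V → let X = 2 ℕ.* (n ℕ.* V) in
            2 ℕ.* ((n ℕ.* (V ℕ.* V ℕ.* V)) ℕ.* (n ℕ.* (V ℕ.* V ℕ.* V))) ℕ.* (32 ℕ.* (n ℕ.* (n ℕ.* (n ℕ.* (n ℕ.* 1)))))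
              ≡
            X ℕ.* (X ℕ.* (X ℕ.* (X ℕ.* (X ℕ.* (X ℕ.* 1)))))
          sixth-power = ℕR.solve-∀

        D²<Z : ∀ j → j ℕ.< W → unitSquare j ℕ.< Z
        D²<Z j j<W = s≤s (ℕ.≤-trans (ℕ.≤-trans (ℕ.m≤n*m (unitSquare j) 2) (2D²≤X⁶ j j<W))
          (ℕ.≤-trans (ℕ.^-monoˡ-≤ 6 (ℕ.m≤n*m X 2)) (ℕ.^-monoʳ-≤ B (ℕ.m≤m+n 6 2))))

        Ω-D² : ∀ j → j ℕ.< W → ι J * (½ * ½) ≤ Ω I (unitSquare j)
        Ω-D² j j<W = Ω-lower (unitSquare j) (begin
            ι D² * u ^ 6                ≡⟨ halve (ι D² * u ^ 6) ⟩
            ½ * (2ℚ * (ι D² * u ^ 6))   ≤⟨ *-monoˡ 0≤½ 2D²u⁶≤1 ⟩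
            ½ * 1ℚ                      ≡⟨ *-identityʳ ½ ⟩
            ½ ∎)
          where
          open ≤-Reasoning
          D² : ℕ
          D² = unitSquare j
          halve : ∀ x → x ≡ ½ * ((1ℚ + 1ℚ) * x)
          halve = solve-∀ ringℚ
          2D²u⁶≤1 : 2ℚ * (ι D² * u ^ 6) ≤ 1ℚ
          2D²u⁶≤1 = begin
            2ℚ * (ι D² * u ^ 6)    ≡⟨ *-assoc 2ℚ (ι D²) (u ^ 6) ⟨
            2ℚ * ι D² * u ^ 6      ≡⟨ cong (_* u ^ 6) (sym (trans (ι-* 2 D²) (cong (_* ι D²) ι-2))) ⟩
            ι (2 ℕ.* D²) * u ^ 6   ≤⟨ *-monoʳ (<⇒≤ (^>0 0<u 6)) (ι-mono (2D²≤X⁶ j j<W)) ⟩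
            ι (X ℕ.^ 6) * u ^ 6    ≡⟨ trans (cong (_* u ^ 6) (ι-^ X 6)) (sym (^-distrib-* (ι X) u 6)) ⟩
            (ι X * u) ^ 6          ≤⟨ ^≤1 (*>0 (<-trans 0<1 1<ιX) 0<u) Xu≤1 6 ⟩
            1ℚ ∎

        harmonic≤ : harmonic Z ≤ 2ℚ + ι 8 * ι B
        harmonic≤ = begin
          harmonic Z                     ≡⟨ ∑-last Z′ (λ i → inv (ι (suc i))) ⟩
          harmonic Z′ + inv (ι Z)
            ≤⟨ +-mono-≤ (subst (λ b → harmonic (b ℕ.^ 8) ≤ 1ℚ + ι 8 * ι (ℕ.pred B)) (ℕ.suc-pred B)
               (harmonic-^ (ℕ.pred B) 8)) (inv≤1 (ι≥1 Z′)) ⟩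
          1ℚ + ι 8 * ι (ℕ.pred B) + 1ℚ   ≤⟨ +-monoˡ-≤ 1ℚ (+-monoʳ-≤ 1ℚ (*-monoˡ (ι≥0 8) (ι-mono ℕ.pred[n]≤n))) ⟩
          1ℚ + ι 8 * ι B + 1ℚ            ≡⟨ collect (ι 8 * ι B) ⟩
          2ℚ + ι 8 * ι B ∎
          where
          open ≤-Reasoning
          collect : ∀ x → 1ℚ + x + 1ℚ ≡ 1ℚ + 1ℚ + x
          collect = solve-∀ ringℚ

        smoothSumMax≤ : smoothSumMax ≤ ι V * κ
        smoothSumMax≤ = begin
          ∥μ∥ * (C * (4ℚ + 2ℚ * harmonic Z))   ≤⟨ *-monoˡ ∥μ∥≥0 (*-monoˡ C≥0 (+-monoʳ-≤ 4ℚ (*-monoˡ 0≤2 harmonic≤))) ⟩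
          ∥μ∥ * (C * (4ℚ + 2ℚ * (2ℚ + ι 8 * ι B)))
            ≡⟨ cong (λ b → ∥μ∥ * (C * (4ℚ + 2ℚ * (2ℚ + ι 8 * b)))) ιB ⟩
          ∥μ∥ * (C * (4ℚ + 2ℚ * (2ℚ + ι 8 * (ι 4 * (ι n * ι V)))))
            ≤⟨ *-monoˡ ∥μ∥≥0 (*-monoˡ C≥0 (≤-by ((ι V - 1ℚ) * (4ℚ + 4ℚ))
               (*≥0 (p≤q⇒0≤q-p (ι≥1 V-1)) (+≥0 (+≥0 0≤2 0≤2) (+≥0 0≤2 0≤2)))
                 (factor (ι 8) (ι 4) (ι n) (ι V)))) ⟩
          ∥μ∥ * (C * (ι V * (4ℚ + 2ℚ * (2ℚ + ι 8 * (ι 4 * ι n)))))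
            ≡⟨ reorder ∥μ∥ C (ι V) (4ℚ + 2ℚ * (2ℚ + ι 8 * (ι 4 * ι n))) ⟩
          ι V * κ ∎
          where
          open ≤-Reasoning
          four : ∀ n V → 2 ℕ.* (2 ℕ.* (n ℕ.* V)) ≡ 4 ℕ.* (n ℕ.* V)
          four = ℕR.solve-∀
          ιB : ι B ≡ ι 4 * (ι n * ι V)
          ιB = trans (cong ι (four n V)) (trans (ι-* 4 (n ℕ.* V)) (cong (ι 4 *_) (ι-* n V)))
          factor : ∀ e f n v → let 2′ = 1ℚ + 1ℚ ; 4′ = 2′ + 2′ in
                   4′ + 2′ * (2′ + e * (f * (n * v))) + (v - 1ℚ) * (4′ + 4′) ≡ v * (4′ + 2′ * (2′ + e * (f * n)))
          factor = solve-∀ ringℚ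
          reorder : ∀ m c v x → m * (c * (v * x)) ≡ v * (m * (c * x))
          reorder = solve-∀ ringℚ

        smoothSumMax≥0 : 0ℚ ≤ smoothSumMax
        smoothSumMax≥0 = *≥0 ∥μ∥≥0 (smoothedBound≥0 Z′ C≥0)

        average-squeeze : ι W * (ι J * (½ * ½) * R 1 1) ≤
          ι (suc I) * (ι n * (smoothSumMax * smoothSumMax) + 2ℚ * Rmax)
        average-squeeze = begin
          ι W * (ι J * (½ * ½) * R 1 1)
            ≤⟨ average-lower W (ι J * (½ * ½)) (*≥0 (ι≥0 J) (*≥0 0≤½ 0≤½)) D²<Z Ω-D² R≥0 ⟩
          average                                ≡⟨ insert average factorisedAverage ⟩
          factorisedAverage - (factorisedAverage - average)
            ≤⟨ ≤-trans (x≤∣x∣ (factorisedAverage - (factorisedAverage - average)))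
               (∣∣-- factorisedAverage≤ factorisedAverage≈average) ⟩
          ι n * (s * (K * K)) + ι Z * (ι Z * (ι Z * (ι Z * (Rmax * (s * (η + η))))))
                                                       ≡⟨ collect (ι n) s (K * K) (ι Z) Rmax η ⟩
          s * (ι n * (K * K) + 2ℚ * Rmax * (Z⁴ * η))
            ≡⟨ cong (λ o → s * (ι n * (K * K) + 2ℚ * Rmax * o)) (*-inv⁺ Z⁴>0) ⟩
          s * (ι n * (K * K) + 2ℚ * Rmax * 1ℚ)   ≡⟨ cong (λ o → s * (ι n * (K * K) + o)) (*-identityʳ (2ℚ * Rmax)) ⟩
          s * (ι n * (K * K) + 2ℚ * Rmax) ∎
          where
          open ≤-Reasoning
          s K : ℚ
          s = ι (suc I)
          K = smoothSumMax
          insert : ∀ x y → x ≡ y - (y - x)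
          insert = solve-∀ ringℚ
          collect : ∀ n s k z r e → n * (s * k) + z * (z * (z * (z * (r * (s * (e + e))))))
                                  ≡ s * (n * k + (1ℚ + 1ℚ) * r * (z * (z * (z * z)) * e))
          collect = solve-∀ ringℚ

        ι[1+I]≤9J : ι (suc I) ≤ ι 9 * ι J
        ι[1+I]≤9J = subst (ι (suc I) ≤_) (ι-* 9 J)
          (ι-mono (ℕ.≤-trans (ℕ.m≤m+n (suc I) J-1) (ℕ.≤-reflexive (nine J-1))))
          where
          nine : ∀ j → suc (8 ℕ.* suc j) ℕ.+ j ≡ 9 ℕ.* suc j
          nine = ℕR.solve-∀

        V*R≤R11Max : ι V * R 1 1 ≤ R11Max
        V*R≤R11Max = *-cancelˡ-≤ 0<c (begin
          c * (ι V * R 1 1)               ≡⟨ regroup (ι J) (ι V) (R 1 1) ⟩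
          ι V * ι V * ι V * (ι J * (½ * ½) * R 1 1)
            ≡⟨ cong (_* (ι J * (½ * ½) * R 1 1)) (sym (trans (ι-* (V ℕ.* V) V) (cong (_* ι V) (ι-* V V)))) ⟩
          ι W * (ι J * (½ * ½) * R 1 1)   ≤⟨ average-squeeze ⟩
          ι (suc I) * (ι n * (smoothSumMax * smoothSumMax) + 2ℚ * Rmax)
            ≤⟨ *-mono (ι≥0 (suc I)) ι[1+I]≤9J (+≥0 (*≥0 (ι≥0 n) (*≥0 smoothSumMax≥0 smoothSumMax≥0)) 2Rmax≥0)
                 (+-mono-≤ (*-monoˡ (ι≥0 n) (*-mono smoothSumMax≥0 smoothSumMax≤ smoothSumMax≥0 smoothSumMax≤))
                   2Rmax≤) ⟩
          ι 9 * ι J * (ι n * (ι V * κ * (ι V * κ)) + ι V * ι V * (2ℚ * Rmax))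
                                                      ≡⟨ collect (ι 9) (ι J) (ι n) (ι V) κ Rmax ⟩
          c * R11Max ∎)
          where
          open ≤-Reasoning
          c : ℚ
          c = ι J * (½ * ½) * (ι V * ι V)
          0<c : 0ℚ < c
          0<c = *>0 (*>0 (ι>0 J-1) (*>0 0<½ 0<½)) (*>0 (ι>0 V-1) (ι>0 V-1))
          2Rmax≥0 : 0ℚ ≤ 2ℚ * Rmax
          2Rmax≥0 = *≥0 0≤2 Rmax≥0
          2Rmax≤ : 2ℚ * Rmax ≤ ι V * ι V * (2ℚ * Rmax)
          2Rmax≤ = subst (_≤ ι V * ι V * (2ℚ * Rmax)) (*-identityˡ (2ℚ * Rmax))
            (*-monoʳ 2Rmax≥0 (*-mono 0≤1 (ι≥1 V-1) 0≤1 (ι≥1 V-1)))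
          regroup : ∀ j v r → j * (½ * ½) * (v * v) * (v * r) ≡ v * v * v * (j * (½ * ½) * r)
          regroup = solve-∀ ringℚ
          collect : ∀ n9 j n v k r → n9 * j * (n * (v * k * (v * k)) + v * v * ((1ℚ + 1ℚ) * r))
                  ≡ j * (½ * ½) * (v * v) * (n9 * ((1ℚ + 1ℚ) + (1ℚ + 1ℚ)) * (n * (k * k) + (1ℚ + 1ℚ) * r))
          collect = solve-∀ ringℚ

      R≤0 : R 1 1 ≤ 0ℚ
      R≤0 = ≤0-by-archimedean R11Max λ where
        zero    → subst (_≤ R11Max) (sym (ι-0* (R 1 1))) R11Max≥0
        (suc V) → Parameters.V*R≤R11Max V

    vanishing : ∀ m → h m ≡ 0ℚ
    vanishing m = trans (sym (periodic m)) (x*x≡0⇒x≡0 (≤-antisym square≤0 (sq≥0 (h (m % n)))))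
      where
      square≤0 : h (m % n) * h (m % n) ≤ 0ℚ
      square≤0 = subst (λ k → h k * h k ≤ 0ℚ) (ℕ.*-identityʳ (m % n))
        (≤-trans (term≤∑ n {λ k → h (k ℕ.* 1) * h (k ℕ.* 1)} (m % n) (m%n<n m n) λ k _ → sq≥0 (h (k ℕ.* 1))) R≤0)

module Fourier where

  open import Algebra.Bundles using (CommutativeRing)
  open import Data.Nat.Base using (_/_)
  open import Data.Nat.DivMod using (m%n<n; m<n⇒m%n≡m; m≡m%n+[m/n]*n)
  open import Level using (0ℓ)
  open import Relation.Binary.PropositionalEquality as ≡ using (_≡_; _≢_)
  open Sums
  open Congruence

  module Geometric (S : CommutativeRing 0ℓ 0ℓ) where
    open CommutativeRing S hiding (zero)
    open RangeSum semiring
    open import Algebra.Properties.AbelianGroup +-abelianGroup using (xyx⁻¹≈y)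
    open import Algebra.Properties.CommutativeSemiring.Exp commutativeSemiring
    open import Algebra.Properties.Ring ring using (+-cancelʳ)
    open import Algebra.Properties.Semiring.Mult semiring using (_×_; ×-homo-+; ×1-homo-*; ×-assoc-*; ×-congʳ)
    open import Algebra.Solver.Ring.NaturalCoefficients.Default commutativeSemiring using
      (solve; _:+_; _:*_; _:=_; con)
    open import Relation.Binary.Reasoning.Setoid setoid

    ν : ℕ → Carrier
    ν n = n × 1#

    ∑-const : ∀ N x → ∑ N (λ _ → x) ≈ ν N * x
    ∑-const N x = trans (∑-replicate N x) (sym (trans (×-assoc-* N 1# x) (×-congʳ N (*-identityˡ x))))

    ν-ℕ∑ : ∀ N (f : ℕ → ℕ) → ν (ℕ∑ N f) ≈ ∑ N (λ i → ν (f i))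
    ν-ℕ∑ zero    f = refl
    ν-ℕ∑ (suc N) f = trans (×-homo-+ 1# (f 0) _) (+-congˡ (ν-ℕ∑ N _))

    1+[x-1] : ∀ x → 1# + (x - 1#) ≈ x
    1+[x-1] x = trans (sym (+-assoc 1# x (- 1#))) (xyx⁻¹≈y 1# x)

    1^ : ∀ k → 1# ^ k ≈ 1#
    1^ zero    = refl
    1^ (suc k) = trans (*-identityˡ _) (1^ k)

    module _ {X e : Carrier} (X≈1+e : X ≈ 1# + e) where

      geometric : ∀ N → e * ∑ N (X ^_) + 1# ≈ X ^ N
      geometric zero    = trans (+-congʳ (zeroʳ e)) (+-identityˡ 1#)
      geometric (suc N) = begin
        e * ∑ (suc N) (X ^_) + 1#         ≈⟨ +-congʳ (*-congˡ (∑-last N (X ^_))) ⟩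
        e * (∑ N (X ^_) + X ^ N) + 1#
          ≈⟨ solve 3 (λ e s p → e :* (s :+ p) :+ con 1 := e :* s :+ con 1 :+ e :* p) refl e (∑ N (X ^_)) (X ^ N) ⟩
        e * ∑ N (X ^_) + 1# + e * X ^ N   ≈⟨ +-congʳ (geometric N) ⟩
        X ^ N + e * X ^ N                 ≈⟨ solve 2 (λ e p → p :+ e :* p := (con 1 :+ e) :* p) refl e (X ^ N) ⟩
        (1# + e) * X ^ N                  ≈⟨ *-congʳ (sym X≈1+e) ⟩
        X * X ^ N ∎

      arithmetico-geometric : ∀ N → e * ∑ N (λ j → ν j * X ^ j) + X * ∑ N (X ^_) ≈ ν N * X ^ N
      arithmetico-geometric zero    = trans (+-cong (zeroʳ e) (zeroʳ X)) (trans (+-identityˡ 0#) (sym (zeroˡ _)))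
      arithmetico-geometric (suc N) = begin
        e * ∑ (suc N) f + X * ∑ (suc N) (X ^_)
          ≈⟨ +-cong (*-congˡ (∑-last N f)) (*-congˡ (∑-last N (X ^_))) ⟩
        e * (∑ N f + ν N * P) + X * (∑ N (X ^_) + P)
          ≈⟨ solve 6 (λ e s n p x g → e :* (s :+ n :* p) :+ x :* (g :+ p) := e :* s :+ x :* g :+
             (e :* (n :* p) :+ x :* p)) refl e (∑ N f) (ν N) P X (∑ N (X ^_)) ⟩
        e * ∑ N f + X * ∑ N (X ^_) + (e * (ν N * P) + X * P)
          ≈⟨ +-congʳ (arithmetico-geometric N) ⟩
        ν N * P + (e * (ν N * P) + X * P)
          ≈⟨ solve 4 (λ e n p x → n :* p :+ (e :* (n :* p) :+ x :* p) := x :* p :+ n :* ((con 1 :+ e) :* p))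
             refl e (ν N) P X ⟩
        X * P + ν N * ((1# + e) * P)   ≈⟨ +-congˡ (*-congˡ (*-congʳ (sym X≈1+e))) ⟩
        X * P + ν N * (X * P)          ≈⟨ solve 2 (λ n y → y :+ n :* y := (con 1 :+ n) :* y) refl (ν N) (X * P) ⟩
        (1# + ν N) * (X * P) ∎
        where
        f : ℕ → Carrier
        f j = ν j * X ^ j
        P : Carrier
        P = X ^ N

      module _ {κ : Carrier} (κe≈1 : κ * e ≈ 1#) (N : ℕ) (X^N≈1 : X ^ N ≈ 1#) where

        private
          cancel : ∀ {x y} → e * x ≈ e * y → x ≈ y
          cancel {x} {y} eq = begin
            x             ≈⟨ *-identityˡ x ⟨
            1# * x        ≈⟨ *-congʳ κe≈1 ⟨
            κ * e * x     ≈⟨ *-assoc κ e x ⟩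
            κ * (e * x)   ≈⟨ *-congˡ eq ⟩
            κ * (e * y)   ≈⟨ *-assoc κ e y ⟨
            κ * e * y     ≈⟨ *-congʳ κe≈1 ⟩
            1# * y        ≈⟨ *-identityˡ y ⟩
            y ∎

        geometric-zero : ∑ N (X ^_) ≈ 0#
        geometric-zero = cancel (trans (+-cancelʳ 1# _ 0# (trans (geometric N) (trans X^N≈1 (sym (+-identityˡ 1#)))))
          (sym (zeroʳ e)))

        cotangent : ∀ {c I} → c * e ≈ I * (X + 1#) →
          ν N * c ≈ I * (ν N + (∑ N (λ j → ν j * X ^ j) + ∑ N (λ j → ν j * X ^ j)))
        cotangent {c} {I} ce = cancel (begin
          e * (ν N * c)                 ≈⟨ solve 3 (λ e n c → e :* (n :* c) := n :* (c :* e)) refl e (ν N) c ⟩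
          ν N * (c * e)                 ≈⟨ *-congˡ (trans ce (*-congˡ (+-congʳ X≈1+e))) ⟩
          ν N * (I * (1# + e + 1#))
            ≈⟨ solve 3 (λ n i e → n :* (i :* (con 1 :+ e :+ con 1)) := i :* (n :* e :+ (n :+ n))) refl (ν N) I e ⟩
          I * (ν N * e + (ν N + ν N))   ≈⟨ *-congˡ (+-congˡ (+-cong (sym eJ) (sym eJ))) ⟩
          I * (ν N * e + (e * J + e * J))
            ≈⟨ solve 4 (λ n i e j → i :* (n :* e :+ (e :* j :+ e :* j)) := e :* (i :* (n :+ (j :+ j))))
               refl (ν N) I e J ⟩
          e * (I * (ν N + (J + J))) ∎)
          where
          J : Carrier
          J = ∑ N (λ j → ν j * X ^ j)
          eJ : e * J ≈ ν N
          eJ = begin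
            e * J                    ≈⟨ +-identityʳ _ ⟨
            e * J + 0#               ≈⟨ +-congˡ (trans (*-congˡ geometric-zero) (zeroʳ X)) ⟨
            e * J + X * ∑ N (X ^_)   ≈⟨ arithmetico-geometric N ⟩
            ν N * X ^ N              ≈⟨ trans (*-congˡ X^N≈1) (*-identityʳ (ν N)) ⟩
            ν N ∎

  module CotangentSums (S : CommutativeRing 0ℓ 0ℓ) where
    open CommutativeRing S hiding (zero)
    open RangeSum semiring
    open Geometric S
    open import Algebra.Properties.CommutativeSemiring.Exp commutativeSemiring
    open import Algebra.Properties.Semiring.Mult semiring using (×1-homo-*)
    open import Algebra.Solver.Ring.NaturalCoefficients.Default commutativeSemiring using
      (solve; _:+_; _:*_; _:=_; con)
    open import Relation.Binary.Reasoning.Setoid setoid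

    -- For ζ = exp(2πi/M) and I = i, c m is cot(πm/M); κ m witnesses that ζᵐ - 1 is invertible.
    record RootOfUnity (M : ℕ) : Set where
      field
        ζ I   : Carrier
        c κ   : ℕ → Carrier
        ζ^M≈1 : ζ ^ M ≈ 1#
        c-eq  : ∀ m → 0 ℕ.< m → m ℕ.< M → c m * (ζ ^ m - 1#) ≈ I * (ζ ^ m + 1#)
        κ-eq  : ∀ m → 0 ℕ.< m → m ℕ.< M → κ m * (ζ ^ m - 1#) ≈ 1#

    module _ (n L : ℕ) {{_ : NonZero n}} {{_ : NonZero L}} (root : RootOfUnity (n ℕ.* L)) where

      open RootOfUnity root

      private
        M : ℕ
        M = n ℕ.* L

        ζ^[M*]≈1 : ∀ k → ζ ^ (M ℕ.* k) ≈ 1#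
        ζ^[M*]≈1 k = trans (sym (^-assocʳ ζ M k)) (trans (^-congˡ k ζ^M≈1) (1^ k))

        drop : ∀ k j → ζ ^ (M ℕ.* k ℕ.+ j) ≈ ζ ^ j
        drop k j = trans (^-homo-* ζ (M ℕ.* k) j) (trans (*-congʳ (ζ^[M*]≈1 k)) (*-identityˡ _))

        ζ^L-mod : ∀ {A B} → A ≡ B mod n → ζ ^ (A ℕ.* L) ≈ ζ ^ (B ℕ.* L)
        ζ^L-mod {A} {B} eq = trans (reduce A) (trans (^-congʳ ζ (≡.cong (ℕ._* L) eq)) (sym (reduce B)))
          where
          divide : ∀ r q n L → (r ℕ.+ q ℕ.* n) ℕ.* L ≡ n ℕ.* L ℕ.* q ℕ.+ r ℕ.* L
          divide = ℕR.solve-∀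
          reduce : ∀ A → ζ ^ (A ℕ.* L) ≈ ζ ^ (A % n ℕ.* L)
          reduce A = trans (^-congʳ ζ (≡.trans (≡.cong (ℕ._* L) (m≡m%n+[m/n]*n A n)) (divide (A % n) (A / n) n L)))
            (drop (A / n) _)

        transform : ℕ → Carrier
        transform m = ∑ M (λ j → ν j * ζ ^ (m ℕ.* j))

        residueTransform : ℕ → Carrier
        residueTransform a = ∑ n (λ r → ν (r ℕ.* a % n) * ζ ^ (r ℕ.* L))

        cotangent-transform : ∀ m → 0 ℕ.< m → m ℕ.< M → ν M * c m ≈ I * (ν M + (transform m + transform m))
        cotangent-transform m 0<m m<M = trans
          (cotangent (sym (1+[x-1] (ζ ^ m))) (κ-eq m 0<m m<M) M period (c-eq m 0<m m<M))
          (*-congˡ (+-congˡ (+-cong powers powers)))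
          where
          period : (ζ ^ m) ^ M ≈ 1#
          period = trans (^-assocʳ ζ m M) (trans (^-congʳ ζ (ℕ.*-comm m M)) (ζ^[M*]≈1 m))
          powers : ∑ M (λ j → ν j * (ζ ^ m) ^ j) ≈ transform m
          powers = ∑-cong′ M λ j → *-congˡ (^-assocʳ ζ m j)

        inner : ℕ → Carrier
        inner j = ∑ L (λ l → ζ ^ (l ℕ.* n ℕ.* j))

        inner-multiple : ∀ q → inner (q ℕ.* L ℕ.+ 0) ≈ ν L
        inner-multiple q = trans (∑-cong′ L λ l → trans (^-congʳ ζ (collect l n q L)) (ζ^[M*]≈1 (l ℕ.* q)))
          (trans (∑-const L 1#) (*-identityʳ _))
          where
          collect : ∀ l n q L → l ℕ.* n ℕ.* (q ℕ.* L ℕ.+ 0) ≡ n ℕ.* L ℕ.* (l ℕ.* q)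
          collect = ℕR.solve-∀

        inner-other : ∀ q ρ → ρ ℕ.< L → ρ ≢ 0 → inner (q ℕ.* L ℕ.+ ρ) ≈ 0#
        inner-other q ρ ρ<L ρ≢0 = trans
          (∑-cong′ L λ l → trans (^-congʳ ζ (collect l n q L ρ))
            (trans (drop (l ℕ.* q) _) (sym (^-assocʳ ζ (n ℕ.* ρ) l))))
          (geometric-zero (sym (1+[x-1] (ζ ^ (n ℕ.* ρ)))) (κ-eq (n ℕ.* ρ) 0<nρ (ℕ.*-monoʳ-< n ρ<L)) L
            (trans (^-assocʳ ζ (n ℕ.* ρ) L) (trans (^-congʳ ζ (xy∙z≈xz∙y n ρ L)) (ζ^[M*]≈1 ρ))))
          where
          open import Algebra.Properties.CommutativeSemigroup ℕ.*-commutativeSemigroup using (xy∙z≈xz∙y)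
          collect : ∀ l n q L ρ → l ℕ.* n ℕ.* (q ℕ.* L ℕ.+ ρ) ≡ n ℕ.* L ℕ.* (l ℕ.* q) ℕ.+ n ℕ.* ρ ℕ.* l
          collect = ℕR.solve-∀
          0<nρ : 0 ℕ.< n ℕ.* ρ
          0<nρ = ℕ.*-mono-< (ℕ.>-nonZero⁻¹ n) (ℕ.n≢0⇒n>0 ρ≢0)

        factor-inner : ∀ m₀ → progressionSum n L transform m₀ ≈ ∑ M (λ j → ν j * ζ ^ (m₀ ℕ.* j) * inner j)
        factor-inner m₀ = trans (∑-comm L M _) (∑-cong′ M λ j → trans (∑-cong′ L λ l → factor j l)
          (sym (*-distribˡ-∑ L (ν j * ζ ^ (m₀ ℕ.* j)) _)))
          where
          factor : ∀ j l → ν j * ζ ^ ((l ℕ.* n ℕ.+ m₀) ℕ.* j) ≈ ν j * ζ ^ (m₀ ℕ.* j) * ζ ^ (l ℕ.* n ℕ.* j)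
          factor j l = begin
            ν j * ζ ^ ((l ℕ.* n ℕ.+ m₀) ℕ.* j)
              ≈⟨ *-congˡ (trans (^-congʳ ζ (ℕ.*-distribʳ-+ j (l ℕ.* n) m₀)) (^-homo-* ζ (l ℕ.* n ℕ.* j) (m₀ ℕ.* j))) ⟩
            ν j * (ζ ^ (l ℕ.* n ℕ.* j) * ζ ^ (m₀ ℕ.* j))   ≈⟨ *-congˡ (*-comm _ _) ⟩
            ν j * (ζ ^ (m₀ ℕ.* j) * ζ ^ (l ℕ.* n ℕ.* j))   ≈⟨ *-assoc (ν j) _ _ ⟨
            ν j * ζ ^ (m₀ ℕ.* j) * ζ ^ (l ℕ.* n ℕ.* j) ∎

        frequency-multiple : ∀ m₀ q → ν (q ℕ.* L ℕ.+ 0) * ζ ^ (m₀ ℕ.* (q ℕ.* L ℕ.+ 0)) * inner (q ℕ.* L ℕ.+ 0) ≈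
                                      ν L * ν L * (ν q * ζ ^ (q ℕ.* m₀ ℕ.* L))
        frequency-multiple m₀ q = begin
          ν (q ℕ.* L ℕ.+ 0) * ζ ^ (m₀ ℕ.* (q ℕ.* L ℕ.+ 0)) * inner (q ℕ.* L ℕ.+ 0)
            ≈⟨ *-cong (*-cong (trans (reflexive (≡.cong ν (ℕ.+-identityʳ (q ℕ.* L)))) (×1-homo-* q L))
               (^-congʳ ζ (reorder m₀ q L))) (inner-multiple q) ⟩
          ν q * ν L * ζ ^ (q ℕ.* m₀ ℕ.* L) * ν L
            ≈⟨ solve 3 (λ q l z → q :* l :* z :* l := l :* l :* (q :* z)) refl (ν q) (ν L) (ζ ^ (q ℕ.* m₀ ℕ.* L)) ⟩
          ν L * ν L * (ν q * ζ ^ (q ℕ.* m₀ ℕ.* L)) ∎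
          where
          reorder : ∀ m q L → m ℕ.* (q ℕ.* L ℕ.+ 0) ≡ q ℕ.* m ℕ.* L
          reorder = ℕR.solve-∀

        -- Summing over the progression m₀ + nℤ kills all frequencies except the multiples of L;
        -- then j = ra mod n turns the inverse m₀ of a into a itself.
        transform-progression : ∀ {a m₀} → a ℕ.* m₀ ≡ 1 mod n →
          progressionSum n L transform m₀ ≈ ν L * ν L * residueTransform a
        transform-progression {a} {m₀} am₀≡1 = begin
          progressionSum n L transform m₀
            ≈⟨ factor-inner m₀ ⟩
          ∑ M (λ j → ν j * ζ ^ (m₀ ℕ.* j) * inner j)
            ≈⟨ ∑-blocks n L _ ⟩
          ∑ n (λ q → ∑ L (λ ρ → ν (q ℕ.* L ℕ.+ ρ) * ζ ^ (m₀ ℕ.* (q ℕ.* L ℕ.+ ρ)) * inner (q ℕ.* L ℕ.+ ρ)))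
            ≈⟨ ∑-cong′ n (λ q → trans (∑-single L 0 (ℕ.>-nonZero⁻¹ L) λ ρ ρ<L ρ≢0 →
               trans (*-congˡ (inner-other q ρ ρ<L ρ≢0)) (zeroʳ _)) (frequency-multiple m₀ q)) ⟩
          ∑ n (λ q → ν L * ν L * (ν q * ζ ^ (q ℕ.* m₀ ℕ.* L)))
            ≈⟨ *-distribˡ-∑ n (ν L * ν L) _ ⟨
          ν L * ν L * ∑ n (λ q → ν q * ζ ^ (q ℕ.* m₀ ℕ.* L))
            ≈⟨ *-congˡ (∑-permute n (λ q → ν q * ζ ^ (q ℕ.* m₀ ℕ.* L)) (λ r → r ℕ.* a % n) (λ q → q ℕ.* m₀ % n)
                 (λ r _ → m%n<n (r ℕ.* a) n) (λ q _ → m%n<n (q ℕ.* m₀) n)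
                 (scale-inverse n (≡.trans (≡.cong (_% n) (ℕ.*-comm m₀ a)) am₀≡1)) (scale-inverse n am₀≡1)) ⟩
          ν L * ν L * ∑ n (λ r → ν (r ℕ.* a % n) * ζ ^ ((r ℕ.* a % n) ℕ.* m₀ ℕ.* L))
            ≈⟨ *-congˡ (∑-cong n λ r r<n →
               *-congˡ (ζ^L-mod (≡.trans (scale-inverse n am₀≡1 r r<n) (≡.sym (m<n⇒m%n≡m r<n))))) ⟩
          ν L * ν L * residueTransform a ∎

        cotangent-progression : ∀ {a m₀} → IsInverse n a m₀ →
          ν M * progressionSum n L c m₀ ≈ I * (ν L * ν M + (ν L * ν L * residueTransform a + ν L * ν
            L * residueTransform a))
        cotangent-progression {a} {m₀} a⁻¹ = begin
          ν M * progressionSum n L c m₀         ≈⟨ *-distribˡ-∑ L (ν M) _ ⟩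
          ∑ L (λ l → ν M * c (l ℕ.* n ℕ.+ m₀))
            ≈⟨ ∑-cong L (λ l l<L → cotangent-transform (l ℕ.* n ℕ.+ m₀) (ℕ.<-≤-trans positive (ℕ.m≤n+m m₀ (l ℕ.* n)))
               (progression-index< n l<L reduced)) ⟩
          ∑ L (λ l → I * (ν M + (T l + T l)))   ≈⟨ *-distribˡ-∑ L I _ ⟨
          I * ∑ L (λ l → ν M + (T l + T l))
            ≈⟨ *-congˡ (trans (∑-distrib-+ L _ _) (+-cong (∑-const L (ν M)) (∑-distrib-+ L T T))) ⟩
          I * (ν L * ν M + (∑ L T + ∑ L T))
            ≈⟨ *-congˡ (+-congˡ (+-cong (transform-progression {a} inverse) (transform-progression {a} inverse))) ⟩
          I * (ν L * ν M + (ν L * ν L * residueTransform a + ν L * ν L * residueTransform a)) ∎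
          where
          open IsInverse a⁻¹
          T : ℕ → Carrier
          T l = transform (l ℕ.* n ℕ.+ m₀)

      equal-progressions : ∀ N (a a⁻¹ b b⁻¹ : ℕ → ℕ) → (∀ i → IsInverse n (a i) (a⁻¹ i)) →
        (∀ i → IsInverse n (b i) (b⁻¹ i)) → (∀ r → residueSum n N a r ≡ residueSum n N b r) →
        ν M * ∑ N (λ i → progressionSum n L c (a⁻¹ i)) ≈ ν M * ∑ N (λ i → progressionSum n L c (b⁻¹ i))
      equal-progressions N a a⁻¹ b b⁻¹ a-inverse b-inverse residueSums =
        trans (expand a a⁻¹ a-inverse) (trans (*-congˡ (+-congˡ (+-cong same same))) (sym (expand b b⁻¹ b-inverse)))
        where
        total : (ℕ → ℕ) → Carrier
        total a = ∑ N (λ i → ν L * ν L * residueTransform (a i))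
        expand : ∀ a a⁻¹ → (∀ i → IsInverse n (a i) (a⁻¹ i)) →
                 ν M * ∑ N (λ i → progressionSum n L c (a⁻¹ i)) ≈ I * (∑ N (λ _ → ν L * ν M) + (total a + total a))
        expand a a⁻¹ a-inverse = trans (*-distribˡ-∑ N (ν M) _)
          (trans (∑-cong′ N λ i → cotangent-progression (a-inverse i))
          (trans (sym (*-distribˡ-∑ N I _)) (*-congˡ (trans (∑-distrib-+ N _ _) (+-congˡ (∑-distrib-+ N _ _))))))
        collect : ∀ a → total a ≈ ν L * ν L * ∑ n (λ r → ν (residueSum n N a r) * ζ ^ (r ℕ.* L))
        collect a = trans (sym (*-distribˡ-∑ N (ν L * ν L) _)) (*-congˡ (trans (∑-comm N n _)
          (∑-cong′ n λ r → trans (sym (*-distribʳ-∑ N (ζ ^ (r ℕ.* L)) _))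
            (*-congʳ (sym (ν-ℕ∑ N λ i → r ℕ.* a i % n))))))
        same : total a ≈ total b
        same = trans (collect a) (trans (*-congˡ (∑-cong′ n λ r → *-congʳ (reflexive (≡.cong ν (residueSums r)))))
          (sym (collect b)))

      antisymmetry : ∀ m m′ → 0 ℕ.< m → m ℕ.< M → 0 ℕ.< m′ → m′ ℕ.< M → m ℕ.+ m′ ≡ M → c m + c m′ ≈ 0#
      antisymmetry m m′ 0<m m<M 0<m′ m′<M m+m′≡M = begin
        c m + c m′                    ≈⟨ *-identityˡ _ ⟨
        1# * (c m + c m′)             ≈⟨ *-congʳ (κ-eq m 0<m m<M) ⟨
        κ m * E * (c m + c m′)
          ≈⟨ solve 4 (λ k e c d → k :* e :* (c :+ d) := k :* (c :* e :+ d :* e)) refl (κ m) E (c m) (c m′) ⟩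
        κ m * (c m * E + c m′ * E)    ≈⟨ *-congˡ (+-congʳ same) ⟩
        κ m * (c m′ * (X * E′) + c m′ * E)
          ≈⟨ solve 4 (λ k c x e → k :* (c :* x :+ c :* e) := k :* (c :* (x :+ e))) refl (κ m) (c m′) (X * E′) E ⟩
        κ m * (c m′ * (X * E′ + E))   ≈⟨ *-congˡ (trans (*-congˡ XE′+E≈0) (zeroʳ (c m′))) ⟩
        κ m * 0#                      ≈⟨ zeroʳ (κ m) ⟩
        0# ∎
        where
        X X′ E E′ : Carrier
        X = ζ ^ m
        X′ = ζ ^ m′
        E = X - 1#
        E′ = X′ - 1#
        XX′≈1 : X * X′ ≈ 1#
        XX′≈1 = trans (sym (^-homo-* ζ m m′)) (trans (^-congʳ ζ m+m′≡M) ζ^M≈1)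
        XE′+E≈0 : X * E′ + E ≈ 0#
        XE′+E≈0 = begin
          X * E′ + E           ≈⟨ +-assoc (X * E′) X (- 1#) ⟨
          X * E′ + X - 1#      ≈⟨ +-congʳ (solve 2 (λ x e → x :* e :+ x := x :* (con 1 :+ e)) refl X E′) ⟩
          X * (1# + E′) - 1#   ≈⟨ +-congʳ (trans (*-congˡ (1+[x-1] X′)) XX′≈1) ⟩
          1# - 1#              ≈⟨ -‿inverseʳ 1# ⟩
          0# ∎
        same : c m * E ≈ c m′ * (X * E′)
        same = begin
          c m * E               ≈⟨ c-eq m 0<m m<M ⟩
          I * (X + 1#)          ≈⟨ *-congˡ (+-congˡ XX′≈1) ⟨
          I * (X + X * X′)      ≈⟨ solve 3 (λ i x y → i :* (x :+ x :* y) := x :* (i :* (y :+ con 1))) refl I X X′ ⟩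
          X * (I * (X′ + 1#))   ≈⟨ *-congˡ (c-eq m′ 0<m′ m′<M) ⟨
          X * (c m′ * E′)       ≈⟨ solve 3 (λ x c e → x :* (c :* e) := c :* (x :* e)) refl X (c m′) E′ ⟩
          c m′ * (X * E′) ∎

  module Rotation (S : CommutativeRing 0ℓ 0ℓ) where
    open CommutativeRing S hiding (zero)
    open Geometric S using (1^)
    open import Algebra.Properties.AbelianGroup +-abelianGroup using (xyx⁻¹≈y)
    open import Algebra.Properties.CommutativeSemiring.Exp commutativeSemiring
    open import Algebra.Solver.Ring.NaturalCoefficients.Default commutativeSemiring using
      (solve; _:+_; _:*_; _:=_; con)
    open import Relation.Binary.Reasoning.Setoid setoid

    module Conjugates (w w̄ e : Carrier) (ww̄e≈1 : w * w̄ * e ≈ 1#) where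

      rotation : Carrier
      rotation = w * w * e

      private
        ζ^ : ∀ m → rotation ^ m ≈ w ^ m * w ^ m * e ^ m
        ζ^ m = trans (^-distrib-* (w * w) e m) (*-congʳ (^-distrib-* w w m))

        unit : ∀ m → w ^ m * w̄ ^ m * e ^ m ≈ 1#
        unit m = trans (sym (trans (^-distrib-* (w * w̄) e m) (*-congʳ (^-distrib-* w w̄ m))))
          (trans (^-congˡ m ww̄e≈1) (1^ m))

      module _ (m : ℕ) {B : Carrier} (w≈w̄+B : w ^ m ≈ w̄ ^ m + B) where

        private
          A Ā E : Carrier
          A = w ^ m
          Ā = w̄ ^ m
          E = e ^ m

          ζ≈1+ : rotation ^ m ≈ 1# + A * E * B
          ζ≈1+ = begin
            rotation ^ m      ≈⟨ ζ^ m ⟩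
            A * A * E         ≈⟨ *-congʳ (*-congˡ w≈w̄+B) ⟩
            A * (Ā + B) * E   ≈⟨ solve 4 (λ a b e d → a :* (b :+ d) :* e := a :* b :* e :+ a :* e :* d) refl A Ā E B ⟩
            A * Ā * E + A * E * B
              ≈⟨ +-congʳ (unit m) ⟩
            1# + A * E * B ∎

          ζ-1 : rotation ^ m - 1# ≈ A * E * B
          ζ-1 = begin
            rotation ^ m - 1#     ≈⟨ +-congʳ ζ≈1+ ⟩
            1# + A * E * B - 1#   ≈⟨ xyx⁻¹≈y 1# (A * E * B) ⟩
            A * E * B ∎

        rotation-cot : ∀ {c I} → c * B ≈ I * (A + Ā) → c * (rotation ^ m - 1#) ≈ I * (rotation ^ m + 1#)
        rotation-cot {c} {I} cB = begin
          c * (rotation ^ m - 1#)   ≈⟨ *-congˡ ζ-1 ⟩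
          c * (A * E * B)           ≈⟨ solve 4 (λ c a e b → c :* (a :* e :* b) := a :* e :* (c :* b)) refl c A E B ⟩
          A * E * (c * B)           ≈⟨ *-congˡ cB ⟩
          A * E * (I * (A + Ā))
            ≈⟨ solve 4 (λ a e i b → a :* e :* (i :* (a :+ b)) := i :* (a :* a :* e :+ a :* b :* e)) refl A E I Ā ⟩
          I * (A * A * E + A * Ā * E)
            ≈⟨ *-congˡ (+-cong (sym (ζ^ m)) (unit m)) ⟩
          I * (rotation ^ m + 1#) ∎

        rotation-inverse : ∀ {G} → G * B ≈ 1# → Ā * G * (rotation ^ m - 1#) ≈ 1#
        rotation-inverse {G} GB = begin
          Ā * G * (rotation ^ m - 1#)   ≈⟨ *-congˡ ζ-1 ⟩
          Ā * G * (A * E * B)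
            ≈⟨ solve 5 (λ b g a e d → b :* g :* (a :* e :* d) := a :* b :* e :* (g :* d)) refl Ā G A E B ⟩
          A * Ā * E * (G * B)           ≈⟨ *-cong (unit m) GB ⟩
          1# * 1#                       ≈⟨ *-identityˡ 1# ⟩
          1# ∎

        rotation-period : B ≈ 0# → rotation ^ m ≈ 1#
        rotation-period B≈0 = trans ζ≈1+ (trans (+-congˡ (trans (*-congˡ B≈0) (zeroʳ _))) (+-identityʳ 1#))

module TangentRoot where

  open import Data.Sum using (_⊎_)
  open Rationals
  open Powers

  -- (1 + √-y)ᵐ = P y m + Q y m √-y.  With y = tan² α this is (cos mα + i sin mα)/cosᵐ α.
  P Q : ℚ → ℕ → ℚ
  P y zero    = 1ℚ
  P y (suc m) = P y m - y * Q y m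
  Q y zero    = 0ℚ
  Q y (suc m) = Q y m + P y m

  private
    0≤4 : 0ℚ ≤ 4ℚ
    0≤4 = +≥0 0≤2 0≤2
    0≤4^ : ∀ m → 0ℚ ≤ 4ℚ ^ m
    0≤4^ m = <⇒≤ (^>0 (positive⁻¹ 4ℚ) m)

  PQ-bound : ∀ {y} → 0ℚ ≤ y → y ≤ 2ℚ → ∀ m → ∣ P y m ∣ ≤ 4ℚ ^ m × ∣ Q y m ∣ ≤ 4ℚ ^ m
  PQ-bound 0≤y y≤2 zero    = ≤-refl , 0≤1
  PQ-bound {y} 0≤y y≤2 (suc m) with PQ-bound 0≤y y≤2 m
  ... | P≤ , Q≤ = ≤-trans (∣∣-- P≤ (∣∣-* (∣∣-nonNeg 0≤y y≤2) Q≤)) (≤-by B (0≤4^ m) (3+1 B)) ,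
                  ≤-trans (∣∣-+ Q≤ P≤) (≤-by (B + B) (+≥0 (0≤4^ m) (0≤4^ m)) (2+2 B))
    where
    B : ℚ
    B = 4ℚ ^ m
    3+1 : ∀ b → b + (1ℚ + 1ℚ) * b + b ≡ ((1ℚ + 1ℚ) + (1ℚ + 1ℚ)) * b
    3+1 = solve-∀ ringℚ
    2+2 : ∀ b → b + b + (b + b) ≡ ((1ℚ + 1ℚ) + (1ℚ + 1ℚ)) * b
    2+2 = solve-∀ ringℚ

  PQ-Lipschitz : ∀ {y δ} → 0ℚ ≤ y → y ≤ 2ℚ → 0ℚ ≤ δ → y + δ ≤ 2ℚ → ∀ m →
                 ∣ P (y + δ) m - P y m ∣ ≤ 4ℚ ^ m * δ × ∣ Q (y + δ) m - Q y m ∣ ≤ 4ℚ ^ m * δ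
  PQ-Lipschitz {y} {δ} 0≤y y≤2 0≤δ y+δ≤2 zero = *≥0 0≤1 0≤δ , *≥0 0≤1 0≤δ
  PQ-Lipschitz {y} {δ} 0≤y y≤2 0≤δ y+δ≤2 (suc m) with PQ-Lipschitz 0≤y y≤2 0≤δ y+δ≤2 m
  ... | ΔP≤ , ΔQ≤ =
      subst₂ (λ x b → ∣ x ∣ ≤ b) (sym (ΔP (P (y + δ) m) (P y m) y δ (Q (y + δ) m) (Q y m))) (1+2+1 B δ)
        (∣∣-- ΔP≤ (∣∣-+ (∣∣-* (∣∣-nonNeg 0≤y y≤2) ΔQ≤) (∣∣-* (∣∣-nonNeg 0≤δ ≤-refl)
          (proj₂ (PQ-bound (+≥0 0≤y 0≤δ) y+δ≤2 m))))) ,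
      ≤-trans (subst (λ x → ∣ x ∣ ≤ B * δ + B * δ) (sym (ΔQ (P (y + δ) m) (P y m) (Q (y + δ) m) (Q y m)))
        (∣∣-+ ΔQ≤ ΔP≤))
        (≤-by (B * δ + B * δ) (+≥0 (*≥0 (0≤4^ m) 0≤δ) (*≥0 (0≤4^ m) 0≤δ)) (2+2 B δ))
    where
    B : ℚ
    B = 4ℚ ^ m
    ΔP : ∀ p′ p y d q′ q → (p′ - (y + d) * q′) - (p - y * q) ≡ (p′ - p) - (y * (q′ - q) + d * q′)
    ΔP = solve-∀ ringℚ
    ΔQ : ∀ p′ p q′ q → (q′ + p′) - (q + p) ≡ (q′ - q) + (p′ - p)
    ΔQ = solve-∀ ringℚ
    1+2+1 : ∀ b d → b * d + ((1ℚ + 1ℚ) * (b * d) + d * b) ≡ ((1ℚ + 1ℚ) + (1ℚ + 1ℚ)) * b * d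
    1+2+1 = solve-∀ ringℚ
    2+2 : ∀ b d → b * d + b * d + (b * d + b * d) ≡ ((1ℚ + 1ℚ) + (1ℚ + 1ℚ)) * b * d
    2+2 = solve-∀ ringℚ

  module SmallAngle {y : ℚ} (x : ℕ) (0≤y : 0ℚ ≤ y) (x²y≤1 : ι x * (ι x * y) ≤ 1ℚ) where

    record Estimates (m : ℕ) : Set where
      field
        P≤1 : P y m ≤ 1ℚ
        P≥  : 1ℚ - ι m * (ι x * y) ≤ P y m
        Q≥0 : 0ℚ ≤ Q y m
        Q≤m : Q y m ≤ ι m

    private
      mxy≤1 : ∀ {m} → m ℕ.≤ x → ι m * (ι x * y) ≤ 1ℚ
      mxy≤1 m≤x = ≤-trans (*-monoʳ (*≥0 (ι≥0 x) 0≤y) (ι-mono m≤x)) x²y≤1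

    estimates : ∀ m → m ℕ.≤ x → Estimates m
    estimates zero _ = record
      { P≤1 = ≤-refl
      ; P≥  = ≤-reflexive (trans (cong (λ z → 1ℚ - z) (ι-0* (ι x * y))) refl)
      ; Q≥0 = ≤-refl
      ; Q≤m = ≤-reflexive (sym fromℤ-0) }
    estimates (suc m) m<x = record
      { P≤1 = ≤-trans (≤-by (y * Q y m) (*≥0 0≤y Q≥0) (restore (P y m) (y * Q y m))) P≤1
      ; P≥  = ≤-trans (≤-by (y * (ι x - Q y m)) (*≥0 0≤y (p≤q⇒0≤q-p (≤-trans Q≤m (ι-mono (ℕ.<⇒≤ m<x)))))
                (trans (cong (λ z → 1ℚ - z * (ι x * y) + y * (ι x - Q y m)) (ι-suc m))
                  (advance (ι m) (ι x) y (Q y m))))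
              (+-monoˡ-≤ (- (y * Q y m)) P≥)
      ; Q≥0 = +≥0 Q≥0 (≤-trans (p≤q⇒0≤q-p (mxy≤1 (ℕ.<⇒≤ m<x))) P≥)
      ; Q≤m = subst (Q y m + P y m ≤_) (trans (+-comm (ι m) 1ℚ) (sym (ι-suc m))) (+-mono-≤ Q≤m P≤1) }
      where
      open Estimates (estimates m (ℕ.<⇒≤ m<x))
      restore : ∀ p z → p - z + z ≡ p
      restore = solve-∀ ringℚ
      advance : ∀ m x y q → 1ℚ - (1ℚ + m) * (x * y) + y * (x - q) ≡ (1ℚ - m * (x * y)) - y * q
      advance = solve-∀ ringℚ

    P≥0 : ∀ m → m ℕ.≤ x → 0ℚ ≤ P y m
    P≥0 m m≤x = ≤-trans (p≤q⇒0≤q-p (mxy≤1 m≤x)) (Estimates.P≥ (estimates m m≤x))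

    Q≥1 : ∀ m → suc m ℕ.≤ x → 1ℚ ≤ Q y (suc m)
    Q≥1 zero    _  = ≤-refl
    Q≥1 (suc m) m+2≤x = ≤-trans (Q≥1 m (ℕ.<⇒≤ m+2≤x)) (≤-by (P y (suc m)) (P≥0 (suc m) (ℕ.<⇒≤ m+2≤x)) refl)

  PositiveUpTo : ℕ → ℚ → Set
  PositiveUpTo M y = ∀ m → 1 ℕ.≤ m → m ℕ.≤ M → 0ℚ < Q y m

  NonPositiveBefore : ℕ → ℚ → Set
  NonPositiveBefore M y = ∃ λ m → m ℕ.≤ M × 1 ℕ.≤ m × Q y m ≤ 0ℚ

  private
    scan : ∀ y M → PositiveUpTo M y ⊎ NonPositiveBefore M y
    scan y zero = inj₁ λ { m 1≤m m≤0 → ⊥-elim (ℕ.<-irrefl refl (ℕ.≤-trans 1≤m m≤0)) }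
    scan y (suc M) with scan y M | 0ℚ <? Q y (suc M)
    ... | inj₂ (m , m≤M , 1≤m , Q≤0) | _ = inj₂ (m , ℕ.m≤n⇒m≤1+n m≤M , 1≤m , Q≤0)
    ... | inj₁ _ | no Q≯0 = inj₂ (suc M , ℕ.≤-refl , s≤s z≤n , ≮⇒≥ Q≯0)
    ... | inj₁ positive | yes Q>0 = inj₁ positive′
      where
      positive′ : PositiveUpTo (suc M) y
      positive′ m 1≤m m≤1+M with ℕ.m≤n⇒m<n∨m≡n m≤1+M
      ... | inj₁ (s≤s m≤M) = positive m 1≤m m≤M
      ... | inj₂ refl = Q>0

    sign-change : ∀ M y δ → PositiveUpTo M y → ∀ k → ¬ PositiveUpTo M (y + ι k * δ) →
                  ∃ λ j → PositiveUpTo M (y + ι j * δ) × NonPositiveBefore M (y + ι j * δ + δ)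
    sign-change M y δ positive zero ¬positive =
      ⊥-elim (¬positive (subst (PositiveUpTo M) (sym (trans (cong (λ z → y + z) (ι-0* δ)) (+-identityʳ y))) positive))
    sign-change M y δ positive (suc k) ¬positive with scan (y + ι k * δ) M
    ... | inj₂ (m , m≤M , 1≤m , Q≤0) = sign-change M y δ positive k λ positive-k → <⇒≱ (positive-k m 1≤m m≤M) Q≤0
    ... | inj₁ positive-k with scan (y + ι k * δ + δ) M
    ...   | inj₂ nonPositive = k , positive-k , nonPositive
    ...   | inj₁ positive-1+k = ⊥-elim (¬positive (subst (PositiveUpTo M)
              (trans (+-assoc y (ι k * δ) δ) (cong (λ z → y + z) (sym (ι-suc* k δ)))) positive-1+k))

    Q-4 : ∀ y → Q y 4 ≡ 4ℚ * (1ℚ - y)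
    Q-4 = unfolded
      where
      unfolded : ∀ y →
        (((0ℚ + 1ℚ) + (1ℚ - y * 0ℚ)) + ((1ℚ - y * 0ℚ) - y * (0ℚ + 1ℚ))) + (((1ℚ - y * 0ℚ) - y * (0ℚ + 1ℚ)) - y *
          ((0ℚ + 1ℚ) + (1ℚ - y * 0ℚ))) ≡ ((1ℚ + 1ℚ) + (1ℚ + 1ℚ)) * (1ℚ - y)
      unfolded = solve-∀ ringℚ

  positive⇒<1 : ∀ {y M} → 4 ℕ.≤ M → PositiveUpTo M y → y < 1ℚ
  positive⇒<1 {y} {M} 4≤M positive with y <? 1ℚ
  ... | yes y<1 = y<1
  ... | no y≮1  = ⊥-elim (<⇒≱ (subst (0ℚ <_) (Q-4 y) (positive 4 (s≤s z≤n) 4≤M))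
      (≤-by (4ℚ * (y - 1ℚ)) (*≥0 0≤4 (p≤q⇒0≤q-p (≮⇒≥ y≮1))) (cancel y)))
    where
    cancel : ∀ y → ((1ℚ + 1ℚ) + (1ℚ + 1ℚ)) * (1ℚ - y) + ((1ℚ + 1ℚ) + (1ℚ + 1ℚ)) * (y - 1ℚ) ≡ 0ℚ
    cancel = solve-∀ ringℚ

  module _ {y : ℚ} {M : ℕ} (0≤y : 0ℚ ≤ y) (positive : PositiveUpTo M y) where

    Q-halving : ∀ m → suc (suc m) ℕ.≤ M → ½ * Q y m ≤ Q y (suc m)
    Q-halving m m+2≤M = ≤-by (½ * (y * Q y m) + ½ * Q y (suc (suc m)))
        (+≥0 (*≥0 0≤½ (*≥0 0≤y (Q≥0 m m+2≤M))) (*≥0 0≤½ (<⇒≤ (positive (suc (suc m)) (s≤s z≤n) m+2≤M))))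
        (recurrence y (Q y m) (P y m))
      where
      recurrence : ∀ y q p → ½ * q + (½ * (y * q) + ½ * ((q + p) + (p - y * q))) ≡ q + p
      recurrence = solve-∀ ringℚ
      Q≥0 : ∀ m → suc (suc m) ℕ.≤ M → 0ℚ ≤ Q y m
      Q≥0 zero    _     = ≤-refl
      Q≥0 (suc m) m+3≤M = <⇒≤ (positive (suc m) (s≤s z≤n) (ℕ.≤-trans (ℕ.m≤n+m (suc m) 2) m+3≤M))

    Q-lower : ∀ m → suc m ℕ.< M → ½ ^ suc m ≤ Q y (suc m)
    Q-lower zero    _     = ≤-by ½ 0≤½ refl
    Q-lower (suc m) m+2<M = ≤-trans (*-monoˡ 0≤½ (Q-lower m (ℕ.<⇒≤ m+2<M))) (Q-halving (suc m) m+2<M)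

  -- y approximates tan²(π/M), the least positive zero of Q in y, to order 1/T.
  record Approximation (M T : ℕ) : Set where
    field
      y        : ℚ
      y≥       : inv (ι M * ι M) ≤ y
      y≤1      : y ≤ 1ℚ
      positive : PositiveUpTo M y
      small    : ι (suc T) * Q y M ≤ (2ℚ * 4ℚ) ^ M * 4ℚ ^ M

  private
    module Search (M-1 T : ℕ) (4≤M : 4 ℕ.≤ suc M-1) where

      M : ℕ
      M = suc M-1

      y₀ δ : ℚ
      y₀ = inv (ι M * ι M)
      δ  = inv (ι (suc T))

      0<M² : 0ℚ < ι M * ι M
      0<M² = *>0 (ι>0 M-1) (ι>0 M-1)

      0≤y₀ : 0ℚ ≤ y₀
      0≤y₀ = inv≥0 0<M²

      δ≥0 : 0ℚ ≤ δ
      δ≥0 = inv≥0 (ι>0 T)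

      positive₀ : PositiveUpTo M y₀
      positive₀ (suc m) _ m≤M = <-≤-trans 0<1
        (SmallAngle.Q≥1 M 0≤y₀ (≤-reflexive (trans (sym (*-assoc (ι M) (ι M) y₀)) (*-inv⁺ 0<M²))) m m≤M)

      ¬positive₁ : ¬ PositiveUpTo M (y₀ + ι (suc T) * δ)
      ¬positive₁ positive₁ = <⇒≱ (positive⇒<1 4≤M positive₁)
        (≤-by y₀ 0≤y₀ (trans (+-comm 1ℚ y₀) (cong (λ z → y₀ + z) (sym (*-inv⁺ (ι>0 T))))))

      crossing : ∃ λ j → PositiveUpTo M (y₀ + ι j * δ) × NonPositiveBefore M (y₀ + ι j * δ + δ)
      crossing = sign-change M y₀ δ positive₀ (suc T) ¬positive₁

      j : ℕ
      j = proj₁ crossing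

      y : ℚ
      y = y₀ + ι j * δ

      positive : PositiveUpTo M y
      positive = proj₁ (proj₂ crossing)

      y≥y₀ : y₀ ≤ y
      y≥y₀ = ≤-by (ι j * δ) (*≥0 (ι≥0 j) δ≥0) refl

      0≤y : 0ℚ ≤ y
      0≤y = ≤-trans 0≤y₀ y≥y₀

      y≤1 : y ≤ 1ℚ
      y≤1 = <⇒≤ (positive⇒<1 4≤M positive)

      y≤2 : y ≤ 2ℚ
      y≤2 = ≤-trans y≤1 (≤-by 1ℚ 0≤1 refl)

      near-zero : ∀ m → Q (y + δ) m ≤ 0ℚ → ι (suc T) * Q y m ≤ 4ℚ ^ m
      near-zero m Q≤0 = begin
        ι (suc T) * Q y m
          ≤⟨ *-monoˡ (ι≥0 (suc T)) (≤-by (- Q (y + δ) m) (neg-antimono-≤ Q≤0) refl) ⟩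
        ι (suc T) * (Q y m - Q (y + δ) m)     ≤⟨ *-monoˡ (ι≥0 (suc T)) (x≤∣x∣ (Q y m - Q (y + δ) m)) ⟩
        ι (suc T) * ∣ Q y m - Q (y + δ) m ∣   ≡⟨ cong (ι (suc T) *_) (∣x-y∣≡∣y-x∣ (Q y m) (Q (y + δ) m)) ⟩
        ι (suc T) * ∣ Q (y + δ) m - Q y m ∣   ≤⟨ *-monoˡ (ι≥0 (suc T)) (proj₂ (PQ-Lipschitz 0≤y y≤2 δ≥0 y+δ≤2 m)) ⟩
        ι (suc T) * (4ℚ ^ m * δ)              ≡⟨ x∙yz≈y∙xz (ι (suc T)) (4ℚ ^ m) δ ⟩
        4ℚ ^ m * (ι (suc T) * δ)              ≡⟨ trans (cong (4ℚ ^ m *_) (*-inv⁺ (ι>0 T))) (*-identityʳ (4ℚ ^ m)) ⟩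
        4ℚ ^ m ∎
        where
        open ≤-Reasoning
        y+δ≤2 : y + δ ≤ 2ℚ
        y+δ≤2 = +-mono-≤ {y} {1ℚ} {δ} {1ℚ} y≤1 (inv≤1 (ι≥1 T))

      1≤8 : 1ℚ ≤ 2ℚ * 4ℚ
      1≤8 = *-mono 0≤1 (≤-by 1ℚ 0≤1 refl) 0≤1 (≤-by (1ℚ + 2ℚ) (+≥0 0≤1 0≤2) refl)

      T≤8^M : ∀ m → suc m ℕ.< M → Q (y + δ) (suc m) ≤ 0ℚ → ι (suc T) ≤ (2ℚ * 4ℚ) ^ M
      T≤8^M m m+1<M Q≤0 = begin
        ι (suc T)                                ≡⟨ trans (cong (ι (suc T) *_) 2^½^≡1) (*-identityʳ (ι (suc T))) ⟨
        ι (suc T) * (2ℚ ^ suc m * ½ ^ suc m)     ≡⟨ x∙yz≈y∙xz (ι (suc T)) (2ℚ ^ suc m) (½ ^ suc m) ⟩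
        2ℚ ^ suc m * (ι (suc T) * ½ ^ suc m)
          ≤⟨ *-monoˡ 2^≥0 (*-monoˡ (ι≥0 (suc T)) (Q-lower 0≤y positive m m+1<M)) ⟩
        2ℚ ^ suc m * (ι (suc T) * Q y (suc m))   ≤⟨ *-monoˡ 2^≥0 (near-zero (suc m) Q≤0) ⟩
        2ℚ ^ suc m * 4ℚ ^ suc m                  ≡⟨ ^-distrib-* 2ℚ 4ℚ (suc m) ⟨
        (2ℚ * 4ℚ) ^ suc m                        ≤⟨ ^-mono 1≤8 (ℕ.<⇒≤ m+1<M) ⟩
        (2ℚ * 4ℚ) ^ M ∎
        where
        open ≤-Reasoning
        2^≥0 : 0ℚ ≤ 2ℚ ^ suc m
        2^≥0 = <⇒≤ (^>0 0<2 (suc m))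
        2^½^≡1 : 2ℚ ^ suc m * ½ ^ suc m ≡ 1ℚ
        2^½^≡1 = trans (sym (^-distrib-* 2ℚ ½ (suc m))) (1^ (suc m))

      small : NonPositiveBefore M (y + δ) → ι (suc T) * Q y M ≤ (2ℚ * 4ℚ) ^ M * 4ℚ ^ M
      small (suc m , m+1≤M , _ , Q≤0) with ℕ.m≤n⇒m<n∨m≡n m+1≤M
      ... | inj₁ m+1<M = *-mono (ι≥0 (suc T)) (T≤8^M m m+1<M Q≤0) (<⇒≤ (positive M (s≤s z≤n) ℕ.≤-refl))
                           (≤-trans (x≤∣x∣ (Q y M)) (proj₂ (PQ-bound 0≤y y≤2 M)))
      ... | inj₂ refl  = ≤-trans (near-zero M Q≤0)
                           (subst (_≤ (2ℚ * 4ℚ) ^ M * 4ℚ ^ M) (*-identityˡ (4ℚ ^ M)) (*-monoʳ (0≤4^ M) (1≤^ 1≤8 M)))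

  approximation : ∀ M T → 4 ℕ.≤ M → Approximation M T
  approximation (suc M-1) T 4≤M = record
    { y = y ; y≥ = y≥y₀ ; y≤1 = y≤1 ; positive = positive ; small = small (proj₂ (proj₂ crossing)) }
    where open Search M-1 T 4≤M

module SequenceRing where

  open import Algebra.Bundles using (CommutativeRing)
  open import Algebra.Structures using (IsCommutativeRing)
  open import Data.Product using () renaming (_,_ to ⟨_,_⟩)
  open import Level using (0ℓ)
  open Rationals

  record Close (f g : ℕ → ℚ) : Set where
    constructor close
    field
      rate   : ℚ
      close≤ : ∀ T → ι (suc T) * ∣ f T - g T ∣ ≤ rate

  close-exact : ∀ {f g} → (∀ T → f T ≡ g T) → Close f g
  close-exact {f} {g} eq = close 0ℚ λ T → ≤-reflexive (y≡0⇒x*y≡0 (ι (suc T))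
    (cong ∣_∣ (trans (cong (_- g T) (eq T)) (+-inverseʳ (g T)))))

  close-sym : ∀ {f g} → Close f g → Close g f
  close-sym {f} {g} (close C bound) = close C λ T → subst (λ x → ι (suc T) * x ≤ C) (∣x-y∣≡∣y-x∣ (f T) (g T))
    (bound T)

  private
    combine : ∀ {x y z a b} T → ∣ z ∣ ≤ ∣ x ∣ + ∣ y ∣ → ι (suc T) * ∣ x ∣ ≤ a → ι (suc T) * ∣ y ∣ ≤ b →
      ι (suc T) * ∣ z ∣ ≤ a + b
    combine {x} {y} T triangle p q = ≤-trans (*-monoˡ (ι≥0 (suc T)) triangle)
      (≤-trans (≤-reflexive (*-distribˡ-+ (ι (suc T)) ∣ x ∣ ∣ y ∣)) (+-mono-≤ p q))

  close-trans : ∀ {f g h} → Close f g → Close g h → Close f h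
  close-trans {f} {g} {h} (close C p) (close D q) = close (C + D) λ T → combine {f T - g T} {g T - h T} T
    (subst (λ x → ∣ x ∣ ≤ ∣ f T - g T ∣ + ∣ g T - h T ∣) (split (f T) (g T) (h T))
      (∣p+q∣≤∣p∣+∣q∣ (f T - g T) (g T - h T))) (p T) (q T)
    where
    split : ∀ a b c → (a - b) + (b - c) ≡ a - c
    split = solve-∀ ringℚ

  close-+ : {f f′ g g′ : ℕ → ℚ} → Close f f′ → Close g g′ → Close (λ T → f T + g T) (λ T → f′ T + g′ T)
  close-+ {f} {f′} {g} {g′} (close C p) (close D q) = close (C + D) λ T → combine {f T - f′ T} {g T - g′ T} T
    (subst (λ x → ∣ x ∣ ≤ ∣ f T - f′ T ∣ + ∣ g T - g′ T ∣) (split (f T) (f′ T) (g T) (g′ T))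
      (∣p+q∣≤∣p∣+∣q∣ (f T - f′ T) (g T - g′ T))) (p T) (q T)
    where
    split : ∀ a b c d → (a - b) + (c - d) ≡ (a + c) - (b + d)
    split = solve-∀ ringℚ

  close-neg : {f f′ : ℕ → ℚ} → Close f f′ → Close (λ T → - f T) (λ T → - f′ T)
  close-neg {f} {f′} (close C bound) = close C λ T →
    subst (λ x → ι (suc T) * x ≤ C) (trans (sym (∣-p∣≡∣p∣ (f T - f′ T))) (cong ∣_∣ (neg-distrib-+ (f T) (- f′ T))))
      (bound T)

  close-scale : (g : ℕ → ℚ) {f f′ : ℕ → ℚ} {b : ℚ} → (∀ T → ∣ g T ∣ ≤ b) → Close f f′ →
    Close (λ T → g T * f T) (λ T → g T * f′ T)
  close-scale g {f} {f′} {b} g≤ (close C p) = close (b * C) λ T → begin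
    ι (suc T) * ∣ g T * f T - g T * f′ T ∣   ≡⟨ cong (λ x → ι (suc T) * ∣ x ∣) (factor (g T) (f T) (f′ T)) ⟩
    ι (suc T) * ∣ g T * (f T - f′ T) ∣       ≡⟨ cong (ι (suc T) *_) (∣p*q∣≡∣p∣*∣q∣ (g T) (f T - f′ T)) ⟩
    ι (suc T) * (∣ g T ∣ * ∣ f T - f′ T ∣)   ≡⟨ x∙yz≈y∙xz (ι (suc T)) ∣ g T ∣ ∣ f T - f′ T ∣ ⟩
    ∣ g T ∣ * (ι (suc T) * ∣ f T - f′ T ∣)
      ≤⟨ *-mono (0≤∣p∣ (g T)) (g≤ T) (*≥0 (ι≥0 (suc T)) (0≤∣p∣ (f T - f′ T))) (p T) ⟩
    b * C ∎
    where
    open ≤-Reasoning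
    factor : ∀ g a b → g * a - g * b ≡ g * (a - b)
    factor = solve-∀ ringℚ

  close-* : {f f′ g g′ : ℕ → ℚ} {b b′ : ℚ} → (∀ T → ∣ f T ∣ ≤ b) → (∀ T → ∣ g′ T ∣ ≤ b′) → Close f f′ → Close g g′ →
            Close (λ T → f T * g T) (λ T → f′ T * g′ T)
  close-* {f} {f′} {g} {g′} f≤ g′≤ p q = close-trans (close-scale f f≤ q)
    (close-trans (close-exact λ T → *-comm (f T) (g′ T)) (close-trans (close-scale g′ g′≤ p)
      (close-exact λ T → *-comm (g′ T) (f′ T))))

  -- Bounded sequences over ℚ[√-Y T], where a sequence that is O(1/T) counts as zero:
  -- identities that hold exactly for the irrational limit of Y can be derived in this ring.
  module Sequences (Y : ℕ → ℚ) (Y≥0 : ∀ T → 0ℚ ≤ Y T) (Y≤1 : ∀ T → Y T ≤ 1ℚ) where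

    record Seq : Set where
      no-eta-equality
      constructor seq
      field
        re im : ℕ → ℚ
        bound : ℚ
        re≤   : ∀ T → ∣ re T ∣ ≤ bound
        im≤   : ∀ T → ∣ im T ∣ ≤ bound

    open Seq public

    infix 4 _≈_

    record _≈_ (x y : Seq) : Set where
      constructor _,_
      field
        re-close : Close (re x) (re y)
        im-close : Close (im x) (im y)

    exact : ∀ {x y} → (∀ T → re x T ≡ re y T) → (∀ T → im x T ≡ im y T) → x ≈ y
    exact p q = close-exact p , close-exact q

    private
      ∣Y∣≤1 : ∀ T → ∣ Y T ∣ ≤ 1ℚ
      ∣Y∣≤1 T = ∣∣-nonNeg (Y≥0 T) (Y≤1 T)

      1*ʳ : ∀ y a b → 1ℚ * a - y * (0ℚ * b) ≡ a
      1*ʳ = solve-∀ ringℚ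
      1*ⁱ : ∀ a b → 1ℚ * b + 0ℚ * a ≡ b
      1*ⁱ = solve-∀ ringℚ
      commʳ : ∀ y a b c d → a * c - y * (b * d) ≡ c * a - y * (d * b)
      commʳ = solve-∀ ringℚ
      commⁱ : ∀ a b c d → a * d + b * c ≡ c * b + d * a
      commⁱ = solve-∀ ringℚ
      assocʳ : ∀ y a b c d e f →
        (a * c - y * (b * d)) * e - y * ((a * d + b * c) * f) ≡ a * (c * e - y * (d * f)) - y * (b * (c * f + d * e))
      assocʳ = solve-∀ ringℚ
      assocⁱ : ∀ y a b c d e f →
        (a * c - y * (b * d)) * f + (a * d + b * c) * e ≡ a * (c * f + d * e) + b * (c * e - y * (d * f))
      assocⁱ = solve-∀ ringℚ
      distʳ : ∀ y a b c d e f → a * (c + e) - y * (b * (d + f)) ≡ (a * c - y * (b * d)) + (a * e - y * (b * f))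
      distʳ = solve-∀ ringℚ
      distⁱ : ∀ a b c d e f → a * (d + f) + b * (c + e) ≡ (a * d + b * c) + (a * f + b * e)
      distⁱ = solve-∀ ringℚ

    real : (f : ℕ → ℚ) (b : ℚ) → (∀ T → ∣ f T ∣ ≤ b) → Seq
    real f b f≤ = seq f (λ _ → 0ℚ) b f≤ (λ T → ≤-trans (0≤∣p∣ (f T)) (f≤ T))

    imaginary : (f : ℕ → ℚ) (b : ℚ) → (∀ T → ∣ f T ∣ ≤ b) → Seq
    imaginary f b f≤ = seq (λ _ → 0ℚ) f b (λ T → ≤-trans (0≤∣p∣ (f T)) (f≤ T)) f≤

    -- Sealed, so that the type checker never compares the boundedness proofs.
    abstract
      _+ₛ_ _*ₛ_ : Seq → Seq → Seq
      x +ₛ y = seq (λ T → re x T + re y T) (λ T → im x T + im y T) (bound x + bound y)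
        (λ T → ∣∣-+ (re≤ x T) (re≤ y T)) (λ T → ∣∣-+ (im≤ x T) (im≤ y T))
      x *ₛ y = seq (λ T → re x T * re y T - Y T * (im x T * im y T)) (λ T → re x T * im y T + im x T * re y T)
        (bound x * bound y + bound x * bound y)
        (λ T → ∣∣-- (∣∣-* (re≤ x T) (re≤ y T)) (subst (∣ Y T * (im x T * im y T) ∣ ≤_)
          (*-identityˡ (bound x * bound y)) (∣∣-* (∣Y∣≤1 T) (∣∣-* (im≤ x T) (im≤ y T)))))
        (λ T → ∣∣-+ (∣∣-* (re≤ x T) (im≤ y T)) (∣∣-* (im≤ x T) (re≤ y T)))

      -ₛ_ : Seq → Seq
      -ₛ x = seq (λ T → - re x T) (λ T → - im x T) (bound x)
        (λ T → subst (_≤ bound x) (sym (∣-p∣≡∣p∣ (re x T))) (re≤ x T))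
          (λ T → subst (_≤ bound x) (sym (∣-p∣≡∣p∣ (im x T))) (im≤ x T))

      0ₛ 1ₛ : Seq
      0ₛ = real (λ _ → 0ℚ) 0ℚ (λ _ → ≤-refl)
      1ₛ = real (λ _ → 1ℚ) 1ℚ (λ _ → ≤-refl)

      re-+ : ∀ x y T → re (x +ₛ y) T ≡ re x T + re y T
      re-+ x y T = refl

      re-* : ∀ x y T → re (x *ₛ y) T ≡ re x T * re y T - Y T * (im x T * im y T)
      re-* x y T = refl

      im-+ : ∀ x y T → im (x +ₛ y) T ≡ im x T + im y T
      im-+ x y T = refl

      im-* : ∀ x y T → im (x *ₛ y) T ≡ re x T * im y T + im x T * re y T
      im-* x y T = refl

      re-0 : ∀ T → re 0ₛ T ≡ 0ℚ
      re-0 T = refl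

      im-0 : ∀ T → im 0ₛ T ≡ 0ℚ
      im-0 T = refl

      re-1 : ∀ T → re 1ₛ T ≡ 1ℚ
      re-1 T = refl

      im-1 : ∀ T → im 1ₛ T ≡ 0ℚ
      im-1 T = refl

      +-congₛ : ∀ {x y u v} → x ≈ y → u ≈ v → (x +ₛ u) ≈ (y +ₛ v)
      +-congₛ (p , q) (r , s) = close-+ p r , close-+ q s

      *-congₛ : ∀ {x y u v} → x ≈ y → u ≈ v → (x *ₛ u) ≈ (y *ₛ v)
      *-congₛ {x} {y} {u} {v} (p , q) (r , s) =
        close-+ (close-* (re≤ x) (re≤ v) p r) (close-neg (close-scale Y ∣Y∣≤1 (close-* (im≤ x) (im≤ v) q s))) ,
        close-+ (close-* (re≤ x) (im≤ v) p s) (close-* (im≤ x) (re≤ v) q r)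

      *-commₛ : ∀ x y → (x *ₛ y) ≈ (y *ₛ x)
      *-commₛ x y = exact (λ T → commʳ (Y T) (re x T) (im x T) (re y T) (im y T)) (λ T → commⁱ (re x T) (im x T)
        (re y T) (im y T))

      ≈-trans : ∀ {x y z} → x ≈ y → y ≈ z → x ≈ z
      ≈-trans (p , q) (r , s) = close-trans p r , close-trans q s

      *-idˡ : ∀ x → (1ₛ *ₛ x) ≈ x
      *-idˡ x = exact (λ T → 1*ʳ (Y T) (re x T) (im x T)) (λ T → 1*ⁱ (re x T) (im x T))

      distribˡₛ : ∀ x y z → (x *ₛ (y +ₛ z)) ≈ ((x *ₛ y) +ₛ (x *ₛ z))
      distribˡₛ x y z = exact (λ T → distʳ (Y T) (re x T) (im x T) (re y T) (im y T) (re z T) (im z T))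
        (λ T → distⁱ (re x T) (im x T) (re y T) (im y T) (re z T) (im z T))

      isCommutativeRing : IsCommutativeRing _≈_ _+ₛ_ _*ₛ_ -ₛ_ 0ₛ 1ₛ
      isCommutativeRing = record
        { isRing = record
          { +-isAbelianGroup = record
            { isGroup = record
              { isMonoid = record
                { isSemigroup = record
                  { isMagma = record
                    { isEquivalence = record
                      { refl = exact (λ _ → refl) (λ _ → refl)
                      ; sym = λ (p , q) → close-sym p , close-sym q
                      ; trans = λ {x} {y} {z} → ≈-trans {x} {y} {z} }
                    ; ∙-cong = λ {x} {y} {u} {v} → +-congₛ {x} {y} {u} {v} }
                  ; assoc = λ x y z → exact (λ T → +-assoc (re x T) (re y T) (re z T))
                    (λ T → +-assoc (im x T) (im y T) (im z T)) }
                ; identity = ⟨_,_⟩ (λ x → exact (λ T → +-identityˡ (re x T)) (λ T → +-identityˡ (im x T)))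
                             (λ x → exact (λ T → +-identityʳ (re x T)) (λ T → +-identityʳ (im x T))) }
              ; inverse = ⟨_,_⟩ (λ x → exact (λ T → +-inverseˡ (re x T)) (λ T → +-inverseˡ (im x T)))
                          (λ x → exact (λ T → +-inverseʳ (re x T)) (λ T → +-inverseʳ (im x T)))
              ; ⁻¹-cong = λ (p , q) → close-neg p , close-neg q }
            ; comm = λ x y → exact (λ T → +-comm (re x T) (re y T)) (λ T → +-comm (im x T) (im y T)) }
          ; *-cong = λ {x} {y} {u} {v} → *-congₛ {x} {y} {u} {v}
          ; *-assoc = λ x y z → exact (λ T → assocʳ (Y T) (re x T) (im x T) (re y T) (im y T) (re z T) (im z T))
            (λ T → assocⁱ (Y T) (re x T) (im x T) (re y T) (im y T) (re z T) (im z T))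
          ; *-identity = ⟨ *-idˡ , (λ x → ≈-trans {x *ₛ 1ₛ} {1ₛ *ₛ x} {x} (*-commₛ x 1ₛ) (*-idˡ x)) ⟩
          ; distrib = ⟨ distribˡₛ , (λ x y z → ≈-trans {(y +ₛ z) *ₛ x} {x *ₛ (y +ₛ z)} {(y *ₛ x) +ₛ (z *ₛ x)}
            (*-commₛ (y +ₛ z) x)
              (≈-trans {x *ₛ (y +ₛ z)} {(x *ₛ y) +ₛ (x *ₛ z)} {(y *ₛ x) +ₛ (z *ₛ x)} (distribˡₛ x y z)
                (+-congₛ {x *ₛ y} {y *ₛ x} {x *ₛ z} {z *ₛ x} (*-commₛ x y) (*-commₛ x z)))) ⟩ }
        ; *-comm = *-commₛ }

    ring : CommutativeRing 0ℓ 0ℓ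
    ring = record
      { Carrier = Seq ; _≈_ = _≈_ ; _+_ = _+ₛ_ ; _*_ = _*ₛ_ ; -_ = -ₛ_ ; 0# = 0ₛ ; 1# = 1ₛ
      ; isCommutativeRing = isCommutativeRing }

module Cotangent where

  open import Algebra.Bundles using (CommutativeRing)
  open Rationals
  open Sums
  open Congruence
  open Powers using (^>0) renaming (_^_ to _^ℚ_)
  open TangentRoot
  open SequenceRing
  open Fourier

  -- The finite-difference analogue of √y cot(mα).
  cot : ℚ → ℕ → ℚ
  cot y m = P y m * inv (Q y m)

  -- A sequence of approximations of tan²(π/M).
  record RootSequence (M : ℕ) : Set where
    field
      Y        : ℕ → ℚ
      y₀ K     : ℚ
      0<y₀     : 0ℚ < y₀
      y₀≤Y     : ∀ T → y₀ ≤ Y T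
      Y≤1      : ∀ T → Y T ≤ 1ℚ
      positive : ∀ T → PositiveUpTo M (Y T)
      small-Q  : ∀ T → ι (suc T) * Q (Y T) M ≤ K

    Y>0 : ∀ T → 0ℚ < Y T
    Y>0 T = <-≤-trans 0<y₀ (y₀≤Y T)

    Y≥0 : ∀ T → 0ℚ ≤ Y T
    Y≥0 T = <⇒≤ (Y>0 T)

  module _ (n L : ℕ) {{_ : NonZero n}} {{_ : NonZero L}} (roots : RootSequence (n ℕ.* L)) where

    open RootSequence roots

    private
      M : ℕ
      M = n ℕ.* L

      1≤M : 1 ℕ.≤ M
      1≤M = ℕ.>-nonZero⁻¹ M {{ℕ.m*n≢0 n L}}

      Y≤2 : ∀ T → Y T ≤ 2ℚ
      Y≤2 T = ≤-trans (Y≤1 T) (≤-by 1ℚ 0≤1 refl)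

      0<½^ : ∀ m → 0ℚ < ½ ^ℚ m
      0<½^ = ^>0 0<½

      ½^≤Q : ∀ m → 0 ℕ.< m → m ℕ.< M → ∀ T → ½ ^ℚ m ≤ Q (Y T) m
      ½^≤Q (suc m) _ m<M T = Q-lower (Y≥0 T) (positive T) m m<M

      Q>0 : ∀ m → 0 ℕ.< m → m ℕ.< M → ∀ T → 0ℚ < Q (Y T) m
      Q>0 m 0<m m<M T = positive T m 0<m (ℕ.<⇒≤ m<M)

      invQ≤ : ∀ m → 0 ℕ.< m → m ℕ.< M → ∀ T → ∣ inv (Q (Y T) m) ∣ ≤ inv (½ ^ℚ m)
      invQ≤ m 0<m m<M T = ∣∣-nonNeg (inv≥0 (Q>0 m 0<m m<M T)) (inv-anti (0<½^ m) (½^≤Q m 0<m m<M T))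

      0<1+Y : ∀ T → 0ℚ < 1ℚ + Y T
      0<1+Y T = <-≤-trans 0<1 (≤-by (Y T) (Y≥0 T) refl)

      open Sequences Y Y≥0 Y≤1
      module S = CommutativeRing ring
      open S using () renaming (_+_ to _⊕_; _*_ to _⊗_)
      open import Algebra.Properties.CommutativeSemiring.Exp S.commutativeSemiring using (_^_)
      open Geometric ring using (ν)
      open RangeSum S.semiring using () renaming (∑ to ∑ₛ; progressionSum to progressionSumₛ)

      √-Y 1+√-Y 1-√-Y 1/[1+Y] : Seq
      √-Y     = imaginary (λ _ → 1ℚ) 1ℚ (λ _ → ≤-refl)
      1+√-Y   = seq (λ _ → 1ℚ) (λ _ → 1ℚ) 1ℚ (λ _ → ≤-refl) (λ _ → ≤-refl)
      1-√-Y   = seq (λ _ → 1ℚ) (λ _ → - 1ℚ) 1ℚ (λ _ → ≤-refl) (λ _ → ≤-refl)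
      1/[1+Y] = real (λ T → inv (1ℚ + Y T)) 1ℚ λ T →
        ∣∣-nonNeg (inv≥0 (0<1+Y T)) (inv≤1 (≤-by (Y T) (Y≥0 T) refl))

      norm : 1+√-Y ⊗ 1-√-Y ⊗ 1/[1+Y] ≈ S.1#
      norm = exact
        (λ T → trans (re-* (1+√-Y ⊗ 1-√-Y) 1/[1+Y] T)
          (trans (cong₂ (λ a b → a * inv (1ℚ + Y T) - Y T * (b * 0ℚ)) (re-* 1+√-Y 1-√-Y T) (im-* 1+√-Y 1-√-Y T))
          (trans (real-part (Y T) (inv (1ℚ + Y T))) (trans (*-inv⁺ (0<1+Y T)) (sym (re-1 T))))))
        (λ T → trans (im-* (1+√-Y ⊗ 1-√-Y) 1/[1+Y] T)
          (trans (cong₂ (λ a b → a * 0ℚ + b * inv (1ℚ + Y T)) (re-* 1+√-Y 1-√-Y T) (im-* 1+√-Y 1-√-Y T))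
          (trans (imaginary-part (Y T) (inv (1ℚ + Y T))) (sym (im-1 T)))))
        where
        real-part : ∀ y i → (1ℚ * 1ℚ - y * (1ℚ * (- 1ℚ))) * i - y * ((1ℚ * (- 1ℚ) + 1ℚ * 1ℚ) * 0ℚ) ≡ (1ℚ + y) * i
        real-part = solve-∀ ringℚ
        imaginary-part : ∀ y i → (1ℚ * 1ℚ - y * (1ℚ * (- 1ℚ))) * 0ℚ + (1ℚ * (- 1ℚ) + 1ℚ * 1ℚ) * i ≡ 0ℚ
        imaginary-part = solve-∀ ringℚ

      re-power : ∀ m T → re (1+√-Y ^ m) T ≡ P (Y T) m
      im-power : ∀ m T → im (1+√-Y ^ m) T ≡ Q (Y T) m
      re-power zero    T = re-1 T
      re-power (suc m) T = trans (re-* 1+√-Y (1+√-Y ^ m) T)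
        (trans (cong₂ (λ p q → 1ℚ * p - Y T * (1ℚ * q)) (re-power m T) (im-power m T))
          (drop-1s (P (Y T) m) (Q (Y T) m) (Y T)))
        where
        drop-1s : ∀ p q y → 1ℚ * p - y * (1ℚ * q) ≡ p - y * q
        drop-1s = solve-∀ ringℚ
      im-power zero    T = im-1 T
      im-power (suc m) T = trans (im-* 1+√-Y (1+√-Y ^ m) T)
        (cong₂ _+_ (trans (*-identityˡ _) (im-power m T)) (trans (*-identityˡ _) (re-power m T)))

      re-conjugate-power : ∀ m T → re (1-√-Y ^ m) T ≡ P (Y T) m
      im-conjugate-power : ∀ m T → im (1-√-Y ^ m) T ≡ - Q (Y T) m
      re-conjugate-power zero    T = re-1 T
      re-conjugate-power (suc m) T = trans (re-* 1-√-Y (1-√-Y ^ m) T)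
        (trans (cong₂ (λ p q → 1ℚ * p - Y T * (- 1ℚ * q)) (re-conjugate-power m T) (im-conjugate-power m T))
          (drop-signs (P (Y T) m) (Q (Y T) m) (Y T)))
        where
        drop-signs : ∀ p q y → 1ℚ * p - y * (- 1ℚ * - q) ≡ p - y * q
        drop-signs = solve-∀ ringℚ
      im-conjugate-power zero    T = im-1 T
      im-conjugate-power (suc m) T = trans (im-* 1-√-Y (1-√-Y ^ m) T)
        (trans (cong₂ (λ p q → 1ℚ * q + - 1ℚ * p) (re-conjugate-power m T) (im-conjugate-power m T))
          (pull-sign (P (Y T) m) (Q (Y T) m)))
        where
        pull-sign : ∀ p q → 1ℚ * - q + - 1ℚ * p ≡ - (q + p)
        pull-sign = solve-∀ ringℚ

      difference : ℕ → Seq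
      difference m = imaginary (λ T → 2ℚ * Q (Y T) m) (2ℚ * 4ℚ ^ℚ m)
        (λ T → ∣∣-* {2ℚ} {Q (Y T) m} {2ℚ} ≤-refl (proj₂ (PQ-bound (Y≥0 T) (Y≤2 T) m)))

      power≈conjugate+difference : ∀ m → 1+√-Y ^ m ≈ (1-√-Y ^ m) ⊕ difference m
      power≈conjugate+difference m = exact
        (λ T → trans (re-power m T) (sym (trans (re-+ (1-√-Y ^ m) (difference m) T)
          (trans (+-identityʳ (re (1-√-Y ^ m) T)) (re-conjugate-power m T)))))
        (λ T → trans (im-power m T) (sym (trans (im-+ (1-√-Y ^ m) (difference m) T)
          (trans (cong (λ z → z + 2ℚ * Q (Y T) m) (im-conjugate-power m T)) (subtract (Q (Y T) m))))))
        where
        subtract : ∀ q → - q + (1ℚ + 1ℚ) * q ≡ q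
        subtract = solve-∀ ringℚ

      -- cot and the inverse of Q are bounded only for 0 < m < M.
      guarded : ∀ {m} → (0 ℕ.< m → m ℕ.< M → Seq) → Dec (0 ℕ.< m) → Dec (m ℕ.< M) → Seq
      guarded f (yes 0<m) (yes m<M) = f 0<m m<M
      guarded f (yes _)   (no _)    = S.0#
      guarded f (no _)    _         = S.0#

      guarded-inside : ∀ {m} (R : Seq → Set) f → (∀ 0<m m<M → R (f 0<m m<M)) →
                       ∀ 0<?m m<?M → 0 ℕ.< m → m ℕ.< M → R (guarded {m} f 0<?m m<?M)
      guarded-inside R f holds (yes p) (yes q) _ _ = holds p q
      guarded-inside R f holds (yes _) (no ¬q) _ q = ⊥-elim (¬q q)
      guarded-inside R f holds (no ¬p) _       p _ = ⊥-elim (¬p p)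

      cotangent-seq : ∀ m → 0 ℕ.< m → m ℕ.< M → Seq
      cotangent-seq m 0<m m<M = real (λ T → cot (Y T) m) (4ℚ ^ℚ m * inv (½ ^ℚ m))
        λ T → ∣∣-* (proj₁ (PQ-bound (Y≥0 T) (Y≤2 T) m)) (invQ≤ m 0<m m<M T)

      c : ℕ → Seq
      c m = guarded (cotangent-seq m) (0 ℕ.<? m) (m ℕ.<? M)

      re-c : ∀ m → 0 ℕ.< m → m ℕ.< M → ∀ T → re (c m) T ≡ cot (Y T) m
      re-c m = guarded-inside (λ x → ∀ T → re x T ≡ cot (Y T) m) (cotangent-seq m) (λ _ _ _ → refl)
        (0 ℕ.<? m) (m ℕ.<? M)

      im-c : ∀ m → 0 ℕ.< m → m ℕ.< M → ∀ T → im (c m) T ≡ 0ℚ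
      im-c m = guarded-inside (λ x → ∀ T → im x T ≡ 0ℚ) (cotangent-seq m) (λ _ _ _ → refl) (0 ℕ.<? m) (m ℕ.<? M)

      trace : ℕ → Seq
      trace m = (1+√-Y ^ m) ⊕ (1-√-Y ^ m)

      re-trace : ∀ m T → re (trace m) T ≡ 2ℚ * P (Y T) m
      re-trace m T = trans (re-+ (1+√-Y ^ m) (1-√-Y ^ m) T) (trans (cong₂ _+_ (re-power m T) (re-conjugate-power m T))
        (double (P (Y T) m)))
        where
        double : ∀ p → p + p ≡ (1ℚ + 1ℚ) * p
        double = solve-∀ ringℚ

      im-trace : ∀ m T → im (trace m) T ≡ 0ℚ
      im-trace m T = trans (im-+ (1+√-Y ^ m) (1-√-Y ^ m) T)
        (trans (cong₂ _+_ (im-power m T) (im-conjugate-power m T)) (+-inverseʳ (Q (Y T) m)))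

      c⊗difference : ∀ m → 0 ℕ.< m → m ℕ.< M → c m ⊗ difference m ≈ √-Y ⊗ trace m
      c⊗difference m 0<m m<M = exact
        (λ T → trans (re-* (c m) (difference m) T)
          (trans (cong₂ (λ a b → a * 0ℚ - Y T * (b * (2ℚ * Q (Y T) m))) (re-c m 0<m m<M T) (im-c m 0<m m<M T))
          (trans (re-left (cot (Y T) m) (Y T) (Q (Y T) m)) (sym (trans (re-* √-Y (trace m) T)
            (trans (cong₂ (λ a b → 0ℚ * a - Y T * (1ℚ * b)) (re-trace m T) (im-trace m T))
              (re-right (2ℚ * P (Y T) m) (Y T))))))))
        (λ T → trans (im-* (c m) (difference m) T)
          (trans (cong₂ (λ a b → a * (2ℚ * Q (Y T) m) + b * 0ℚ) (re-c m 0<m m<M T) (im-c m 0<m m<M T))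
          (trans (im-left (P (Y T) m) (inv (Q (Y T) m)) (Q (Y T) m))
          (trans (cong (λ o → 2ℚ * (P (Y T) m * o)) (*-inv⁺ (Q>0 m 0<m m<M T)))
          (sym (trans (im-* √-Y (trace m) T)
            (trans (cong₂ (λ a b → 0ℚ * b + 1ℚ * a) (re-trace m T) (im-trace m T)) (im-right (P (Y T) m)))))))))
        where
        re-left : ∀ c y q → c * 0ℚ - y * (0ℚ * ((1ℚ + 1ℚ) * q)) ≡ 0ℚ
        re-left = solve-∀ ringℚ
        re-right : ∀ a y → 0ℚ * a - y * (1ℚ * 0ℚ) ≡ 0ℚ
        re-right = solve-∀ ringℚ
        im-left : ∀ p i q → p * i * ((1ℚ + 1ℚ) * q) + 0ℚ * 0ℚ ≡ (1ℚ + 1ℚ) * (p * (q * i))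
        im-left = solve-∀ ringℚ
        im-right : ∀ p → 0ℚ * 0ℚ + 1ℚ * ((1ℚ + 1ℚ) * p) ≡ (1ℚ + 1ℚ) * (p * 1ℚ)
        im-right = solve-∀ ringℚ

      inverse-value : ℕ → ℕ → ℚ
      inverse-value m T = - (½ * (inv (Q (Y T) m) * inv (Y T)))

      inverse-seq : ∀ m → 0 ℕ.< m → m ℕ.< M → Seq
      inverse-seq m 0<m m<M = imaginary (inverse-value m) (½ * (inv (½ ^ℚ m) * inv y₀))
        λ T → subst (_≤ ½ * (inv (½ ^ℚ m) * inv y₀)) (sym (∣-p∣≡∣p∣ (½ * (inv (Q (Y T) m) * inv (Y T)))))
          (∣∣-* {½} {inv (Q (Y T) m) * inv (Y T)} {½} ≤-refl
            (∣∣-* (invQ≤ m 0<m m<M T) (∣∣-nonNeg (inv≥0 (Y>0 T)) (inv-anti 0<y₀ (y₀≤Y T)))))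

      g : ℕ → Seq
      g m = guarded (inverse-seq m) (0 ℕ.<? m) (m ℕ.<? M)

      re-g : ∀ m → 0 ℕ.< m → m ℕ.< M → ∀ T → re (g m) T ≡ 0ℚ
      re-g m = guarded-inside (λ x → ∀ T → re x T ≡ 0ℚ) (inverse-seq m) (λ _ _ _ → refl) (0 ℕ.<? m) (m ℕ.<? M)

      im-g : ∀ m → 0 ℕ.< m → m ℕ.< M → ∀ T → im (g m) T ≡ inverse-value m T
      im-g m = guarded-inside (λ x → ∀ T → im x T ≡ inverse-value m T) (inverse-seq m) (λ _ _ _ → refl)
        (0 ℕ.<? m) (m ℕ.<? M)

      g⊗difference≈1 : ∀ m → 0 ℕ.< m → m ℕ.< M → g m ⊗ difference m ≈ S.1#
      g⊗difference≈1 m 0<m m<M = exact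
        (λ T → trans (re-* (g m) (difference m) T)
          (trans (cong₂ (λ a b → a * 0ℚ - Y T * (b * (2ℚ * Q (Y T) m))) (re-g m 0<m m<M T) (im-g m 0<m m<M T))
          (trans (regroup (Y T) (Q (Y T) m) (inv (Q (Y T) m)) (inv (Y T)))
          (trans (cong₂ _*_ (*-inv⁺ (Q>0 m 0<m m<M T)) (*-inv⁺ (Y>0 T))) (sym (re-1 T))))))
        (λ T → trans (im-* (g m) (difference m) T)
          (trans (cong₂ (λ a b → a * (2ℚ * Q (Y T) m) + b * 0ℚ) (re-g m 0<m m<M T) (im-g m 0<m m<M T))
          (trans (vanish (inverse-value m T) (Q (Y T) m)) (sym (im-1 T)))))
        where
        regroup : ∀ y q i j → 0ℚ * 0ℚ - y * (- (½ * (i * j)) * ((1ℚ + 1ℚ) * q)) ≡ (q * i) * (y * j)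
        regroup = solve-∀ ringℚ
        vanish : ∀ i q → 0ℚ * ((1ℚ + 1ℚ) * q) + i * 0ℚ ≡ 0ℚ
        vanish = solve-∀ ringℚ

      difference-M≈0 : difference M ≈ S.0#
      difference-M≈0 = close-exact (λ T → sym (re-0 T)) , close (2ℚ * K) λ T → begin
        ι (suc T) * ∣ 2ℚ * Q (Y T) M - im S.0# T ∣
          ≡⟨ cong (λ z → ι (suc T) * ∣ 2ℚ * Q (Y T) M - z ∣) (im-0 T) ⟩
        ι (suc T) * ∣ 2ℚ * Q (Y T) M - 0ℚ ∣   ≡⟨ cong (λ z → ι (suc T) * ∣ z ∣) (+-identityʳ (2ℚ * Q (Y T) M)) ⟩
        ι (suc T) * ∣ 2ℚ * Q (Y T) M ∣
          ≡⟨ cong (ι (suc T) *_) (0≤p⇒∣p∣≡p (*≥0 0≤2 (<⇒≤ (positive T M 1≤M ℕ.≤-refl)))) ⟩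
        ι (suc T) * (2ℚ * Q (Y T) M)          ≡⟨ x∙yz≈y∙xz (ι (suc T)) 2ℚ (Q (Y T) M) ⟩
        2ℚ * (ι (suc T) * Q (Y T) M)          ≤⟨ *-monoˡ 0≤2 (small-Q T) ⟩
        2ℚ * K ∎
        where open ≤-Reasoning

      module ζ = Rotation.Conjugates ring 1+√-Y 1-√-Y 1/[1+Y] norm

      root : CotangentSums.RootOfUnity ring M
      root = record
        { ζ     = ζ.rotation
        ; I     = √-Y
        ; c     = c
        ; κ     = λ m → (1-√-Y ^ m) ⊗ g m
        ; ζ^M≈1 = ζ.rotation-period M {difference M} (power≈conjugate+difference M) difference-M≈0
        ; c-eq  = λ m 0<m m<M → ζ.rotation-cot m {difference m} (power≈conjugate+difference m) {c m} {√-Y}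
          (c⊗difference m 0<m m<M)
        ; κ-eq  = λ m 0<m m<M → ζ.rotation-inverse m {difference m} (power≈conjugate+difference m) {g m}
          (g⊗difference≈1 m 0<m m<M)
        }

      re-∑ : ∀ N (f : ℕ → Seq) T → re (∑ₛ N f) T ≡ ∑ N (λ i → re (f i) T)
      re-∑ zero    f T = re-0 T
      re-∑ (suc N) f T = trans (re-+ (f 0) (∑ₛ N (λ i → f (suc i))) T) (cong (λ z → re (f 0) T + z)
        (re-∑ N (λ i → f (suc i)) T))

      re-ν : ∀ k T → re (ν k) T ≡ ι k
      re-ν zero    T = trans (re-0 T) (sym fromℤ-0)
      re-ν (suc k) T = trans (trans (re-+ S.1# (ν k) T) (cong₂ _+_ (re-1 T) (re-ν k T))) (sym (ι-suc k))

      im-ν : ∀ k T → im (ν k) T ≡ 0ℚ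
      im-ν zero    T = im-0 T
      im-ν (suc k) T = trans (im-+ S.1# (ν k) T) (cong₂ _+_ (im-1 T) (im-ν k T))

      re-ν* : ∀ k x T → re (ν k ⊗ x) T ≡ ι k * re x T
      re-ν* k x T = trans (re-* (ν k) x T)
        (trans (cong₂ (λ a b → a * re x T - Y T * (b * im x T)) (re-ν k T) (im-ν k T))
        (drop-imaginary (ι k) (re x T) (Y T) (im x T)))
        where
        drop-imaginary : ∀ k a y b → k * a - y * (0ℚ * b) ≡ k * a
        drop-imaginary = solve-∀ ringℚ

      re-progressions : ∀ N {a α : ℕ → ℕ} → (∀ i → IsInverse n (a i) (α i)) → ∀ T →
        re (ν M ⊗ ∑ₛ N (λ i → progressionSumₛ n L c (α i))) T ≡ ι M * ∑ N (λ i → progressionSum n L (cot (Y T)) (α i))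
      re-progressions N {α = α} inverse T = trans (re-ν* M (∑ₛ N (λ i → progressionSumₛ n L c (α i))) T)
        (cong (ι M *_)
        (trans (re-∑ N (λ i → progressionSumₛ n L c (α i)) T) (∑-cong′ N λ i →
          trans (re-∑ L (λ l → c (l ℕ.* n ℕ.+ α i)) T) (∑-cong L λ l l<L → re-c (l ℕ.* n ℕ.+ α i)
            (ℕ.<-≤-trans (IsInverse.positive (inverse i)) (ℕ.m≤n+m (α i) (l ℕ.* n)))
              (progression-index< n l<L (IsInverse.reduced (inverse i))) T))))

    cot-antisymmetric : ∀ m → 0 ℕ.< m → m ℕ.< M → Close (λ T → cot (Y T) m + cot (Y T) (M ∸ m)) (λ _ → 0ℚ)
    cot-antisymmetric m 0<m m<M = close-trans
      (close-exact λ T → sym (trans (re-+ (c m) (c m′) T) (cong₂ _+_ (re-c m 0<m m<M T) (re-c m′ 0<m′ m′<M T))))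
      (close-trans (_≈_.re-close opposite) (close-exact re-0))
      where
      m′ : ℕ
      m′ = M ∸ m
      0<m′ : 0 ℕ.< m′
      0<m′ = ℕ.m<n⇒0<n∸m m<M
      m′<M : m′ ℕ.< M
      m′<M = ℕ.∸-monoʳ-< 0<m (ℕ.<⇒≤ m<M)
      opposite : c m ⊕ c m′ ≈ S.0#
      opposite = CotangentSums.antisymmetry ring n L root m m′ 0<m m<M 0<m′ m′<M (ℕ.m+[n∸m]≡n (ℕ.<⇒≤ m<M))

    cot-balanced : ∀ N (a a⁻¹ b b⁻¹ : ℕ → ℕ) → (∀ i → IsInverse n (a i) (a⁻¹ i)) → (∀ i → IsInverse n (b i) (b⁻¹ i)) →
      (∀ r → residueSum n N a r ≡ residueSum n N b r) →
      Close (λ T → ι M * ∑ N (λ i → progressionSum n L (cot (Y T)) (a⁻¹ i)))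
            (λ T → ι M * ∑ N (λ i → progressionSum n L (cot (Y T)) (b⁻¹ i)))
    cot-balanced N a a⁻¹ b b⁻¹ a-inverse b-inverse residueSums = close-trans (close-exact λ T →
      sym (re-progressions N a-inverse T))
      (close-trans (_≈_.re-close (CotangentSums.equal-progressions ring n L root N a a⁻¹ b b⁻¹ a-inverse
        b-inverse residueSums))
        (close-exact (re-progressions N b-inverse)))

module CotangentBounds where

  open Rationals
  open TangentRoot
  open Cotangent using (cot)

  module _ {y : ℚ} {M : ℕ} (0≤y : 0ℚ ≤ y) (positive : PositiveUpTo M y) where

    private
      Q>0 : ∀ m → suc m ℕ.≤ M → 0ℚ < Q y (suc m)
      Q>0 m = positive (suc m) (s≤s z≤n)

      Q≥0 : ∀ m → m ℕ.≤ M → 0ℚ ≤ Q y m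
      Q≥0 zero    _     = ≤-refl
      Q≥0 (suc m) m+1≤M = <⇒≤ (Q>0 m m+1≤M)

      1/Q : ℕ → ℚ
      1/Q m = inv (Q y m)

      1/Q≥0 : ∀ m → suc m ℕ.≤ M → 0ℚ ≤ 1/Q (suc m)
      1/Q≥0 m m+1≤M = inv≥0 (Q>0 m m+1≤M)

      Q*1/Q≡1 : ∀ m → suc m ℕ.≤ M → Q y (suc m) * 1/Q (suc m) ≡ 1ℚ
      Q*1/Q≡1 m m+1≤M = *-inv⁺ (Q>0 m m+1≤M)

      squarePart : ℕ → ℚ
      squarePart m = 1/Q (suc m) * 1/Q (suc (suc m)) * (P y (suc m) * P y (suc m))

      squarePart≥0 : ∀ m → suc (suc m) ℕ.≤ M → 0ℚ ≤ squarePart m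
      squarePart≥0 m m+2≤M = *≥0 (*≥0 (1/Q≥0 m (ℕ.<⇒≤ m+2≤M)) (1/Q≥0 (suc m) m+2≤M)) (sq≥0 (P y (suc m)))

      cot-step : ∀ m → suc (suc m) ℕ.≤ M →
                 cot y (suc m) - cot y (suc (suc m)) ≡ squarePart m + y * (1/Q (suc (suc m)) * Q y (suc m))
      cot-step m m+2≤M = begin-equality
        p * j - (p - y * q) * j′                ≡⟨ cong₂ _-_ (*-identityʳ (p * j)) (*-identityʳ ((p - y * q) * j′)) ⟨
        p * j * 1ℚ - (p - y * q) * j′ * 1ℚ
          ≡⟨ cong₂ (λ o o′ → p * j * o - (p - y * q) * j′ * o′) (sym (Q*1/Q≡1 (suc m) m+2≤M)) (sym qj≡1) ⟩
        p * j * ((q + p) * j′) - (p - y * q) * j′ * (q * j)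
          ≡⟨ common-denominator p q j j′ y ⟩
        squarePart m + y * (j′ * q) * (q * j)   ≡⟨ cong (λ o → squarePart m + y * (j′ * q) * o) qj≡1 ⟩
        squarePart m + y * (j′ * q) * 1ℚ        ≡⟨ cong (λ z → squarePart m + z) (*-identityʳ (y * (j′ * q))) ⟩
        squarePart m + y * (j′ * q) ∎
        where
        open ≤-Reasoning
        p q j j′ : ℚ
        p = P y (suc m)
        q = Q y (suc m)
        j = 1/Q (suc m)
        j′ = 1/Q (suc (suc m))
        qj≡1 : q * j ≡ 1ℚ
        qj≡1 = Q*1/Q≡1 m (ℕ.<⇒≤ m+2≤M)
        common-denominator : ∀ p q j k y →
          p * j * ((q + p) * k) - (p - y * q) * k * (q * j) ≡ j * k * (p * p) + y * (k * q) * (q * j)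
        common-denominator = solve-∀ ringℚ

    cot-1 : cot y 1 ≡ 1ℚ
    cot-1 = trans (cong (λ a → a * inv 1ℚ) (drop-y y)) (trans (*-identityˡ (inv 1ℚ)) inv-1)
      where
      drop-y : ∀ y → 1ℚ - y * 0ℚ ≡ 1ℚ
      drop-y = solve-∀ ringℚ

    cot-decreasing : ∀ m → suc (suc m) ℕ.≤ M → cot y (suc (suc m)) ≤ cot y (suc m)
    cot-decreasing m m+2≤M = 0≤q-p⇒p≤q (subst (0ℚ ≤_) (sym (cot-step m m+2≤M))
      (+≥0 (squarePart≥0 m m+2≤M) (*≥0 0≤y (*≥0 (1/Q≥0 (suc m) m+2≤M) (<⇒≤ (Q>0 m (ℕ.<⇒≤ m+2≤M)))))))

    cot≤1 : ∀ m → suc m ℕ.≤ M → cot y (suc m) ≤ 1ℚ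
    cot≤1 zero    _     = ≤-reflexive cot-1
    cot≤1 (suc m) m+2≤M = ≤-trans (cot-decreasing m m+2≤M) (cot≤1 m (ℕ.<⇒≤ m+2≤M))

    private
      P≤Q : ∀ m → suc m ℕ.≤ M → P y (suc m) ≤ Q y (suc m)
      P≤Q m m+1≤M = begin
        P y (suc m)                                 ≡⟨ *-identityʳ (P y (suc m)) ⟨
        P y (suc m) * 1ℚ
          ≡⟨ cong (P y (suc m) *_) (sym (trans (*-comm (1/Q (suc m)) (Q y (suc m))) (Q*1/Q≡1 m m+1≤M))) ⟩
        P y (suc m) * (1/Q (suc m) * Q y (suc m))   ≡⟨ *-assoc (P y (suc m)) (1/Q (suc m)) (Q y (suc m)) ⟨
        cot y (suc m) * Q y (suc m)                 ≤⟨ *-monoʳ (<⇒≤ (Q>0 m m+1≤M)) (cot≤1 m m+1≤M) ⟩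
        1ℚ * Q y (suc m)                            ≡⟨ *-identityˡ (Q y (suc m)) ⟩
        Q y (suc m) ∎
        where open ≤-Reasoning

      cot-drop : ∀ m → suc (suc m) ℕ.≤ M → ½ * y ≤ cot y (suc m) - cot y (suc (suc m))
      cot-drop m m+2≤M = subst (½ * y ≤_) (sym (cot-step m m+2≤M)) (≤-by (squarePart m + y * (½ * (j * (q - p))))
          (+≥0 (squarePart≥0 m m+2≤M)
            (*≥0 0≤y (*≥0 0≤½ (*≥0 (1/Q≥0 (suc m) m+2≤M) (p≤q⇒0≤q-p (P≤Q m (ℕ.<⇒≤ m+2≤M)))))))
          (trans (cong (_+ (squarePart m + y * (½ * (j * (q - p)))))
              (trans (sym (*-identityʳ (½ * y))) (cong (½ * y *_) (sym (Q*1/Q≡1 (suc m) m+2≤M)))))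
            (halve y q p j (squarePart m))))
        where
        p q j : ℚ
        p = P y (suc m)
        q = Q y (suc m)
        j = 1/Q (suc (suc m))
        halve : ∀ y q p j x → ½ * y * ((q + p) * j) + (x + y * (½ * (j * (q - p)))) ≡ x + y * (j * q)
        halve = solve-∀ ringℚ

      cot≤ : ∀ k → suc k ℕ.≤ M → cot y (suc k) ≤ 1ℚ - ι k * (½ * y)
      cot≤ zero    _     = ≤-reflexive (trans cot-1 (sym (trans (cong (λ z → 1ℚ - z) (ι-0* (½ * y))) refl)))
      cot≤ (suc k) k+2≤M = begin
        cot y (suc (suc k))            ≡⟨ insert (cot y (suc (suc k))) (cot y (suc k)) ⟩
        cot y (suc k) - (cot y (suc k) - cot y (suc (suc k)))
          ≤⟨ +-mono-≤ (cot≤ k (ℕ.<⇒≤ k+2≤M)) (neg-antimono-≤ (cot-drop k k+2≤M)) ⟩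
        1ℚ - ι k * (½ * y) - ½ * y     ≡⟨ collect (ι k * (½ * y)) (½ * y) ⟩
        1ℚ - (ι k * (½ * y) + ½ * y)   ≡⟨ cong (λ z → 1ℚ - z) (sym (ι-suc* k (½ * y))) ⟩
        1ℚ - ι (suc k) * (½ * y) ∎
        where
        open ≤-Reasoning
        insert : ∀ a b → a ≡ b - (b - a)
        insert = solve-∀ ringℚ
        collect : ∀ a b → 1ℚ - a - b ≡ 1ℚ - (a + b)
        collect = solve-∀ ringℚ

    root-small : ∀ k → M ≡ suc (suc k) → ι k * y ≤ 4ℚ
    root-small k refl = ≤-by (2ℚ * (1ℚ - ι k * (½ * y) - cot y (suc k)) + 2ℚ * (1ℚ + cot y (suc k)))
        (+≥0 (*≥0 0≤2 (p≤q⇒0≤q-p (cot≤ k (ℕ.n≤1+n (suc k))))) (*≥0 0≤2 cot≥-1)) (restore (ι k) y (cot y (suc k)))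
      where
      restore : ∀ k y c → k * y + ((1ℚ + 1ℚ) * (1ℚ - k * (½ * y) - c) + (1ℚ + 1ℚ) * (1ℚ + c)) ≡ (1ℚ + 1ℚ) + (1ℚ + 1ℚ)
      restore = solve-∀ ringℚ
      cot≥-1 : 0ℚ ≤ 1ℚ + cot y (suc k)
      cot≥-1 = subst (0ℚ ≤_)
        (trans (*-distribʳ-+ (1/Q (suc k)) (Q y (suc k)) (P y (suc k)))
          (cong (_+ cot y (suc k)) (Q*1/Q≡1 k (ℕ.n≤1+n (suc k)))))
        (*≥0 (<⇒≤ (Q>0 (suc k) ℕ.≤-refl)) (1/Q≥0 k (ℕ.n≤1+n (suc k))))

    private
      Δ : ℕ → ℚ
      Δ m = Q y m - ι m * P y m

      Δ-suc : ∀ m → Δ (suc m) ≡ Δ m + (1ℚ + ι m) * (y * Q y m)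
      Δ-suc m = trans (cong (λ z → Q y m + P y m - z * (P y m - y * Q y m)) (ι-suc m))
        (expand (Q y m) (P y m) (ι m) y)
        where
        expand : ∀ q p m y → q + p - (1ℚ + m) * (p - y * q) ≡ q - m * p + (1ℚ + m) * (y * q)
        expand = solve-∀ ringℚ

      Δ-0 : Δ 0 ≡ 0ℚ
      Δ-0 = cong (λ z → 0ℚ - z) (ι-0* 1ℚ)

      Δ≥0 : ∀ m → m ℕ.≤ M → 0ℚ ≤ Δ m
      Δ≥0 zero    _     = ≤-reflexive (sym Δ-0)
      Δ≥0 (suc m) m+1≤M = subst (0ℚ ≤_) (sym (Δ-suc m))
        (+≥0 (Δ≥0 m (ℕ.<⇒≤ m+1≤M)) (*≥0 (+≥0 0≤1 (ι≥0 m)) (*≥0 0≤y (Q≥0 m (ℕ.<⇒≤ m+1≤M)))))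

      gap : ∀ m → suc m ℕ.≤ M → inv (ι (suc m)) - cot y (suc m) ≡ inv (ι (suc m)) * 1/Q (suc m) * Δ (suc m)
      gap m m+1≤M = begin-equality
        1/m - p * j                                 ≡⟨ cong₂ _-_ (*-identityʳ 1/m) (*-identityʳ (p * j)) ⟨
        1/m * 1ℚ - p * j * 1ℚ
          ≡⟨ cong₂ (λ o o′ → 1/m * o - p * j * o′) (sym (Q*1/Q≡1 m m+1≤M)) (sym (*-inv⁺ (ι>0 m))) ⟩
        1/m * (q * j) - p * j * (ι (suc m) * 1/m)   ≡⟨ factor 1/m q j p (ι (suc m)) ⟩
        1/m * j * (q - ι (suc m) * p) ∎
        where
        open ≤-Reasoning
        1/m p q j : ℚ
        1/m = inv (ι (suc m))
        p = P y (suc m)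
        q = Q y (suc m)
        j = 1/Q (suc m)
        factor : ∀ I q j p μ → I * (q * j) - p * j * (μ * I) ≡ I * j * (q - μ * p)
        factor = solve-∀ ringℚ

    cot≤inv : ∀ m → suc m ℕ.≤ M → cot y (suc m) ≤ inv (ι (suc m))
    cot≤inv m m+1≤M = 0≤q-p⇒p≤q (subst (0ℚ ≤_) (sym (gap m m+1≤M))
      (*≥0 (*≥0 (inv≥0 (ι>0 m)) (1/Q≥0 m m+1≤M)) (Δ≥0 (suc m) m+1≤M)))

    module _ (x : ℕ) (x≤M : x ℕ.≤ M) (x²y≤1 : ι x * (ι x * y) ≤ 1ℚ) where

      open SmallAngle x 0≤y x²y≤1

      cot≥0 : ∀ m → suc m ℕ.≤ x → 0ℚ ≤ cot y (suc m)
      cot≥0 m m+1≤x = *≥0 (P≥0 (suc m) m+1≤x) (1/Q≥0 m (ℕ.≤-trans m+1≤x x≤M))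

      private
        Δ≤ : ∀ m → m ℕ.≤ x → Δ m ≤ ι m * (ι x * (ι x * y))
        Δ≤ zero    _     = ≤-reflexive (trans Δ-0 (sym (ι-0* (ι x * (ι x * y)))))
        Δ≤ (suc m) m+1≤x = begin
          Δ (suc m)                                   ≡⟨ Δ-suc m ⟩
          Δ m + (1ℚ + ι m) * (y * Q y m)
            ≤⟨ +-mono-≤ (Δ≤ m (ℕ.<⇒≤ m+1≤x)) (*-mono (+≥0 0≤1 (ι≥0 m)) 1+m≤x (*≥0 0≤y Em.Q≥0) yQ≤xy) ⟩
          ι m * (ι x * (ι x * y)) + ι x * (ι x * y)   ≡⟨ ι-suc* m (ι x * (ι x * y)) ⟨
          ι (suc m) * (ι x * (ι x * y)) ∎
          where
          open ≤-Reasoning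
          module Em = Estimates (estimates m (ℕ.<⇒≤ m+1≤x))
          1+m≤x : 1ℚ + ι m ≤ ι x
          1+m≤x = subst (_≤ ι x) (ι-suc m) (ι-mono m+1≤x)
          yQ≤xy : y * Q y m ≤ ι x * y
          yQ≤xy = ≤-trans (*-monoˡ 0≤y (≤-trans Em.Q≤m (ι-mono (ℕ.<⇒≤ m+1≤x)))) (≤-reflexive (*-comm y (ι x)))

      inv-cot≤ : ∀ m → suc m ℕ.≤ x → inv (ι (suc m)) - cot y (suc m) ≤ ι x * (ι x * y)
      inv-cot≤ m m+1≤x = subst (_≤ X) (sym (gap m (ℕ.≤-trans m+1≤x x≤M))) (begin
        1/m * 1/Q (suc m) * Δ (suc m)   ≤⟨ *-monoˡ (*≥0 1/m≥0 (1/Q≥0 m (ℕ.≤-trans m+1≤x x≤M))) (Δ≤ (suc m) m+1≤x) ⟩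
        1/m * 1/Q (suc m) * (ι (suc m) * X)
          ≤⟨ *-monoʳ (*≥0 (ι≥0 (suc m)) X≥0) (subst (1/m * 1/Q (suc m) ≤_) (*-identityʳ 1/m)
             (*-monoˡ 1/m≥0 (inv≤1 (Q≥1 m m+1≤x)))) ⟩
        1/m * (ι (suc m) * X)           ≡⟨ *-assoc 1/m (ι (suc m)) X ⟨
        1/m * ι (suc m) * X             ≡⟨ cong (_* X) (trans (*-comm 1/m (ι (suc m))) (*-inv⁺ (ι>0 m))) ⟩
        1ℚ * X                          ≡⟨ *-identityˡ X ⟩
        X ∎)
        where
        open ≤-Reasoning
        X 1/m : ℚ
        X = ι x * (ι x * y)
        1/m = inv (ι (suc m))
        1/m≥0 : 0ℚ ≤ 1/m
        1/m≥0 = inv≥0 (ι>0 m)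
        X≥0 : 0ℚ ≤ X
        X≥0 = *≥0 (ι≥0 x) (*≥0 (ι≥0 x) 0≤y)

module Charge where

  open import Data.Nat.Coprimality using (Coprime)
  open import Data.Nat.DivMod using (m%n<n; m<n⇒m%n≡m; [m+kn]%n≡m%n)
  open Rationals
  open Congruence

  module _ (n : ℕ) {{_ : NonZero n}} where

    ∑-residue : ∀ L α (f : ℕ → ℚ) → α ℕ.< n → ∑ (n ℕ.* L) (λ m → ⟦ m % n ℕ.≟ α ⟧ * f m) ≡ progressionSum n L f α
    ∑-residue L α f α<n = begin
      ∑ (n ℕ.* L) F   ≡⟨ cong (λ M → ∑ M F) (ℕ.*-comm n L) ⟩
      ∑ (L ℕ.* n) F   ≡⟨ ∑-blocks L n F ⟩
      ∑ L (λ l → ∑ n (λ r → F (l ℕ.* n ℕ.+ r)))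
        ≡⟨ ∑-cong′ L (λ l → trans (∑-cong n λ r r<n → reduce l r r<n) (∑-select n (λ r → f (l ℕ.* n ℕ.+ r)) α
           (outside l))) ⟩
      progressionSum n L f α ∎
      where
      open ≡-Reasoning
      F : ℕ → ℚ
      F m = ⟦ m % n ℕ.≟ α ⟧ * f m
      outside : ∀ l → n ℕ.≤ α → f (l ℕ.* n ℕ.+ α) ≡ 0ℚ
      outside l n≤α with () ← ℕ.<⇒≱ α<n n≤α
      residue≡r : ∀ l r → r ℕ.< n → (l ℕ.* n ℕ.+ r) % n ≡ r
      residue≡r l r r<n = trans (cong (_% n) (ℕ.+-comm (l ℕ.* n) r)) (trans ([m+kn]%n≡m%n r l n) (m<n⇒m%n≡m r<n))
      reduce : ∀ l r → r ℕ.< n → F (l ℕ.* n ℕ.+ r) ≡ ⟦ r ℕ.≟ α ⟧ * f (l ℕ.* n ℕ.+ r)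
      reduce l r r<n = cong (_* f (l ℕ.* n ℕ.+ r)) (⟦⟧-cong ((l ℕ.* n ℕ.+ r) % n ℕ.≟ α) (r ℕ.≟ α)
        (trans (sym (residue≡r l r r<n))) (trans (residue≡r l r r<n)))

    charge : ℕ → ℕ → ℚ
    charge x m = ⟦ m % n ℕ.≟ x ⟧ - ⟦ (m ℕ.+ x) % n ℕ.≟ 0 ⟧

    ∣charge∣≤1 : ∀ x m → ∣ charge x m ∣ ≤ 1ℚ
    ∣charge∣≤1 x m = by-cases (m % n ℕ.≟ x) ((m ℕ.+ x) % n ℕ.≟ 0)
      where
      by-cases : ∀ {A B : Set} (d : Dec A) (e : Dec B) → ∣ ⟦ d ⟧ - ⟦ e ⟧ ∣ ≤ 1ℚ
      by-cases (yes _) (yes _) = 0≤1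
      by-cases (yes _) (no _)  = ≤-refl
      by-cases (no _)  (yes _) = ≤-refl
      by-cases (no _)  (no _)  = 0≤1

    charge-cong : ∀ x {m m′} → m ≡ m′ mod n → charge x m ≡ charge x m′
    charge-cong x {m} {m′} m≡m′ = cong₂ _-_
      (⟦⟧-cong (m % n ℕ.≟ x) (m′ % n ℕ.≟ x) (trans (sym m≡m′)) (trans m≡m′))
      (⟦⟧-cong ((m ℕ.+ x) % n ℕ.≟ 0) ((m′ ℕ.+ x) % n ℕ.≟ 0)
        (trans (sym (+-mod n {c = x} m≡m′ refl))) (trans (+-mod n {c = x} m≡m′ refl)))

    charge-zero : ∀ {x m} → ¬ (m % n ≡ x) → ¬ ((m ℕ.+ x) % n ≡ 0) → charge x m ≡ 0ℚ
    charge-zero {x} {m} m≢x m+x≢0 = cong₂ _-_ (⟦⟧-no (m % n ℕ.≟ x) m≢x) (⟦⟧-no ((m ℕ.+ x) % n ℕ.≟ 0) m+x≢0)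

    charge-complement : ∀ {x} → 0 ℕ.< x → x ℕ.< n → ∀ m → charge x m ≡ ⟦ m % n ℕ.≟ x ⟧ - ⟦ m % n ℕ.≟ n ∸ x ⟧
    charge-complement {x} 0<x x<n m = cong (λ z → ⟦ m % n ℕ.≟ x ⟧ - z)
      (⟦⟧-cong ((m ℕ.+ x) % n ℕ.≟ 0) (m % n ℕ.≟ n ∸ x) (opposite⇒complement n m 0<x x<n)
        (complement⇒opposite n m x<n))

    charge-at-0 : ∀ {x} → 0 ℕ.< x → x ℕ.< n → charge x 0 ≡ 0ℚ
    charge-at-0 0<x x<n = charge-zero
      (λ 0≡x → ℕ.<-irrefl (trans (sym (m<n⇒m%n≡m (ℕ.>-nonZero⁻¹ n))) 0≡x) 0<x)
      (λ x≡0 → ℕ.<-irrefl (trans (sym x≡0) (m<n⇒m%n≡m x<n)) 0<x)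

    private
      negated-residue : ∀ {x} → x ℕ.< n → ∀ m m′ → (m ℕ.+ m′) % n ≡ 0 → ⟦ m′ % n ℕ.≟ x ⟧ ≡ ⟦ (m ℕ.+ x) % n ℕ.≟ 0 ⟧
      negated-residue {x} x<n m m′ m+m′≡0 = ⟦⟧-cong (m′ % n ℕ.≟ x) ((m ℕ.+ x) % n ℕ.≟ 0)
        (λ m′≡x → trans (cong (λ z → (m ℕ.+ z) % n) (sym m′≡x)) (trans (+-mod n {m} refl (%-mod n m′)) m+m′≡0))
        (λ m+x≡0 → begin
          m′ % n                 ≡⟨ +-mod n {m ℕ.+ x} {0} {m′} (0-mod n m+x≡0) refl ⟨
          (m ℕ.+ x ℕ.+ m′) % n   ≡⟨ cong (_% n) (+-xy∙z≈xz∙y m x m′) ⟩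
          (m ℕ.+ m′ ℕ.+ x) % n   ≡⟨ +-mod n {m ℕ.+ m′} {0} {x} (0-mod n m+m′≡0) refl ⟩
          x % n                  ≡⟨ m<n⇒m%n≡m x<n ⟩
          x ∎)
        where
        open ≡-Reasoning
        open import Algebra.Properties.CommutativeSemigroup ℕ.+-commutativeSemigroup using () renaming
          (xy∙z≈xz∙y to +-xy∙z≈xz∙y)

    charge-odd : ∀ {x} → x ℕ.< n → ∀ m m′ → (m ℕ.+ m′) % n ≡ 0 → charge x m′ ≡ - charge x m
    charge-odd {x} x<n m m′ m+m′≡0 = trans
      (cong₂ _-_ (negated-residue x<n m m′ m+m′≡0)
        (sym (negated-residue x<n m′ m (trans (cong (_% n) (ℕ.+-comm m′ m)) m+m′≡0))))
      (sym (⁻¹-anti-homo‿- ⟦ m % n ℕ.≟ x ⟧ ⟦ (m ℕ.+ x) % n ℕ.≟ 0 ⟧))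

    ∑-charge : ∀ {x} → 0 ℕ.< x → x ℕ.< n → ∑ n (charge x) ≡ 0ℚ
    ∑-charge {x} 0<x x<n = begin
      ∑ n (charge x)   ≡⟨ ∑-cong′ n (charge-complement 0<x x<n) ⟩
      ∑ n (λ m → ⟦ m % n ℕ.≟ x ⟧ - ⟦ m % n ℕ.≟ n ∸ x ⟧)
        ≡⟨ ∑-- n (λ m → ⟦ m % n ℕ.≟ x ⟧) (λ m → ⟦ m % n ℕ.≟ n ∸ x ⟧) ⟩
      ∑ n (λ m → ⟦ m % n ℕ.≟ x ⟧) - ∑ n (λ m → ⟦ m % n ℕ.≟ n ∸ x ⟧)
        ≡⟨ cong₂ _-_ (once x x<n) (once (n ∸ x) (ℕ.∸-monoʳ-< 0<x (ℕ.<⇒≤ x<n))) ⟩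
      1ℚ - 1ℚ ∎
      where
      open ≡-Reasoning
      once : ∀ y → y ℕ.< n → ∑ n (λ m → ⟦ m % n ℕ.≟ y ⟧) ≡ 1ℚ
      once y y<n = trans (∑-single n y y<n λ m m<n m≢y → ⟦⟧-no (m % n ℕ.≟ y) λ m≡y →
        m≢y (trans (sym (m<n⇒m%n≡m m<n)) m≡y))
        (⟦⟧-yes (y % n ℕ.≟ y) (m<n⇒m%n≡m y<n))

    charge-support : ∀ {a α} → IsInverse n a α → ∀ {m} → ¬ Coprime m n → charge α m ≡ 0ℚ
    charge-support {a} {α} inverse {m} ¬m⊥n = charge-zero
      (λ m≡α → ¬m⊥n (unit {a} (IsInverse.≡⇒inverse inverse {m} m≡α)))
      (λ m+α≡0 → ¬m⊥n (unit {(n ∸ 1) ℕ.* a} (IsInverse.≡⇒inverse (IsInverse-neg n inverse) {m}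
        (opposite⇒complement n m (IsInverse.positive inverse) (IsInverse.reduced inverse) m+α≡0))))
      where
      unit : ∀ {b} → b ℕ.* m ≡ 1 mod n → Coprime m n
      unit {b} bm≡1 = invertible⇒coprime n {m} {b} (trans (cong (_% n) (ℕ.*-comm m b)) bm≡1)

    charge-* : ∀ {k k′ x} → k ℕ.* k′ ≡ 1 mod n → x ℕ.< n → ∀ m → charge x (k ℕ.* m) ≡ charge (k′ ℕ.* x % n) m
    charge-* {k} {k′} {x} kk′≡1 x<n m = cong₂ _-_
      (⟦⟧-cong ((k ℕ.* m) % n ℕ.≟ x) (m % n ℕ.≟ x′)
        (λ km≡x → trans (sym k′km≡m) (*-mod n {k′} {k′} {k ℕ.* m} {x} refl (trans km≡x (sym (m<n⇒m%n≡m x<n)))))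
        (λ m≡x′ → trans (*-mod n {k} {k} {m} {x′} refl (trans m≡x′ (sym (m<n⇒m%n≡m (m%n<n (k′ ℕ.* x) n)))))
          (trans kx′≡x (m<n⇒m%n≡m x<n))))
      (⟦⟧-cong ((k ℕ.* m ℕ.+ x) % n ℕ.≟ 0) ((m ℕ.+ x′) % n ℕ.≟ 0)
        (λ km+x≡0 → trans (+-mod n {m} {k′ ℕ.* (k ℕ.* m)} (sym k′km≡m) (%-mod n (k′ ℕ.* x)))
          (trans (cong (_% n) (sym (ℕ.*-distribˡ-+ k′ (k ℕ.* m) x))) (*-mod-0 n k′ km+x≡0)))
        (λ m+x′≡0 → trans (+-mod n {k ℕ.* m} refl (sym kx′≡x)) (trans (cong (_% n) (sym (ℕ.*-distribˡ-+ k m x′)))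
          (*-mod-0 n k m+x′≡0))))
      where
      x′ : ℕ
      x′ = k′ ℕ.* x % n
      k′km≡m : k′ ℕ.* (k ℕ.* m) ≡ m mod n
      k′km≡m = inverse-cancel n {k′} {k} m (trans (cong (_% n) (ℕ.*-comm k′ k)) kk′≡1)
      kx′≡x : k ℕ.* x′ ≡ x mod n
      kx′≡x = *-inverse-cancel n {k} {k′} kk′≡1 x

module HarmonicMean where

  open import Data.Nat.Base using (_/_)
  open import Data.Nat.Coprimality using (Coprime)
  open import Data.Nat.DivMod using (m%n≤n; m≡m%n+[m/n]*n; [m+kn]%n≡m%n; m*n%n≡0)
  open Rationals
  open Congruence
  open TangentRoot
  open SequenceRing using (Close; close)
  open Cotangent
  open CotangentBounds
  open Charge

  close-uniform : ∀ K (F : ℕ → ℕ → ℚ) → (∀ j → j ℕ.< K → Close (F j) (λ _ → 0ℚ)) →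
                  ∃ λ D → 0ℚ ≤ D × (∀ j → j ℕ.< K → ∀ T → ι (suc T) * ∣ F j T ∣ ≤ D)
  close-uniform zero    F small = 0ℚ , ≤-refl , λ j ()
  close-uniform (suc K) F small = D + ∣ C ∣ , +≥0 0≤D (0≤∣p∣ C) , bounded
    where
    smaller : ∃ λ D → 0ℚ ≤ D × (∀ j → j ℕ.< K → ∀ T → ι (suc T) * ∣ F j T ∣ ≤ D)
    smaller = close-uniform K F (λ j j<K → small j (ℕ.m<n⇒m<1+n j<K))
    D C : ℚ
    D = proj₁ smaller
    C = Close.rate (small K ℕ.≤-refl)
    0≤D : 0ℚ ≤ D
    0≤D = proj₁ (proj₂ smaller)
    last≤ : ∀ T → ι (suc T) * ∣ F K T ∣ ≤ C
    last≤ T = subst (λ z → ι (suc T) * ∣ z ∣ ≤ C) (+-identityʳ (F K T)) (Close.close≤ (small K ℕ.≤-refl) T)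
    bounded : ∀ j → j ℕ.< suc K → ∀ T → ι (suc T) * ∣ F j T ∣ ≤ D + ∣ C ∣
    bounded j (s≤s j≤K) T with ℕ.m≤n⇒m<n∨m≡n j≤K
    ... | inj₁ j<K  = ≤-trans (proj₂ (proj₂ smaller) j j<K T) (≤-by ∣ C ∣ (0≤∣p∣ C) refl)
    ... | inj₂ refl = ≤-trans (≤-trans (last≤ T) (x≤∣x∣ C)) (≤-by D 0≤D (+-comm ∣ C ∣ D))

  periodic-partial-sums : ∀ n {{_ : NonZero n}} {f : ℕ → ℚ} {B} → (∀ {m m′} → m ≡ m′ mod n → f m ≡ f m′) →
                          ∑ n f ≡ 0ℚ → (∀ m → ∣ f m ∣ ≤ B) → ∀ x → ∣ ∑ x f ∣ ≤ ι n * B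
  periodic-partial-sums n {f} {B} periodic ∑f≡0 f≤ x = begin
    ∣ ∑ x f ∣             ≡⟨ cong ∣_∣ reduce ⟩
    ∣ ∑ (x % n) (λ j → f (q ℕ.* n ℕ.+ j)) ∣
      ≤⟨ ∑-abs (x % n) (λ j _ → f≤ (q ℕ.* n ℕ.+ j)) ⟩
    ∑ (x % n) (λ _ → B)   ≡⟨ ∑-const (x % n) B ⟩
    ι (x % n) * B         ≤⟨ *-monoʳ (≤-trans (0≤∣p∣ (f 0)) (f≤ 0)) (ι-mono (m%n≤n x n)) ⟩
    ι n * B ∎
    where
    open ≤-Reasoning
    q : ℕ
    q = x / n
    rest : ℚ
    rest = ∑ (x % n) (λ j → f (q ℕ.* n ℕ.+ j))
    block : ∀ l → ∑ n (λ r → f (l ℕ.* n ℕ.+ r)) ≡ 0ℚ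
    block l = trans (∑-cong′ n λ r → periodic {l ℕ.* n ℕ.+ r} {r} (trans (cong (_% n) (ℕ.+-comm (l ℕ.* n) r))
      ([m+kn]%n≡m%n r l n))) ∑f≡0
    reduce : ∑ x f ≡ rest
    reduce = begin-equality
      ∑ x f                     ≡⟨ cong (λ z → ∑ z f) (trans (m≡m%n+[m/n]*n x n) (ℕ.+-comm (x % n) (q ℕ.* n))) ⟩
      ∑ (q ℕ.* n ℕ.+ x % n) f   ≡⟨ ∑-split (q ℕ.* n) (x % n) f ⟩
      ∑ (q ℕ.* n) f + rest      ≡⟨ cong (_+ rest) (trans (∑-blocks q n f) (∑-zero q λ l _ → block l)) ⟩
      0ℚ + rest                 ≡⟨ +-identityˡ rest ⟩
      rest ∎

  module OddSum (n N : ℕ) {{_ : NonZero n}} {a α : ℕ → ℕ} (inverses : ∀ i → IsInverse n (a i) (α i)) where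

    private
      0<α : ∀ i → 0 ℕ.< α i
      0<α i = IsInverse.positive (inverses i)

      α<n : ∀ i → α i ℕ.< n
      α<n i = IsInverse.reduced (inverses i)

    h : ℕ → ℚ
    h m = ∑ N (λ i → charge n (α i) m)

    h≤ : ∀ m → ∣ h m ∣ ≤ ι N
    h≤ m = ≤-trans (∑-abs N λ i _ → ∣charge∣≤1 n (α i) m) (≤-reflexive (trans (∑-const N 1ℚ) (*-identityʳ (ι N))))

    h-cong : ∀ {m m′} → m ≡ m′ mod n → h m ≡ h m′
    h-cong m≡m′ = ∑-cong′ N λ i → charge-cong n (α i) m≡m′

    h-support : ∀ m → ¬ Coprime m n → h m ≡ 0ℚ
    h-support m ¬m⊥n = ∑-zero N λ i _ → charge-support n (inverses i) {m} ¬m⊥n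

    h-0 : h 0 ≡ 0ℚ
    h-0 = ∑-zero N λ i _ → charge-at-0 n (0<α i) (α<n i)

    h-odd : ∀ m m′ → (m ℕ.+ m′) % n ≡ 0 → h m′ ≡ - h m
    h-odd m m′ m+m′≡0 = trans (∑-cong′ N λ i → charge-odd n (α<n i) m m′ m+m′≡0) (∑-neg N (λ i → charge n (α i) m))

    ∑-h : ∑ n h ≡ 0ℚ
    ∑-h = trans (∑-comm n N (λ m i → charge n (α i) m)) (∑-zero N λ i _ → ∑-charge n (0<α i) (α<n i))

    partialBound : ℚ
    partialBound = ι n * ι N

    partialBound≥0 : 0ℚ ≤ partialBound
    partialBound≥0 = *≥0 (ι≥0 n) (ι≥0 N)

    partial-sums : ∀ x → ∣ ∑ x h ∣ ≤ partialBound
    partial-sums = periodic-partial-sums n h-cong ∑-h h≤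

    private
      interval-sums : ∀ k x → ∣ ∑ x (λ j → h (k ℕ.+ j)) ∣ ≤ partialBound + partialBound
      interval-sums k x = subst (λ z → ∣ z ∣ ≤ partialBound + partialBound)
        (trans (cong (_- ∑ k h) (∑-split k x h)) (xyx⁻¹≈y (∑ k h) (∑ x (λ j → h (k ℕ.+ j)))))
        (∣∣-- (partial-sums (k ℕ.+ x)) (partial-sums k))

    ∑-h* : ∀ L (f : ℕ → ℚ) → ∑ (n ℕ.* L) (λ m → h m * f m) ≡
           ∑ N (λ i → progressionSum n L f (α i)) - ∑ N (λ i → progressionSum n L f (n ∸ α i))
    ∑-h* L f = begin-equality
      ∑ M (λ m → h m * f m)
        ≡⟨ ∑-cong′ M (λ m → trans (*-distribʳ-∑ N (f m) (λ i → charge n (α i) m)) (∑-cong′ N λ i → as-indicators i m))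
           ⟩
      ∑ M (λ m → ∑ N (λ i → at (α i) m - at (n ∸ α i) m))
        ≡⟨ ∑-comm M N (λ m i → at (α i) m - at (n ∸ α i) m) ⟩
      ∑ N (λ i → ∑ M (λ m → at (α i) m - at (n ∸ α i) m))
        ≡⟨ ∑-cong′ N (λ i → trans (∑-- M (at (α i)) (at (n ∸ α i)))
             (cong₂ _-_ (∑-residue n L (α i) f (α<n i))
               (∑-residue n L (n ∸ α i) f (IsInverse.reduced (IsInverse-neg n (inverses i)))))) ⟩
      ∑ N (λ i → progressionSum n L f (α i) - progressionSum n L f (n ∸ α i))
        ≡⟨ ∑-- N (λ i → progressionSum n L f (α i)) (λ i → progressionSum n L f (n ∸ α i)) ⟩
      ∑ N (λ i → progressionSum n L f (α i)) - ∑ N (λ i → progressionSum n L f (n ∸ α i)) ∎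
      where
      open ≤-Reasoning
      M : ℕ
      M = n ℕ.* L
      at : ℕ → ℕ → ℚ
      at r m = ⟦ m % n ℕ.≟ r ⟧ * f m
      distribute : ∀ a b c → (a - b) * c ≡ a * c - b * c
      distribute = solve-∀ ringℚ
      as-indicators : ∀ i m → charge n (α i) m * f m ≡ at (α i) m - at (n ∸ α i) m
      as-indicators i m = trans (cong (_* f m) (charge-complement n (0<α i) (α<n i) m))
        (distribute ⟦ m % n ℕ.≟ α i ⟧ ⟦ m % n ℕ.≟ n ∸ α i ⟧ (f m))

    meanBound : ℚ
    meanBound = 1ℚ + (4ℚ + 2ℚ) * partialBound + ι N

    meanBound≥0 : 0ℚ ≤ meanBound
    meanBound≥0 = +≥0 (+≥0 0≤1 (*≥0 (nonNegative⁻¹ (4ℚ + 2ℚ)) partialBound≥0)) (ι≥0 N)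

    -- The sum of h(m) cot(m) over a full period is, up to ε, twice its part with m ≤ x plus a middle part, which is
    -- small because cot decreases there.
    module CotangentMean (L x : ℕ) {y ε : ℚ} (0≤y : 0ℚ ≤ y) (positive : PositiveUpTo (n ℕ.* L) y)
      (x<M : 2 ℕ.* suc x ℕ.< n ℕ.* L)
      (x²y≤1 : ι (suc x) * (ι (suc x) * y) ≤ 1ℚ)
      (antisymmetric : ∀ j → j ℕ.< suc x → ∣ cot y (suc j) + cot y (n ℕ.* L ∸ suc j) ∣ ≤ ε)
      (total : ∣ ∑ (n ℕ.* L) (λ m → h m * cot y m) ∣ ≤ ε) where

      private
        M x₁ R-1 R : ℕ
        M = n ℕ.* L
        x₁ = suc x
        R-1 = M ∸ (2 ℕ.* x₁)
        R = suc R-1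

        c f : ℕ → ℚ
        c = cot y
        f m = h m * c m

        head middle tail asymmetry mean : ℚ
        head      = ∑ x (λ j → h (suc j) * c (suc j))
        middle    = ∑ R (λ j → f (x₁ ℕ.+ j))
        tail      = ∑ x (λ j → f (x₁ ℕ.+ (R ℕ.+ j)))
        asymmetry = ∑ x (λ j → h (suc j) * (c (suc j) + c (M ∸ suc j)))
        mean      = ∑ x (λ j → h (suc j) * inv (ι (suc j)))

        length : x₁ ℕ.+ (R ℕ.+ x) ≡ M
        length = trans (reorder x R-1) (ℕ.m+[n∸m]≡n (ℕ.<⇒≤ x<M))
          where
          reorder : ∀ x r → suc x ℕ.+ (suc r ℕ.+ x) ≡ 2 ℕ.* suc x ℕ.+ r
          reorder = ℕR.solve-∀

        x₁≤M : x₁ ℕ.≤ M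
        x₁≤M = ℕ.≤-trans (ℕ.m≤n*m x₁ 2) (ℕ.<⇒≤ x<M)

        reflected : ∀ j → j ℕ.< x → x₁ ℕ.+ (R ℕ.+ (x ∸ suc j)) ≡ M ∸ suc j
        reflected j j<x = sym (trans (cong (_∸ suc j)
          (trans (sym length) (cong (λ z → x₁ ℕ.+ (R ℕ.+ z)) (sym (ℕ.m∸n+n≡m j<x)))))
          (trans (cong (_∸ suc j) (reassociate x₁ R (x ∸ suc j) (suc j)))
            (ℕ.m+n∸n≡m (x₁ ℕ.+ (R ℕ.+ (x ∸ suc j))) (suc j))))
          where
          reassociate : ∀ a r b k → a ℕ.+ (r ℕ.+ (b ℕ.+ k)) ≡ a ℕ.+ (r ℕ.+ b) ℕ.+ k
          reassociate = ℕR.solve-∀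

        f-reflected : ∀ j → j ℕ.< x → f (M ∸ suc j) ≡ h (suc j) * c (suc j) - h (suc j) * (c (suc j) + c (M ∸ suc j))
        f-reflected j j<x = trans (cong (_* c (M ∸ suc j)) (h-odd (suc j) (M ∸ suc j) period))
          (split (h (suc j)) (c (suc j)) (c (M ∸ suc j)))
          where
          period : (suc j ℕ.+ (M ∸ suc j)) % n ≡ 0
          period = trans (cong (_% n) (trans (ℕ.m+[n∸m]≡n (ℕ.≤-trans (ℕ.m<n⇒m<1+n j<x) x₁≤M)) (ℕ.*-comm n L)))
            (m*n%n≡0 L n)
          split : ∀ h c d → - h * d ≡ h * c - h * (c + d)
          split = solve-∀ ringℚ

        tail≡ : tail ≡ head - asymmetry
        tail≡ = begin-equality
          ∑ x (λ j → f (x₁ ℕ.+ (R ℕ.+ j)))   ≡⟨ ∑-reverse x (λ j → f (x₁ ℕ.+ (R ℕ.+ j))) ⟩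
          ∑ x (λ j → f (x₁ ℕ.+ (R ℕ.+ (x ∸ suc j))))
            ≡⟨ ∑-cong x (λ j j<x → trans (cong f (reflected j j<x)) (f-reflected j j<x)) ⟩
          ∑ x (λ j → h (suc j) * c (suc j) - h (suc j) * (c (suc j) + c (M ∸ suc j)))
            ≡⟨ ∑-- x (λ j → h (suc j) * c (suc j)) (λ j → h (suc j) * (c (suc j) + c (M ∸ suc j))) ⟩
          head - asymmetry ∎
          where open ≤-Reasoning

        decompose : ∑ M f ≡ head + (middle + (head - asymmetry))
        decompose = begin-equality
          ∑ M f                    ≡⟨ cong (λ z → ∑ z f) (sym length) ⟩
          ∑ (x₁ ℕ.+ (R ℕ.+ x)) f   ≡⟨ ∑-split x₁ (R ℕ.+ x) f ⟩
          f 0 + head + ∑ (R ℕ.+ x) (λ i → f (x₁ ℕ.+ i))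
            ≡⟨ cong₂ _+_ (trans (cong (_+ head) (x≡0⇒x*y≡0 (c 0) h-0)) (+-identityˡ head))
               (∑-split R x (λ i → f (x₁ ℕ.+ i))) ⟩
          head + (middle + tail)   ≡⟨ cong (λ z → head + (middle + z)) tail≡ ⟩
          head + (middle + (head - asymmetry)) ∎
          where open ≤-Reasoning

        cx : ℚ
        cx = c x₁

        cx≥0 : 0ℚ ≤ cx
        cx≥0 = cot≥0 0≤y positive x₁ x₁≤M x²y≤1 x ℕ.≤-refl

        middle≤ : ∣ middle ∣ ≤ (partialBound + partialBound) * (cx + ε + (cx + (cx + ε)))
        middle≤ = ≤-trans
          (summation-by-parts-bound R-1 (λ j → h (x₁ ℕ.+ j)) g (λ i → g i - g (suc i)) (partialBound + partialBound)
            (+≥0 partialBound≥0 partialBound≥0) (interval-sums x₁)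
              (λ i i<R-1 → ∣∣-nonNeg (decreasing i i<R-1) ≤-refl))
          (*-monoˡ (+≥0 partialBound≥0 partialBound≥0) (begin
            ∣ g R-1 ∣ + ∑ R-1 (λ i → g i - g (suc i))
              ≡⟨ cong (λ z → ∣ g R-1 ∣ + z) (∑-telescope R-1 g) ⟩
            ∣ g R-1 ∣ + (g 0 - g R-1)      ≤⟨ +-monoʳ-≤ ∣ g R-1 ∣ (+-mono-≤ (≤-reflexive g0≡cx) (-x≤∣x∣ (g R-1))) ⟩
            ∣ g R-1 ∣ + (cx + ∣ g R-1 ∣)   ≤⟨ +-mono-≤ last≤ (+-monoʳ-≤ cx last≤) ⟩
            cx + ε + (cx + (cx + ε)) ∎))
          where
          open ≤-Reasoning
          g : ℕ → ℚ
          g j = c (x₁ ℕ.+ j)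
          g0≡cx : g 0 ≡ cx
          g0≡cx = cong c (ℕ.+-identityʳ x₁)
          decreasing : ∀ i → i ℕ.< R-1 → 0ℚ ≤ g i - g (suc i)
          decreasing i i<R-1 = p≤q⇒0≤q-p (subst (λ m → c m ≤ g i) (sym (ℕ.+-suc x₁ i)) (cot-decreasing 0≤y positive
            (x ℕ.+ i) i+2≤M))
            where
            reorder : ∀ x r → suc (suc (x ℕ.+ r)) ℕ.+ x ≡ suc x ℕ.+ (suc r ℕ.+ x)
            reorder = ℕR.solve-∀
            i+2≤M : suc (suc (x ℕ.+ i)) ℕ.≤ M
            i+2≤M = ℕ.≤-trans (s≤s (s≤s (ℕ.+-monoʳ-≤ x (ℕ.<⇒≤ i<R-1))))
              (ℕ.≤-trans (ℕ.m≤m+n (suc (suc (x ℕ.+ R-1))) x) (ℕ.≤-reflexive (trans (reorder x R-1) length)))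
          last≡ : g R-1 ≡ c (M ∸ x₁)
          last≡ = cong c (sym (trans (cong (_∸ x₁) (trans (sym length) (reorder x R-1))) (ℕ.m+n∸n≡m (x₁ ℕ.+ R-1) x₁)))
            where
            reorder : ∀ x r → suc x ℕ.+ (suc r ℕ.+ x) ≡ suc x ℕ.+ r ℕ.+ suc x
            reorder = ℕR.solve-∀
          last≤ : ∣ g R-1 ∣ ≤ cx + ε
          last≤ = subst (λ z → ∣ z ∣ ≤ cx + ε) (trans (xyx⁻¹≈y cx (c (M ∸ x₁))) (sym last≡))
            (≤-trans (∣∣-- (antisymmetric x ℕ.≤-refl) (∣∣-nonNeg cx≥0 ≤-refl)) (≤-reflexive (+-comm ε cx)))

        asymmetry≤ : ∣ asymmetry ∣ ≤ ι x * (ι N * ε)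
        asymmetry≤ = ≤-trans (∑-abs x λ j j<x → ∣∣-* (h≤ (suc j)) (antisymmetric j (ℕ.m<n⇒m<1+n j<x)))
          (≤-reflexive (∑-const x (ι N * ε)))

        head≤ : ∣ head ∣ ≤ ε + (partialBound + partialBound) * (cx + ε + (cx + (cx + ε))) + ι x * (ι N * ε)
        head≤ = ≤-trans (∣x∣≤∣2x∣ head) (≤-trans (≤-reflexive (cong ∣_∣ 2head≡))
          (∣∣-+ (∣∣-- total middle≤) asymmetry≤))
          where
          solve-for-head : ∀ u s e → u + (s + (u - e)) - s + e ≡ (1ℚ + 1ℚ) * u
          solve-for-head = solve-∀ ringℚ
          2head≡ : 2ℚ * head ≡ ∑ M f - middle + asymmetry
          2head≡ = sym (trans (cong (λ z → z - middle + asymmetry) decompose) (solve-for-head head middle asymmetry))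

        X : ℚ
        X = ι x₁ * (ι x₁ * y)

        mean≤ : ∣ mean ∣ ≤ ∣ head ∣ + ι x * (ι N * X)
        mean≤ = subst (λ z → ∣ z ∣ ≤ ∣ head ∣ + ι x * (ι N * X)) head+gap≡mean
          (∣∣-+ {head} ≤-refl (≤-trans (∑-abs x λ j j<x → ∣∣-* (h≤ (suc j)) (gap≤ j (ℕ.m<n⇒m<1+n j<x)))
            (≤-reflexive (∑-const x (ι N * X)))))
          where
          gap : ℕ → ℚ
          gap j = inv (ι (suc j)) - c (suc j)
          gap≤ : ∀ j → j ℕ.< x₁ → ∣ gap j ∣ ≤ X
          gap≤ j j<x₁ = ∣∣-nonNeg (p≤q⇒0≤q-p (cot≤inv 0≤y positive j (ℕ.≤-trans j<x₁ x₁≤M)))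
            (inv-cot≤ 0≤y positive x₁ x₁≤M x²y≤1 j j<x₁)
          recombine : ∀ h c i → h * c + h * (i - c) ≡ h * i
          recombine = solve-∀ ringℚ
          head+gap≡mean : head + ∑ x (λ j → h (suc j) * gap j) ≡ mean
          head+gap≡mean = trans (sym (∑-distrib-+ x (λ j → h (suc j) * c (suc j)) (λ j → h (suc j) * gap j)))
            (∑-cong′ x λ j → recombine (h (suc j)) (c (suc j)) (inv (ι (suc j))))

      errorFactor : ℚ
      errorFactor = ι x + 4ℚ * partialBound * ι x + ι x * (ι x * ι N)

      mean-bound : ε * errorFactor ≤ 1ℚ → ι x * (ι x * X) ≤ 1ℚ → ι x * ∣ mean ∣ ≤ meanBound
      mean-bound εE≤1 x²X≤1 = begin
        ι x * ∣ mean ∣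
          ≤⟨ *-monoˡ (ι≥0 x) (≤-trans mean≤ (+-monoˡ-≤ (ι x * (ι N * X)) head≤)) ⟩
        ι x * (ε + (partialBound + partialBound) * (cx + ε + (cx + (cx + ε))) + ι x * (ι N * ε) + ι x * (ι N * X))
          ≡⟨ collect (ι x) ε partialBound cx (ι N) X ⟩
        ε * errorFactor + (4ℚ + 2ℚ) * partialBound * (ι x * cx) + ι N * (ι x * (ι x * X))
          ≤⟨ +-mono-≤ (+-mono-≤ εE≤1 (*-monoˡ (*≥0 (nonNegative⁻¹ (4ℚ + 2ℚ)) partialBound≥0) x*cx≤1))
             (*-monoˡ (ι≥0 N) x²X≤1) ⟩
        1ℚ + (4ℚ + 2ℚ) * partialBound * 1ℚ + ι N * 1ℚ
          ≡⟨ cong₂ (λ a b → 1ℚ + a + b) (*-identityʳ ((4ℚ + 2ℚ) * partialBound)) (*-identityʳ (ι N)) ⟩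
        meanBound ∎
        where
        open ≤-Reasoning
        x*cx≤1 : ι x * cx ≤ 1ℚ
        x*cx≤1 = ≤-trans (*-mono (ι≥0 x) (ι-mono (ℕ.n≤1+n x)) cx≥0 (cot≤inv 0≤y positive x x₁≤M))
          (≤-reflexive (*-inv⁺ (ι>0 x)))
        collect : ∀ x e b g n X →
          x * (e + (b + b) * (g + e + (g + (g + e))) + x * (n * e) + x * (n * X)) ≡
            e * (x + ((1ℚ + 1ℚ) + (1ℚ + 1ℚ)) * b * x + x * (x * n)) + (((1ℚ + 1ℚ) + (1ℚ + 1ℚ)) + (1ℚ + 1ℚ)) * b *
            (x * g) + n * (x * (x * X))
        collect = solve-∀ ringℚ

  rootSequence : ∀ M → 4 ℕ.≤ M → RootSequence M
  rootSequence M 4≤M = record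
    { Y = λ T → y (approximation M T 4≤M) ; y₀ = inv (ι M * ι M) ; K = _ ; 0<y₀ = inv>0 (*>0 0<M 0<M)
    ; y₀≤Y = λ T → y≥ (approximation M T 4≤M) ; Y≤1 = λ T → y≤1 (approximation M T 4≤M)
    ; positive = λ T → positive (approximation M T 4≤M) ; small-Q = λ T → small (approximation M T 4≤M)
    }
    where
    open Approximation
    0<M : 0ℚ < ι M
    0<M = <-≤-trans (ι>0 3) (ι-mono 4≤M)

  module BalancedSum (n N : ℕ) {{_ : NonZero n}} {a α : ℕ → ℕ} (inverses : ∀ i → IsInverse n (a i) (α i))
    (balanced : Balanced n N a) where

    open OddSum n N inverses

    private
      module Total (L : ℕ) {{_ : NonZero L}} (roots : RootSequence (n ℕ.* L)) where

        open RootSequence roots using (Y)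

        M : ℕ
        M = n ℕ.* L

        total : ℕ → ℚ
        total T = ∑ M (λ m → h m * cot (Y T) m)

        ∣total∣≤ : ∀ T → ∣ total T ∣ ≤ ∣ ι M * ∑ N (λ i → progressionSum n L (cot (Y T)) (α i))
                                      - ι M * ∑ N (λ i → progressionSum n L (cot (Y T)) (n ∸ α i)) ∣
        ∣total∣≤ T = begin
          ∣ total T ∣             ≡⟨ *-identityˡ ∣ total T ∣ ⟨
          1ℚ * ∣ total T ∣        ≤⟨ *-monoʳ (0≤∣p∣ (total T)) 1≤M ⟩
          ∣ ι M ∣ * ∣ total T ∣   ≡⟨ ∣p*q∣≡∣p∣*∣q∣ (ι M) (total T) ⟨
          ∣ ι M * total T ∣       ≡⟨ cong (λ z → ∣ ι M * z ∣) (∑-h* L (cot (Y T))) ⟩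
          ∣ ι M * (∑α - ∑-α) ∣    ≡⟨ cong ∣_∣ (distribute (ι M) ∑α ∑-α) ⟩
          ∣ ι M * ∑α - ι M * ∑-α ∣ ∎
          where
          open ≤-Reasoning
          ∑α ∑-α : ℚ
          ∑α  = ∑ N (λ i → progressionSum n L (cot (Y T)) (α i))
          ∑-α = ∑ N (λ i → progressionSum n L (cot (Y T)) (n ∸ α i))
          1≤M : 1ℚ ≤ ∣ ι M ∣
          1≤M = ≤-trans (≤-trans (≤-reflexive (sym fromℤ-1)) (ι-mono (ℕ.>-nonZero⁻¹ M {{ℕ.m*n≢0 n L}}))) (x≤∣x∣ (ι M))
          distribute : ∀ m a b → m * (a - b) ≡ m * a - m * b
          distribute = solve-∀ ringℚ

        total-small : Close total (λ _ → 0ℚ)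
        total-small = close (Close.rate progressions-close) λ T → ≤-trans
          (*-monoˡ (ι≥0 (suc T)) (≤-trans (≤-reflexive (cong ∣_∣ (+-identityʳ (total T)))) (∣total∣≤ T)))
            (Close.close≤ progressions-close T)
          where
          progressions-close : Close (λ T → ι M * ∑ N (λ i → progressionSum n L (cot (Y T)) (α i)))
                                     (λ T → ι M * ∑ N (λ i → progressionSum n L (cot (Y T)) (n ∸ α i)))
          progressions-close = cot-balanced n L roots N a α (λ i → (n ∸ 1) ℕ.* a i) (λ i → n ∸ α i)
            inverses (λ i → IsInverse-neg n (inverses i)) balanced

      module Parameters (x : ℕ) where

        -- M ≥ 4x⁴ makes tan²(π/M) = O(x⁻⁴); after M is fixed, T makes the error of its approximation negligible.
        x₁ q L M : ℕ
        x₁ = suc x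
        q = 4 ℕ.* (x₁ ℕ.* (x₁ ℕ.* (x₁ ℕ.* x₁)))
        L = q ℕ.+ 4 ℕ.* x₁
        M = n ℕ.* L

        instance
          L≢0 : NonZero L
          L≢0 = ℕ.>-nonZero (ℕ.<-≤-trans (s≤s z≤n) (ℕ.m≤n+m (4 ℕ.* x₁) q))

        L≤M : L ℕ.≤ M
        L≤M = ℕ.m≤n*m L n

        4≤M : 4 ℕ.≤ M
        4≤M = ℕ.≤-trans (ℕ.m≤m*n 4 x₁) (ℕ.≤-trans (ℕ.m≤n+m (4 ℕ.* x₁) q) L≤M)

        x<M : 2 ℕ.* x₁ ℕ.< M
        x<M = ℕ.<-≤-trans (ℕ.*-monoˡ-< x₁ {2} {4} (s≤s (s≤s (s≤s z≤n)))) (ℕ.≤-trans (ℕ.m≤n+m (4 ℕ.* x₁) q) L≤M)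

        roots : RootSequence M
        roots = rootSequence M 4≤M

        open RootSequence roots public using (Y; Y≥0; positive)
        open Total L roots using (total; total-small)

        deviation : ℕ → ℕ → ℚ
        deviation zero    = total
        deviation (suc j) = λ T → cot (Y T) (suc j) + cot (Y T) (M ∸ suc j)

        deviations-small : ∃ λ D → 0ℚ ≤ D × (∀ j → j ℕ.< suc x₁ → ∀ T → ι (suc T) * ∣ deviation j T ∣ ≤ D)
        deviations-small = close-uniform (suc x₁) deviation λ where
          zero    _          → total-small
          (suc j) (s≤s j<x₁) → cot-antisymmetric n L roots (suc j) (s≤s z≤n)
            (ℕ.≤-<-trans j<x₁ (ℕ.≤-<-trans (ℕ.m≤n*m x₁ 2) x<M))

        D errorFactor : ℚ
        D = proj₁ deviations-small
        errorFactor = ι x + 4ℚ * partialBound * ι x + ι x * (ι x * ι N)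

        T : ℕ
        T = proj₁ (archimedean (D * errorFactor))

        y ε : ℚ
        y = Y T
        ε = D * inv (ι (suc T))

        deviation≤ε : ∀ j → j ℕ.< suc x₁ → ∣ deviation j T ∣ ≤ ε
        deviation≤ε j j≤x₁ = ≤-inv (ι>0 T) (proj₂ (proj₂ deviations-small) j j≤x₁ T)

        ε*errorFactor≤1 : ε * errorFactor ≤ 1ℚ
        ε*errorFactor≤1 = begin
          D * inv (ι (suc T)) * errorFactor   ≡⟨ xy∙z≈xz∙y D (inv (ι (suc T))) errorFactor ⟩
          D * errorFactor * inv (ι (suc T))
            ≤⟨ *-monoʳ (inv≥0 (ι>0 T)) (≤-trans (proj₂ (archimedean (D * errorFactor))) (ι-mono (ℕ.n≤1+n T))) ⟩
          ι (suc T) * inv (ι (suc T))         ≡⟨ *-inv⁺ (ι>0 T) ⟩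
          1ℚ ∎
          where open ≤-Reasoning

        x⁴y≤1 : ι x₁ * (ι x₁ * (ι x₁ * (ι x₁ * y))) ≤ 1ℚ
        x⁴y≤1 = *-cancelˡ-≤ (positive⁻¹ 4ℚ) (begin
          4ℚ * (ι x₁ * (ι x₁ * (ι x₁ * (ι x₁ * y))))   ≡⟨ regroup 4ℚ (ι x₁) y ⟨
          4ℚ * (ι x₁ * (ι x₁ * (ι x₁ * ι x₁))) * y     ≡⟨ cong (_* y) (sym ι-q) ⟩
          ι q * y                                      ≤⟨ *-monoʳ (Y≥0 T) (ι-mono q≤M-2) ⟩
          ι (M ∸ 2) * y
            ≤⟨ root-small (Y≥0 T) (positive T) (M ∸ 2) (sym (ℕ.m+[n∸m]≡n (ℕ.≤-trans (s≤s (s≤s z≤n)) 4≤M))) ⟩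
          4ℚ                                           ≡⟨ *-identityʳ 4ℚ ⟨
          4ℚ * 1ℚ ∎)
          where
          open ≤-Reasoning
          q≤M-2 : q ℕ.≤ M ∸ 2
          q≤M-2 = ℕ.≤-trans (ℕ.≤-reflexive (sym (ℕ.m+n∸n≡m q 2)))
            (ℕ.∸-monoˡ-≤ 2 (ℕ.≤-trans (ℕ.+-monoʳ-≤ q (ℕ.≤-trans (s≤s (s≤s z≤n)) (ℕ.m≤m*n 4 x₁))) L≤M))
          ι-q : ι q ≡ 4ℚ * (ι x₁ * (ι x₁ * (ι x₁ * ι x₁)))
          ι-q = trans (ι-* 4 (x₁ ℕ.* (x₁ ℕ.* (x₁ ℕ.* x₁)))) (cong₂ _*_ ι-4
            (trans (ι-* x₁ (x₁ ℕ.* (x₁ ℕ.* x₁)))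
              (cong (ι x₁ *_) (trans (ι-* x₁ (x₁ ℕ.* x₁)) (cong (ι x₁ *_) (ι-* x₁ x₁))))))
          regroup : ∀ f x y → f * (x * (x * (x * x))) * y ≡ f * (x * (x * (x * (x * y))))
          regroup = solve-∀ ringℚ

        x²y≥0 : 0ℚ ≤ ι x₁ * (ι x₁ * y)
        x²y≥0 = *≥0 (ι≥0 x₁) (*≥0 (ι≥0 x₁) (Y≥0 T))

        x²y≤1 : ι x₁ * (ι x₁ * y) ≤ 1ℚ
        x²y≤1 = ≤-trans (≤-trans (z≤x₁z x²y≥0) (*-monoˡ (ι≥0 x₁) (z≤x₁z x²y≥0))) x⁴y≤1
          where
          z≤x₁z : ∀ {z} → 0ℚ ≤ z → z ≤ ι x₁ * z
          z≤x₁z {z} 0≤z = subst (_≤ ι x₁ * z) (*-identityˡ z) (*-monoʳ 0≤z (ι≥1 x))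

        x²X≤1 : ι x * (ι x * (ι x₁ * (ι x₁ * y))) ≤ 1ℚ
        x²X≤1 = ≤-trans (*-mono (ι≥0 x) ιx≤ιx₁ (*≥0 (ι≥0 x) x²y≥0) (*-monoʳ x²y≥0 ιx≤ιx₁)) x⁴y≤1
          where
          ιx≤ιx₁ : ι x ≤ ι x₁
          ιx≤ιx₁ = ι-mono (ℕ.n≤1+n x)

    harmonic-mean : ∀ x → ι x * ∣ ∑ x (λ m → h (suc m) * inv (ι (suc m))) ∣ ≤ meanBound
    harmonic-mean x = CotangentMean.mean-bound L x (Y≥0 T) (positive T) x<M x²y≤1
      (λ j j<x₁ → deviation≤ε (suc j) (s≤s j<x₁)) (deviation≤ε 0 (s≤s z≤n)) ε*errorFactor≤1 x²X≤1
      where open Parameters x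

module OddVanishing where

  open import Data.Nat.Coprimality using (Coprime; coprime?)
  open import Data.Nat.Divisibility using (m∣m*n)
  open Rationals
  open Sums using (ℕ∑-cong)
  open Congruence
  open NonVanishing using (vanishing)
  open Charge
  open HarmonicMean

  module UnitFamily (n N : ℕ) {{_ : NonZero n}} {a α : ℕ → ℕ} (inverses : ∀ i → IsInverse n (a i) (α i))
    (balanced : Balanced n N a) where

    open OddSum n N inverses

    private
      C : ℚ
      C = partialBound + meanBound

      C≥0 : 0ℚ ≤ C
      C≥0 = +≥0 partialBound≥0 meanBound≥0

      module Dilated {k k′} (kk′≡1 : k ℕ.* k′ ≡ 1 mod n) where

        dilated-inverses : ∀ i → IsInverse n (k ℕ.* a i) (k′ ℕ.* α i % n)
        dilated-inverses i = IsInverse-* n {k} {k′} kk′≡1 (inverses i)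

        dilated-balanced : Balanced n N (λ i → k ℕ.* a i)
        dilated-balanced r = trans (ℕ∑-cong N λ i → cong (_% n) (sym (ℕ.*-assoc r k (a i))))
          (trans (balanced (r ℕ.* k)) (ℕ∑-cong N λ i → cong (_% n) (reorder r k (n ∸ 1) (a i))))
          where
          reorder : ∀ r k m a → r ℕ.* k ℕ.* (m ℕ.* a) ≡ r ℕ.* (m ℕ.* (k ℕ.* a))
          reorder = ℕR.solve-∀

        open OddSum n N dilated-inverses public using () renaming (h to h′; partial-sums to partial-sums′)
        open BalancedSum n N dilated-inverses dilated-balanced public using (harmonic-mean)

        h-dilated : ∀ m → h (k ℕ.* m) ≡ h′ m
        h-dilated m = ∑-cong′ N λ i → charge-* n {k} {k′} kk′≡1 (IsInverse.reduced (inverses i)) m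

      h-degenerate : ∀ {k} → ¬ Coprime k n → ∀ m → h (k ℕ.* m) ≡ 0ℚ
      h-degenerate {k} ¬k⊥n m = h-support (k ℕ.* m) λ km⊥n → ¬k⊥n (coprime-∣ (m∣m*n m) km⊥n)

      partial : ∀ k i → ∣ ∑ i (λ m → h (k ℕ.* m)) ∣ ≤ C
      partial k i with coprime? k n
      ... | no ¬k⊥n = subst (λ z → ∣ z ∣ ≤ C) (sym (∑-zero i λ m _ → h-degenerate ¬k⊥n m)) C≥0
      ... | yes k⊥n = unit (coprime⇒invertible n k⊥n)
        where
        unit : (∃ λ k′ → k ℕ.* k′ ≡ 1 mod n) → ∣ ∑ i (λ m → h (k ℕ.* m)) ∣ ≤ C
        unit (k′ , kk′≡1) = subst (λ z → ∣ z ∣ ≤ C) (sym (∑-cong′ i h-dilated))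
          (≤-trans (partial-sums′ i) (≤-by meanBound meanBound≥0 refl))
          where open Dilated {k} {k′} kk′≡1

      mean : ∀ k x → ι x * ∣ ∑ x (λ m → h (k ℕ.* suc m) * inv (ι (suc m))) ∣ ≤ C
      mean k x with coprime? k n
      ... | no ¬k⊥n = ≤-trans (≤-reflexive (y≡0⇒x*y≡0 (ι x)
                        (cong ∣_∣ (∑-zero x λ m _ → x≡0⇒x*y≡0 (inv (ι (suc m))) (h-degenerate ¬k⊥n (suc m)))))) C≥0
      ... | yes k⊥n = unit (coprime⇒invertible n k⊥n)
        where
        unit : (∃ λ k′ → k ℕ.* k′ ≡ 1 mod n) → ι x * ∣ ∑ x (λ m → h (k ℕ.* suc m) * inv (ι (suc m))) ∣ ≤ C
        unit (k′ , kk′≡1) = subst (λ z → ι x * ∣ z ∣ ≤ C)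
          (sym (∑-cong′ x λ m → cong (_* inv (ι (suc m))) (h-dilated (suc m))))
          (≤-trans (harmonic-mean x) (≤-by partialBound partialBound≥0 (+-comm meanBound partialBound)))
          where open Dilated {k} {k′} kk′≡1

    odd-vanishing : 1 ℕ.< n → ∀ m → h m ≡ 0ℚ
    odd-vanishing 1<n = vanishing n 1<n record
      { unitFunction = record { periodic = λ m → h-cong (%-mod n m) ; support = h-support }
      ; C≥0          = C≥0
      ; partial      = partial
      ; mean         = mean
      }

module Matching where

  open import Data.Empty using (⊥-elim)
  open import Data.Fin using (Fin; zero; suc; punchIn; punchOut)
  open import Data.Fin.Properties using (_≟_; punchIn-punchOut; punchOut-punchIn; punchInᵢ≢i)
  open import Data.Product using (∃; _,_; proj₁; proj₂)
  open import Data.Sum using (_⊎_; inj₁; inj₂; [_,_]′)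
  import Data.Sum as Sum
  open import Relation.Binary.PropositionalEquality using (_≡_; refl; sym; trans; cong)
  open import Relation.Nullary using (Dec; yes; no)

  record Pairing {N : ℕ} (d : ℕ) (Opp : Fin N → Fin N → Set) : Set where
    field
      σ σ′ : Fin d → Fin N
      ν    : Fin N → Fin d ⊎ Fin d
      ν-σ  : ∀ i → ν (σ i) ≡ inj₁ i
      ν-σ′ : ∀ i → ν (σ′ i) ≡ inj₂ i
      σ-ν  : ∀ k → [ σ , σ′ ]′ (ν k) ≡ k
      opp  : ∀ i → Opp (σ i) (σ′ i)

  open Pairing

  Anchored : ∀ {N d} {Opp : Fin (suc N) → Fin (suc N) → Set} → Pairing (suc d) Opp → Set
  Anchored P = σ P zero ≡ zero

  map : ∀ {N d} {Opp Opp′ : Fin N → Fin N → Set} → (∀ i j → Opp i j → Opp′ i j) → Pairing d Opp → Pairing d Opp′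
  map weaken P = record
    { σ = σ P ; σ′ = σ′ P ; ν = ν P ; ν-σ = ν-σ P ; ν-σ′ = ν-σ′ P ; σ-ν = σ-ν P ; opp = λ i → weaken (σ P i)
      (σ′ P i) (opp P i) }

  module _ {N d : ℕ} {Opp : Fin (suc (suc N)) → Fin (suc (suc N)) → Set} (j : Fin (suc N)) (0-j : Opp zero (suc j))
    (P : Pairing d (λ i k → Opp (suc (punchIn j i)) (suc (punchIn j k)))) where

    private
      τ τ′ : Fin (suc d) → Fin (suc (suc N))
      τ zero     = zero
      τ (suc i)  = suc (punchIn j (σ P i))
      τ′ zero    = suc j
      τ′ (suc i) = suc (punchIn j (σ′ P i))

      locate : (k : Fin (suc N)) → Dec (j ≡ k) → Fin (suc d) ⊎ Fin (suc d)
      locate k (yes _)  = inj₂ zero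
      locate k (no j≢k) = Sum.map suc suc (ν P (punchOut j≢k))

      locate-old : ∀ i x (dec : Dec (j ≡ punchIn j i)) → ν P i ≡ x → locate (punchIn j i) dec ≡ Sum.map suc suc x
      locate-old i x (yes j≡) _    = ⊥-elim (punchInᵢ≢i j i (sym j≡))
      locate-old i x (no j≢k) refl = cong (λ z → Sum.map suc suc (ν P z)) (punchOut-punchIn j)

      locate-new : (dec : Dec (j ≡ j)) → locate j dec ≡ inj₂ zero
      locate-new (yes _)  = refl
      locate-new (no j≢j) = ⊥-elim (j≢j refl)

      τ-map : ∀ x → [ τ , τ′ ]′ (Sum.map suc suc x) ≡ suc (punchIn j ([ σ P , σ′ P ]′ x))
      τ-map (inj₁ _) = refl
      τ-map (inj₂ _) = refl

      τ-locate : ∀ k (dec : Dec (j ≡ k)) → [ τ , τ′ ]′ (locate k dec) ≡ suc k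
      τ-locate k (yes refl) = refl
      τ-locate k (no j≢k)   = trans (τ-map (ν P (punchOut j≢k)))
        (cong suc (trans (cong (punchIn j) (σ-ν P (punchOut j≢k))) (punchIn-punchOut j≢k)))

    extend : Pairing (suc d) Opp
    extend .σ  = τ
    extend .σ′ = τ′
    extend .ν zero    = inj₁ zero
    extend .ν (suc k) = locate k (j ≟ k)
    extend .ν-σ zero     = refl
    extend .ν-σ (suc i)  = locate-old (σ P i) (inj₁ i) (j ≟ _) (ν-σ P i)
    extend .ν-σ′ zero    = locate-new (j ≟ j)
    extend .ν-σ′ (suc i) = locate-old (σ′ P i) (inj₂ i) (j ≟ _) (ν-σ′ P i)
    extend .σ-ν zero    = refl
    extend .σ-ν (suc k) = τ-locate k (j ≟ k)
    extend .opp zero    = 0-j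
    extend .opp (suc i) = opp P i

  module _ {X : Set} (Opp : X → X → Set) (Balanced : ∀ {N} → (Fin N → X) → Set)
    (partner : ∀ {N} (f : Fin (suc (suc N)) → X) → Balanced f → ∃ λ j → Opp (f zero) (f (suc j)))
    (remove : ∀ {N} (f : Fin (suc (suc N)) → X) j → Balanced f → Opp (f zero) (f (suc j)) →
      Balanced (λ i → f (suc (punchIn j i)))) where

    match : ∀ d {N} → N ≡ d ℕ.+ d → (f : Fin N → X) → Balanced f → Pairing d (λ i j → Opp (f i) (f j))
    match zero    {zero}        _    f _        =
      record { σ = λ () ; σ′ = λ () ; ν = λ () ; ν-σ = λ () ; ν-σ′ = λ () ; σ-ν = λ () ; opp = λ () }
    match (suc d) {suc zero}    1≡2d f _        = ⊥-elim (ℕ.1+n≢0 (sym (trans (ℕ.suc-injective 1≡2d) (ℕ.+-suc d d))))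
    match (suc d) {suc (suc N)} N≡2d f balanced =
      extend j 0-j (match d (ℕ.suc-injective (trans (ℕ.suc-injective N≡2d) (ℕ.+-suc d d)))
        (λ i → f (suc (punchIn j i))) (remove f j balanced 0-j))
      where
      j : Fin (suc N)
      j = proj₁ (partner f balanced)
      0-j : Opp (f zero) (f (suc j))
      0-j = proj₂ (partner f balanced)

    anchoredMatch : ∀ d {N} → suc (suc N) ≡ suc d ℕ.+ suc d → (f : Fin (suc (suc N)) → X) → Balanced f →
                    ∃ λ (P : Pairing (suc d) (λ i j → Opp (f i) (f j))) → Anchored P
    anchoredMatch d N≡2d f balanced = match (suc d) N≡2d f balanced , refl

module FiniteSum where

  open import Algebra.Bundles using (CommutativeRing; CommutativeSemiring)
  open import Data.Fin using (Fin; zero; suc; punchIn; inject₁; fromℕ; _↑ˡ_; _↑ʳ_)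
  open import Data.Fin.Permutation using (Permutation; _⟨$⟩ʳ_)
  open import Data.Fin.Properties using (punchInᵢ≢i)
  import Data.Integer.Base as ℤ
  open import Data.Integer.Base using (ℤ; +_)
  import Data.Integer.Properties as ℤ
  open import Data.Rational.Base as ℚ using (ℚ; 0ℚ)
  import Data.Rational.Properties as ℚ
  open import Level using (0ℓ)
  open import Relation.Binary.PropositionalEquality as ≡ using (_≡_; _≢_)
  open import Defs using (sumℤ; sumℚ)

  module _ (R : CommutativeSemiring 0ℓ 0ℓ) where
    open CommutativeSemiring R hiding (zero)

    -- Transfers the library's lemmas on finite sums to any S with the same recursion.
    module FiniteSums (S : ∀ {n} → (Fin n → Carrier) → Carrier) (S-empty : ∀ (f : Fin 0 → Carrier) → S f ≡ 0#)
      (S-suc : ∀ {n} (f : Fin (suc n) → Carrier) → S f ≡ f zero + S (λ i → f (suc i))) where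

      open import Algebra.Properties.CommutativeSemigroup *-commutativeSemigroup using (x∙yz≈y∙xz)
      import Algebra.Properties.CommutativeMonoid.Sum +-commutativeMonoid as Sum
      import Algebra.Properties.Semiring.Sum semiring as Sum*
      open import Relation.Binary.Reasoning.Setoid setoid

      private
        S≡ : ∀ {n} (f : Fin n → Carrier) → S f ≡ Sum.sum f
        S≡ {zero}  f = S-empty f
        S≡ {suc n} f = ≡.trans (S-suc f) (≡.cong (λ z → f zero + z) (S≡ (λ i → f (suc i))))

        S≈ : ∀ {n} (f : Fin n → Carrier) → S f ≈ Sum.sum f
        S≈ f = reflexive (S≡ f)

        transfer : ∀ {m n} (f : Fin m → Carrier) (g : Fin n → Carrier) → Sum.sum f ≈ Sum.sum g → S f ≈ S g
        transfer f g eq = trans (S≈ f) (trans eq (sym (S≈ g)))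

      sum-cong : ∀ {n} {f g : Fin n → Carrier} → (∀ i → f i ≈ g i) → S f ≈ S g
      sum-cong {f = f} {g} eq = transfer f g (Sum.sum-cong-≋ eq)

      sum-distrib-+ : ∀ {n} (f g : Fin n → Carrier) → S (λ i → f i + g i) ≈ S f + S g
      sum-distrib-+ f g = trans (S≈ (λ i → f i + g i)) (trans (Sum.∑-distrib-+ f g) (sym (+-cong (S≈ f) (S≈ g))))

      *-distribˡ-sum : ∀ {n} x (f : Fin n → Carrier) → x * S f ≈ S (λ i → x * f i)
      *-distribˡ-sum x f = trans (*-congˡ (S≈ f)) (trans (Sum*.*-distribˡ-sum x f) (sym (S≈ (λ i → x * f i))))

      *-distribʳ-sum : ∀ {n} x (f : Fin n → Carrier) → S f * x ≈ S (λ i → f i * x)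
      *-distribʳ-sum x f = trans (*-congʳ (S≈ f)) (trans (Sum*.*-distribʳ-sum x f) (sym (S≈ (λ i → f i * x))))

      sum-comm : ∀ {m n} (f : Fin m → Fin n → Carrier) → S (λ i → S (f i)) ≈ S (λ j → S (λ i → f i j))
      sum-comm f = begin
        S (λ i → S (f i))         ≈⟨ sum-cong (λ i → S≈ (f i)) ⟩
        S (λ i → Sum.sum (f i))   ≈⟨ transfer (λ i → Sum.sum (f i)) (λ j → Sum.sum (λ i → f i j)) (Sum.∑-comm f) ⟩
        S (λ j → Sum.sum (λ i → f i j))
          ≈⟨ sum-cong (λ j → sym (S≈ (λ i → f i j))) ⟩
        S (λ j → S (λ i → f i j)) ∎

      sum-remove : ∀ {n} (j : Fin (suc n)) f → S f ≈ f j + S (λ i → f (punchIn j i))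
      sum-remove j f = trans (S≈ f) (trans (Sum.sum-remove {i = j} f) (+-congˡ (sym (S≈ (λ i → f (punchIn j i))))))

      sum-permute : ∀ {m n} (f : Fin n → Carrier) (π : Permutation m n) → S f ≈ S (λ i → f (π ⟨$⟩ʳ i))
      sum-permute f π = transfer f (λ i → f (π ⟨$⟩ʳ i)) (Sum.sum-permute f π)

      sum-init-last : ∀ {n} (f : Fin (suc n) → Carrier) → S f ≈ S (λ i → f (inject₁ i)) + f (fromℕ n)
      sum-init-last f = trans (S≈ f) (trans (Sum.sum-init-last f) (+-congʳ (sym (S≈ (λ i → f (inject₁ i))))))

      sum-zero : ∀ {n} {f : Fin n → Carrier} → (∀ i → f i ≈ 0#) → S f ≈ 0#
      sum-zero {n} eq = trans (sum-cong eq) (trans (S≈ (λ _ → 0#)) (Sum.sum-replicate-zero n))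

      sum-single : ∀ {n} (j : Fin n) {f : Fin n → Carrier} → (∀ i → i ≢ j → f i ≈ 0#) → S f ≈ f j
      sum-single {suc n} j {f} eq = trans (sum-remove j f)
        (trans (+-congˡ (sum-zero λ i → eq (punchIn j i) (punchInᵢ≢i j i))) (+-identityʳ (f j)))

      sum-++ : ∀ m {n} (f : Fin (m ℕ.+ n) → Carrier) → S f ≈ S (λ i → f (i ↑ˡ n)) + S (λ j → f (m ↑ʳ j))
      sum-++ zero        f = trans (sym (+-identityˡ (S f))) (+-congʳ (reflexive (≡.sym (S-empty _))))
      sum-++ (suc m) {n} f = begin
        S f                            ≈⟨ reflexive (S-suc f) ⟩
        f zero + S (λ i → f (suc i))   ≈⟨ +-congˡ (sum-++ m (λ i → f (suc i))) ⟩
        f zero + (S (λ i → f (suc (i ↑ˡ n))) + S (λ j → f (suc m ↑ʳ j)))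
          ≈⟨ +-assoc _ _ _ ⟨
        f zero + S (λ i → f (suc (i ↑ˡ n))) + S (λ j → f (suc m ↑ʳ j))
          ≈⟨ +-congʳ (reflexive (≡.sym (S-suc (λ i → f (i ↑ˡ n))))) ⟩
        S (λ i → f (i ↑ˡ n)) + S (λ j → f (suc m ↑ʳ j)) ∎

      sum-bilinear : ∀ {m n} (x : Fin m → Carrier) (y : Fin n → Carrier) (p : Fin m → Fin n → Carrier) →
                     S (λ i → x i * S (λ j → y j * p i j)) ≈ S (λ j → y j * S (λ i → x i * p i j))
      sum-bilinear x y p = begin
        S (λ i → x i * S (λ j → y j * p i j))     ≈⟨ sum-cong (λ i → *-distribˡ-sum (x i) (λ j → y j * p i j)) ⟩
        S (λ i → S (λ j → x i * (y j * p i j)))   ≈⟨ sum-comm (λ i j → x i * (y j * p i j)) ⟩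
        S (λ j → S (λ i → x i * (y j * p i j)))   ≈⟨ sum-cong (λ j → sum-cong λ i → x∙yz≈y∙xz (x i) (y j) (p i j)) ⟩
        S (λ j → S (λ i → y j * (x i * p i j)))   ≈⟨ sum-cong (λ j → sym (*-distribˡ-sum (y j) (λ i → x i * p i j))) ⟩
        S (λ j → y j * S (λ i → x i * p i j)) ∎

  module ℤSum = FiniteSums ℤ.+-*-commutativeSemiring sumℤ (λ _ → ≡.refl) (λ _ → ≡.refl)
  module ℚSum = FiniteSums (CommutativeRing.commutativeSemiring ℚ.+-*-commutativeRing) sumℚ (λ _ → ≡.refl)
    (λ _ → ≡.refl)

  sumℤ-const : ∀ {n} x → sumℤ {n} (λ _ → x) ≡ + n ℤ.* x
  sumℤ-const {zero}  x = ≡.sym (ℤ.*-zeroˡ x)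
  sumℤ-const {suc n} x = ≡.trans (≡.cong (λ z → x ℤ.+ z) (sumℤ-const {n} x)) (≡.sym (ℤ.suc-* (+ n) x))

  sumℤ-≥1 : ∀ {n} (f : Fin n → ℤ) → (∀ i → + 1 ℤ.≤ f i) → + n ℤ.≤ sumℤ f
  sumℤ-≥1 {zero}  f f≥1 = ℤ.≤-refl
  sumℤ-≥1 {suc n} f f≥1 = ℤ.+-mono-≤ (f≥1 zero) (sumℤ-≥1 (λ i → f (suc i)) (λ i → f≥1 (suc i)))

  sumℚ-≥0 : ∀ {n} (f : Fin n → ℚ) → (∀ i → 0ℚ ℚ.≤ f i) → 0ℚ ℚ.≤ sumℚ f
  sumℚ-≥0 {zero}  f f≥0 = ℚ.≤-refl
  sumℚ-≥0 {suc n} f f≥0 = ℚ.+-mono-≤ (f≥0 zero) (sumℚ-≥0 (λ i → f (suc i)) (λ i → f≥0 (suc i)))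

module UnitPairing where

  open import Data.Fin using (Fin; zero; suc; punchIn)
  open import Data.Fin.Properties using (any?)
  open import Data.Nat.Coprimality using (Coprime; coprime-divisor) renaming (sym to coprime-sym)
  open import Data.Nat.DivMod using (m%n<n; m<n⇒m%n≡m; n%1≡0)
  open import Data.Nat.Divisibility using (_∣_; _∣0; ∣⇒≤; m%n≡0⇒n∣m; ∣-refl)
  open import Data.Unit using (⊤; tt)
  open Rationals hiding (∣_∣)
  open Congruence
  open Charge
  open OddVanishing
  open Matching
  open FiniteSum
  open import Defs using (sumℚ)

  module _ (n : ℕ) {{_ : NonZero n}} where

    Opposite : ℕ → ℕ → Set
    Opposite x y = (x ℕ.+ y) % n ≡ 0

    Opposite-inverse : ∀ {a α b β} → IsInverse n a α → IsInverse n b β → Opposite α β → Opposite a b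
    Opposite-inverse {a} {α} {b} {β} a-inverse b-inverse α+β≡0 = begin
      (a ℕ.+ b) % n                               ≡⟨ cong (_% n) (units a b) ⟩
      (b ℕ.* 1 ℕ.+ a ℕ.* 1) % n                          ≡⟨ +-mod n {b ℕ.* (a ℕ.* α)} {b ℕ.* 1} {a ℕ.* (b ℕ.* β)}
        {a ℕ.* 1}
        (*-mod n {b} {b} {a ℕ.* α} {1} refl (IsInverse.inverse a-inverse)) (*-mod n {a} {a} {b ℕ.* β} {1} refl
          (IsInverse.inverse b-inverse)) ⟨
      (b ℕ.* (a ℕ.* α) ℕ.+ a ℕ.* (b ℕ.* β)) % n   ≡⟨ cong (_% n) (factor a b α β) ⟩
      (a ℕ.* b ℕ.* (α ℕ.+ β)) % n                 ≡⟨ *-mod-0 n (a ℕ.* b) α+β≡0 ⟩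
      0 ∎
      where
      open ≡-Reasoning
      units : ∀ a b → a ℕ.+ b ≡ b ℕ.* 1 ℕ.+ a ℕ.* 1
      units = ℕR.solve-∀
      factor : ∀ a b x y → b ℕ.* (a ℕ.* x) ℕ.+ a ℕ.* (b ℕ.* y) ≡ a ℕ.* b ℕ.* (x ℕ.+ y)
      factor = ℕR.solve-∀

    ∃-inverse : 1 ℕ.< n → ∀ {a} → Coprime a n → ∃ λ α → IsInverse n a α
    ∃-inverse 1<n {a} a⊥n =
      α , record { positive = ℕ.n≢0⇒n>0 α≢0 ; reduced = m%n<n a⁻¹ n ; inverse = aα≡1 }
      where
      a⁻¹ α : ℕ
      a⁻¹ = proj₁ (coprime⇒invertible n a⊥n)
      α = a⁻¹ % n
      aα≡1 : a ℕ.* α ≡ 1 mod n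
      aα≡1 = trans (*-mod n {a} {a} {α} {a⁻¹} refl (%-mod n a⁻¹)) (proj₂ (coprime⇒invertible n a⊥n))
      α≢0 : ¬ α ≡ 0
      α≢0 α≡0 = ℕ.1+n≢0 (begin
        1               ≡⟨ m<n⇒m%n≡m 1<n ⟨
        1 % n           ≡⟨ aα≡1 ⟨
        (a ℕ.* α) % n   ≡⟨ cong (λ z → (a ℕ.* z) % n) α≡0 ⟩
        (a ℕ.* 0) % n   ≡⟨ mod-0 n (cong (_% n) (ℕ.*-zeroʳ a)) ⟩
        0 ∎)
        where open ≡-Reasoning

    charge-opposite : ∀ {x y} → 0 ℕ.< x → x ℕ.< n → 0 ℕ.< y → y ℕ.< n → Opposite x y → ∀ m →
      charge n x m + charge n y m ≡ 0ℚ
    charge-opposite {x} {y} 0<x x<n 0<y y<n x+y≡0 m = begin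
      charge n x m + charge n y m   ≡⟨ cong₂ _+_ (charge-complement n 0<x x<n m) (charge-complement n 0<y y<n m) ⟩
      at x - at (n ∸ x) + (at y - at (n ∸ y))
        ≡⟨ cong₂ (λ u v → at x - at u + (at y - at v)) (sym y≡n∸x) (sym x≡n∸y) ⟩
      at x - at y + (at y - at x)   ≡⟨ cancel (at x) (at y) ⟩
      0ℚ ∎
      where
      open ≡-Reasoning
      at : ℕ → ℚ
      at r = ⟦ m % n ℕ.≟ r ⟧
      x≡n∸y : x ≡ n ∸ y
      x≡n∸y = trans (sym (m<n⇒m%n≡m x<n)) (opposite⇒complement n x 0<y y<n x+y≡0)
      y≡n∸x : y ≡ n ∸ x
      y≡n∸x = trans (sym (m<n⇒m%n≡m y<n)) (opposite⇒complement n y 0<x x<n (trans (cong (_% n) (ℕ.+-comm y x)) x+y≡0))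
      cancel : ∀ a b → a - b + (b - a) ≡ 0ℚ
      cancel = solve-∀ ringℚ

    record Neutral {N} (f : Fin N → ℕ) : Set where
      field
        ∑charge≡0 : ∀ m → sumℚ (λ i → charge n (f i) m) ≡ 0ℚ
        reduced   : ∀ i → f i ℕ.< n
        coprime   : ∀ i → Coprime (f i) n

    open Neutral

    module _ (2<n : 2 ℕ.< n) where

      private
        unit>0 : ∀ {x} → Coprime x n → 0 ℕ.< x
        unit>0 {zero}  0⊥n = ⊥-elim (ℕ.<-irrefl (sym (0⊥n (n ∣0 , ∣-refl))) (ℕ.<-trans (s≤s (s≤s z≤n)) 2<n))
        unit>0 {suc x} _   = s≤s z≤n

        not-self-opposite : ∀ {x} → Coprime x n → ¬ Opposite x x
        not-self-opposite {x} x⊥n x+x≡0 = ℕ.<⇒≱ 2<n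
          (∣⇒≤ (coprime-divisor (coprime-sym x⊥n) (subst (n ∣_) (double x) (m%n≡0⇒n∣m (x ℕ.+ x) n x+x≡0))))
          where
          double : ∀ x → x ℕ.+ x ≡ x ℕ.* 2
          double = ℕR.solve-∀

      partner : ∀ {N} (f : Fin (suc (suc N)) → ℕ) → Neutral f → ∃ λ j → Opposite (f zero) (f (suc j))
      partner f neutral with any? (λ j → (f zero ℕ.+ f (suc j)) % n ℕ.≟ 0)
      ... | yes found = found
      ... | no none   = ⊥-elim (<⇒≱ 0<1 (≤-by (sumℚ rest) (sumℚ-≥0 rest rest≥0) (trans (cong (_+ sumℚ rest) (sym own))
        (∑charge≡0 neutral x))))
        where
        x : ℕ
        x = f zero
        own : charge n x x ≡ 1ℚ
        own = cong₂ _-_ (⟦⟧-yes (x % n ℕ.≟ x) (m<n⇒m%n≡m (reduced neutral zero)))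
                        (⟦⟧-no ((x ℕ.+ x) % n ℕ.≟ 0) (not-self-opposite (coprime neutral zero)))
        rest : Fin _ → ℚ
        rest j = charge n (f (suc j)) x
        rest≥0 : ∀ j → 0ℚ ≤ rest j
        rest≥0 j = p≤q⇒0≤q-p (≤-trans (≤-reflexive (⟦⟧-no ((x ℕ.+ f (suc j)) % n ℕ.≟ 0) λ opposite →
          none (j , opposite)))
          (⟦⟧≥0 (x % n ℕ.≟ f (suc j))))

      remove : ∀ {N} (f : Fin (suc (suc N)) → ℕ) j → Neutral f → Opposite (f zero) (f (suc j)) →
        Neutral (λ i → f (suc (punchIn j i)))
      remove f j neutral opposite = record
        { ∑charge≡0 = λ m → begin
            sumℚ (rest m)        ≡⟨ +-identityˡ (sumℚ (rest m)) ⟨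
            0ℚ + sumℚ (rest m)   ≡⟨ cong (_+ sumℚ (rest m)) (sym (pair≡0 m)) ⟩
            q zero m + q (suc j) m + sumℚ (rest m)
              ≡⟨ +-assoc (q zero m) (q (suc j) m) (sumℚ (rest m)) ⟩
            q zero m + (q (suc j) m + sumℚ (rest m))
              ≡⟨ cong (q zero m +_) (sym (ℚSum.sum-remove j (λ i → q (suc i) m))) ⟩
            sumℚ (λ i → q i m)   ≡⟨ ∑charge≡0 neutral m ⟩
            0ℚ ∎
        ; reduced   = λ i → reduced neutral (suc (punchIn j i))
        ; coprime   = λ i → coprime neutral (suc (punchIn j i))
        }
        where
        open ≡-Reasoning
        q : Fin _ → ℕ → ℚ
        q i = charge n (f i)
        rest : ℕ → Fin _ → ℚ
        rest m i = q (suc (punchIn j i)) m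
        pair≡0 : ∀ m → q zero m + q (suc j) m ≡ 0ℚ
        pair≡0 = charge-opposite (unit>0 (coprime neutral zero)) (reduced neutral zero)
          (unit>0 (coprime neutral (suc j))) (reduced neutral (suc j)) opposite

  clamp : ∀ {N} → ℕ → Fin (suc N)
  clamp {zero}  _       = zero
  clamp {suc N} zero    = zero
  clamp {suc N} (suc i) = suc (clamp i)

  ∑-clamp : ∀ {N} (f : Fin (suc N) → ℚ) → ∑ (suc N) (λ i → f (clamp i)) ≡ sumℚ f
  ∑-clamp {zero}  f = refl
  ∑-clamp {suc N} f = cong (f zero +_) (∑-clamp (λ i → f (suc i)))

  coprime-to-2⇒odd : ∀ {x} → Coprime x 2 → x % 2 ≡ 1
  coprime-to-2⇒odd {x} x⊥2 with x % 2 | m%n<n x 2 | m%n≡0⇒n∣m x 2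
  ... | zero        | _                | 0≡0⇒2∣x with () ← x⊥2 (0≡0⇒2∣x refl , ∣-refl)
  ... | suc zero    | _                | _ = refl
  ... | suc (suc _) | s≤s (s≤s ())     | _

  module _ (n : ℕ) {{_ : NonZero n}} (2<n : 2 ℕ.< n) {N : ℕ} (a : Fin (suc N) → ℕ) (a⊥n : ∀ i → Coprime (a i) n)
    (balanced : Balanced n (suc N) (λ i → a (clamp i))) where

    private
      1<n : 1 ℕ.< n
      1<n = ℕ.<-trans (s≤s (s≤s z≤n)) 2<n

    inverseOf : Fin (suc N) → ℕ
    inverseOf i = proj₁ (∃-inverse n 1<n (a⊥n i))

    inverseOf-inverse : ∀ i → IsInverse n (a i) (inverseOf i)
    inverseOf-inverse i = proj₂ (∃-inverse n 1<n (a⊥n i))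

    inverses-neutral : Neutral n inverseOf
    inverses-neutral = record
      { ∑charge≡0 = λ m → trans (sym (∑-clamp (λ i → charge n (inverseOf i) m)))
          (UnitFamily.odd-vanishing n (suc N) (λ i → inverseOf-inverse (clamp i)) balanced 1<n m)
      ; reduced   = λ i → IsInverse.reduced (inverseOf-inverse i)
      ; coprime   = λ i → invertible⇒coprime n {inverseOf i} {a i}
          (trans (cong (_% n) (ℕ.*-comm (inverseOf i) (a i))) (IsInverse.inverse (inverseOf-inverse i)))
      }

  pairing : (n : ℕ) {{_ : NonZero n}} (e : ℕ) {N : ℕ} → suc (suc N) ≡ suc e ℕ.+ suc e →
            (a : Fin (suc (suc N)) → ℕ) → (∀ i → Coprime (a i) n) →
            Balanced n (suc (suc N)) (λ i → a (clamp i)) →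
            ∃ λ (P : Pairing (suc e) (λ i j → Opposite n (a i) (a j))) → Anchored P
  pairing 1 e N≡2e a a⊥n balanced =
    anchoredMatch (Opposite 1) (λ _ → ⊤) (λ f _ → zero , n%1≡0 (f zero ℕ.+ f (suc zero))) (λ _ _ _ _ → tt) e N≡2e a tt
  pairing 2 e N≡2e a a⊥n balanced =
    anchoredMatch (Opposite 2) (λ f → ∀ i → f i % 2 ≡ 1)
      (λ f odd → zero , +-mod 2 {f zero} {1} {f (suc zero)} {1} (odd zero) (odd (suc zero)))
        (λ f j odd _ i → odd (suc (punchIn j i)))
      e N≡2e a (λ i → coprime-to-2⇒odd (a⊥n i))
  pairing n@(suc (suc (suc _))) e N≡2e a a⊥n balanced = map (λ i j → Opposite-inverse n (inverse i) (inverse j))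
    (proj₁ matched) , proj₂ matched
    where
    2<n : 2 ℕ.< n
    2<n = s≤s (s≤s (s≤s z≤n))
    inverse : ∀ i → IsInverse n (a i) (inverseOf n 2<n a a⊥n balanced i)
    inverse = inverseOf-inverse n 2<n a a⊥n balanced
    matched : ∃ λ (P : Pairing (suc e) (λ i j → Opposite n (inverseOf n 2<n a a⊥n balanced i)
      (inverseOf n 2<n a a⊥n balanced j))) →
      Anchored P
    matched = anchoredMatch (Opposite n) (Neutral n) (partner n 2<n) (remove n 2<n) e N≡2e
      (inverseOf n 2<n a a⊥n balanced)
      (inverses-neutral n 2<n a a⊥n balanced)

module RationalPoints where

  open import Data.Fin using (Fin; zero; suc)
  import Data.Integer.Base as ℤ
  open import Data.Integer.Base using (ℤ; +_)
  import Data.Integer.Properties as ℤ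
  open import Data.Rational
  open import Data.Rational.Properties
  import Data.Rational.Unnormalised as ℚᵘ
  import Data.Rational.Unnormalised.Properties as ℚᵘ
  open import Relation.Binary.PropositionalEquality using (_≡_; refl; sym; trans; cong; cong₂; subst;
    module ≡-Reasoning)
  open import Tactic.RingSolver using (solve-∀)
  open import Defs using (ℤ→ℚ; sumℤ; sumℚ; Pt; QPt; combℤ; AffIndep; _≋ℚ_)
  open FiniteSum
  open Rationals using (ringℚ; fromℤ; fromℤ≡/1; fromℤ-+; fromℤ-*; fromℤ-injective; fromℤ≥1; ι>0; x∙yz≈y∙xz; xy∙z≈y∙xz)

  private
    from-fromℤ : ∀ {x y} i → fromℤ i ≡ x → x ≡ y → ℤ→ℚ i ≡ y
    from-fromℤ i i≡x x≡y = trans (sym (fromℤ≡/1 i)) (trans i≡x x≡y)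

  ℤ→ℚ-+ : ∀ i j → ℤ→ℚ (i ℤ.+ j) ≡ ℤ→ℚ i + ℤ→ℚ j
  ℤ→ℚ-+ i j = from-fromℤ (i ℤ.+ j) (fromℤ-+ i j) (cong₂ _+_ (fromℤ≡/1 i) (fromℤ≡/1 j))

  ℤ→ℚ-* : ∀ i j → ℤ→ℚ (i ℤ.* j) ≡ ℤ→ℚ i * ℤ→ℚ j
  ℤ→ℚ-* i j = from-fromℤ (i ℤ.* j) (fromℤ-* i j) (cong₂ _*_ (fromℤ≡/1 i) (fromℤ≡/1 j))

  ℤ→ℚ-injective : ∀ {i j} → ℤ→ℚ i ≡ ℤ→ℚ j → i ≡ j
  ℤ→ℚ-injective {i} {j} eq = fromℤ-injective (trans (fromℤ≡/1 i) (trans eq (sym (fromℤ≡/1 j))))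

  ℤ→ℚ-sum : ∀ {n} (f : Fin n → ℤ) → ℤ→ℚ (sumℤ f) ≡ sumℚ (λ i → ℤ→ℚ (f i))
  ℤ→ℚ-sum {zero}  f = refl
  ℤ→ℚ-sum {suc n} f = trans (ℤ→ℚ-+ (f zero) (sumℤ λ i → f (suc i))) (cong (λ z → ℤ→ℚ (f zero) + z)
    (ℤ→ℚ-sum λ i → f (suc i)))

  ℤ→ℚ>0 : ∀ n → 0ℚ < ℤ→ℚ (+ suc n)
  ℤ→ℚ>0 n = subst (0ℚ <_) (fromℤ≡/1 (+ suc n)) (ι>0 n)

  ℤ→ℚ≥1 : ∀ {i} → 0ℚ < ℤ→ℚ i → + 1 ℤ.≤ i
  ℤ→ℚ≥1 {i} i>0 = fromℤ≥1 (subst (0ℚ <_) (sym (fromℤ≡/1 i)) i>0)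

  infix 8 _∙_

  _∙_ : ∀ {m} → Pt m → QPt m → ℚ
  l ∙ x = sumℚ (λ s → ℤ→ℚ (l s) * x s)

  ℤ→ℚ-∙ : ∀ {m} (l z : Pt m) → ℤ→ℚ (sumℤ λ s → l s ℤ.* z s) ≡ l ∙ (λ s → ℤ→ℚ (z s))
  ℤ→ℚ-∙ l z = trans (ℤ→ℚ-sum λ s → l s ℤ.* z s) (ℚSum.sum-cong λ s → ℤ→ℚ-* (l s) (z s))

  ∙-cong : ∀ {m} (l : Pt m) {x y : QPt m} → x ≋ℚ y → l ∙ x ≡ l ∙ y
  ∙-cong l x≋y = ℚSum.sum-cong λ s → cong (ℤ→ℚ (l s) *_) (x≋y s)

  ∙-scale : ∀ {m} (l : Pt m) k (x : QPt m) → l ∙ (λ s → k * x s) ≡ k * (l ∙ x)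
  ∙-scale l k x = trans (ℚSum.sum-cong λ s → x∙yz≈y∙xz (ℤ→ℚ (l s)) k (x s))
    (sym (ℚSum.*-distribˡ-sum k λ s → ℤ→ℚ (l s) * x s))

  ∙-difference : ∀ {m} (l : Pt m) (x y : QPt m) → l ∙ (λ s → x s - y s) ≡ l ∙ x - l ∙ y
  ∙-difference l x y = begin
    l ∙ (λ s → x s - y s)    ≡⟨ ℚSum.sum-cong (λ s → distribute (ℤ→ℚ (l s)) (x s) (y s)) ⟩
    sumℚ (λ s → ℤ→ℚ (l s) * x s + - 1ℚ * (ℤ→ℚ (l s) * y s))
      ≡⟨ ℚSum.sum-distrib-+ (λ s → ℤ→ℚ (l s) * x s) (λ s → - 1ℚ * (ℤ→ℚ (l s) * y s)) ⟩
    l ∙ x + sumℚ (λ s → - 1ℚ * (ℤ→ℚ (l s) * y s))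
      ≡⟨ cong (λ z → l ∙ x + z) (sym (ℚSum.*-distribˡ-sum (- 1ℚ) λ s → ℤ→ℚ (l s) * y s)) ⟩
    l ∙ x + - 1ℚ * (l ∙ y)   ≡⟨ cong (λ z → l ∙ x + z) (negate (l ∙ y)) ⟩
    l ∙ x - l ∙ y ∎
    where
    open ≡-Reasoning
    distribute : ∀ l x y → l * (x - y) ≡ l * x + - 1ℚ * (l * y)
    distribute = solve-∀ ringℚ
    negate : ∀ x → - 1ℚ * x ≡ - x
    negate = solve-∀ ringℚ

  AffIndep⇒ℤ : ∀ {n m} {p : Fin n → Pt m} → AffIndep p → (c : Fin n → ℤ) → sumℤ c ≡ + 0 → (∀ s → combℤ c p s ≡ + 0) →
    ∀ i → c i ≡ + 0
  AffIndep⇒ℤ {p = p} indep c ∑c≡0 ∑cp≡0 i = ℤ→ℚ-injective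
    (indep (λ i → ℤ→ℚ (c i)) (trans (sym (ℤ→ℚ-sum c)) (cong ℤ→ℚ ∑c≡0))
    (λ s → trans (sym (ℤ→ℚ-∙ c (λ i → p i s))) (cong ℤ→ℚ (∑cp≡0 s))) i)

  record Cleared {m} (x : QPt m) : Set where
    field
      denominator-1 : ℕ
      numerator     : Pt m

    denominator : ℚ
    denominator = ℤ→ℚ (+ suc denominator-1)

    field
      cleared : ∀ s → denominator * x s ≡ ℤ→ℚ (numerator s)

  clear-denominators : ∀ {m} (x : QPt m) → Cleared x
  clear-denominators {zero}  x = record { denominator-1 = 0 ; numerator = λ () ; cleared = λ () }
  clear-denominators {suc m} x = record
    { denominator-1 = D′ ℕ.+ D ℕ.* suc D′
    ; numerator     = λ { zero → + suc D′ ℤ.* ↥ x zero ; (suc s) → + suc D ℤ.* numerator s }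
    ; cleared       = λ
      { zero    → begin
          ℤ→ℚ (+ suc D ℤ.* + suc D′) * x zero      ≡⟨ cong (_* x zero) (ℤ→ℚ-* (+ suc D) (+ suc D′)) ⟩
          ℤ→ℚ (+ suc D) * denominator * x zero     ≡⟨ xy∙z≈y∙xz (ℤ→ℚ (+ suc D)) denominator (x zero) ⟩
          denominator * (ℤ→ℚ (+ suc D) * x zero)   ≡⟨ cong (denominator *_) (numerator-of (x zero)) ⟩
          denominator * ℤ→ℚ (↥ x zero)             ≡⟨ ℤ→ℚ-* (+ suc D′) (↥ x zero) ⟨
          ℤ→ℚ (+ suc D′ ℤ.* ↥ x zero) ∎
      ; (suc s) → begin
          ℤ→ℚ (+ suc D ℤ.* + suc D′) * x (suc s)      ≡⟨ cong (_* x (suc s)) (ℤ→ℚ-* (+ suc D) (+ suc D′)) ⟩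
          ℤ→ℚ (+ suc D) * denominator * x (suc s)     ≡⟨ *-assoc (ℤ→ℚ (+ suc D)) denominator (x (suc s)) ⟩
          ℤ→ℚ (+ suc D) * (denominator * x (suc s))   ≡⟨ cong (ℤ→ℚ (+ suc D) *_) (cleared s) ⟩
          ℤ→ℚ (+ suc D) * ℤ→ℚ (numerator s)           ≡⟨ ℤ→ℚ-* (+ suc D) (numerator s) ⟨
          ℤ→ℚ (+ suc D ℤ.* numerator s) ∎
      }
    }
    where
    open ≡-Reasoning
    open Cleared (clear-denominators (λ s → x (suc s)))
    D D′ : ℕ
    D  = ℚ.denominator-1 (x zero)
    D′ = denominator-1
    /-cancel : ∀ p d → (p / suc d) * (+ suc d / 1) ≡ p / 1
    /-cancel p d = toℚᵘ-injective (ℚᵘ.≃-trans (toℚᵘ-homo-* (p / suc d) (+ suc d / 1))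
      (ℚᵘ.≃-trans (ℚᵘ.*-cong (toℚᵘ-fromℚᵘ (ℚᵘ.mkℚᵘ p d)) (toℚᵘ-fromℚᵘ (ℚᵘ.mkℚᵘ (+ suc d) 0)))
      (ℚᵘ.≃-trans (ℚᵘ.*≡* {ℚᵘ.mkℚᵘ p d ℚᵘ.* ℚᵘ.mkℚᵘ (+ suc d) 0} {ℚᵘ.mkℚᵘ p 0} cross-multiplied)
        (ℚᵘ.≃-sym (toℚᵘ-fromℚᵘ (ℚᵘ.mkℚᵘ p 0))))))
      where
      cross-multiplied : p ℤ.* + suc d ℤ.* + 1 ≡ p ℤ.* + (suc d ℕ.* 1)
      cross-multiplied = trans (ℤ.*-identityʳ (p ℤ.* + suc d)) (cong (λ k → p ℤ.* + k) (sym (ℕ.*-identityʳ (suc d))))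
    numerator-of : ∀ q → ℤ→ℚ (↧ q) * q ≡ ℤ→ℚ (↥ q)
    numerator-of q = begin
      ℤ→ℚ (↧ q) * q              ≡⟨ cong (ℤ→ℚ (↧ q) *_) (sym (↥p/↧p≡p q)) ⟩
      ℤ→ℚ (↧ q) * (↥ q / ↧ₙ q)   ≡⟨ *-comm (ℤ→ℚ (↧ q)) (↥ q / ↧ₙ q) ⟩
      (↥ q / ↧ₙ q) * ℤ→ℚ (↧ q)   ≡⟨ /-cancel (↥ q) (ℚ.denominator-1 q) ⟩
      ℤ→ℚ (↥ q) ∎

  ∙-cleared : ∀ {m} (l : Pt m) {x : QPt m} (c : Cleared x) →
              Cleared.denominator c * (l ∙ x) ≡ ℤ→ℚ (sumℤ λ s → l s ℤ.* Cleared.numerator c s)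
  ∙-cleared l {x} c = trans (sym (∙-scale l denominator x)) (trans (∙-cong l cleared) (sym (ℤ→ℚ-∙ l numerator)))
    where open Cleared c

module AffineFunctional where

  open import Data.Bool using (if_then_else_)
  open import Data.Fin using (Fin; zero; suc)
  open import Data.Fin.Properties using (_≟_)
  open import Data.Integer.Base using (ℤ; +_; _+_; _*_; _-_; -_)
  open import Data.Integer.Properties using (+-identityʳ; *-comm; *-zeroˡ; *-zeroʳ; *-identityʳ; i-j≡0⇒i≡j;
    *-commutativeSemigroup)
  open import Algebra.Properties.CommutativeSemigroup *-commutativeSemigroup using (x∙yz≈y∙xz)
  open import Data.Integer.Tactic.RingSolver using (solve-∀)
  open import Data.Product using (proj₁; proj₂)
  open import Relation.Binary.PropositionalEquality using (_≡_; _≢_; refl; sym; trans; cong; cong₂;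
    module ≡-Reasoning)
  open import Relation.Nullary using (yes; no)
  open import Relation.Nullary.Decidable using (dec-true; dec-false)
  open import Defs
  open FiniteSum
  open ℤSum

  unitVec-same : ∀ {r} (i : Fin r) → unitVec i i ≡ + 1
  unitVec-same i = cong (if_then + 1 else + 0) (dec-true (i ≟ i) refl)

  unitVec-other : ∀ {r} {i t : Fin r} → i ≢ t → unitVec i t ≡ + 0
  unitVec-other {i = i} {t} i≢t = cong (if_then + 1 else + 0) (dec-false (i ≟ t) i≢t)

  unitVec-injective : ∀ {q r} {f : Fin q → Fin r} → (∀ {i j} → f i ≡ f j → i ≡ j) → ∀ i t →
    unitVec (f i) (f t) ≡ unitVec i t
  unitVec-injective {f = f} injective i t with i ≟ t
  ... | yes refl = unitVec-same (f i)
  ... | no i≢t   = unitVec-other λ fi≡ft → i≢t (injective fi≡ft)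

  unitVec-sym : ∀ {r} (i t : Fin r) → unitVec i t ≡ unitVec t i
  unitVec-sym i t with i ≟ t
  ... | yes refl = sym (unitVec-same i)
  ... | no i≢t   = sym (unitVec-other λ t≡i → i≢t (sym t≡i))

  sum-unitVec : ∀ {n} (f : Fin n → ℤ) j → sumℤ (λ i → f i * unitVec i j) ≡ f j
  sum-unitVec f j = trans (sum-single j λ i i≢j → trans (cong (f i *_) (unitVec-other i≢j)) (*-zeroʳ (f i)))
    (trans (cong (f j *_) (unitVec-same j)) (*-identityʳ (f j)))

  -- The integral affine functional z ↦ c + Σ ℓ z, homogenised: it takes the value c t + Σ ℓ z at (z, t).
  record Functional (m : ℕ) : Set where
    constructor functional
    field
      const  : ℤ
      linear : Pt m

    _⟨_,_⟩ : Pt m → ℤ → ℤ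
    _⟨_,_⟩ z t = const * t + sumℤ (λ s → linear s * z s)

  open Functional public

  value-cong : ∀ {m} (f : Functional m) {z z′ t} → (∀ s → z s ≡ z′ s) → f ⟨ z , t ⟩ ≡ f ⟨ z′ , t ⟩
  value-cong f {t = t} z≡z′ = cong (λ y → const f * t + y) (sum-cong λ s → cong (linear f s *_) (z≡z′ s))

  value-scale : ∀ {m} (f : Functional m) c z t → f ⟨ (λ s → c * z s) , c * t ⟩ ≡ c * (f ⟨ z , t ⟩)
  value-scale f c z t = trans
    (cong₂ _+_ (x∙yz≈y∙xz (const f) c t) (trans (sum-cong λ s → x∙yz≈y∙xz (linear f s) c (z s))
      (sym (*-distribˡ-sum c λ s → linear f s * z s))))
    (factor c (const f * t) (sumℤ λ s → linear f s * z s))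
    where
    factor : ∀ c a b → c * a + c * b ≡ c * (a + b)
    factor = solve-∀

  constant : ∀ {m} → ℤ → Functional m
  constant c = functional c (λ _ → + 0)

  constant-value : ∀ {m} c (z : Pt m) t → constant c ⟨ z , t ⟩ ≡ c * t
  constant-value c z t = trans (cong (λ y → c * t + y) (sum-zero λ s → *-zeroˡ (z s))) (+-identityʳ (c * t))

  infixl 6 _⊕_
  infixr 7 _⊙_

  _⊕_ : ∀ {m} → Functional m → Functional m → Functional m
  f ⊕ g = functional (const f + const g) (λ s → linear f s + linear g s)

  ⊕-value : ∀ {m} (f g : Functional m) z t → (f ⊕ g) ⟨ z , t ⟩ ≡ f ⟨ z , t ⟩ + g ⟨ z , t ⟩
  ⊕-value f g z t = trans
    (cong (λ y → (const f + const g) * t + y)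
      (trans (sum-cong λ s → distribute (linear f s) (linear g s) (z s)) (sum-distrib-+ (λ s → linear f s * z s)
        (λ s → linear g s * z s))))
    (rearrange (const f) (const g) t (sumℤ λ s → linear f s * z s) (sumℤ λ s → linear g s * z s))
    where
    distribute : ∀ a b z → (a + b) * z ≡ a * z + b * z
    distribute = solve-∀
    rearrange : ∀ a b t x y → (a + b) * t + (x + y) ≡ a * t + x + (b * t + y)
    rearrange = solve-∀

  _⊙_ : ∀ {m} → ℤ → Functional m → Functional m
  c ⊙ f = functional (c * const f) (λ s → c * linear f s)

  ⊙-value : ∀ {m} c (f : Functional m) z t → (c ⊙ f) ⟨ z , t ⟩ ≡ c * (f ⟨ z , t ⟩)
  ⊙-value c f z t = trans
    (cong (λ y → c * const f * t + y) (trans (sum-cong λ s → assoc c (linear f s) (z s))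
      (sym (*-distribˡ-sum c λ s → linear f s * z s))))
    (factor c (const f) t (sumℤ λ s → linear f s * z s))
    where
    assoc : ∀ c a z → c * a * z ≡ c * (a * z)
    assoc = solve-∀
    factor : ∀ c a t x → c * a * t + c * x ≡ c * (a * t + x)
    factor = solve-∀

  sumᶠ : ∀ {m n} → (Fin n → Functional m) → Functional m
  sumᶠ {n = 0}     f = constant (+ 0)
  sumᶠ {n = suc n} f = f zero ⊕ sumᶠ (λ i → f (suc i))

  sumᶠ-value : ∀ {m n} (f : Fin n → Functional m) z t → sumᶠ f ⟨ z , t ⟩ ≡ sumℤ (λ i → f i ⟨ z , t ⟩)
  sumᶠ-value {n = 0}     f z t = constant-value (+ 0) z t
  sumᶠ-value {n = suc n} f z t = trans (⊕-value (f zero) (sumᶠ (λ i → f (suc i))) z t)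
    (cong (λ y → f zero ⟨ z , t ⟩ + y) (sumᶠ-value (λ i → f (suc i)) z t))

  module LatticeBasis {m} (b : Fin m → Pt m) (basis : IsLatticeBasis b) where

    dual : Fin m → Pt m
    dual x t = proj₁ (proj₁ basis (unitVec t)) x

    coordinate : Fin m → Pt m → ℤ
    coordinate x z = sumℤ (λ t → dual x t * z t)

    coordinate-expand : ∀ z s → sumℤ (λ x → coordinate x z * b x s) ≡ z s
    coordinate-expand z s = begin
      sumℤ (λ x → coordinate x z * b x s)
        ≡⟨ sum-cong (λ x → trans (*-comm (coordinate x z) (b x s))
           (cong (b x s *_) (sum-cong λ t → *-comm (dual x t) (z t)))) ⟩
      sumℤ (λ x → b x s * sumℤ (λ t → z t * dual x t))   ≡⟨ sum-bilinear (λ x → b x s) z dual ⟩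
      sumℤ (λ t → z t * sumℤ (λ x → b x s * dual x t))
        ≡⟨ sum-cong (λ t → cong (z t *_) (trans (sum-cong λ x → *-comm (b x s) (dual x t))
           (proj₂ (proj₁ basis (unitVec t)) s))) ⟩
      sumℤ (λ t → z t * unitVec t s)                     ≡⟨ sum-unitVec z s ⟩
      z s ∎
      where open ≡-Reasoning

    coordinate-basis : ∀ x y → coordinate x (b y) ≡ unitVec y x
    coordinate-basis x y = i-j≡0⇒i≡j (coordinate x (b y)) (unitVec y x)
      (proj₂ basis (λ x → coordinate x (b y) - unitVec y x) (λ s → begin
      sumℤ (λ x → (coordinate x (b y) - unitVec y x) * b x s)
        ≡⟨ sum-cong (λ x → distribute (coordinate x (b y)) (unitVec y x) (b x s)) ⟩
      sumℤ (λ x → coordinate x (b y) * b x s + - (+ 1) * (b x s * unitVec y x))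
        ≡⟨ sum-distrib-+ (λ x → coordinate x (b y) * b x s) (λ x → - (+ 1) * (b x s * unitVec y x)) ⟩
      sumℤ (λ x → coordinate x (b y) * b x s) + sumℤ (λ x → - (+ 1) * (b x s * unitVec y x))
        ≡⟨ cong₂ _+_ (coordinate-expand (b y) s) (sym (*-distribˡ-sum (- (+ 1)) λ x → b x s * unitVec y x)) ⟩
      b y s + - (+ 1) * sumℤ (λ x → b x s * unitVec y x)
        ≡⟨ cong (λ v → b y s + - (+ 1) * v) (trans (sum-cong λ x → cong (b x s *_) (unitVec-sym y x))
           (sum-unitVec (λ x → b x s) y)) ⟩
      b y s + - (+ 1) * b y s   ≡⟨ cancel (b y s) ⟩
      + 0 ∎) x)
      where
      open ≡-Reasoning
      distribute : ∀ a b c → (a - b) * c ≡ a * c + - (+ 1) * (c * b)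
      distribute = solve-∀
      cancel : ∀ a → a + - (+ 1) * a ≡ + 0
      cancel = solve-∀

    coordinate-affine : ∀ {n} x z (c : Fin n → ℤ) p y q → (∀ s → z s ≡ combℤ c p s + y * q s) →
                        coordinate x z ≡ sumℤ (λ i → c i * coordinate x (p i)) + y * coordinate x q
    coordinate-affine x z c p y q z≡ = begin
      sumℤ (λ t → dual x t * z t)
        ≡⟨ sum-cong (λ t → trans (cong (dual x t *_) (z≡ t)) (distribute (dual x t) (combℤ c p t) y (q t))) ⟩
      sumℤ (λ t → dual x t * combℤ c p t + y * (dual x t * q t))
        ≡⟨ sum-distrib-+ (λ t → dual x t * combℤ c p t) (λ t → y * (dual x t * q t)) ⟩
      sumℤ (λ t → dual x t * combℤ c p t) + sumℤ (λ t → y * (dual x t * q t))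
        ≡⟨ cong₂ _+_ (sym (sum-bilinear c (dual x) p)) (sym (*-distribˡ-sum y λ t → dual x t * q t)) ⟩
      sumℤ (λ i → c i * coordinate x (p i)) + y * coordinate x q ∎
      where
      open ≡-Reasoning
      distribute : ∀ b u y q → b * (u + y * q) ≡ b * u + y * (b * q)
      distribute = solve-∀

module Frame where

  open import Data.Empty using (⊥-elim)
  open import Data.Fin using (Fin; punchIn; punchOut; inject₁; fromℕ)
  open import Data.Fin.Permutation using (Permutation; permutation; _⟨$⟩ʳ_)
  open import Data.Fin.Properties using (_≟_; any?; ¬∀⟶∃¬; injective⇒≤; punchIn-punchOut; punchOut-injective)
  open import Data.Fin.Relation.Unary.Top using (view; ‵fromℕ; ‵inject₁; view-fromℕ; view-inject₁)
  open import Data.Integer.Base using (ℤ; +_; _+_; _*_; _-_; -_)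
  open import Data.Integer.Properties using (+-identityʳ; +-identityˡ; *-zeroʳ; *-identityʳ)
  open import Data.Integer.Tactic.RingSolver using (solve-∀)
  open import Data.Product using (∃; _×_; _,_; proj₁; proj₂)
  open import Function.Definitions using (Injective)
  open import Relation.Binary.PropositionalEquality using (_≡_; _≢_; refl; sym; trans; cong; cong₂;
    module ≡-Reasoning)
  open import Relation.Nullary using (yes; no; ¬_)
  open import Defs
  open FiniteSum
  open AffineFunctional
  open ℤSum

  injective⇒surjective : ∀ {k} (f : Fin k → Fin k) → Injective _≡_ _≡_ f → ∀ y → ∃ λ x → f x ≡ y
  injective⇒surjective {suc k} f injective y with any? (λ x → f x ≟ y)
  ... | yes found = found
  ... | no missed = ⊥-elim (ℕ.1+n≰n (injective⇒≤ {f = λ x → punchOut (y≢f x)} λ {i} {j} eq →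
    injective (punchOut-injective (y≢f i) (y≢f j) eq)))
    where
    y≢f : ∀ x → y ≢ f x
    y≢f x y≡fx = missed (x , sym y≡fx)

  -- An injection Fin k → Fin (k + 1) is, up to a permutation of Fin k, the one that skips the index it misses.
  record Skipping {k} (ι : Fin k → Fin (suc k)) : Set where
    field
      skipped          : Fin (suc k)
      avoids           : ∀ i → ι i ≢ skipped
      permuted         : Permutation k k
      punchIn-permuted : ∀ i → punchIn skipped (permuted ⟨$⟩ʳ i) ≡ ι i

  skipping : ∀ {k} (ι : Fin k → Fin (suc k)) → Injective _≡_ _≡_ ι → Skipping ι
  skipping {k} ι injective = record
    { skipped          = proj₁ missed
    ; avoids           = avoids
    ; permuted         = permutation f f⁻¹ f-f⁻¹ (λ x → f-injective (f-f⁻¹ (f x)))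
    ; punchIn-permuted = λ i → punchIn-punchOut (skipped≢ι i)
    }
    where
    missed : ∃ λ j → ¬ (∃ λ i → ι i ≡ j)
    missed = ¬∀⟶∃¬ (suc k) (λ j → ∃ λ i → ι i ≡ j) (λ j → any? λ i → ι i ≟ j) λ all →
      ℕ.1+n≰n (injective⇒≤ {f = λ j → proj₁ (all j)}
      λ {x} {y} eq → trans (sym (proj₂ (all x))) (trans (cong ι eq) (proj₂ (all y))))
    avoids : ∀ i → ι i ≢ proj₁ missed
    avoids i ιi≡ = proj₂ missed (i , ιi≡)
    skipped≢ι : ∀ i → proj₁ missed ≢ ι i
    skipped≢ι i ≡ιi = avoids i (sym ≡ιi)
    f : Fin k → Fin k
    f i = punchOut (skipped≢ι i)
    f-injective : Injective _≡_ _≡_ f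
    f-injective {x} {y} eq = injective (punchOut-injective (skipped≢ι x) (skipped≢ι y) eq)
    f⁻¹ : Fin k → Fin k
    f⁻¹ y = proj₁ (injective⇒surjective f f-injective y)
    f-f⁻¹ : ∀ y → f (f⁻¹ y) ≡ y
    f-f⁻¹ y = proj₂ (injective⇒surjective f f-injective y)

  snoc : ∀ {A : Set} {k} → (Fin k → A) → A → Fin (suc k) → A
  snoc f x l with view l
  ... | ‵fromℕ     = x
  ... | ‵inject₁ i = f i

  snoc-inject₁ : ∀ {A : Set} {k} (f : Fin k → A) x i → snoc f x (inject₁ i) ≡ f i
  snoc-inject₁ f x i rewrite view-inject₁ i = refl

  snoc-fromℕ : ∀ {A : Set} {k} (f : Fin k → A) x → snoc f x (fromℕ k) ≡ x
  snoc-fromℕ {k = k} f x rewrite view-fromℕ k = refl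

  -- The lattice basis given by a basic simplex w, in homogenised coordinates: (z , t) = Σ Qᵢ (wᵢ , 1) + L (normal , 0).
  record AffineFrame {k} (w : Fin (suc k) → Pt (suc k)) : Set where
    field
      normal : Pt (suc k)
      Q      : Fin (suc k) → Functional (suc k)
      L      : Functional (suc k)
      total  : ∀ z t → sumℤ (λ l → Q l ⟨ z , t ⟩) ≡ t
      expand : ∀ z t s → combℤ (λ l → Q l ⟨ z , t ⟩) w s + (L ⟨ z , t ⟩) * normal s ≡ z s
      unique : ∀ z t x y → sumℤ x ≡ t → (∀ s → combℤ x w s + y * normal s ≡ z s) →
        (∀ l → Q l ⟨ z , t ⟩ ≡ x l) × L ⟨ z , t ⟩ ≡ y

  private
    module BasisFrame {k} (w : Fin (suc k) → Pt (suc k)) (b : Fin (suc k) → Pt (suc k)) (ι : Fin k → Fin (suc k))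
      (ι-injective : Injective _≡_ _≡_ ι) (basis : IsLatticeBasis b)
      (b-ι : ∀ i → b (ι i) ≡ λ t → w (inject₁ i) t - w (fromℕ k) t) where

      open LatticeBasis b basis
      open Skipping (skipping ι ι-injective)

      origin : Pt (suc k)
      origin = w (fromℕ k)

      shift : Pt (suc k) → ℤ → Pt (suc k)
      shift z t s = z s - t * origin s

      centred : Fin (suc k) → Functional (suc k)
      centred x = functional (- coordinate x origin) (dual x)

      lastQ : Functional (suc k)
      lastQ = constant (+ 1) ⊕ - (+ 1) ⊙ sumᶠ (λ i → centred (ι i))

      Q : Fin (suc k) → Functional (suc k)
      Q = snoc (λ i → centred (ι i)) lastQ

      centred-value : ∀ x z t → centred x ⟨ z , t ⟩ ≡ coordinate x (shift z t)
      centred-value x z t = sym (begin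
        sumℤ (λ s → dual x s * (z s - t * origin s))
          ≡⟨ sum-cong (λ s → distribute (dual x s) (z s) t (origin s)) ⟩
        sumℤ (λ s → dual x s * z s + - t * (dual x s * origin s))
          ≡⟨ sum-distrib-+ (λ s → dual x s * z s) (λ s → - t * (dual x s * origin s)) ⟩
        sumℤ (λ s → dual x s * z s) + sumℤ (λ s → - t * (dual x s * origin s))
          ≡⟨ cong (λ v → sumℤ (λ s → dual x s * z s) + v) (sym (*-distribˡ-sum (- t) λ s → dual x s * origin s)) ⟩
        sumℤ (λ s → dual x s * z s) + - t * coordinate x origin
          ≡⟨ reorder (sumℤ (λ s → dual x s * z s)) t (coordinate x origin) ⟩
        centred x ⟨ z , t ⟩ ∎)
        where
        open ≡-Reasoning
        distribute : ∀ d z t p → d * (z - t * p) ≡ d * z + - t * (d * p)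
        distribute = solve-∀
        reorder : ∀ a t b → a + - t * b ≡ - b * t + a
        reorder = solve-∀

      Q-inject₁ : ∀ i z t → Q (inject₁ i) ⟨ z , t ⟩ ≡ centred (ι i) ⟨ z , t ⟩
      Q-inject₁ i z t = cong (_⟨ z , t ⟩) (snoc-inject₁ (λ i → centred (ι i)) lastQ i)

      lastQ-value : ∀ z t → lastQ ⟨ z , t ⟩ ≡ t - sumℤ (λ i → centred (ι i) ⟨ z , t ⟩)
      lastQ-value z t = begin
        lastQ ⟨ z , t ⟩
          ≡⟨ ⊕-value (constant (+ 1)) (- (+ 1) ⊙ sumᶠ (λ i → centred (ι i))) z t ⟩
        constant (+ 1) ⟨ z , t ⟩ + (- (+ 1) ⊙ sumᶠ (λ i → centred (ι i))) ⟨ z , t ⟩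
          ≡⟨ cong₂ _+_ (constant-value (+ 1) z t)
               (trans (⊙-value (- (+ 1)) (sumᶠ (λ i → centred (ι i))) z t)
                 (cong (- (+ 1) *_) (sumᶠ-value (λ i → centred (ι i)) z t))) ⟩
        + 1 * t + - (+ 1) * sumℤ (λ i → centred (ι i) ⟨ z , t ⟩)
          ≡⟨ simplify t (sumℤ (λ i → centred (ι i) ⟨ z , t ⟩)) ⟩
        t - sumℤ (λ i → centred (ι i) ⟨ z , t ⟩) ∎
        where
        open ≡-Reasoning
        simplify : ∀ t x → + 1 * t + - (+ 1) * x ≡ t - x
        simplify = solve-∀

      sum-basis : ∀ (F : Fin (suc k) → ℤ) → sumℤ F ≡ F skipped + sumℤ (λ i → F (ι i))
      sum-basis F = trans (sum-remove skipped F) (cong (λ v → F skipped + v)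
        (trans (sum-permute (λ i → F (punchIn skipped i)) permuted) (sum-cong λ i → cong F (punchIn-permuted i))))

      edges : (Fin (suc k) → ℤ) → Pt (suc k)
      edges x = combℤ (λ i → x (inject₁ i)) (λ i → b (ι i))

      comb-edges : ∀ x s → combℤ x w s ≡ edges x s + sumℤ x * origin s
      comb-edges x s = begin
        combℤ x w s
          ≡⟨ sum-init-last (λ l → x l * w l s) ⟩
        sumℤ (λ i → x (inject₁ i) * w (inject₁ i) s) + x (fromℕ k) * origin s
          ≡⟨ cong (λ v → v + x (fromℕ k) * origin s) (trans (sum-cong λ i → trans (cong (x (inject₁ i) *_) (w≡ i))
             (distribute (x (inject₁ i)) (b (ι i) s) (origin s)))
               (sum-distrib-+ (λ i → x (inject₁ i) * b (ι i) s) (λ i → x (inject₁ i) * origin s))) ⟩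
        edges x s + sumℤ (λ i → x (inject₁ i) * origin s) + x (fromℕ k) * origin s
          ≡⟨ cong (λ v → edges x s + v + x (fromℕ k) * origin s)
             (sym (*-distribʳ-sum (origin s) λ i → x (inject₁ i))) ⟩
        edges x s + sumℤ (λ i → x (inject₁ i)) * origin s + x (fromℕ k) * origin s
          ≡⟨ factor (edges x s) (sumℤ λ i → x (inject₁ i)) (origin s) (x (fromℕ k)) ⟩
        edges x s + (sumℤ (λ i → x (inject₁ i)) + x (fromℕ k)) * origin s
          ≡⟨ cong (λ v → edges x s + v * origin s) (sym (sum-init-last x)) ⟩
        edges x s + sumℤ x * origin s ∎
        where
        open ≡-Reasoning
        restore : ∀ a b → a ≡ a - b + b
        restore = solve-∀
        w≡ : ∀ i → w (inject₁ i) s ≡ b (ι i) s + origin s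
        w≡ i = trans (restore (w (inject₁ i) s) (origin s)) (cong (λ u → u s + origin s) (sym (b-ι i)))
        distribute : ∀ x b p → x * (b + p) ≡ x * b + x * p
        distribute = solve-∀
        factor : ∀ c a p l → c + a * p + l * p ≡ c + (a + l) * p
        factor = solve-∀

      total : ∀ z t → sumℤ (λ l → Q l ⟨ z , t ⟩) ≡ t
      total z t = trans (sum-init-last (λ l → Q l ⟨ z , t ⟩))
        (trans (cong₂ _+_ (sum-cong λ i → Q-inject₁ i z t) Q-fromℕ)
        (cancel (sumℤ λ i → centred (ι i) ⟨ z , t ⟩) t))
        where
        Q-fromℕ : Q (fromℕ k) ⟨ z , t ⟩ ≡ t - sumℤ (λ i → centred (ι i) ⟨ z , t ⟩)
        Q-fromℕ = trans (cong (_⟨ z , t ⟩) (snoc-fromℕ (λ i → centred (ι i)) lastQ)) (lastQ-value z t)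
        cancel : ∀ a t → a + (t - a) ≡ t
        cancel = solve-∀

      expand : ∀ z t s → combℤ (λ l → Q l ⟨ z , t ⟩) w s + (centred skipped ⟨ z , t ⟩) * b skipped s ≡ z s
      expand z t s = begin
        combℤ (λ l → Q l ⟨ z , t ⟩) w s + (centred skipped ⟨ z , t ⟩) * b skipped s
          ≡⟨ cong₂ _+_ (comb-edges (λ l → Q l ⟨ z , t ⟩) s) (cong (_* b skipped s) (centred-value skipped z t)) ⟩
        edges (λ l → Q l ⟨ z , t ⟩) s + sumℤ (λ l → Q l ⟨ z , t ⟩) * origin s + coordinate skipped d * b skipped s
          ≡⟨ cong₂ (λ u v → u + v * origin s + coordinate skipped d * b skipped s)
               (sum-cong λ i → cong (_* b (ι i) s) (trans (Q-inject₁ i z t) (centred-value (ι i) z t))) (total z t) ⟩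
        sumℤ (λ i → coordinate (ι i) d * b (ι i) s) + t * origin s + coordinate skipped d * b skipped s
          ≡⟨ reorder (sumℤ λ i → coordinate (ι i) d * b (ι i) s) (t * origin s) (coordinate skipped d * b skipped s) ⟩
        coordinate skipped d * b skipped s + sumℤ (λ i → coordinate (ι i) d * b (ι i) s) + t * origin s
          ≡⟨ cong (λ v → v + t * origin s) (trans (sym (sum-basis λ x → coordinate x d * b x s))
             (coordinate-expand d s)) ⟩
        z s - t * origin s + t * origin s
          ≡⟨ restore (z s) (t * origin s) ⟩
        z s ∎
        where
        open ≡-Reasoning
        d : Pt (suc k)
        d = shift z t
        reorder : ∀ a b c → a + b + c ≡ c + a + b
        reorder = solve-∀
        restore : ∀ a b → a - b + b ≡ a
        restore = solve-∀

      module Uniqueness (z : Pt (suc k)) (t : ℤ) (x : Fin (suc k) → ℤ) (y : ℤ) (∑x≡t : sumℤ x ≡ t)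
        (expansion : ∀ s → combℤ x w s + y * b skipped s ≡ z s) where

        shift≡ : ∀ s → shift z t s ≡ edges x s + y * b skipped s
        shift≡ s = begin
          z s - t * origin s   ≡⟨ cong (_- t * origin s) (sym (expansion s)) ⟩
          combℤ x w s + y * b skipped s - t * origin s
            ≡⟨ cong (λ v → v + y * b skipped s - t * origin s) (comb-edges x s) ⟩
          edges x s + sumℤ x * origin s + y * b skipped s - t * origin s
            ≡⟨ cong (λ v → edges x s + v * origin s + y * b skipped s - t * origin s) ∑x≡t ⟩
          edges x s + t * origin s + y * b skipped s - t * origin s
            ≡⟨ cancel (edges x s) (t * origin s) (y * b skipped s) ⟩
          edges x s + y * b skipped s ∎
          where
          open ≡-Reasoning
          cancel : ∀ c a b → c + a + b - a ≡ c + b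
          cancel = solve-∀

        centred≡ : ∀ u → centred u ⟨ z , t ⟩ ≡ sumℤ (λ i → x (inject₁ i) * unitVec (ι i) u) + y * unitVec skipped u
        centred≡ u = trans (centred-value u z t) (trans (coordinate-affine u (shift z t) (λ i → x (inject₁ i))
          (λ i → b (ι i)) y (b skipped) shift≡)
          (cong₂ (λ a c → a + y * c) (sum-cong λ i → cong (x (inject₁ i) *_) (coordinate-basis u (ι i)))
            (coordinate-basis u skipped)))

        centred-ι≡ : ∀ i → centred (ι i) ⟨ z , t ⟩ ≡ x (inject₁ i)
        centred-ι≡ i = trans (centred≡ (ι i)) (trans (cong₂ _+_
          (trans (sum-cong λ i′ → cong (x (inject₁ i′) *_) (unitVec-injective ι-injective i′ i))
            (sum-unitVec (λ i′ → x (inject₁ i′)) i))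
          (trans (cong (y *_) (unitVec-other λ skipped≡ι → avoids i (sym skipped≡ι))) (*-zeroʳ y)))
            (+-identityʳ (x (inject₁ i))))

        centred-skipped≡ : centred skipped ⟨ z , t ⟩ ≡ y
        centred-skipped≡ = trans (centred≡ skipped) (trans (cong₂ _+_
          (sum-zero λ i → trans (cong (x (inject₁ i) *_) (unitVec-other (avoids i))) (*-zeroʳ (x (inject₁ i))))
          (trans (cong (y *_) (unitVec-same skipped)) (*-identityʳ y))) (+-identityˡ y))

        Q≡ : ∀ l → Q l ⟨ z , t ⟩ ≡ x l
        Q≡ l with view l
        ... | ‵inject₁ i = centred-ι≡ i
        ... | ‵fromℕ     = begin
          lastQ ⟨ z , t ⟩   ≡⟨ lastQ-value z t ⟩
          t - sumℤ (λ i → centred (ι i) ⟨ z , t ⟩)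
            ≡⟨ cong₂ _-_ (trans (sym ∑x≡t) (sum-init-last x)) (sum-cong centred-ι≡) ⟩
          sumℤ (λ i → x (inject₁ i)) + x (fromℕ k) - sumℤ (λ i → x (inject₁ i))
            ≡⟨ cancel (sumℤ λ i → x (inject₁ i)) (x (fromℕ k)) ⟩
          x (fromℕ k) ∎
          where
          open ≡-Reasoning
          cancel : ∀ a b → a + b - a ≡ b
          cancel = solve-∀

      basisFrame : AffineFrame w
      basisFrame = record
        { normal = b skipped
        ; Q      = Q
        ; L      = centred skipped
        ; total  = total
        ; expand = expand
        ; unique = λ z t x y ∑x≡t expansion → Uniqueness.Q≡ z t x y ∑x≡t expansion , Uniqueness.centred-skipped≡ z t x
          y ∑x≡t expansion
        }

  abstract
    frame : ∀ {k} (w : Fin (suc k) → Pt (suc k)) → IsBasic w → AffineFrame w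
    frame w (_ , b , ι , ι-injective , basis , b-ι) = BasisFrame.basisFrame w b ι ι-injective basis b-ι

module LatticeQuotient where

  open import Data.Empty using (⊥-elim)
  open import Data.Fin using (Fin; zero; suc; punchIn; punchOut)
  open import Data.Fin.Properties using (_≟_; punchIn-punchOut)
  open import Data.Integer.Base using (ℤ; +_; -[1+_]; _+_; _*_; _-_; -_)
  open import Data.Integer.Divisibility.Signed using (_∣_; divides)
  open import Data.Integer.Properties using (*-zeroˡ; *-identityˡ; *-identityʳ; *-comm; *-assoc; +-identityˡ;
    neg-distribˡ-*; neg-distribʳ-*; +-0-abelianGroup)
  open import Algebra.Properties.AbelianGroup +-0-abelianGroup using (inverseʳ-unique)
  open import Data.Integer.Tactic.RingSolver using (solve-∀)
  open import Data.Product using (∃; _×_; _,_; proj₁; proj₂)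
  open import Relation.Binary.PropositionalEquality using (_≡_; _≢_; refl; sym; trans; cong; cong₂; subst;
    module ≡-Reasoning)
  open import Relation.Nullary using (yes; no)
  open import Defs
  open FiniteSum
  open RationalPoints using (AffIndep⇒ℤ)
  open AffineFunctional
  open Frame
  open ℤSum

  -- ℤ^m is spanned by the vertices and Γ, and nΓ = Σ aᵢ vᵢ: modulo the vertex lattice, ℤ^m is cyclic of order n.
  record CyclicQuotient {m} (v : Fin (suc m) → Pt m) : Set where
    field
      n-1    : ℕ
      a      : Fin (suc m) → ℤ
      a-zero : a zero ≡ + 1
      a-sum  : sumℤ a ≡ + 0
      Γ      : Pt m
      nΓ     : ∀ s → + suc n-1 * Γ s ≡ combℤ a v s
      q      : Fin (suc m) → Functional m
      L      : Functional m
      q-zero : ∀ z t → q zero ⟨ z , t ⟩ ≡ + 0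
      total  : ∀ z t → sumℤ (λ i → q i ⟨ z , t ⟩) ≡ t
      expand : ∀ z t s → combℤ (λ i → q i ⟨ z , t ⟩) v s + (L ⟨ z , t ⟩) * Γ s ≡ z s
      unique : ∀ z t x y → x zero ≡ + 0 → sumℤ x ≡ t → (∀ s → combℤ x v s + y * Γ s ≡ z s) →
        (∀ i → q i ⟨ z , t ⟩ ≡ x i) × L ⟨ z , t ⟩ ≡ y

  sign-magnitude : ∀ h → h ≢ + 0 → ∃ λ n → ∃ λ ε → h ≡ + suc n * ε × ε * ε ≡ + 1
  sign-magnitude (+ zero)   h≢0 = ⊥-elim (h≢0 refl)
  sign-magnitude (+ suc n)  h≢0 = n , + 1 , sym (*-identityʳ (+ suc n)) , refl
  sign-magnitude (-[1+ n ]) h≢0 = n , - (+ 1) , negate (+ suc n) , refl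
    where
    negate : ∀ x → - x ≡ x * - (+ 1)
    negate = solve-∀

  module _ {k} (v : Fin (suc (suc k)) → Pt (suc k)) (indep : AffIndep v) (basic : IsBasic (λ i → v (suc i))) where

    private
      open module F = AffineFrame (frame (λ i → v (suc i)) basic) using (Q; normal)

      facet : Fin (suc k) → Pt (suc k)
      facet i = v (suc i)

      apex : Fin (suc k) → ℤ
      apex i = Q i ⟨ v zero , + 1 ⟩

      height : ℤ
      height = F.L ⟨ v zero , + 1 ⟩

      a : Fin (suc (suc k)) → ℤ
      a zero    = + 1
      a (suc i) = - (+ 1) * apex i

      a-sum : sumℤ a ≡ + 0
      a-sum = cong (λ x → + 1 + x) (trans (sym (*-distribˡ-sum (- (+ 1)) apex))
        (cong (- (+ 1) *_) (F.total (v zero) (+ 1))))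

      comb-a : ∀ s → combℤ a v s ≡ height * normal s
      comb-a s = begin
        + 1 * v zero s + sumℤ (λ i → - (+ 1) * apex i * facet i s)
          ≡⟨ cong₂ _+_ (*-identityˡ (v zero s)) (trans (sum-cong λ i → *-assoc (- (+ 1)) (apex i) (facet i s))
             (sym (*-distribˡ-sum (- (+ 1)) λ i → apex i * facet i s))) ⟩
        v zero s + - (+ 1) * combℤ apex facet s
          ≡⟨ cong (λ x → x + - (+ 1) * combℤ apex facet s) (sym (F.expand (v zero) (+ 1) s)) ⟩
        combℤ apex facet s + height * normal s + - (+ 1) * combℤ apex facet s
          ≡⟨ cancel (combℤ apex facet s) (height * normal s) ⟩
        height * normal s ∎
        where
        open ≡-Reasoning
        cancel : ∀ c h → c + h + - (+ 1) * c ≡ h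
        cancel = solve-∀

      height≢0 : height ≢ + 0
      height≢0 h≡0 = 1≢0 (AffIndep⇒ℤ {p = v} indep a a-sum
        (λ s → trans (comb-a s) (trans (cong (_* normal s) h≡0) (*-zeroˡ (normal s)))) zero)
        where
        1≢0 : + 1 ≢ + 0
        1≢0 ()

      module _ (n-1 : ℕ) (ε : ℤ) (height≡ : height ≡ + suc n-1 * ε) (ε*ε≡1 : ε * ε ≡ + 1) where

        Γ : Pt (suc k)
        Γ s = ε * normal s

        q : Fin (suc (suc k)) → Functional (suc k)
        q zero    = constant (+ 0)
        q (suc i) = Q i

        L : Functional (suc k)
        L = ε ⊙ F.L

        q-zero : ∀ z t → q zero ⟨ z , t ⟩ ≡ + 0
        q-zero z t = trans (constant-value (+ 0) z t) (*-zeroˡ t)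

        ε-cancel : ∀ x → ε * (ε * x) ≡ x
        ε-cancel x = trans (sym (*-assoc ε ε x)) (trans (cong (_* x) ε*ε≡1) (*-identityˡ x))

        L*Γ : ∀ z t s → (L ⟨ z , t ⟩) * Γ s ≡ (F.L ⟨ z , t ⟩) * normal s
        L*Γ z t s = begin
          (L ⟨ z , t ⟩) * (ε * normal s)           ≡⟨ cong (_* (ε * normal s)) (⊙-value ε F.L z t) ⟩
          ε * (F.L ⟨ z , t ⟩) * (ε * normal s)     ≡⟨ regroup ε (F.L ⟨ z , t ⟩) (normal s) ⟩
          ε * (ε * ((F.L ⟨ z , t ⟩) * normal s))   ≡⟨ ε-cancel ((F.L ⟨ z , t ⟩) * normal s) ⟩
          (F.L ⟨ z , t ⟩) * normal s ∎
          where
          open ≡-Reasoning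
          regroup : ∀ e x y → e * x * (e * y) ≡ e * (e * (x * y))
          regroup = solve-∀

        drop-zero : ∀ {x} y u → x ≡ + 0 → x * y + u ≡ u
        drop-zero y u refl = trans (cong (_+ u) (*-zeroˡ y)) (+-identityˡ u)

        unique : ∀ z t x y → x zero ≡ + 0 → sumℤ x ≡ t → (∀ s → combℤ x v s + y * Γ s ≡ z s) →
          (∀ i → q i ⟨ z , t ⟩ ≡ x i) × L ⟨ z , t ⟩ ≡ y
        unique z t x y x₀≡0 ∑x≡t expansion =
          (λ { zero → trans (q-zero z t) (sym x₀≡0) ; (suc i) → proj₁ facet-unique i }) ,
          trans (⊙-value ε F.L z t) (trans (cong (ε *_) (proj₂ facet-unique)) (ε-cancel y))
          where
          swap : ∀ e y b → e * y * b ≡ y * (e * b)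
          swap = solve-∀
          facet-unique : (∀ i → Q i ⟨ z , t ⟩ ≡ x (suc i)) × F.L ⟨ z , t ⟩ ≡ ε * y
          facet-unique = F.unique z t (λ i → x (suc i)) (ε * y)
            (trans (sym (trans (cong (_+ sumℤ (λ i → x (suc i))) x₀≡0) (+-identityˡ _))) ∑x≡t)
            (λ s → trans (cong₂ _+_ (sym (drop-zero (v zero s) (combℤ (λ i → x (suc i)) facet s) x₀≡0))
              (swap ε y (normal s))) (expansion s))

        quotient : CyclicQuotient v
        quotient = record
          { n-1 = n-1 ; a = a ; a-zero = refl ; a-sum = a-sum ; Γ = Γ ; q = q ; L = L ; q-zero = q-zero ;
            unique = unique
          ; nΓ     = λ s → trans (sym (*-assoc (+ suc n-1) ε (normal s))) (trans (cong (_* normal s) (sym height≡))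
            (sym (comb-a s)))
          ; total  = λ z t → trans (cong₂ _+_ (q-zero z t) (F.total z t)) (+-identityˡ t)
          ; expand = λ z t s → trans
              (cong₂ _+_ (drop-zero (v zero s) (combℤ (λ i → Q i ⟨ z , t ⟩) facet s) (q-zero z t)) (L*Γ z t s))
                (F.expand z t s)
          }

    cyclicQuotient : CyclicQuotient v
    cyclicQuotient = let n-1 , ε , height≡ , ε*ε≡1 = sign-magnitude height height≢0 in quotient n-1 ε height≡ ε*ε≡1

  module Divisibility {k} (v : Fin (suc (suc k)) → Pt (suc k)) (basic : ∀ j → IsBasic (λ i → v (punchIn j i)))
    (C : CyclicQuotient v) where

    open CyclicQuotient C

    n : ℤ
    n = + suc n-1

    private
      -- The lattice vector rΓ - c vⱼ lies in the span of the basic facet j, so its coordinates r aᵢ / n are integers.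
      module Facet (j : Fin (suc (suc k))) (r c : ℤ) (raⱼ≡cn : r * a j ≡ c * n) where

        w : Fin (suc k) → Pt (suc k)
        w i = v (punchIn j i)

        module F = AffineFrame (frame w (basic j))

        z : Pt (suc k)
        z s = r * Γ s - c * v j s

        x : Fin (suc k) → ℤ
        x l = r * a (punchIn j l)

        x-sum : sumℤ x ≡ n * (- c)
        x-sum = begin
          sumℤ x        ≡⟨ *-distribˡ-sum r (λ l → a (punchIn j l)) ⟨
          r * sumℤ (λ l → a (punchIn j l))
            ≡⟨ cong (r *_) (inverseʳ-unique (a j) (sumℤ λ l → a (punchIn j l)) (trans (sym (sum-remove j a)) a-sum)) ⟩
          r * - a j     ≡⟨ neg-distribʳ-* r (a j) ⟨
          - (r * a j)   ≡⟨ cong -_ raⱼ≡cn ⟩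
          - (c * n)     ≡⟨ trans (neg-distribˡ-* c n) (*-comm (- c) n) ⟩
          n * (- c) ∎
          where open ≡-Reasoning

        x-comb : ∀ s → combℤ x w s + + 0 * F.normal s ≡ n * z s
        x-comb s = begin
          combℤ x w s + + 0 * F.normal s    ≡⟨ add-and-subtract (combℤ x w s) (F.normal s) (r * a j * v j s) ⟩
          r * a j * v j s + combℤ x w s - r * a j * v j s
            ≡⟨ cong (_- r * a j * v j s) (sym (sum-remove j λ i → r * a i * v i s)) ⟩
          sumℤ (λ i → r * a i * v i s) - r * a j * v j s
            ≡⟨ cong₂ _-_ (trans (sum-cong λ i → *-assoc r (a i) (v i s)) (sym (*-distribˡ-sum r λ i → a i * v i s)))
               (cong (_* v j s) raⱼ≡cn) ⟩
          r * combℤ a v s - c * n * v j s   ≡⟨ cong (λ u → r * u - c * n * v j s) (sym (nΓ s)) ⟩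
          r * (n * Γ s) - c * n * v j s     ≡⟨ factor r n (Γ s) c (v j s) ⟩
          n * z s ∎
          where
          open ≡-Reasoning
          add-and-subtract : ∀ a b c → a + + 0 * b ≡ c + a - c
          add-and-subtract = solve-∀
          factor : ∀ r n g c v → r * (n * g) - c * n * v ≡ n * (r * g - c * v)
          factor = solve-∀

        n∣x : ∀ l → n ∣ x l
        n∣x l = divides (F.Q l ⟨ z , - c ⟩) (begin
          x l                                   ≡⟨ proj₁ (F.unique (λ s → n * z s) (n * - c) x (+ 0) x-sum x-comb) l ⟨
          F.Q l ⟨ (λ s → n * z s) , n * - c ⟩   ≡⟨ value-scale (F.Q l) n z (- c) ⟩
          n * (F.Q l ⟨ z , - c ⟩)               ≡⟨ *-comm n (F.Q l ⟨ z , - c ⟩) ⟩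
          (F.Q l ⟨ z , - c ⟩) * n ∎)
          where open ≡-Reasoning

      divides-all : ∀ j r → n ∣ r * a j → ∀ i → n ∣ r * a i
      divides-all j r n∣raⱼ@(divides c raⱼ≡cn) i with j ≟ i
      ... | yes refl = n∣raⱼ
      ... | no j≢i   = subst (λ i → n ∣ r * a i) (punchIn-punchOut j≢i) (Facet.n∣x j r c raⱼ≡cn (punchOut j≢i))

    divides-multiplier : ∀ j r → n ∣ r * a j → n ∣ r
    divides-multiplier j r n∣raⱼ = subst (n ∣_) (trans (cong (r *_) a-zero) (*-identityʳ r))
      (divides-all j r n∣raⱼ zero)

module DegreeBalance where

  open import Data.Fin using (Fin; zero; suc; punchIn)
  open import Data.Integer.Base as ℤ using (ℤ; +_; _+_; _*_; _-_; -_; +<+; +≤+)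
  open import Data.Integer.DivMod using (_/ℕ_; _%ℕ_; a≡a%ℕn+[a/ℕn]*n)
  open import Data.Integer.Divisibility.Signed using (_∣_; divides; ∣m∣n⇒∣m+n; ∣m∣n⇒∣m-n; ∣n⇒∣m*n; ∣m⇒∣m*n; ∣-refl;
    ∣⇒∣ᵤ)
  import Data.Integer.Properties as ℤ
  open import Data.Integer.Tactic.RingSolver using (solve-∀)
  open import Data.Nat.Coprimality using (Coprime)
  open import Data.Nat.Divisibility as ℕ using (n∣m⇒m%n≡0; ∣1⇒≡1; *-cancelˡ-∣)
  open import Data.Nat.DivMod using (m*n%n≡0; m%n<n)
  open import Data.Product using (∃; _×_; _,_; proj₁; proj₂)
  import Data.Rational as ℚ
  import Data.Rational.Properties as ℚ
  open import Relation.Binary.PropositionalEquality using (_≡_; _≢_; refl; sym; trans; cong; cong₂; subst;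
    module ≡-Reasoning)
  open import Relation.Nullary using (yes; no)
  import Tactic.RingSolver as ℚR
  open import Defs
  open Rationals using (ringℚ; inv; inv>0; *-inv⁺; *>0; xy∙z≈xz∙y)
  open Sums using (ℕ∑)
  open Congruence
  open UnitPairing using (clamp)
  open FiniteSum
  open RationalPoints
  open LatticeQuotient
  open ℤSum

  ℕ∑-clamp : ∀ {N} (f : Fin (suc N) → ℕ) → + ℕ∑ (suc N) (λ i → f (clamp i)) ≡ sumℤ (λ i → + f i)
  ℕ∑-clamp {zero}  f = refl
  ℕ∑-clamp {suc N} f = cong (λ z → + f zero + z) (ℕ∑-clamp (λ i → f (suc i)))

  n∣i-i%ℕn : ∀ i n .{{_ : NonZero n}} → + n ∣ i - + (i %ℕ n)
  n∣i-i%ℕn i n = divides (i /ℕ n) (trans (cong (_- + (i %ℕ n)) (a≡a%ℕn+[a/ℕn]*n i n))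
    (cancel (+ (i %ℕ n)) ((i /ℕ n) * + n)))
    where
    cancel : ∀ a b → a + b - a ≡ b
    cancel = solve-∀

  0<i⇒i≡+suc : ∀ {i} → + 0 ℤ.< i → ∃ λ t → i ≡ + suc t
  0<i⇒i≡+suc {+ suc t} _ = t , refl
  0<i⇒i≡+suc {+ zero}  (+<+ ())

  scaled-barycentric⇒interior : ∀ {m} (v : Fin (suc m) → Pt m) n-1 t (f : Fin (suc m) → ℕ) x → (∀ i → 0 ℕ.< f i) →
    sumℤ (λ i → + f i) ≡ + suc n-1 * + suc t → (∀ s → combℤ (λ i → + f i) v s ≡ + suc n-1 * x s) →
    InIntMultiple (suc t) v x
  scaled-barycentric⇒interior v n-1 t f x f>0 f-sum f-comb = weights , weights>0 , weights-sum , weights-comb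
    where
    n k D : ℚ.ℚ
    n = ℤ→ℚ (+ suc n-1)
    k = ℤ→ℚ (+ suc t)
    D = n ℚ.* k
    D>0 : ℚ.0ℚ ℚ.< D
    D>0 = *>0 (ℤ→ℚ>0 n-1) (ℤ→ℚ>0 t)
    weights : Fin _ → ℚ.ℚ
    weights i = ℤ→ℚ (+ f i) ℚ.* inv D
    weights>0 : ∀ i → ℚ.0ℚ ℚ.< weights i
    weights>0 i with f i | f>0 i
    ... | suc fᵢ-1 | _ = *>0 (ℤ→ℚ>0 fᵢ-1) (inv>0 D>0)
    open ≡-Reasoning
    weights-sum : sumℚ weights ≡ ℚ.1ℚ
    weights-sum = begin
      sumℚ weights                          ≡⟨ ℚSum.*-distribʳ-sum (inv D) (λ i → ℤ→ℚ (+ f i)) ⟨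
      sumℚ (λ i → ℤ→ℚ (+ f i)) ℚ.* inv D    ≡⟨ cong (ℚ._* inv D) (sym (ℤ→ℚ-sum λ i → + f i)) ⟩
      ℤ→ℚ (sumℤ λ i → + f i) ℚ.* inv D      ≡⟨ cong (λ z → ℤ→ℚ z ℚ.* inv D) f-sum ⟩
      ℤ→ℚ (+ suc n-1 * + suc t) ℚ.* inv D   ≡⟨ cong (ℚ._* inv D) (ℤ→ℚ-* (+ suc n-1) (+ suc t)) ⟩
      D ℚ.* inv D                           ≡⟨ *-inv⁺ D>0 ⟩
      ℚ.1ℚ ∎
    weights-comb : ∀ s → k ℚ.* combℚ weights (λ i → toQ (v i)) s ≡ ℤ→ℚ (x s)
    weights-comb s = begin
      k ℚ.* sumℚ (λ i → ℤ→ℚ (+ f i) ℚ.* inv D ℚ.* V i)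
        ≡⟨ cong (k ℚ.*_) (trans (ℚSum.sum-cong λ i → xy∙z≈xz∙y (ℤ→ℚ (+ f i)) (inv D) (V i))
           (sym (ℚSum.*-distribʳ-sum (inv D) λ i → ℤ→ℚ (+ f i) ℚ.* V i))) ⟩
      k ℚ.* ((λ i → + f i) ∙ V ℚ.* inv D)
        ≡⟨ cong (λ z → k ℚ.* (z ℚ.* inv D)) (trans (sym (ℤ→ℚ-∙ (λ i → + f i) (λ i → v i s)))
           (trans (cong ℤ→ℚ (f-comb s)) (ℤ→ℚ-* (+ suc n-1) (x s)))) ⟩
      k ℚ.* (n ℚ.* ℤ→ℚ (x s) ℚ.* inv D)   ≡⟨ collect k n (ℤ→ℚ (x s)) (inv D) ⟩
      D ℚ.* inv D ℚ.* ℤ→ℚ (x s)           ≡⟨ trans (cong (ℚ._* ℤ→ℚ (x s)) (*-inv⁺ D>0)) (ℚ.*-identityˡ (ℤ→ℚ (x s))) ⟩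
      ℤ→ℚ (x s) ∎
      where
      V : Fin _ → ℚ.ℚ
      V i = ℤ→ℚ (v i s)
      collect : ∀ k n x i → k ℚ.* (n ℚ.* x ℚ.* i) ≡ n ℚ.* k ℚ.* i ℚ.* x
      collect = ℚR.solve-∀ ringℚ

  module _ (e : ℕ) (v : Fin (suc (suc (e ℕ.+ e))) → Pt (suc (e ℕ.+ e)))
    (basic : ∀ j → IsBasic (λ i → v (punchIn j i)))
    (C : CyclicQuotient v) (empty : NoInteriorPoints e v) where

    private
      open CyclicQuotient C
      open Divisibility v basic C using (n; divides-multiplier)

      nℕ N m : ℕ
      nℕ = suc n-1
      m = suc (e ℕ.+ e)
      N = suc m

      -- The point r Γ - Σ cᵢ vᵢ has barycentric coordinates fᵢ / n.
      module FractionalPart (r : ℤ) (f : Fin N → ℕ) (n∣ra-f : ∀ i → n ∣ r * a i - + f i) where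

        c : Fin N → ℤ
        c i = _∣_.quotient (n∣ra-f i)

        f≡ : ∀ i → + f i ≡ r * a i + - n * c i
        f≡ i = trans (solve-for-f (+ f i) (r * a i)) (trans (cong (λ z → r * a i - z) (_∣_.equality (n∣ra-f i)))
          (negate (r * a i) (c i) n))
          where
          solve-for-f : ∀ f x → f ≡ x - (x - f)
          solve-for-f = solve-∀
          negate : ∀ x c n → x - c * n ≡ x + - n * c
          negate = solve-∀

        point : Pt m
        point s = r * Γ s - combℤ c v s

        f-weighted : ∀ (g : Fin N → ℤ) →
          sumℤ (λ i → + f i * g i) ≡ r * sumℤ (λ i → a i * g i) + - n * sumℤ (λ i → c i * g i)
        f-weighted g = begin
          sumℤ (λ i → + f i * g i)
            ≡⟨ sum-cong (λ i → trans (cong (_* g i) (f≡ i)) (distribute r (a i) n (c i) (g i))) ⟩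
          sumℤ (λ i → r * (a i * g i) + - n * (c i * g i))
            ≡⟨ sum-distrib-+ (λ i → r * (a i * g i)) (λ i → - n * (c i * g i)) ⟩
          sumℤ (λ i → r * (a i * g i)) + sumℤ (λ i → - n * (c i * g i))
            ≡⟨ cong₂ _+_ (*-distribˡ-sum r λ i → a i * g i) (*-distribˡ-sum (- n) λ i → c i * g i) ⟨
          r * sumℤ (λ i → a i * g i) + - n * sumℤ (λ i → c i * g i) ∎
          where
          open ≡-Reasoning
          distribute : ∀ r a n c g → (r * a + - n * c) * g ≡ r * (a * g) + - n * (c * g)
          distribute = solve-∀

        f-sum : sumℤ (λ i → + f i) ≡ n * - sumℤ c
        f-sum = begin
          sumℤ (λ i → + f i)         ≡⟨ *1 (λ i → + f i) ⟨
          sumℤ (λ i → + f i * + 1)   ≡⟨ f-weighted (λ _ → + 1) ⟩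
          r * sumℤ (λ i → a i * + 1) + - n * sumℤ (λ i → c i * + 1)
            ≡⟨ cong₂ (λ x y → r * x + - n * y) (trans (*1 a) a-sum) (*1 c) ⟩
          r * + 0 + - n * sumℤ c     ≡⟨ simplify r n (sumℤ c) ⟩
          n * - sumℤ c ∎
          where
          open ≡-Reasoning
          *1 : ∀ (g : Fin N → ℤ) → sumℤ (λ i → g i * + 1) ≡ sumℤ g
          *1 g = sum-cong λ i → ℤ.*-identityʳ (g i)
          simplify : ∀ r n c → r * + 0 + - n * c ≡ n * - c
          simplify = solve-∀

        f-comb : ∀ s → combℤ (λ i → + f i) v s ≡ n * point s
        f-comb s = trans (f-weighted (λ i → v i s)) (trans (cong (λ z → r * z + - n * combℤ c v s) (sym (nΓ s)))
          (factor r n (Γ s) (combℤ c v s)))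
          where
          factor : ∀ r n g c → r * (n * g) + - n * c ≡ n * (r * g - c)
          factor = solve-∀

      degree-bound : ∀ r f → (∀ i → n ∣ r * a i - + f i) → (∀ i → 0 ℕ.< f i) → ∃ λ t →
        sumℤ (λ i → + f i) ≡ n * + t × suc e ℕ.≤ t
      degree-bound r f n∣ra-f f>0 = suc t , ∑f≡n*t , ℕ.≰⇒> λ t≤e →
        empty (suc t) (s≤s z≤n) t≤e point (scaled-barycentric⇒interior v n-1 t f point f>0 ∑f≡n*t f-comb)
        where
        open FractionalPart r f n∣ra-f
        0<n*degree : n * + 0 ℤ.< n * - sumℤ c
        0<n*degree = begin-strict
          n * + 0              ≡⟨ ℤ.*-zeroʳ n ⟩
          + 0                  <⟨ +<+ (s≤s z≤n) ⟩
          + N                  ≤⟨ sumℤ-≥1 (λ i → + f i) (λ i → +≤+ (f>0 i)) ⟩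
          sumℤ (λ i → + f i)   ≡⟨ f-sum ⟩
          n * - sumℤ c ∎
          where open ℤ.≤-Reasoning
        degree : ∃ λ t → - sumℤ c ≡ + suc t
        degree = 0<i⇒i≡+suc (ℤ.*-cancelˡ-<-nonNeg n 0<n*degree)
        t : ℕ
        t = proj₁ degree
        ∑f≡n*t : sumℤ (λ i → + f i) ≡ n * + suc t
        ∑f≡n*t = trans f-sum (cong (n *_) (proj₂ degree))

    residue : Fin N → ℕ
    residue i = a i %ℕ nℕ

    residue-coprime : ∀ i → Coprime (residue i) nℕ
    residue-coprime i {d} (ℕ.divides w A≡wd , ℕ.divides u n≡ud) = ∣1⇒≡1 (*-cancelˡ-∣ u {{ℕ.≢-nonZero u≢0}}
        (subst (ℕ._∣ u ℕ.* 1) n≡ud (subst (nℕ ℕ.∣_) (sym (ℕ.*-identityʳ u))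
          (∣⇒∣ᵤ (divides-multiplier i (+ u) n∣ua)))))
      where
      u≢0 : u ≢ 0
      u≢0 refl = ℕ.1+n≢0 n≡ud
      split : ∀ u a A → u * (a - A) + u * A ≡ u * a
      split = solve-∀
      uA≡wn : + u * + residue i ≡ + w * n
      uA≡wn = begin
        + u * + residue i     ≡⟨ ℤ.pos-* u (residue i) ⟨
        + (u ℕ.* residue i)   ≡⟨ cong (λ z → + (u ℕ.* z)) A≡wd ⟩
        + (u ℕ.* (w ℕ.* d))   ≡⟨ cong +_ (reorder u w d) ⟩
        + (w ℕ.* (u ℕ.* d))   ≡⟨ cong (λ z → + (w ℕ.* z)) (sym n≡ud) ⟩
        + (w ℕ.* nℕ)          ≡⟨ ℤ.pos-* w nℕ ⟩
        + w * n ∎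
        where
        open ≡-Reasoning
        reorder : ∀ u w d → u ℕ.* (w ℕ.* d) ≡ w ℕ.* (u ℕ.* d)
        reorder = ℕR.solve-∀
      n∣ua : n ∣ + u * a i
      n∣ua = subst (n ∣_) (split (+ u) (a i) (+ residue i)) (∣m∣n⇒∣m+n (∣n⇒∣m*n (+ u) (n∣i-i%ℕn (a i) nℕ))
        (divides (+ w) uA≡wn))

    private
      module _ (r : ℕ) where

        F F⁻ : Fin N → ℕ
        F i  = r ℕ.* residue i % nℕ
        F⁻ i = r ℕ.* (n-1 ℕ.* residue i) % nℕ

        n∣ra-F : ∀ i → n ∣ + r * a i - + F i
        n∣ra-F i = subst (n ∣_) (trans (cong (λ z → + r * (a i - + residue i) + (z - + F i)) (ℤ.pos-* r (residue i)))
          (combine (+ r) (a i) (+ residue i) (+ F i)))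
          (∣m∣n⇒∣m+n (∣n⇒∣m*n (+ r) (n∣i-i%ℕn (a i) nℕ)) (n∣i-i%ℕn (+ (r ℕ.* residue i)) nℕ))
          where
          combine : ∀ r a A f → r * (a - A) + (r * A - f) ≡ r * a - f
          combine = solve-∀

        n∣-ra-F⁻ : ∀ i → n ∣ - + r * a i - + F⁻ i
        n∣-ra-F⁻ i = subst (n ∣_) (trans (cong (λ z → - + r * (a i - A) + (z - + F⁻ i) - n * (+ r * A)) product)
          (combine (+ r) (a i) A (+ n-1) (+ F⁻ i)))
          (∣m∣n⇒∣m-n (∣m∣n⇒∣m+n (∣n⇒∣m*n (- + r) (n∣i-i%ℕn (a i) nℕ)) (n∣i-i%ℕn (+ (r ℕ.* (n-1 ℕ.* residue i))) nℕ))
            (∣m⇒∣m*n (+ r * A) ∣-refl))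
          where
          A : ℤ
          A = + residue i
          product : + (r ℕ.* (n-1 ℕ.* residue i)) ≡ + r * (+ n-1 * A)
          product = trans (ℤ.pos-* r (n-1 ℕ.* residue i)) (cong (+ r *_) (ℤ.pos-* n-1 (residue i)))
          combine : ∀ r a A p f → - r * (a - A) + (r * (p * A) - f) - (+ 1 + p) * (r * A) ≡ - r * a - f
          combine = solve-∀

        module _ (r≢0 : r % nℕ ≢ 0) where

          F>0 : ∀ i → 0 ℕ.< F i
          F>0 i = ℕ.n≢0⇒n>0 λ F≡0 → r≢0 (n∣m⇒m%n≡0 r nℕ (∣⇒∣ᵤ (divides-multiplier i (+ r)
            (subst (n ∣_) (trans (cong (λ z → + r * a i - + z) F≡0) (ℤ.+-identityʳ (+ r * a i))) (n∣ra-F i)))))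

          F⁻≡n-F : ∀ i → F⁻ i ≡ nℕ ∸ F i
          F⁻≡n-F i = opposite⇒complement nℕ (r ℕ.* (n-1 ℕ.* residue i)) (F>0 i) (m%n<n (r ℕ.* residue i) nℕ) (begin
            (r ℕ.* (n-1 ℕ.* residue i) ℕ.+ F i) % nℕ
              ≡⟨ +-mod nℕ {r ℕ.* (n-1 ℕ.* residue i)} {r ℕ.* (n-1 ℕ.* residue i)} {F i} {r ℕ.* residue i} refl
                 (%-mod nℕ (r ℕ.* residue i)) ⟩
            (r ℕ.* (n-1 ℕ.* residue i) ℕ.+ r ℕ.* residue i) % nℕ
              ≡⟨ cong (_% nℕ) (collect r n-1 (residue i)) ⟩
            (r ℕ.* residue i ℕ.* nℕ) % nℕ
              ≡⟨ m*n%n≡0 (r ℕ.* residue i) nℕ ⟩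
            0 ∎)
            where
            open ≡-Reasoning
            collect : ∀ r p x → r ℕ.* (p ℕ.* x) ℕ.+ r ℕ.* x ≡ r ℕ.* x ℕ.* (1 ℕ.+ p)
            collect = ℕR.solve-∀

          F⁻>0 : ∀ i → 0 ℕ.< F⁻ i
          F⁻>0 i = subst (0 ℕ.<_) (sym (F⁻≡n-F i)) (ℕ.m<n⇒0<n∸m (m%n<n (r ℕ.* residue i) nℕ))

          F+F⁻≡n : ∀ i → F i ℕ.+ F⁻ i ≡ nℕ
          F+F⁻≡n i = trans (cong (F i ℕ.+_) (F⁻≡n-F i)) (ℕ.m+[n∸m]≡n (ℕ.<⇒≤ (m%n<n (r ℕ.* residue i) nℕ)))

          degrees-sum : ∀ {t t⁻} → sumℤ (λ i → + F i) ≡ n * + t → sumℤ (λ i → + F⁻ i) ≡ n * + t⁻ →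
            t ℕ.+ t⁻ ≡ suc e ℕ.+ suc e
          degrees-sum {t} {t⁻} ∑F ∑F⁻ = trans (ℤ.+-injective (ℤ.*-cancelˡ-≡ n (+ (t ℕ.+ t⁻)) (+ N) (begin
            n * (+ t + + t⁻)                           ≡⟨ ℤ.*-distribˡ-+ n (+ t) (+ t⁻) ⟩
            n * + t + n * + t⁻                         ≡⟨ cong₂ _+_ ∑F ∑F⁻ ⟨
            sumℤ (λ i → + F i) + sumℤ (λ i → + F⁻ i)   ≡⟨ sum-distrib-+ (λ i → + F i) (λ i → + F⁻ i) ⟨
            sumℤ (λ i → + (F i ℕ.+ F⁻ i))              ≡⟨ sum-cong (λ i → cong +_ (F+F⁻≡n i)) ⟩
            sumℤ {N} (λ i → n)                         ≡⟨ sumℤ-const {N} n ⟩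
            + N * n                                    ≡⟨ ℤ.*-comm (+ N) n ⟩
            n * + N ∎))) (cong suc (sym (ℕ.+-suc e e)))
            where open ≡-Reasoning

          equal-halves : ∀ {t t⁻} → suc e ℕ.≤ t → suc e ℕ.≤ t⁻ → t ℕ.+ t⁻ ≡ suc e ℕ.+ suc e → t ≡ t⁻
          equal-halves {t} {t⁻} d≤t d≤t⁻ t+t⁻≡2d = trans (ℕ.≤-antisym t≤d d≤t) (ℕ.≤-antisym d≤t⁻ t⁻≤d)
            where
            t≤d : t ℕ.≤ suc e
            t≤d = ℕ.+-cancelʳ-≤ (suc e) t (suc e) (ℕ.≤-trans (ℕ.+-monoʳ-≤ t d≤t⁻) (ℕ.≤-reflexive t+t⁻≡2d))
            t⁻≤d : t⁻ ℕ.≤ suc e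
            t⁻≤d = ℕ.+-cancelˡ-≤ (suc e) t⁻ (suc e) (ℕ.≤-trans (ℕ.+-monoˡ-≤ t⁻ d≤t) (ℕ.≤-reflexive t+t⁻≡2d))

          sums-agree : sumℤ (λ i → + F i) ≡ sumℤ (λ i → + F⁻ i)
          sums-agree = let t , ∑F , d≤t = degree-bound (+ r) F n∣ra-F F>0
                           t⁻ , ∑F⁻ , d≤t⁻ = degree-bound (- + r) F⁻ n∣-ra-F⁻ F⁻>0
                       in trans ∑F (trans (cong (λ z → n * + z) (equal-halves d≤t d≤t⁻ (degrees-sum {t} {t⁻} ∑F ∑F⁻)))
                         (sym ∑F⁻))

        residue-sums-agree : residueSum nℕ N (λ i → residue (clamp i)) r ≡
          residueSum nℕ N (λ i → n-1 ℕ.* residue (clamp i)) r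
        residue-sums-agree = ℤ.+-injective (trans (ℕ∑-clamp F) (trans ∑F≡∑F⁻ (sym (ℕ∑-clamp F⁻))))
          where
          vanishes : r % nℕ ≡ 0 → ∀ x → r ℕ.* x % nℕ ≡ 0
          vanishes r≡0 x = *-mod nℕ {r} {0} {x} {x} r≡0 refl
          ∑F≡∑F⁻ : sumℤ (λ i → + F i) ≡ sumℤ (λ i → + F⁻ i)
          ∑F≡∑F⁻ with r % nℕ ℕ.≟ 0
          ... | yes r≡0 = sum-cong λ i → cong +_ (trans (vanishes r≡0 (residue i))
            (sym (vanishes r≡0 (n-1 ℕ.* residue i))))
          ... | no r≢0  = sums-agree r≢0

    residues-balanced : Balanced nℕ N (λ i → residue (clamp i))
    residues-balanced = residue-sums-agree

module AffineMaps where

  open import Data.Fin using (Fin; splitAt; join; _↑ˡ_; _↑ʳ_)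
  open import Data.Fin.Permutation using (Permutation; _⟨$⟩ʳ_; _⟨$⟩ˡ_; inverseˡ)
  open import Data.Fin.Properties using (join-splitAt)
  import Data.Integer.Base as ℤ
  open import Data.Nat.Base using (_+_)
  open import Data.Product using (∃; _×_; _,_)
  import Data.Rational as ℚ
  open import Data.Rational using (ℚ; 1ℚ)
  import Data.Rational.Properties as ℚ
  open import Data.Sum using (inj₁; inj₂)
  open import Relation.Binary.PropositionalEquality using (_≡_; refl; sym; trans; cong; cong₂; subst;
    module ≡-Reasoning)
  open import Defs
  open FiniteSum
  open RationalPoints

  splitAt-elim : ∀ m {n} (P : Fin (m + n) → Set) → (∀ i → P (i ↑ˡ n)) → (∀ j → P (m ↑ʳ j)) → ∀ k → P k
  splitAt-elim m {n} P left right k = subst P (join-splitAt m n k) (from-join (splitAt m k))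
    where
    from-join : ∀ x → P (join m n x)
    from-join (inj₁ i) = left i
    from-join (inj₂ j) = right j

  applyℚ-toQ : ∀ {m M} (φ : AffMap m M) z t → applyℚ φ (toQ z) t ≡ ℤ→ℚ (applyℤ φ z t)
  applyℚ-toQ φ z t = sym (trans (ℤ→ℚ-+ (AffMap.c φ t) (sumℤ λ j → AffMap.A φ t j ℤ.* z j))
    (cong (λ x → ℤ→ℚ (AffMap.c φ t) ℚ.+ x) (ℤ→ℚ-∙ (AffMap.A φ t) z)))

  applyℚ-cong : ∀ {m M} (φ : AffMap m M) {x y} → x ≋ℚ y → ∀ t → applyℚ φ x t ≡ applyℚ φ y t
  applyℚ-cong φ x≋y t = cong (λ x → ℤ→ℚ (AffMap.c φ t) ℚ.+ x) (∙-cong (AffMap.A φ t) x≋y)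

  applyℚ-comb : ∀ {m M n} (φ : AffMap m M) (μ : Fin n → ℚ) (p : Fin n → QPt m) → sumℚ μ ≡ 1ℚ →
                ∀ t → applyℚ φ (combℚ μ p) t ≡ combℚ μ (λ i → applyℚ φ (p i)) t
  applyℚ-comb φ μ p ∑μ≡1 t = sym (begin
    sumℚ (λ i → μ i ℚ.* (c ℚ.+ A ∙ p i))           ≡⟨ ℚSum.sum-cong (λ i → ℚ.*-distribˡ-+ (μ i) c (A ∙ p i)) ⟩
    sumℚ (λ i → μ i ℚ.* c ℚ.+ μ i ℚ.* (A ∙ p i))   ≡⟨ ℚSum.sum-distrib-+ (λ i → μ i ℚ.* c) (λ i → μ i ℚ.* (A ∙ p i)) ⟩
    sumℚ (λ i → μ i ℚ.* c) ℚ.+ sumℚ (λ i → μ i ℚ.* (A ∙ p i))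
      ≡⟨ cong₂ ℚ._+_ (trans (sym (ℚSum.*-distribʳ-sum c μ)) (cong (ℚ._* c) ∑μ≡1))
         (ℚSum.sum-bilinear μ (λ j → ℤ→ℚ (A j)) p) ⟩
    1ℚ ℚ.* c ℚ.+ A ∙ combℚ μ p                     ≡⟨ cong (ℚ._+ A ∙ combℚ μ p) (ℚ.*-identityˡ c) ⟩
    c ℚ.+ A ∙ combℚ μ p ∎)
    where
    open ≡-Reasoning
    c : ℚ
    c = ℤ→ℚ (AffMap.c φ t)
    A : Pt _
    A = AffMap.A φ t

  mapsOnto-permuted : ∀ {m M N K} (φ : AffMap m M) (v : Fin N → Pt m) (w : Fin K → Pt M) (π : Permutation K N) →
                      (∀ k t → w k t ≡ applyℤ φ (v (π ⟨$⟩ʳ k)) t) → MapsOnto φ v w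
  mapsOnto-permuted φ v w π w≡ y = onto , into
    where
    image : ∀ (μ : Fin _ → ℚ) → sumℚ μ ≡ 1ℚ → ∀ t →
      applyℚ φ (combℚ μ (λ i → toQ (v i))) t ≡ combℚ (λ k → μ (π ⟨$⟩ʳ k)) (λ k → toQ (w k)) t
    image μ ∑μ≡1 t = trans (applyℚ-comb φ μ (λ i → toQ (v i)) ∑μ≡1 t)
      (trans (ℚSum.sum-permute (λ i → μ i ℚ.* applyℚ φ (toQ (v i)) t) π)
      (ℚSum.sum-cong λ k → cong (μ (π ⟨$⟩ʳ k) ℚ.*_) (trans (applyℚ-toQ φ (v (π ⟨$⟩ʳ k)) t)
        (cong ℤ→ℚ (sym (w≡ k t))))))
    into : (x : QPt _) → InConv (λ i → toQ (v i)) x → applyℚ φ x ≋ℚ y → InConv (λ j → toQ (w j)) y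
    into x (μ , μ≥0 , ∑μ≡1 , comb≡x) φx≡y = (λ k → μ (π ⟨$⟩ʳ k)) , (λ k → μ≥0 (π ⟨$⟩ʳ k)) ,
      trans (sym (ℚSum.sum-permute μ π)) ∑μ≡1 ,
      λ t → trans (sym (image μ ∑μ≡1 t)) (trans (applyℚ-cong φ comb≡x t) (φx≡y t))
    onto : InConv (λ j → toQ (w j)) y → ∃ λ (x : QPt _) → InConv (λ i → toQ (v i)) x × applyℚ φ x ≋ℚ y
    onto (ν , ν≥0 , ∑ν≡1 , comb≡y) = combℚ μ (λ i → toQ (v i)) , (μ , (λ i → ν≥0 (π ⟨$⟩ˡ i)) , ∑μ≡1 , λ _ → refl) ,
      λ t → trans (image μ ∑μ≡1 t) (trans (ℚSum.sum-cong λ k → cong (λ x → x ℚ.* ℤ→ℚ (w k t)) (μ-π k)) (comb≡y t))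
      where
      μ : Fin _ → ℚ
      μ i = ν (π ⟨$⟩ˡ i)
      μ-π : ∀ k → μ (π ⟨$⟩ʳ k) ≡ ν k
      μ-π k = cong ν (inverseˡ π)
      ∑μ≡1 : sumℚ μ ≡ 1ℚ
      ∑μ≡1 = trans (ℚSum.sum-permute μ π) (trans (ℚSum.sum-cong μ-π) ∑ν≡1)

module CayleyIsomorphism where

  open import Data.Empty using (⊥-elim)
  open import Data.Fin using (Fin; zero; suc; splitAt; join; _↑ˡ_; _↑ʳ_)
  open import Data.Fin.Permutation using (Permutation; permutation; _⟨$⟩ʳ_)
  open import Data.Fin.Properties using (splitAt-↑ˡ; splitAt-↑ʳ; join-splitAt; splitAt-join)
  open import Data.Integer.Base as ℤ using (ℤ; +_; _+_; _*_; _-_; -_)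
  open import Data.Integer.Divisibility.Signed using (_∣_)
  import Data.Integer.Properties as ℤ
  open import Data.Integer.Tactic.RingSolver using (solve-∀)
  open import Data.Product using (_×_; _,_; proj₁; proj₂)
  import Data.Rational as ℚ
  open import Data.Rational using (ℚ; 0ℚ; 1ℚ)
  import Data.Rational.Properties as ℚ
  open import Algebra.Properties.AbelianGroup ℚ.+-0-abelianGroup using (∙-cancelˡ; x∙y⁻¹≈ε⇒x≈y; inverseʳ-unique)
  open import Data.Sum using (inj₁; inj₂; [_,_]′)
  open import Data.Sum.Properties using (inj₁-injective; inj₂-injective)
  open import Data.Vec.Functional using (_++_)
  open import Data.Vec.Functional.Properties using (lookup-++ˡ; lookup-++ʳ)
  open import Relation.Binary.PropositionalEquality using (_≡_; _≢_; refl; sym; trans; cong; cong₂; subst;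
    module ≡-Reasoning)
  open import Relation.Nullary using (yes; no; ¬_)
  import Tactic.RingSolver as ℚR
  open import Defs
  open Rationals using (ringℚ; inv; *-inv; *-cancelˡ-≡; y≡0⇒x*y≡0)
  open Matching
  open FiniteSum
  open RationalPoints
  open AffineFunctional
  open AffineMaps
  open LatticeQuotient
  open ℤSum

  module _ {N d : ℕ} {Opp : Fin N → Fin N → Set} (P : Pairing d Opp) where

    open Pairing P

    arrangement : Permutation (d ℕ.+ d) N
    arrangement = permutation to from to-from from-to
      where
      to : Fin (d ℕ.+ d) → Fin N
      to k = [ σ , σ′ ]′ (splitAt d k)
      from : Fin N → Fin (d ℕ.+ d)
      from i = join d d (ν i)
      to-from : ∀ i → to (from i) ≡ i
      to-from i = trans (cong [ σ , σ′ ]′ (splitAt-join d d (ν i))) (σ-ν i)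
      ν-to : ∀ x → ν ([ σ , σ′ ]′ x) ≡ x
      ν-to (inj₁ i) = ν-σ i
      ν-to (inj₂ i) = ν-σ′ i
      from-to : ∀ k → from (to k) ≡ k
      from-to k = trans (cong (join d d) (ν-to (splitAt d k))) (join-splitAt d d k)

    arrangement-σ : ∀ i → arrangement ⟨$⟩ʳ (i ↑ˡ d) ≡ σ i
    arrangement-σ i = cong [ σ , σ′ ]′ (splitAt-↑ˡ d i d)

    arrangement-σ′ : ∀ i → arrangement ⟨$⟩ʳ (d ↑ʳ i) ≡ σ′ i
    arrangement-σ′ i = cong [ σ , σ′ ]′ (splitAt-↑ʳ d d i)

    sum-pairs : ∀ (f : Fin N → ℤ) → sumℤ f ≡ sumℤ (λ i → f (σ i) + f (σ′ i))
    sum-pairs f = begin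
      sumℤ f                                         ≡⟨ sum-permute f arrangement ⟩
      sumℤ (λ k → f (arrangement ⟨$⟩ʳ k))            ≡⟨ sum-++ d (λ k → f (arrangement ⟨$⟩ʳ k)) ⟩
      sumℤ (λ i → f (arrangement ⟨$⟩ʳ (i ↑ˡ d))) + sumℤ (λ i → f (arrangement ⟨$⟩ʳ (d ↑ʳ i)))
        ≡⟨ cong₂ _+_ (sum-cong λ i → cong f (arrangement-σ i)) (sum-cong λ i → cong f (arrangement-σ′ i)) ⟩
      sumℤ (λ i → f (σ i)) + sumℤ (λ i → f (σ′ i))   ≡⟨ sum-distrib-+ (λ i → f (σ i)) (λ i → f (σ′ i)) ⟨
      sumℤ (λ i → f (σ i) + f (σ′ i)) ∎
      where open ≡-Reasoning

    pairing-elim : ∀ (R : Fin N → Set) → (∀ i → R (σ i)) → (∀ i → R (σ′ i)) → ∀ k → R k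
    pairing-elim R left right k = subst R (σ-ν k) (from-ν (ν k))
      where
      from-ν : ∀ x → R ([ σ , σ′ ]′ x)
      from-ν (inj₁ i) = left i
      from-ν (inj₂ i) = right i

    σ-injective : ∀ {i j} → σ i ≡ σ j → i ≡ j
    σ-injective {i} {j} eq = inj₁-injective (trans (sym (ν-σ i)) (trans (cong ν eq) (ν-σ j)))

    σ′-injective : ∀ {i j} → σ′ i ≡ σ′ j → i ≡ j
    σ′-injective {i} {j} eq = inj₂-injective (trans (sym (ν-σ′ i)) (trans (cong ν eq) (ν-σ′ j)))

    σ≢σ′ : ∀ i j → σ i ≢ σ′ j
    σ≢σ′ i j eq = inj₁≢inj₂ (trans (sym (ν-σ i)) (trans (cong ν eq) (ν-σ′ j)))
      where
      inj₁≢inj₂ : ∀ {x y : Fin d} → inj₁ x ≢ inj₂ y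
      inj₁≢inj₂ ()

  distinct⇒AffIndep : ∀ {d} (p q : Pt d) → ¬ (∀ t → p t ≡ q t) → AffIndep (seg p q)
  distinct⇒AffIndep p q p≢q w ∑w≡0 comb≡0 = λ { zero → w₀≡0 ; (suc zero) → trans w₁≡-w₀ (cong ℚ.-_ w₀≡0) }
    where
    w₀ w₁ : ℚ
    w₀ = w zero
    w₁ = w (suc zero)
    w₁≡-w₀ : w₁ ≡ ℚ.- w₀
    w₁≡-w₀ = inverseʳ-unique w₀ w₁ (trans (cong (w₀ ℚ.+_) (sym (ℚ.+-identityʳ w₁))) ∑w≡0)
    difference≡0 : ∀ t → w₀ ℚ.* (ℤ→ℚ (p t) ℚ.- ℤ→ℚ (q t)) ≡ 0ℚ
    difference≡0 t = trans (distribute w₀ (ℤ→ℚ (p t)) (ℤ→ℚ (q t)))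
      (trans (cong (λ x → w₀ ℚ.* ℤ→ℚ (p t) ℚ.+ (x ℚ.* ℤ→ℚ (q t) ℚ.+ 0ℚ)) (sym w₁≡-w₀)) (comb≡0 t))
      where
      distribute : ∀ w x y → w ℚ.* (x ℚ.- y) ≡ w ℚ.* x ℚ.+ (ℚ.- w ℚ.* y ℚ.+ 0ℚ)
      distribute = ℚR.solve-∀ ringℚ
    w₀≡0 : w₀ ≡ 0ℚ
    w₀≡0 with w₀ ℚ.≟ 0ℚ
    ... | yes w₀≡0 = w₀≡0
    ... | no w₀≢0  = ⊥-elim (p≢q λ t → ℤ→ℚ-injective (x∙y⁻¹≈ε⇒x≈y (ℤ→ℚ (p t)) (ℤ→ℚ (q t)) (begin
      ℤ→ℚ (p t) ℚ.- ℤ→ℚ (q t)                         ≡⟨ ℚ.*-identityˡ (ℤ→ℚ (p t) ℚ.- ℤ→ℚ (q t)) ⟨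
      1ℚ ℚ.* (ℤ→ℚ (p t) ℚ.- ℤ→ℚ (q t))
        ≡⟨ cong (ℚ._* (ℤ→ℚ (p t) ℚ.- ℤ→ℚ (q t))) (trans (sym (*-inv w₀≢0)) (ℚ.*-comm w₀ (inv w₀))) ⟩
      inv w₀ ℚ.* w₀ ℚ.* (ℤ→ℚ (p t) ℚ.- ℤ→ℚ (q t))     ≡⟨ ℚ.*-assoc (inv w₀) w₀ (ℤ→ℚ (p t) ℚ.- ℤ→ℚ (q t)) ⟩
      inv w₀ ℚ.* (w₀ ℚ.* (ℤ→ℚ (p t) ℚ.- ℤ→ℚ (q t)))   ≡⟨ y≡0⇒x*y≡0 (inv w₀) (difference≡0 t) ⟩
      0ℚ ∎)))
      where open ≡-Reasoning

  module FromFunctionals {m M : ℕ} (Φ : Fin M → Functional m) where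

    φ : AffMap m M
    φ = record { c = λ t → const (Φ t) ; A = λ t → linear (Φ t) }

    applyℤ-φ : ∀ z t → applyℤ φ z t ≡ Φ t ⟨ z , + 1 ⟩
    applyℤ-φ z t = cong (λ x → x + sumℤ (λ j → linear (Φ t) j * z j)) (sym (ℤ.*-identityʳ (const (Φ t))))

    applyℚ-φ : ∀ x t (c : Cleared x) →
      Cleared.denominator c ℚ.* applyℚ φ x t ≡ ℤ→ℚ (Φ t ⟨ Cleared.numerator c , + suc (Cleared.denominator-1 c) ⟩)
    applyℚ-φ x t c = begin
      denominator ℚ.* (ℤ→ℚ (const (Φ t)) ℚ.+ linear (Φ t) ∙ x)
        ≡⟨ ℚ.*-distribˡ-+ denominator (ℤ→ℚ (const (Φ t))) (linear (Φ t) ∙ x) ⟩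
      denominator ℚ.* ℤ→ℚ (const (Φ t)) ℚ.+ denominator ℚ.* (linear (Φ t) ∙ x)
        ≡⟨ cong₂ ℚ._+_ (trans (ℚ.*-comm denominator (ℤ→ℚ (const (Φ t))))
           (sym (ℤ→ℚ-* (const (Φ t)) (+ suc denominator-1)))) (∙-cleared (linear (Φ t)) c) ⟩
      ℤ→ℚ (const (Φ t) * + suc denominator-1) ℚ.+ ℤ→ℚ (sumℤ λ j → linear (Φ t) j * numerator j)
        ≡⟨ ℤ→ℚ-+ (const (Φ t) * + suc denominator-1) (sumℤ λ j → linear (Φ t) j * numerator j) ⟨
      ℤ→ℚ (Φ t ⟨ numerator , + suc denominator-1 ⟩) ∎
      where
      open ≡-Reasoning
      open Cleared c

    trivial-kernel⇒injective : (∀ z → (∀ t → Φ t ⟨ z , + 0 ⟩ ≡ + 0) → ∀ s → z s ≡ + 0) → (x y : QPt m) →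
      applyℚ φ x ≋ℚ applyℚ φ y → x ≋ℚ y
    trivial-kernel⇒injective kernel x y φx≡φy s = x∙y⁻¹≈ε⇒x≈y (x s) (y s) (*-cancelˡ-≡ (ℤ→ℚ>0 denominator-1) (begin
      denominator ℚ.* (x s ℚ.- y s)   ≡⟨ cleared s ⟩
      ℤ→ℚ (numerator s)               ≡⟨ cong ℤ→ℚ (kernel numerator vanishes s) ⟩
      0ℚ                              ≡⟨ ℚ.*-zeroʳ denominator ⟨
      denominator ℚ.* 0ℚ ∎))
      where
      open ≡-Reasoning
      difference : Cleared (λ s → x s ℚ.- y s)
      difference = clear-denominators (λ s → x s ℚ.- y s)
      open Cleared difference
      vanishes : ∀ t → Φ t ⟨ numerator , + 0 ⟩ ≡ + 0
      vanishes t = ℤ→ℚ-injective (begin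
        ℤ→ℚ (const (Φ t) * + 0 + sumℤ (λ j → l j * numerator j))
          ≡⟨ cong ℤ→ℚ (trans (cong (_+ sumℤ (λ j → l j * numerator j)) (ℤ.*-zeroʳ (const (Φ t))))
             (ℤ.+-identityˡ (sumℤ λ j → l j * numerator j))) ⟩
        ℤ→ℚ (sumℤ (λ j → l j * numerator j))        ≡⟨ ∙-cleared l difference ⟨
        denominator ℚ.* (l ∙ (λ s → x s ℚ.- y s))   ≡⟨ cong (denominator ℚ.*_) (∙-difference l x y) ⟩
        denominator ℚ.* (l ∙ x ℚ.- l ∙ y)
          ≡⟨ cong (λ u → denominator ℚ.* (u ℚ.- l ∙ y)) (∙-cancelˡ (ℤ→ℚ (const (Φ t))) (l ∙ x) (l ∙ y) (φx≡φy t)) ⟩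
        denominator ℚ.* (l ∙ y ℚ.- l ∙ y)           ≡⟨ y≡0⇒x*y≡0 denominator (ℚ.+-inverseʳ (l ∙ y)) ⟩
        0ℚ ∎)
        where
        l : Pt m
        l = linear (Φ t)

  module _ {m : ℕ} (v : Fin (suc m) → Pt m) (indep : AffIndep v) (C : CyclicQuotient v) where

    private
      open CyclicQuotient C

      n : ℤ
      n = + suc n-1

      -- n qₖ + aₖ L is n times the k-th barycentric coordinate.
      module Vertex (j : Fin (suc m)) where

        ℓ : ℤ
        ℓ = L ⟨ v j , + 1 ⟩

        qⱼ defect : Fin (suc m) → ℤ
        qⱼ k = q k ⟨ v j , + 1 ⟩
        defect k = n * qⱼ k + a k * ℓ - n * unitVec k j

        defect-weighted : ∀ (f : Fin (suc m) → ℤ) →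
          sumℤ (λ k → defect k * f k) ≡ n * sumℤ (λ k → qⱼ k * f k) + ℓ * sumℤ (λ k → a k * f k) + - n * f j
        defect-weighted f = begin
          sumℤ (λ k → defect k * f k)
            ≡⟨ sum-cong (λ k → distribute n (qⱼ k) (a k) ℓ (unitVec k j) (f k)) ⟩
          sumℤ (λ k → n * (qⱼ k * f k) + ℓ * (a k * f k) + - n * (f k * unitVec k j))
            ≡⟨ sum-distrib-+ (λ k → n * (qⱼ k * f k) + ℓ * (a k * f k)) (λ k → - n * (f k * unitVec k j)) ⟩
          sumℤ (λ k → n * (qⱼ k * f k) + ℓ * (a k * f k)) + sumℤ (λ k → - n * (f k * unitVec k j))
            ≡⟨ cong₂ _+_ (sum-distrib-+ (λ k → n * (qⱼ k * f k)) (λ k → ℓ * (a k * f k)))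
               (sym (*-distribˡ-sum (- n) λ k → f k * unitVec k j)) ⟩
          sumℤ (λ k → n * (qⱼ k * f k)) + sumℤ (λ k → ℓ * (a k * f k)) + - n * sumℤ (λ k → f k * unitVec k j)
            ≡⟨ cong₂ _+_ (sym (cong₂ _+_ (*-distribˡ-sum n λ k → qⱼ k * f k) (*-distribˡ-sum ℓ λ k → a k * f k)))
               (cong (- n *_) (sum-unitVec f j)) ⟩
          n * sumℤ (λ k → qⱼ k * f k) + ℓ * sumℤ (λ k → a k * f k) + - n * f j ∎
          where
          open ≡-Reasoning
          distribute : ∀ n q a l u f → (n * q + a * l - n * u) * f ≡ n * (q * f) + l * (a * f) + - n * (f * u)
          distribute = solve-∀

        defect-sum : sumℤ defect ≡ + 0
        defect-sum = begin
          sumℤ defect                     ≡⟨ *1 defect ⟨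
          sumℤ (λ k → defect k * + 1)     ≡⟨ defect-weighted (λ _ → + 1) ⟩
          n * sumℤ (λ k → qⱼ k * + 1) + ℓ * sumℤ (λ k → a k * + 1) + - n * + 1
            ≡⟨ cong₂ (λ u w → n * u + ℓ * w + - n * + 1) (trans (*1 qⱼ) (total (v j) (+ 1))) (trans (*1 a) a-sum) ⟩
          n * + 1 + ℓ * + 0 + - n * + 1   ≡⟨ cancel n ℓ ⟩
          + 0 ∎
          where
          open ≡-Reasoning
          *1 : ∀ (g : Fin (suc m) → ℤ) → sumℤ (λ k → g k * + 1) ≡ sumℤ g
          *1 g = sum-cong λ k → ℤ.*-identityʳ (g k)
          cancel : ∀ n l → n * + 1 + l * + 0 + - n * + 1 ≡ + 0
          cancel = solve-∀

        defect-comb : ∀ s → combℤ defect v s ≡ + 0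
        defect-comb s = begin
          combℤ defect v s
            ≡⟨ defect-weighted (λ k → v k s) ⟩
          n * combℤ qⱼ v s + ℓ * combℤ a v s + - n * v j s
            ≡⟨ cong₂ (λ u w → n * combℤ qⱼ v s + ℓ * u + - n * w) (sym (nΓ s)) (sym (expand (v j) (+ 1) s)) ⟩
          n * combℤ qⱼ v s + ℓ * (n * Γ s) + - n * (combℤ qⱼ v s + ℓ * Γ s)
            ≡⟨ cancel n (combℤ qⱼ v s) ℓ (Γ s) ⟩
          + 0 ∎
          where
          open ≡-Reasoning
          cancel : ∀ n q l g → n * q + l * (n * g) + - n * (q + l * g) ≡ + 0
          cancel = solve-∀

        barycentric : ∀ k → n * qⱼ k + a k * ℓ ≡ n * unitVec k j
        barycentric k = ℤ.i-j≡0⇒i≡j _ _ (AffIndep⇒ℤ {p = v} indep defect defect-sum defect-comb k)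

      open Vertex using (barycentric)

      barycentric-cong : ∀ {i j} → (∀ s → v i s ≡ v j s) → ∀ k → unitVec k i ≡ unitVec k j
      barycentric-cong {i} {j} vᵢ≡vⱼ k = ℤ.*-cancelˡ-≡ n (unitVec k i) (unitVec k j) (trans (sym (barycentric i k))
        (trans (cong₂ (λ x y → n * x + a k * y) (value-cong (q k) vᵢ≡vⱼ) (value-cong L vᵢ≡vⱼ)) (barycentric j k)))

    module Construction {e : ℕ} (P : Pairing (suc e) (λ i j → n ∣ a i + a j)) (anchored : Anchored P) where

      open Pairing P

      private
        d : ℕ
        d = suc e

        slope : Fin d → ℤ
        slope i = _∣_.quotient (opp i)

        slope-sum : sumℤ slope ≡ + 0
        slope-sum = ℤ.*-cancelʳ-≡ (sumℤ slope) (+ 0) n (begin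
          sumℤ slope * n                    ≡⟨ *-distribʳ-sum n slope ⟩
          sumℤ (λ i → slope i * n)          ≡⟨ sum-cong (λ i → sym (_∣_.equality (opp i))) ⟩
          sumℤ (λ i → a (σ i) + a (σ′ i))   ≡⟨ sum-pairs P a ⟨
          sumℤ a                            ≡⟨ a-sum ⟩
          + 0 ∎)
          where open ≡-Reasoning

        base fibre : Fin d → Functional m
        base i = q (σ i) ⊕ q (σ′ i) ⊕ slope i ⊙ L
        fibre zero    = L
        fibre (suc i) = q (σ (suc i))

        Φ : Fin (d ℕ.+ d) → Functional m
        Φ = base ++ fibre

        Φ-base : ∀ i → Φ (i ↑ˡ d) ≡ base i
        Φ-base i = lookup-++ˡ base fibre i

        Φ-fibre : ∀ i → Φ (d ↑ʳ i) ≡ fibre i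
        Φ-fibre i = lookup-++ʳ base fibre i

        base-value : ∀ i z t → base i ⟨ z , t ⟩ ≡ q (σ i) ⟨ z , t ⟩ + q (σ′ i) ⟨ z , t ⟩ + slope i * (L ⟨ z , t ⟩)
        base-value i z t = trans (⊕-value (q (σ i) ⊕ q (σ′ i)) (slope i ⊙ L) z t)
          (cong₂ _+_ (⊕-value (q (σ i)) (q (σ′ i)) z t) (⊙-value (slope i) L z t))

      open FromFunctionals Φ using (φ)

      private
        open FromFunctionals Φ using (applyℤ-φ; applyℚ-φ; trivial-kernel⇒injective)

        base-sum : ∀ z t → sumℤ (λ i → base i ⟨ z , t ⟩) ≡ t
        base-sum z t = begin
          sumℤ (λ i → base i ⟨ z , t ⟩)
            ≡⟨ sum-cong (λ i → base-value i z t) ⟩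
          sumℤ (λ i → q (σ i) ⟨ z , t ⟩ + q (σ′ i) ⟨ z , t ⟩ + slope i * ℓ)
            ≡⟨ sum-distrib-+ (λ i → q (σ i) ⟨ z , t ⟩ + q (σ′ i) ⟨ z , t ⟩) (λ i → slope i * ℓ) ⟩
          sumℤ (λ i → q (σ i) ⟨ z , t ⟩ + q (σ′ i) ⟨ z , t ⟩) + sumℤ (λ i → slope i * ℓ)
            ≡⟨ cong₂ _+_ (trans (sym (sum-pairs P λ i → q i ⟨ z , t ⟩)) (total z t)) (sym (*-distribʳ-sum ℓ slope)) ⟩
          t + sumℤ slope * ℓ   ≡⟨ cong (λ x → t + x * ℓ) slope-sum ⟩
          t + + 0              ≡⟨ ℤ.+-identityʳ t ⟩
          t ∎
          where
          open ≡-Reasoning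
          ℓ : ℤ
          ℓ = L ⟨ z , t ⟩

        into-H : (x : QPt m) → InH d (applyℚ φ x)
        into-H x = *-cancelˡ-≡ (ℤ→ℚ>0 denominator-1) (begin
          denominator ℚ.* sumℚ (λ (i : Fin d) → applyℚ φ x (i ↑ˡ d))
            ≡⟨ ℚSum.*-distribˡ-sum denominator (λ (i : Fin d) → applyℚ φ x (i ↑ˡ d)) ⟩
          sumℚ (λ (i : Fin d) → denominator ℚ.* applyℚ φ x (i ↑ˡ d))
            ≡⟨ ℚSum.sum-cong (λ i → trans (applyℚ-φ x (i ↑ˡ d) c)
               (cong (λ f → ℤ→ℚ (f ⟨ numerator , + suc denominator-1 ⟩)) (Φ-base i))) ⟩
          sumℚ (λ i → ℤ→ℚ (base i ⟨ numerator , + suc denominator-1 ⟩))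
            ≡⟨ ℤ→ℚ-sum (λ i → base i ⟨ numerator , + suc denominator-1 ⟩) ⟨
          ℤ→ℚ (sumℤ λ i → base i ⟨ numerator , + suc denominator-1 ⟩)
            ≡⟨ cong ℤ→ℚ (base-sum numerator (+ suc denominator-1)) ⟩
          denominator   ≡⟨ ℚ.*-identityʳ denominator ⟨
          denominator ℚ.* 1ℚ ∎)
          where
          open ≡-Reasoning
          c : Cleared x
          c = clear-denominators x
          open Cleared c

        kernel : ∀ z → (∀ t → Φ t ⟨ z , + 0 ⟩ ≡ + 0) → ∀ s → z s ≡ + 0
        kernel z Φ≡0 s = trans (sym (expand z (+ 0) s)) (cong₂ _+_
          (sum-zero λ k → trans (cong (_* v k s) (q≡0 k)) (ℤ.*-zeroˡ (v k s)))
            (trans (cong (_* Γ s) L≡0) (ℤ.*-zeroˡ (Γ s))))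
          where
          value≡0 : ∀ {f} t → Φ t ≡ f → f ⟨ z , + 0 ⟩ ≡ + 0
          value≡0 t refl = Φ≡0 t
          L≡0 : L ⟨ z , + 0 ⟩ ≡ + 0
          L≡0 = value≡0 (d ↑ʳ zero) (Φ-fibre zero)
          σ≡0 : ∀ i → q (σ i) ⟨ z , + 0 ⟩ ≡ + 0
          σ≡0 zero    = trans (cong (λ i → q i ⟨ z , + 0 ⟩) anchored) (q-zero z (+ 0))
          σ≡0 (suc i) = value≡0 (d ↑ʳ suc i) (Φ-fibre (suc i))
          σ′≡0 : ∀ i → q (σ′ i) ⟨ z , + 0 ⟩ ≡ + 0
          σ′≡0 i = begin
            q (σ′ i) ⟨ z , + 0 ⟩   ≡⟨ isolate (q (σ′ i) ⟨ z , + 0 ⟩) (slope i) ⟩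
            + 0 + q (σ′ i) ⟨ z , + 0 ⟩ + slope i * + 0
              ≡⟨ cong₂ (λ x y → x + q (σ′ i) ⟨ z , + 0 ⟩ + slope i * y) (σ≡0 i) L≡0 ⟨
            q (σ i) ⟨ z , + 0 ⟩ + q (σ′ i) ⟨ z , + 0 ⟩ + slope i * (L ⟨ z , + 0 ⟩)
              ≡⟨ base-value i z (+ 0) ⟨
            base i ⟨ z , + 0 ⟩     ≡⟨ value≡0 (i ↑ˡ d) (Φ-base i) ⟩
            + 0 ∎
            where
            open ≡-Reasoning
            isolate : ∀ b s → b ≡ + 0 + b + s * + 0
            isolate = solve-∀
          q≡0 : ∀ k → q k ⟨ z , + 0 ⟩ ≡ + 0
          q≡0 = pairing-elim P (λ k → q k ⟨ z , + 0 ⟩ ≡ + 0) σ≡0 σ′≡0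

        injective : (x y : QPt m) → applyℚ φ x ≋ℚ applyℚ φ y → x ≋ℚ y
        injective = trivial-kernel⇒injective kernel

        module Preimage (y : Pt (d ℕ.+ d)) (y∈H : InH d (toQ y)) where

          ℓ : ℤ
          ℓ = y (d ↑ʳ zero)

          ξ ξ′ : Fin d → ℤ
          ξ zero    = + 0
          ξ (suc i) = y (d ↑ʳ suc i)
          ξ′ i = y (i ↑ˡ d) - ξ i - slope i * ℓ

          x : Fin (suc m) → ℤ
          x k = [ ξ , ξ′ ]′ (ν k)

          x-σ : ∀ i → x (σ i) ≡ ξ i
          x-σ i = cong [ ξ , ξ′ ]′ (ν-σ i)

          x-σ′ : ∀ i → x (σ′ i) ≡ ξ′ i
          x-σ′ i = cong [ ξ , ξ′ ]′ (ν-σ′ i)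

          y-sum : sumℤ (λ (i : Fin d) → y (i ↑ˡ d)) ≡ + 1
          y-sum = ℤ→ℚ-injective (trans (ℤ→ℚ-sum λ (i : Fin d) → y (i ↑ˡ d)) y∈H)

          x-sum : sumℤ x ≡ + 1
          x-sum = begin
            sumℤ x   ≡⟨ sum-pairs P x ⟩
            sumℤ (λ i → x (σ i) + x (σ′ i))
              ≡⟨ sum-cong (λ i → trans (cong₂ _+_ (x-σ i) (x-σ′ i)) (simplify (ξ i) (y (i ↑ˡ d)) (slope i) ℓ)) ⟩
            sumℤ (λ (i : Fin d) → y (i ↑ˡ d) + slope i * - ℓ)
              ≡⟨ sum-distrib-+ (λ (i : Fin d) → y (i ↑ˡ d)) (λ i → slope i * - ℓ) ⟩
            sumℤ (λ (i : Fin d) → y (i ↑ˡ d)) + sumℤ (λ i → slope i * - ℓ)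
              ≡⟨ cong₂ _+_ y-sum (trans (sym (*-distribʳ-sum (- ℓ) slope)) (cong (_* - ℓ) slope-sum)) ⟩
            + 1 ∎
            where
            open ≡-Reasoning
            simplify : ∀ x y s l → x + (y - x - s * l) ≡ y + s * - l
            simplify = solve-∀

          z : Pt m
          z s = combℤ x v s + ℓ * Γ s

          z-coordinates : (∀ i → q i ⟨ z , + 1 ⟩ ≡ x i) × L ⟨ z , + 1 ⟩ ≡ ℓ
          z-coordinates = unique z (+ 1) x ℓ (trans (cong x (sym anchored)) (x-σ zero)) x-sum (λ _ → refl)

          base-z : ∀ i → base i ⟨ z , + 1 ⟩ ≡ y (i ↑ˡ d)
          base-z i = begin
            base i ⟨ z , + 1 ⟩                       ≡⟨ base-value i z (+ 1) ⟩
            q (σ i) ⟨ z , + 1 ⟩ + q (σ′ i) ⟨ z , + 1 ⟩ + slope i * (L ⟨ z , + 1 ⟩)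
              ≡⟨ cong₂ (λ u w → u + w + slope i * (L ⟨ z , + 1 ⟩)) (trans (proj₁ z-coordinates (σ i)) (x-σ i))
                 (trans (proj₁ z-coordinates (σ′ i)) (x-σ′ i)) ⟩
            ξ i + ξ′ i + slope i * (L ⟨ z , + 1 ⟩)   ≡⟨ cong (λ w → ξ i + ξ′ i + slope i * w) (proj₂ z-coordinates) ⟩
            ξ i + ξ′ i + slope i * ℓ                 ≡⟨ cancel (ξ i) (y (i ↑ˡ d)) (slope i) ℓ ⟩
            y (i ↑ˡ d) ∎
            where
            open ≡-Reasoning
            cancel : ∀ x y s l → x + (y - x - s * l) + s * l ≡ y
            cancel = solve-∀

          fibre-z : ∀ i → fibre i ⟨ z , + 1 ⟩ ≡ y (d ↑ʳ i)
          fibre-z zero    = proj₂ z-coordinates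
          fibre-z (suc i) = trans (proj₁ z-coordinates (σ (suc i))) (x-σ (suc i))

          image : ∀ t → applyℤ φ z t ≡ y t
          image t = trans (applyℤ-φ z t) (splitAt-elim d (λ t → Φ t ⟨ z , + 1 ⟩ ≡ y t)
            (λ i → trans (cong (_⟨ z , + 1 ⟩) (Φ-base i)) (base-z i)) (λ i → trans (cong (_⟨ z , + 1 ⟩) (Φ-fibre i))
              (fibre-z i)) t)

        base-vertex : ∀ i j → applyℤ φ (v j) (i ↑ˡ d) ≡ unitVec (σ i) j + unitVec (σ′ i) j
        base-vertex i j = trans (applyℤ-φ (v j) (i ↑ˡ d)) (trans (cong (_⟨ v j , + 1 ⟩) (Φ-base i))
          (ℤ.*-cancelˡ-≡ n (base i ⟨ v j , + 1 ⟩) (unitVec (σ i) j + unitVec (σ′ i) j) (begin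
            n * (base i ⟨ v j , + 1 ⟩)                    ≡⟨ cong (n *_) (base-value i (v j) (+ 1)) ⟩
            n * (qσ + qσ′ + slope i * ℓ)                  ≡⟨ distribute n qσ qσ′ (slope i) ℓ ⟩
            n * qσ + n * qσ′ + slope i * n * ℓ
              ≡⟨ cong (λ x → n * qσ + n * qσ′ + x * ℓ) (sym (_∣_.equality (opp i))) ⟩
            n * qσ + n * qσ′ + (a (σ i) + a (σ′ i)) * ℓ   ≡⟨ regroup (n * qσ) (n * qσ′) (a (σ i)) (a (σ′ i)) ℓ ⟩
            n * qσ + a (σ i) * ℓ + (n * qσ′ + a (σ′ i) * ℓ)
              ≡⟨ cong₂ _+_ (barycentric j (σ i)) (barycentric j (σ′ i)) ⟩
            n * unitVec (σ i) j + n * unitVec (σ′ i) j    ≡⟨ ℤ.*-distribˡ-+ n (unitVec (σ i) j) (unitVec (σ′ i) j) ⟨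
            n * (unitVec (σ i) j + unitVec (σ′ i) j) ∎)))
          where
          open ≡-Reasoning
          ℓ qσ qσ′ : ℤ
          ℓ   = L ⟨ v j , + 1 ⟩
          qσ  = q (σ i) ⟨ v j , + 1 ⟩
          qσ′ = q (σ′ i) ⟨ v j , + 1 ⟩
          distribute : ∀ n a b s l → n * (a + b + s * l) ≡ n * a + n * b + s * n * l
          distribute = solve-∀
          regroup : ∀ x y a b l → x + y + (a + b) * l ≡ x + a * l + (y + b * l)
          regroup = solve-∀

        base-σ : ∀ i j → applyℤ φ (v (σ j)) (i ↑ˡ d) ≡ unitVec j i
        base-σ i j = trans (base-vertex i (σ j))
          (trans (cong₂ _+_ (trans (unitVec-injective (σ-injective P) i j) (unitVec-sym i j))
          (unitVec-other λ σ′i≡σj → σ≢σ′ P j i (sym σ′i≡σj))) (ℤ.+-identityʳ (unitVec j i)))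

        base-σ′ : ∀ i j → applyℤ φ (v (σ′ j)) (i ↑ˡ d) ≡ unitVec j i
        base-σ′ i j = trans (base-vertex i (σ′ j)) (trans (cong₂ _+_ (unitVec-other (σ≢σ′ P i j))
          (trans (unitVec-injective (σ′-injective P) i j) (unitVec-sym i j))) (ℤ.+-identityˡ (unitVec j i)))

      start end : Fin d → Pt d
      start i t = applyℤ φ (v (σ i)) (d ↑ʳ t)
      end i t   = applyℤ φ (v (σ′ i)) (d ↑ʳ t)

      private
        glue : ∀ k i (p : Pt d) → (∀ j → applyℤ φ (v k) (j ↑ˡ d) ≡ unitVec i j) →
          (∀ t → p t ≡ applyℤ φ (v k) (d ↑ʳ t)) → ∀ t → (unitVec i ++ p) t ≡ applyℤ φ (v k) t
        glue k i p base≡ fibre≡ = splitAt-elim d (λ t → (unitVec i ++ p) t ≡ applyℤ φ (v k) t)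
          (λ j → trans (lookup-++ˡ (unitVec i) p j) (sym (base≡ j)))
            (λ j → trans (lookup-++ʳ (unitVec i) p j) (fibre≡ j))

        vertex : ∀ k t → cayleyVerts start end k t ≡ applyℤ φ (v (arrangement P ⟨$⟩ʳ k)) t
        vertex = splitAt-elim d (λ k → ∀ t → cayleyVerts start end k t ≡ applyℤ φ (v (arrangement P ⟨$⟩ʳ k)) t)
          (λ i t → trans (cong (λ p → p t) (lookup-++ˡ (λ i → unitVec i ++ start i) (λ i → unitVec i ++ end i) i))
            (trans (glue (σ i) i (start i) (λ j → base-σ j i) (λ _ → refl) t) (cong (λ k → applyℤ φ (v k) t)
              (sym (arrangement-σ P i)))))
          (λ i t → trans (cong (λ p → p t) (lookup-++ʳ (λ i → unitVec i ++ start i) (λ i → unitVec i ++ end i) i))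
            (trans (glue (σ′ i) i (end i) (λ j → base-σ′ j i) (λ _ → refl) t) (cong (λ k → applyℤ φ (v k) t)
              (sym (arrangement-σ′ P i)))))

        start≢end : ∀ i → ¬ (∀ t → start i t ≡ end i t)
        start≢end i start≡end = 1≢0 (trans (sym (unitVec-same (σ i))) (trans (barycentric-cong vσ≡vσ′ (σ i))
          (unitVec-other (σ≢σ′ P i i))))
          where
          1≢0 : + 1 ≢ + 0
          1≢0 ()
          φσ≡φσ′ : ∀ t → applyℤ φ (v (σ i)) t ≡ applyℤ φ (v (σ′ i)) t
          φσ≡φσ′ = splitAt-elim d (λ t → applyℤ φ (v (σ i)) t ≡ applyℤ φ (v (σ′ i)) t)
            (λ j → trans (base-σ j i) (sym (base-σ′ j i))) start≡end
          vσ≡vσ′ : ∀ s → v (σ i) s ≡ v (σ′ i) s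
          vσ≡vσ′ s = ℤ→ℚ-injective (injective (toQ (v (σ i))) (toQ (v (σ′ i)))
            (λ t → trans (applyℚ-toQ φ (v (σ i)) t) (trans (cong ℤ→ℚ (φσ≡φσ′ t)) (sym (applyℚ-toQ φ (v (σ′ i)) t))))
              s)

      cayley : IsCayleyOfSegments d v
      cayley = start , end , (λ i → distinct⇒AffIndep (start i) (end i) (start≢end i)) , φ ,
        (into-H , injective , λ y y∈H → Preimage.z y y∈H , Preimage.image y y∈H) , mapsOnto-permuted φ v
          (cayleyVerts start end) (arrangement P) vertex

module InteriorBound where

  open import Data.Empty using (⊥-elim)
  open import Data.Fin using (Fin; suc; punchIn; _↑ˡ_; _↑ʳ_)
  open import Data.Fin.Properties using (any?; _≟_)
  open import Data.Integer.Base as ℤ using (ℤ; +_)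
  import Data.Integer.Properties as ℤ
  open import Data.Product using (∃; _×_; _,_; proj₁; proj₂)
  open import Data.Rational hiding (_≟_)
  open import Data.Rational.Properties hiding (_≟_)
  open import Data.Vec.Functional using (_++_)
  open import Data.Vec.Functional.Properties using (lookup-++ˡ; lookup-++ʳ)
  open import Relation.Binary.PropositionalEquality using (_≡_; _≢_; refl; sym; trans; cong; cong₂; subst;
    module ≡-Reasoning)
  open import Relation.Nullary using (yes; no)
  open import Defs
  open Rationals using (*≥0; *>0; 0<1; 0≤1; ≤-by; x≡0⇒x*y≡0; y≡0⇒x*y≡0)
  open FiniteSum
  open RationalPoints
  open AffineFunctional using (unitVec-same; unitVec-other)
  open AffineMaps
  open ℚSum

  ℤ→ℚ-unitVec≥0 : ∀ {r} (i t : Fin r) → 0ℚ ≤ ℤ→ℚ (unitVec i t)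
  ℤ→ℚ-unitVec≥0 i t with i ≟ t
  ... | yes _ = 0≤1
  ... | no _  = ≤-refl

  sumℚ->0 : ∀ {n} (f : Fin n → ℚ) → (∀ i → 0ℚ ≤ f i) → ∀ j → 0ℚ < f j → 0ℚ < sumℚ f
  sumℚ->0 {suc n} f f≥0 j fⱼ>0 = <-≤-trans fⱼ>0 (≤-by (sumℚ rest) (sumℚ-≥0 rest (λ i → f≥0 (punchIn j i)))
    (sym (sum-remove j f)))
    where
    rest : Fin n → ℚ
    rest i = f (punchIn j i)

  positive-combination>0 : ∀ {n} (g ρ μ : Fin n → ℚ) → (∀ i → 0ℚ ≤ g i) → sumℚ (λ i → ρ i * g i) ≡ 1ℚ →
    (∀ i → 0ℚ < μ i) → 0ℚ < sumℚ (λ i → μ i * g i)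
  positive-combination>0 g ρ μ g≥0 ∑ρg≡1 μ>0 with any? (λ i → 0ℚ <? g i)
  ... | yes (j , gⱼ>0) = sumℚ->0 (λ i → μ i * g i) (λ i → *≥0 (<⇒≤ (μ>0 i)) (g≥0 i)) j (*>0 (μ>0 j) gⱼ>0)
  ... | no none        = ⊥-elim (<-irrefl (trans (sym (sum-zero λ i → y≡0⇒x*y≡0 (ρ i) (g≡0 i))) ∑ρg≡1) 0<1)
    where
    g≡0 : ∀ i → g i ≡ 0ℚ
    g≡0 i = ≤-antisym (≮⇒≥ λ gᵢ>0 → none (i , gᵢ>0)) (g≥0 i)

  vertex∈conv : ∀ {N m} (p : Fin N → Pt m) j → InConv (λ i → toQ (p i)) (toQ (p j))
  vertex∈conv p j = δ , ℤ→ℚ-unitVec≥0 j , trans (sum-single j δ≡0) δ≡1 ,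
    λ t → trans (sum-single j λ i i≢j → x≡0⇒x*y≡0 (toQ (p i) t) (δ≡0 i i≢j)) (trans (cong (_* toQ (p j) t) δ≡1)
      (*-identityˡ (toQ (p j) t)))
    where
    δ : Fin _ → ℚ
    δ i = ℤ→ℚ (unitVec j i)
    δ≡1 : δ j ≡ 1ℚ
    δ≡1 = cong ℤ→ℚ (unitVec-same j)
    δ≡0 : ∀ i → i ≢ j → δ i ≡ 0ℚ
    δ≡0 i i≢j = cong ℤ→ℚ (unitVec-other λ j≡i → i≢j (sym j≡i))

  module _ {d} (a b : Fin d → Pt d) where

    head-start : ∀ i j → cayleyVerts a b (j ↑ˡ d) (i ↑ˡ d) ≡ unitVec j i
    head-start i j = trans (cong (λ p → p (i ↑ˡ d)) (lookup-++ˡ (λ i → unitVec i ++ a i) (λ i → unitVec i ++ b i) j))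
      (lookup-++ˡ (unitVec j) (a j) i)

    head-end : ∀ i j → cayleyVerts a b (d ↑ʳ j) (i ↑ˡ d) ≡ unitVec j i
    head-end i j = trans (cong (λ p → p (i ↑ˡ d)) (lookup-++ʳ (λ i → unitVec i ++ a i) (λ i → unitVec i ++ b i) j))
      (lookup-++ˡ (unitVec j) (b j) i)

    head≥0 : ∀ i k → 0ℚ ≤ toQ (cayleyVerts a b k) (i ↑ˡ d)
    head≥0 i = splitAt-elim d (λ k → 0ℚ ≤ toQ (cayleyVerts a b k) (i ↑ˡ d))
      (λ j → subst (λ z → 0ℚ ≤ ℤ→ℚ z) (sym (head-start i j)) (ℤ→ℚ-unitVec≥0 j i))
      (λ j → subst (λ z → 0ℚ ≤ ℤ→ℚ z) (sym (head-end i j)) (ℤ→ℚ-unitVec≥0 j i))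

  applyℚ-scale : ∀ {m M} (φ : AffMap m M) k (x : Pt m) (y : QPt m) → (∀ s → ℕ→ℚ k * y s ≡ toQ x s) → ∀ t →
                 ℤ→ℚ (+ k ℤ.* AffMap.c φ t ℤ.+ sumℤ (λ s → AffMap.A φ t s ℤ.* x s)) ≡ ℕ→ℚ k * applyℚ φ y t
  applyℚ-scale φ k x y ky≡x t = begin
    ℤ→ℚ (+ k ℤ.* c ℤ.+ sumℤ (λ s → A s ℤ.* x s))     ≡⟨ ℤ→ℚ-+ (+ k ℤ.* c) (sumℤ λ s → A s ℤ.* x s) ⟩
    ℤ→ℚ (+ k ℤ.* c) + ℤ→ℚ (sumℤ λ s → A s ℤ.* x s)   ≡⟨ cong₂ _+_ (ℤ→ℚ-* (+ k) c) (ℤ→ℚ-∙ A x) ⟩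
    ℕ→ℚ k * ℤ→ℚ c + A ∙ toQ x
      ≡⟨ cong (λ z → ℕ→ℚ k * ℤ→ℚ c + z) (trans (∙-cong A λ s → sym (ky≡x s)) (∙-scale A (ℕ→ℚ k) y)) ⟩
    ℕ→ℚ k * ℤ→ℚ c + ℕ→ℚ k * (A ∙ y)                  ≡⟨ *-distribˡ-+ (ℕ→ℚ k) (ℤ→ℚ c) (A ∙ y) ⟨
    ℕ→ℚ k * applyℚ φ y t ∎
    where
    open ≡-Reasoning
    c : ℤ
    c = AffMap.c φ t
    A : Pt _
    A = AffMap.A φ t

  module _ {m d} (v : Fin (suc m) → Pt m) (a b : Fin d → Pt d) (φ : AffMap m (d ℕ.+ d))
    (iso : IsLatticeIsoOntoH m d d φ)
    (maps : MapsOnto φ v (cayleyVerts a b)) where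

    private
      w : Fin (d ℕ.+ d) → Pt (d ℕ.+ d)
      w = cayleyVerts a b

      level : Fin d → Fin (suc m) → ℚ
      level i j = applyℚ φ (toQ (v j)) (i ↑ˡ d)

      level≥0 : ∀ i j → 0ℚ ≤ level i j
      level≥0 i j = let μ , μ≥0 , _ , comb≡ = proj₂ (maps (applyℚ φ (toQ (v j)))) (toQ (v j)) (vertex∈conv v j)
                          (λ _ → refl)
                    in subst (0ℚ ≤_) (comb≡ (i ↑ˡ d)) (sumℚ-≥0 (λ k → μ k * toQ (w k) (i ↑ˡ d))
                      (λ k → *≥0 (μ≥0 k) (head≥0 a b i k)))

      level-attains-1 : ∀ i → ∃ λ (ρ : Fin (suc m) → ℚ) → sumℚ (λ j → ρ j * level i j) ≡ 1ℚ
      level-attains-1 i = from-conv (proj₁ (maps (toQ (w (i ↑ˡ d)))) (vertex∈conv w (i ↑ˡ d)))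
        where
        open ≡-Reasoning
        from-conv : (∃ λ x → InConv (λ j → toQ (v j)) x × applyℚ φ x ≋ℚ toQ (w (i ↑ˡ d))) →
          ∃ λ (ρ : Fin (suc m) → ℚ) → sumℚ (λ j → ρ j * level i j) ≡ 1ℚ
        from-conv (x , (ρ , _ , ∑ρ≡1 , comb≡x) , φx≡w) = ρ , (begin
          sumℚ (λ j → ρ j * level i j)                    ≡⟨ applyℚ-comb φ ρ (λ j → toQ (v j)) ∑ρ≡1 (i ↑ˡ d) ⟨
          applyℚ φ (combℚ ρ (λ j → toQ (v j))) (i ↑ˡ d)   ≡⟨ applyℚ-cong φ comb≡x (i ↑ˡ d) ⟩
          applyℚ φ x (i ↑ˡ d)                             ≡⟨ φx≡w (i ↑ˡ d) ⟩
          toQ (w (i ↑ˡ d)) (i ↑ˡ d)                       ≡⟨ cong ℤ→ℚ (trans (head-start a b i i) (unitVec-same i)) ⟩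
          1ℚ ∎)

    -- Each of the d integral functionals k cᵢ + Aᵢ x is positive on Int(kΔ), and they add up to k.
    interior-multiple-bound : ∀ k x → 1 ℕ.≤ k → InIntMultiple k v x → d ℕ.≤ k
    interior-multiple-bound k@(suc k-1) x _ (μ , μ>0 , ∑μ≡1 , comb≡x) = ℤ.drop‿+≤+ (subst (+ d ℤ.≤_) G-sum
      (sumℤ-≥1 G (λ i → ℤ→ℚ≥1 (G>0 i))))
      where
      y : QPt m
      y = combℚ μ (λ j → toQ (v j))
      G : Fin d → ℤ
      G i = + k ℤ.* AffMap.c φ (i ↑ˡ d) ℤ.+ sumℤ (λ t → AffMap.A φ (i ↑ˡ d) t ℤ.* x t)
      G≡ : ∀ i → ℤ→ℚ (G i) ≡ ℕ→ℚ k * applyℚ φ y (i ↑ˡ d)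
      G≡ i = applyℚ-scale φ k x y comb≡x (i ↑ˡ d)
      G>0 : ∀ i → 0ℚ < ℤ→ℚ (G i)
      G>0 i = subst (0ℚ <_) (sym (G≡ i))
        (*>0 (ℤ→ℚ>0 k-1) (subst (0ℚ <_) (sym (applyℚ-comb φ μ (λ j → toQ (v j)) ∑μ≡1 (i ↑ˡ d)))
        (positive-combination>0 (level i) (proj₁ (level-attains-1 i)) μ (level≥0 i) (proj₂ (level-attains-1 i)) μ>0)))
      G-sum : sumℤ G ≡ + k
      G-sum = ℤ→ℚ-injective (begin
        ℤ→ℚ (sumℤ G)             ≡⟨ ℤ→ℚ-sum G ⟩
        sumℚ (λ i → ℤ→ℚ (G i))   ≡⟨ sum-cong G≡ ⟩
        sumℚ (λ (i : Fin d) → ℕ→ℚ k * applyℚ φ y (i ↑ˡ d))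
          ≡⟨ *-distribˡ-sum (ℕ→ℚ k) (λ (i : Fin d) → applyℚ φ y (i ↑ˡ d)) ⟨
        ℕ→ℚ k * sumℚ (λ (i : Fin d) → applyℚ φ y (i ↑ˡ d))
          ≡⟨ trans (cong (ℕ→ℚ k *_) (proj₁ iso y)) (*-identityʳ (ℕ→ℚ k)) ⟩
        ℕ→ℚ k ∎)
        where open ≡-Reasoning

open import Defs
open import Data.Nat using (ℕ; suc; _+_)
open import Data.Fin using (Fin; punchIn)
open import Data.Product using (_×_)
open import Function.Bundles using (_⇔_)
open import Data.Fin using (zero)
open import Data.Integer.Base as ℤ using (+_)
open import Data.Integer.DivMod using (_%ℕ_)
open import Data.Integer.Divisibility.Signed using (_∣_; ∣m∣n⇒∣m+n; ∣ᵤ⇒∣)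
open import Data.Integer.Tactic.RingSolver using (solve-∀)
open import Data.Nat.Divisibility using (m%n≡0⇒n∣m)
open import Data.Product using (∃; _,_; proj₁; proj₂)
open import Function.Bundles using (mk⇔)
open import Relation.Binary.PropositionalEquality using (_≡_; sym; cong; subst)
open Matching
open UnitPairing using (Opposite; pairing)
open LatticeQuotient
open DegreeBalance
open CayleyIsomorphism
open InteriorBound

Opposite-%ℕ⇒∣ : ∀ n {{_ : NonZero n}} i j → Opposite n (i %ℕ n) (j %ℕ n) → + n ∣ i ℤ.+ j
Opposite-%ℕ⇒∣ n i j opposite = subst (+ n ∣_) (cancel i j (+ (i %ℕ n)) (+ (j %ℕ n)))
  (∣m∣n⇒∣m+n (∣m∣n⇒∣m+n (n∣i-i%ℕn i n) (n∣i-i%ℕn j n)) (∣ᵤ⇒∣ (m%n≡0⇒n∣m (i %ℕ n + j %ℕ n) n opposite)))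
  where
  cancel : ∀ i j r s → i ℤ.- r ℤ.+ (j ℤ.- s) ℤ.+ (r ℤ.+ s) ≡ i ℤ.+ j
  cancel = solve-∀

noInteriorPoints⇒cayley : ∀ e (v : Fin (suc (suc (e + e))) → Pt (suc (e + e))) → AffIndep v →
  (∀ j → IsBasic (λ i → v (punchIn j i))) → NoInteriorPoints e v → IsCayleyOfSegments (suc e) v
noInteriorPoints⇒cayley e v indep basic empty = Construction.cayley v indep quotient
  (map (λ i j → Opposite-%ℕ⇒∣ (suc n-1) (a i) (a j)) (proj₁ paired)) (proj₂ paired)
  where
  quotient : CyclicQuotient v
  quotient = cyclicQuotient v indep (basic zero)
  open CyclicQuotient quotient
  paired : ∃ λ (P : Pairing (suc e) (λ i j → Opposite (suc n-1) (a i %ℕ suc n-1) (a j %ℕ suc n-1))) → Anchored P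
  paired = pairing (suc n-1) e (cong suc (sym (ℕ.+-suc e e))) (residue e v basic quotient empty)
    (residue-coprime e v basic quotient empty) (residues-balanced e v basic quotient empty)

cayley⇒noInteriorPoints : ∀ e (v : Fin (suc (suc (e + e))) → Pt (suc (e + e))) → IsCayleyOfSegments (suc e) v →
  NoInteriorPoints e v
cayley⇒noInteriorPoints e v (a , b , _ , φ , iso , maps) k 1≤k k≤e x interior =
  ℕ.<⇒≱ (interior-multiple-bound v a b φ iso maps k x 1≤k interior) k≤e

theorem1p6 : (e : ℕ) → (v : Fin (suc (suc (e + e))) → Pt (suc (e + e))) →
    AffIndep v →
    ((j : Fin (suc (suc (e + e)))) → IsBasic (λ i → v (punchIn j i))) →
    (NoInteriorPoints e v ⇔ IsCayleyOfSegments (suc e) v)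
theorem1p6 e v indep basic = mk⇔ (noInteriorPoints⇒cayley e v indep basic) (cayley⇒noInteriorPoints e v)
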